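{- Let $(\sigma_n)_{n=1}^\infty$ be an increasing sequence of positive integers with $\sigma_{n+1}-\sigma_n\ge n$ for all $n\ge1$ and such that the limit \[\beta:=\lim_{n\to\infty}\frac{\sigma_{n+1}-\sigma_n}{n}\] exists in $[1,\infty]$. Define \[G((\sigma_n)_{n=1}^\infty)=\{x\in J\colon a_{\sigma_n}(x),\ldots,a_{\sigma_n+n-1}(x)\ \text{is an arithmetic progression for all sufficiently large}\ n\}.\] Then \[\dim_{\rm H} G((\sigma_n)_{n=1}^\infty)=\begin{cases}\dfrac{\beta-1}{2\beta}&\text{if }\beta<\infty,\\ 1/2&\text{otherwise.}\end{cases}\]
   Context: Every irrational $x\in(0,1)$ has a regular continued fraction expansion $x=\cfrac{1}{a_1(x)+\cfrac{1}{a_2(x)+\cdots}}$ with partial quotients $a_n(x)\in\mathbb N$. $J=\{x\in(0,1)\setminus\mathbb Q\colon a_n(x)<a_{n+1}(x)\text{ for every }n\ge1\}$. $\dim_{\rm H}$ denotes Hausdorff dimension in $[0,1]$ with the Euclidean metric. -}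

module Defs where

open import Level using (Level; 0ℓ) renaming (suc to lsuc)
open import Data.Nat.Base as ℕ using (ℕ; zero; suc; _!)
import Data.Nat.Properties as ℕ
open import Data.Integer.Base as ℤ using (ℤ; +_)
open import Data.Rational.Base as ℚ using (ℚ; mkℚ; 0ℚ; 1ℚ; ½)
import Data.Rational.Properties as ℚ
open import Data.Rational.Solver using (module +-*-Solver)
open import Data.Fin.Base using (Fin; toℕ)
open import Data.Product.Base using (Σ; ∃-syntax; _×_; _,_)
open import Data.Sum.Base using (_⊎_; inj₁; inj₂)
open import Relation.Nullary using (¬_)
open import Relation.Nullary.Decidable using (toWitness)
open import Relation.Unary using (Pred; _∈_; _⊆_; ⋃; Empty)
open import Relation.Binary.Core using (Rel)
open import Relation.Binary.PropositionalEquality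
  using (_≡_; refl; sym; trans; cong; cong₂; subst)

------------------------------------------------------------------------
-- Real numbers: Cauchy sequences of rationals, up to the equivalence _≈_.
-- Only the proofs that sequences are Cauchy are abstract; the underlying
-- sequences compute.

Eventually : ∀ {ℓ} → (ℕ → Set ℓ) → Set ℓ
Eventually P = ∃[ N ] ∀ n → N ℕ.≤ n → P n

IsCauchy : (ℕ → ℚ) → Set
IsCauchy u = ∀ ε → 0ℚ ℚ.< ε →
  ∃[ N ] ∀ m n → N ℕ.≤ m → N ℕ.≤ n → ℚ.∣ u m ℚ.- u n ∣ ℚ.< ε

record ℝ : Set where
  constructor mkℝ
  field
    seq    : ℕ → ℚ
    cauchy : IsCauchy seq
open ℝ public

infix 4 _≈_ _<_ _≤_

_≈_ : Rel ℝ 0ℓ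
x ≈ y = ∀ ε → 0ℚ ℚ.< ε → Eventually λ n → ℚ.∣ seq x n ℚ.- seq y n ∣ ℚ.< ε

_<_ : Rel ℝ 0ℓ
x < y = ∃[ ε ] (0ℚ ℚ.< ε) × Eventually λ n → seq x n ℚ.+ ε ℚ.≤ seq y n

_≤_ : Rel ℝ 0ℓ
x ≤ y = ∀ ε → 0ℚ ℚ.< ε → Eventually λ n → seq x n ℚ.≤ seq y n ℚ.+ ε

private
  open +-*-Solver using (solve; con; _:=_; _:+_; _:*_; _:-_; :-_)

  pos* : ∀ {p q} → 0ℚ ℚ.< p → 0ℚ ℚ.< q → 0ℚ ℚ.< p ℚ.* q
  pos* {p} {q} 0<p 0<q = subst (ℚ._< p ℚ.* q) (ℚ.*-zeroʳ p)
    (ℚ.*-monoʳ-<-pos p {{ℚ.positive 0<p}} 0<q)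

  pos1/ : ∀ p (0<p : 0ℚ ℚ.< p) → 0ℚ ℚ.< (ℚ.1/ p) {{ℚ.pos⇒nonZero p {{ℚ.positive 0<p}}}}
  pos1/ p 0<p = ℚ.positive⁻¹ _ {{ℚ.1/pos⇒pos p {{ℚ.positive 0<p}}}}

  0<½ : 0ℚ ℚ.< ½
  0<½ = toWitness {a? = 0ℚ ℚ.<? ½} _

  0<1 : 0ℚ ℚ.< 1ℚ
  0<1 = toWitness {a? = 0ℚ ℚ.<? 1ℚ} _

  halves : ∀ ε → ε ℚ.* ½ ℚ.+ ε ℚ.* ½ ≡ ε
  halves ε = trans (sym (ℚ.*-distribˡ-+ ε ½ ½)) (ℚ.*-identityʳ ε)

  product-bound : ∀ a b c d →
    ℚ.∣ a ℚ.* b ℚ.- c ℚ.* d ∣ ℚ.≤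
    ℚ.∣ a ∣ ℚ.* ℚ.∣ b ℚ.- d ∣ ℚ.+ ℚ.∣ d ∣ ℚ.* ℚ.∣ a ℚ.- c ∣
  product-bound a b c d = begin
    ℚ.∣ a ℚ.* b ℚ.- c ℚ.* d ∣
      ≡⟨ cong ℚ.∣_∣ (solve 4 (λ a b c d →
           a :* b :- c :* d := a :* (b :- d) :+ d :* (a :- c)) refl a b c d) ⟩
    ℚ.∣ a ℚ.* (b ℚ.- d) ℚ.+ d ℚ.* (a ℚ.- c) ∣
      ≤⟨ ℚ.∣p+q∣≤∣p∣+∣q∣ (a ℚ.* (b ℚ.- d)) (d ℚ.* (a ℚ.- c)) ⟩
    ℚ.∣ a ℚ.* (b ℚ.- d) ∣ ℚ.+ ℚ.∣ d ℚ.* (a ℚ.- c) ∣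
      ≡⟨ cong₂ ℚ._+_ (ℚ.∣p*q∣≡∣p∣*∣q∣ a (b ℚ.- d)) (ℚ.∣p*q∣≡∣p∣*∣q∣ d (a ℚ.- c)) ⟩
    ℚ.∣ a ∣ ℚ.* ℚ.∣ b ℚ.- d ∣ ℚ.+ ℚ.∣ d ∣ ℚ.* ℚ.∣ a ℚ.- c ∣ ∎
    where open ℚ.≤-Reasoning

  bounded : (x : ℝ) → ∃[ B ] (0ℚ ℚ.< B) × Eventually λ n → ℚ.∣ seq x n ∣ ℚ.≤ B
  bounded x = let (N , h) = cauchy x 1ℚ 0<1; c = seq x N in
    ℚ.∣ c ∣ ℚ.+ 1ℚ ,
    ℚ.+-mono-≤-< (ℚ.0≤∣p∣ c) 0<1 ,
    N , λ n N≤n → let u = seq x n in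
      begin
        ℚ.∣ u ∣
          ≡⟨ cong ℚ.∣_∣ (solve 2 (λ u c → u := c :+ (u :- c)) refl u c) ⟩
        ℚ.∣ c ℚ.+ (u ℚ.- c) ∣
          ≤⟨ ℚ.∣p+q∣≤∣p∣+∣q∣ c (u ℚ.- c) ⟩
        ℚ.∣ c ∣ ℚ.+ ℚ.∣ u ℚ.- c ∣
          ≤⟨ ℚ.+-monoʳ-≤ ℚ.∣ c ∣ (ℚ.<⇒≤ (h n N N≤n ℕ.≤-refl)) ⟩
        ℚ.∣ c ∣ ℚ.+ 1ℚ ∎
    where open ℚ.≤-Reasoning

  scaled : ∀ a B δ e (0<B : 0ℚ ℚ.< B) → ℚ.∣ a ∣ ℚ.≤ B →
    (0≤e : 0ℚ ℚ.≤ e) →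
    e ℚ.< δ ℚ.* ½ ℚ.* (ℚ.1/ B) {{ℚ.pos⇒nonZero B {{ℚ.positive 0<B}}}} →
    ℚ.∣ a ∣ ℚ.* e ℚ.< δ ℚ.* ½
  scaled a B δ e 0<B a≤B 0≤e e< = begin-strict
    ℚ.∣ a ∣ ℚ.* e              ≤⟨ ℚ.*-monoʳ-≤-nonNeg e {{ℚ.nonNegative 0≤e}} a≤B ⟩
    B ℚ.* e                    <⟨ ℚ.*-monoʳ-<-pos B {{ℚ.positive 0<B}} e< ⟩
    B ℚ.* (δ ℚ.* ½ ℚ.* B⁻¹)    ≡⟨ solve 3 (λ b d i → b :* (d :* i) := d :* (b :* i))
                                    refl B (δ ℚ.* ½) B⁻¹ ⟩
    δ ℚ.* ½ ℚ.* (B ℚ.* B⁻¹)    ≡⟨ cong (δ ℚ.* ½ ℚ.*_) (ℚ.*-inverseʳ B {{nz}}) ⟩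
    δ ℚ.* ½ ℚ.* 1ℚ             ≡⟨ ℚ.*-identityʳ (δ ℚ.* ½) ⟩
    δ ℚ.* ½                    ∎
    where
    open ℚ.≤-Reasoning
    nz  = ℚ.pos⇒nonZero B {{ℚ.positive 0<B}}
    B⁻¹ = (ℚ.1/ B) {{nz}}

abstract
  const-cauchy : ∀ q → IsCauchy (λ _ → q)
  const-cauchy q ε 0<ε = 0 , λ _ _ _ _ →
    subst (λ z → ℚ.∣ z ∣ ℚ.< ε) (sym (ℚ.+-inverseʳ q)) 0<ε

fromℚ : ℚ → ℝ
fromℚ q = mkℝ (λ _ → q) (const-cauchy q)

0ℝ 1ℝ 2ℝ ½ℝ : ℝ
0ℝ = fromℚ 0ℚ
1ℝ = fromℚ 1ℚ
2ℝ = fromℚ (+ 2 ℚ./ 1)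
½ℝ = fromℚ ½

infixl 6 _+_ _-_
infixl 7 _*_
infix  8 -_

abstract
  +-cauchy : ∀ x y → IsCauchy (λ n → seq x n ℚ.+ seq y n)
  +-cauchy x y ε 0<ε =
    let (M , hx) = cauchy x (ε ℚ.* ½) (pos* 0<ε 0<½)
        (N , hy) = cauchy y (ε ℚ.* ½) (pos* 0<ε 0<½)
    in M ℕ.⊔ N , λ m n ≤m ≤n →
      let a = seq x m; b = seq y m; c = seq x n; d = seq y n in
      begin-strict
        ℚ.∣ (a ℚ.+ b) ℚ.- (c ℚ.+ d) ∣
          ≡⟨ cong ℚ.∣_∣ (solve 4 (λ a b c d →
               (a :+ b) :- (c :+ d) := (a :- c) :+ (b :- d)) refl a b c d) ⟩
        ℚ.∣ (a ℚ.- c) ℚ.+ (b ℚ.- d) ∣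
          ≤⟨ ℚ.∣p+q∣≤∣p∣+∣q∣ (a ℚ.- c) (b ℚ.- d) ⟩
        ℚ.∣ a ℚ.- c ∣ ℚ.+ ℚ.∣ b ℚ.- d ∣
          <⟨ ℚ.+-mono-< (hx m n (ℕ.m⊔n≤o⇒m≤o M N ≤m) (ℕ.m⊔n≤o⇒m≤o M N ≤n))
                        (hy m n (ℕ.m⊔n≤o⇒n≤o M N ≤m) (ℕ.m⊔n≤o⇒n≤o M N ≤n)) ⟩
        ε ℚ.* ½ ℚ.+ ε ℚ.* ½
          ≡⟨ halves ε ⟩
        ε ∎
    where open ℚ.≤-Reasoning

_+_ : ℝ → ℝ → ℝ
x + y = mkℝ (λ n → seq x n ℚ.+ seq y n) (+-cauchy x y)

abstract
  neg-cauchy : ∀ x → IsCauchy (λ n → ℚ.- seq x n)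
  neg-cauchy x ε 0<ε =
    let (N , h) = cauchy x ε 0<ε in
    N , λ m n ≤m ≤n → let a = seq x m; c = seq x n in
      subst (ℚ._< ε)
        (trans (sym (ℚ.∣-p∣≡∣p∣ (a ℚ.- c)))
               (cong ℚ.∣_∣ (solve 2 (λ a c → :- (a :- c) := (:- a) :- (:- c)) refl a c)))
        (h m n ≤m ≤n)

-_ : ℝ → ℝ
- x = mkℝ (λ n → ℚ.- seq x n) (neg-cauchy x)

_-_ : ℝ → ℝ → ℝ
x - y = x + (- y)

abstract
  *-cauchy : ∀ x y → IsCauchy (λ n → seq x n ℚ.* seq y n)
  *-cauchy x y ε 0<ε =
    let (A , 0<A , K , hA) = bounded x
        (B , 0<B , L , hB) = bounded y
        (M , hx) = cauchy x _ (pos* (pos* 0<ε 0<½) (pos1/ B 0<B))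
        (N , hy) = cauchy y _ (pos* (pos* 0<ε 0<½) (pos1/ A 0<A))
    in (K ℕ.⊔ L) ℕ.⊔ (M ℕ.⊔ N) , λ m n ≤m ≤n →
      let a = seq x m; b = seq y m; c = seq x n; d = seq y n
          KLm = ℕ.m⊔n≤o⇒m≤o (K ℕ.⊔ L) (M ℕ.⊔ N) ≤m
          KLn = ℕ.m⊔n≤o⇒m≤o (K ℕ.⊔ L) (M ℕ.⊔ N) ≤n
          MNm = ℕ.m⊔n≤o⇒n≤o (K ℕ.⊔ L) (M ℕ.⊔ N) ≤m
          MNn = ℕ.m⊔n≤o⇒n≤o (K ℕ.⊔ L) (M ℕ.⊔ N) ≤n
      in
      begin-strict
        ℚ.∣ a ℚ.* b ℚ.- c ℚ.* d ∣
          ≤⟨ product-bound a b c d ⟩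
        ℚ.∣ a ∣ ℚ.* ℚ.∣ b ℚ.- d ∣ ℚ.+ ℚ.∣ d ∣ ℚ.* ℚ.∣ a ℚ.- c ∣
          <⟨ ℚ.+-mono-<
               (scaled a A ε _ 0<A (hA m (ℕ.m⊔n≤o⇒m≤o K L KLm)) (ℚ.0≤∣p∣ (b ℚ.- d))
                 (hy m n (ℕ.m⊔n≤o⇒n≤o M N MNm) (ℕ.m⊔n≤o⇒n≤o M N MNn)))
               (scaled d B ε _ 0<B (hB n (ℕ.m⊔n≤o⇒n≤o K L KLn)) (ℚ.0≤∣p∣ (a ℚ.- c))
                 (hx m n (ℕ.m⊔n≤o⇒m≤o M N MNm) (ℕ.m⊔n≤o⇒m≤o M N MNn))) ⟩
        ε ℚ.* ½ ℚ.+ ε ℚ.* ½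
          ≡⟨ halves ε ⟩
        ε ∎
    where open ℚ.≤-Reasoning

_*_ : ℝ → ℝ → ℝ
x * y = mkℝ (λ n → seq x n ℚ.* seq y n) (*-cauchy x y)

abstract
  abs-cauchy : ∀ x → IsCauchy (λ n → ℚ.∣ seq x n ∣)
  abs-cauchy x ε 0<ε =
    let (N , h) = cauchy x ε 0<ε in
    N , λ m n ≤m ≤n → ℚ.≤-<-trans (reverse-triangle (seq x m) (seq x n)) (h m n ≤m ≤n)
    where
    open ℚ.≤-Reasoning

    one-sided : ∀ a c → ℚ.∣ a ∣ ℚ.- ℚ.∣ c ∣ ℚ.≤ ℚ.∣ a ℚ.- c ∣
    one-sided a c = begin
      ℚ.∣ a ∣ ℚ.- ℚ.∣ c ∣
        ≡⟨ cong (λ z → ℚ.∣ z ∣ ℚ.- ℚ.∣ c ∣)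
             (solve 2 (λ a c → a := (a :- c) :+ c) refl a c) ⟩
      ℚ.∣ (a ℚ.- c) ℚ.+ c ∣ ℚ.- ℚ.∣ c ∣
        ≤⟨ ℚ.+-monoˡ-≤ (ℚ.- ℚ.∣ c ∣) (ℚ.∣p+q∣≤∣p∣+∣q∣ (a ℚ.- c) c) ⟩
      (ℚ.∣ a ℚ.- c ∣ ℚ.+ ℚ.∣ c ∣) ℚ.- ℚ.∣ c ∣
        ≡⟨ solve 2 (λ p q → (p :+ q) :- q := p) refl ℚ.∣ a ℚ.- c ∣ ℚ.∣ c ∣ ⟩
      ℚ.∣ a ℚ.- c ∣ ∎

    swap : ∀ a c → ℚ.∣ c ℚ.- a ∣ ≡ ℚ.∣ a ℚ.- c ∣
    swap a c = trans (cong ℚ.∣_∣ (solve 2 (λ a c → c :- a := :- (a :- c)) refl a c))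
                     (ℚ.∣-p∣≡∣p∣ (a ℚ.- c))

    reverse-triangle : ∀ a c → ℚ.∣ ℚ.∣ a ∣ ℚ.- ℚ.∣ c ∣ ∣ ℚ.≤ ℚ.∣ a ℚ.- c ∣
    reverse-triangle a c with ℚ.∣p∣≡p∨∣p∣≡-p (ℚ.∣ a ∣ ℚ.- ℚ.∣ c ∣)
    ... | inj₁ eq = subst (ℚ._≤ ℚ.∣ a ℚ.- c ∣) (sym eq) (one-sided a c)
    ... | inj₂ eq = subst (ℚ._≤ ℚ.∣ a ℚ.- c ∣)
          (trans (solve 2 (λ p q → q :- p := :- (p :- q)) refl ℚ.∣ a ∣ ℚ.∣ c ∣) (sym eq))
          (subst (ℚ.∣ c ∣ ℚ.- ℚ.∣ a ∣ ℚ.≤_) (swap a c) (one-sided c a))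

∣_∣ : ℝ → ℝ
∣ x ∣ = mkℝ (λ n → ℚ.∣ seq x n ∣) (abs-cauchy x)

-- Reciprocal of a rational, with the junk value 0 at 0.
recip : ℚ → ℚ
recip (mkℚ (+ 0) _ _)         = 0ℚ
recip q@(mkℚ (+ (suc _)) _ _)   = ℚ.1/ q
recip q@(mkℚ (ℤ.-[1+ _ ]) _ _) = ℚ.1/ q

private
  recip-inverse : ∀ q → 0ℚ ℚ.< q → recip q ℚ.* q ≡ 1ℚ
  recip-inverse (mkℚ (+ 0) _ _) (ℚ.*<* (ℤ.+<+ ()))
  recip-inverse q@(mkℚ (+ (suc _)) _ _) _ = ℚ.*-inverseˡ q
  recip-inverse (mkℚ (ℤ.-[1+ _ ]) _ _) (ℚ.*<* ())

  recip-pos : ∀ q → 0ℚ ℚ.< q → 0ℚ ℚ.< recip q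
  recip-pos (mkℚ (+ 0) _ _) (ℚ.*<* (ℤ.+<+ ()))
  recip-pos q@(mkℚ (+ (suc _)) _ _) 0<q = pos1/ q 0<q
  recip-pos (mkℚ (ℤ.-[1+ _ ]) _ _) (ℚ.*<* ())

abstract
  recip-cauchy : ∀ x → 0ℝ < x → IsCauchy (λ n → recip (seq x n))
  recip-cauchy x (δ , 0<δ , K , δ≤) ε 0<ε =
    let (N , h) = cauchy x (ε ℚ.* (δ ℚ.* δ)) (pos* 0<ε (pos* 0<δ 0<δ)) in
    K ℕ.⊔ N , λ m n ≤m ≤n →
      close (seq x m) (seq x n) ε 0<ε
        (bound m (ℕ.m⊔n≤o⇒m≤o K N ≤m)) (bound n (ℕ.m⊔n≤o⇒m≤o K N ≤n))
        (h n m (ℕ.m⊔n≤o⇒n≤o K N ≤n) (ℕ.m⊔n≤o⇒n≤o K N ≤m))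
    where
    open ℚ.≤-Reasoning

    bound : ∀ n → K ℕ.≤ n → δ ℚ.≤ seq x n
    bound n K≤n = subst (ℚ._≤ seq x n) (ℚ.+-identityˡ δ) (δ≤ n K≤n)

    δ*recip≤1 : ∀ a → δ ℚ.≤ a → δ ℚ.* recip a ℚ.≤ 1ℚ
    δ*recip≤1 a δ≤a = begin
      δ ℚ.* recip a  ≤⟨ ℚ.*-monoʳ-≤-nonNeg (recip a)
                          {{ℚ.nonNegative (ℚ.<⇒≤ (recip-pos a 0<a))}} δ≤a ⟩
      a ℚ.* recip a  ≡⟨ trans (ℚ.*-comm a (recip a)) (recip-inverse a 0<a) ⟩
      1ℚ             ∎
      where
      0<a : 0ℚ ℚ.< a
      0<a = ℚ.<-≤-trans 0<δ δ≤a

    close : ∀ a c ε → 0ℚ ℚ.< ε → δ ℚ.≤ a → δ ℚ.≤ c →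
            ℚ.∣ c ℚ.- a ∣ ℚ.< ε ℚ.* (δ ℚ.* δ) →
            ℚ.∣ recip a ℚ.- recip c ∣ ℚ.< ε
    close a c ε 0<ε δ≤a δ≤c c-a< = begin-strict
      ℚ.∣ r ℚ.- t ∣
        ≡⟨ cong ℚ.∣_∣ difference ⟩
      ℚ.∣ (c ℚ.- a) ℚ.* (r ℚ.* t) ∣
        ≡⟨ ℚ.∣p*q∣≡∣p∣*∣q∣ (c ℚ.- a) (r ℚ.* t) ⟩
      ℚ.∣ c ℚ.- a ∣ ℚ.* ℚ.∣ r ℚ.* t ∣
        ≡⟨ cong (ℚ.∣ c ℚ.- a ∣ ℚ.*_) (ℚ.0≤p⇒∣p∣≡p (ℚ.<⇒≤ 0<rt)) ⟩
      ℚ.∣ c ℚ.- a ∣ ℚ.* (r ℚ.* t)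
        <⟨ ℚ.*-monoˡ-<-pos (r ℚ.* t) {{ℚ.positive 0<rt}} c-a< ⟩
      ε ℚ.* (δ ℚ.* δ) ℚ.* (r ℚ.* t)
        ≡⟨ solve 4 (λ e d r t → e :* (d :* d) :* (r :* t) := e :* ((d :* r) :* (d :* t)))
             refl ε δ r t ⟩
      ε ℚ.* ((δ ℚ.* r) ℚ.* (δ ℚ.* t))
        ≤⟨ ℚ.*-monoˡ-≤-nonNeg ε {{ℚ.nonNegative (ℚ.<⇒≤ 0<ε)}} product≤1 ⟩
      ε ℚ.* 1ℚ
        ≡⟨ ℚ.*-identityʳ ε ⟩
      ε ∎
      where
      r t : ℚ
      r = recip a
      t = recip c
      0<a : 0ℚ ℚ.< a
      0<a = ℚ.<-≤-trans 0<δ δ≤a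
      0<c : 0ℚ ℚ.< c
      0<c = ℚ.<-≤-trans 0<δ δ≤c
      0<rt : 0ℚ ℚ.< r ℚ.* t
      0<rt = pos* (recip-pos a 0<a) (recip-pos c 0<c)

      difference : r ℚ.- t ≡ (c ℚ.- a) ℚ.* (r ℚ.* t)
      difference = begin-equality
        r ℚ.- t
          ≡⟨ cong₂ ℚ._-_ (sym (ℚ.*-identityʳ r)) (sym (ℚ.*-identityʳ t)) ⟩
        r ℚ.* 1ℚ ℚ.- t ℚ.* 1ℚ
          ≡⟨ cong₂ (λ p q → r ℚ.* p ℚ.- t ℚ.* q)
               (sym (recip-inverse c 0<c)) (sym (recip-inverse a 0<a)) ⟩
        r ℚ.* (t ℚ.* c) ℚ.- t ℚ.* (r ℚ.* a)
          ≡⟨ solve 4 (λ a c r t →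
               r :* (t :* c) :- t :* (r :* a) := (c :- a) :* (r :* t)) refl a c r t ⟩
        (c ℚ.- a) ℚ.* (r ℚ.* t) ∎

      product≤1 : (δ ℚ.* r) ℚ.* (δ ℚ.* t) ℚ.≤ 1ℚ
      product≤1 = begin
        (δ ℚ.* r) ℚ.* (δ ℚ.* t)
          ≤⟨ ℚ.*-monoˡ-≤-nonNeg (δ ℚ.* r)
               {{ℚ.nonNegative (ℚ.<⇒≤ (pos* 0<δ (recip-pos a 0<a)))}} (δ*recip≤1 c δ≤c) ⟩
        (δ ℚ.* r) ℚ.* 1ℚ  ≡⟨ ℚ.*-identityʳ (δ ℚ.* r) ⟩
        δ ℚ.* r           ≤⟨ δ*recip≤1 a δ≤a ⟩
        1ℚ                ∎

inv : (x : ℝ) → 0ℝ < x → ℝ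
inv x 0<x = mkℝ (λ n → recip (seq x n)) (recip-cauchy x 0<x)

------------------------------------------------------------------------
-- Extended reals, suprema and infima, limits

data ℝ∞ : Set where
  fin : ℝ → ℝ∞
  ∞   : ℝ∞

infix 4 _≤∞_

data _≤∞_ : Rel ℝ∞ 0ℓ where
  fin≤fin : ∀ {x y} → x ≤ y → fin x ≤∞ fin y
  ≤-top   : ∀ {t} → t ≤∞ ∞

module _ {A : Set} (_≼_ : Rel A 0ℓ) {ℓ : Level} (P : Pred A ℓ) where

  IsSup : A → Set ℓ
  IsSup s = (∀ t → t ∈ P → t ≼ s) × (∀ b → (∀ t → t ∈ P → t ≼ b) → s ≼ b)

  IsInf : A → Set ℓ
  IsInf i = (∀ t → t ∈ P → i ≼ t) × (∀ b → (∀ t → t ∈ P → b ≼ t) → b ≼ i)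

infix 4 _⟶_

_⟶_ : (ℕ → ℝ) → ℝ∞ → Set
u ⟶ fin x = ∀ ε → 0ℝ < ε → Eventually λ n → ∣ u n - x ∣ < ε
u ⟶ ∞     = ∀ M → Eventually λ n → M < u n

partialSum : (ℕ → ℝ) → ℕ → ℝ
partialSum u zero    = 0ℝ
partialSum u (suc n) = partialSum u n + u n

------------------------------------------------------------------------
-- Real powers, through the exponential series

_^_ : ℝ → ℕ → ℝ
x ^ zero  = 1ℝ
x ^ suc n = x * (x ^ n)

IsExp : ℝ → ℝ → Set
IsExp u y = partialSum (λ k → (u ^ k) * fromℚ ((+ 1 ℚ./ (k !)) {{k ℕ.!≢0}})) ⟶ fin y

-- IsPower r s y says  r ^ s = y  for  r , s ≥ 0 : for r > 0 this is
-- exp (s · log r) = y, with log r given as the u such that exp u = r.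
IsPower : (r s y : ℝ) → Set
IsPower r s y =
  (r ≈ 0ℝ × s ≈ 0ℝ × y ≈ 1ℝ) ⊎
  (r ≈ 0ℝ × 0ℝ < s × y ≈ 0ℝ) ⊎
  (∃[ u ] IsExp u r × IsExp (s * u) y)

------------------------------------------------------------------------
-- Hausdorff measure and dimension in [0,1]

record 𝕀 : Set where
  constructor mk𝕀
  field
    point   : ℝ
    0≤point : 0ℝ ≤ point
    point≤1 : point ≤ 1ℝ
open 𝕀 public

dist : 𝕀 → 𝕀 → ℝ
dist x y = ∣ point x - point y ∣

-- For inhabited U only: the empty set has no least upper bound in ℝ.
IsDiameter : Pred 𝕀 0ℓ → ℝ → Set
IsDiameter U = IsSup _≤_ (λ r → ∃[ x ] ∃[ y ] x ∈ U × y ∈ U × r ≈ dist x y)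

-- diam U ≤ δ and c = (diam U) ^ s, where the empty set contributes 0.
IsTerm : (s δ : ℝ) → Pred 𝕀 0ℓ → ℝ → Set
IsTerm s δ U c =
  (Empty U × c ≈ 0ℝ) ⊎
  (∃[ d ] IsDiameter U d × d ≤ δ × IsPower d s c)

-- t is the sum, over some countable δ-cover of A, of the s-th powers of the
-- diameters; the terms being nonnegative, the sum is the supremum of the
-- partial sums.  Finite covers are padded with empty sets.
CoverSum : (s δ : ℝ) → Pred 𝕀 0ℓ → Pred ℝ∞ (lsuc 0ℓ)
CoverSum s δ A t = Σ (ℕ → Pred 𝕀 0ℓ) λ U → ∃[ c ]
  A ⊆ ⋃ ℕ U ×
  (∀ i → IsTerm s δ (U i) (c i)) ×
  IsSup _≤∞_ (λ r → ∃[ n ] r ≡ fin (partialSum c n)) t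

IsHausdorffPremeasure : (s δ : ℝ) → Pred 𝕀 0ℓ → ℝ∞ → Set₁
IsHausdorffPremeasure s δ A = IsInf _≤∞_ (CoverSum s δ A)

-- The limit as δ → 0 of the premeasures, which are nonincreasing in δ.
IsHausdorffMeasure : ℝ → Pred 𝕀 0ℓ → ℝ∞ → Set₁
IsHausdorffMeasure s A =
  IsSup _≤∞_ (λ t → ∃[ δ ] 0ℝ < δ × IsHausdorffPremeasure s δ A t)

IsHausdorffDim : Pred 𝕀 0ℓ → ℝ∞ → Set₁
IsHausdorffDim A =
  IsInf _≤∞_ (λ t → ∃[ s ] t ≡ fin s × 0ℝ ≤ s × IsHausdorffMeasure s A (fin 0ℝ))

------------------------------------------------------------------------
-- Continued fractions.  Sequences of the mathematics indexed by n ≥ 1 are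
-- functions on ℕ whose value at 0 is ignored.

-- convergent a n = 1 / (a 1 + 1 / (a 2 + ⋯ + 1 / a n))
convergent : (ℕ → ℕ) → ℕ → ℚ
convergent a zero    = 0ℚ
convergent a (suc n) = recip ((+ a 1 ℚ./ 1) ℚ.+ convergent (λ k → a (suc k)) n)

IsIrrational : ℝ → Set
IsIrrational x = ∀ q → ¬ (x ≈ fromℚ q)

ArePartialQuotients : (ℕ → ℕ) → ℝ → Set
ArePartialQuotients a x =
  (∀ n → 1 ℕ.≤ n → 1 ℕ.≤ a n) × (λ n → fromℚ (convergent a n)) ⟶ fin x

IncreasingFrom1 : (ℕ → ℕ) → Set
IncreasingFrom1 a = ∀ n → 1 ℕ.≤ n → a n ℕ.< a (suc n)

J : Pred 𝕀 0ℓ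
J x = 0ℝ < point x × point x < 1ℝ × IsIrrational (point x) ×
      ∃[ a ] ArePartialQuotients a (point x) × IncreasingFrom1 a

IsArithmeticProgression : ∀ {n} → (Fin n → ℕ) → Set
IsArithmeticProgression f =
  Σ ℤ λ c → Σ ℤ λ d → ∀ i → + f i ≡ c ℤ.+ + toℕ i ℤ.* d

-- An irrational has exactly one sequence of partial quotients (at n ≥ 1), so
-- the a below and the one witnessing x ∈ J agree.
G : (ℕ → ℕ) → Pred 𝕀 0ℓ
G σ x = x ∈ J × ∃[ a ] ArePartialQuotients a (point x) ×
  Eventually λ n → 1 ℕ.≤ n →
    IsArithmeticProgression {n} (λ i → a (σ n ℕ.+ toℕ i))

-- The n-th term, n = 0, 1, …, is  (σ (k + 1) − σ k) / k  with  k = n + 1.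
gapRatio : (ℕ → ℕ) → ℕ → ℝ
gapRatio σ n = fromℚ (+ (σ (suc k) ℕ.∸ σ k) ℚ./ k)
  where k = suc n

abstract
  0<2* : ∀ x → 1ℝ ≤ x → 0ℝ < 2ℝ * x
  0<2* x 1≤x = let (N , h) = 1≤x ½ 0<½ in
    1ℚ , 0<1 , N , λ n N≤n → let u = seq x n in
      begin
        0ℚ ℚ.+ 1ℚ                            ≡⟨⟩
        2q ℚ.* (1ℚ ℚ.- ½)                    ≤⟨ ℚ.*-monoˡ-≤-nonNeg 2q (ℚ.+-monoˡ-≤ (ℚ.- ½) (h n N≤n)) ⟩
        2q ℚ.* ((u ℚ.+ ½) ℚ.- ½)             ≡⟨ cong (2q ℚ.*_) (solve 2 (λ u h → (u :+ h) :- h := u) refl u ½) ⟩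
        2q ℚ.* u                             ∎
    where
    open ℚ.≤-Reasoning
    2q : ℚ
    2q = + 2 ℚ./ 1

dimFormula : (β : ℝ∞) → fin 1ℝ ≤∞ β → ℝ
dimFormula (fin β) (fin≤fin 1≤β) = (β - 1ℝ) * inv (2ℝ * β) (0<2* β 1≤β)
dimFormula ∞       _             = ½ℝ

{-# OPTIONS --safe --inversion-max-depth=1 #-}

-- Write D for the claimed dimension and g for the n-th gap of σ.
--
-- Upper bound.  A cylinder has diameter at most the inverse square of the
-- product of its digits.  The digits of a point of J increase, so if f free
-- digits with product V are followed by k digits determined by a progression,
-- the latter have product at least V^(k/f), and the s-th power of the diameter
-- gains the factor V^(-2s(f+k)/f).  Here f is about g - n and f + k about g, so
-- for s > D the exponent eventually exceeds 1, and the sum over the free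
-- digits, which are at least their position, becomes arbitrarily small.
--
-- Lower bound.  Let the free digit at position j range over [4^j, 2·4^j) and
-- continue each progression with difference 1.  Up to position k there are
-- 2^F points of this tree, whereas points that differ there are at distance at
-- least 2^(-2k²-4k-1), and F / 2k² tends to D.  A cover whose sum of s-th powers
-- is small, s < D, therefore forbids too few nodes of the tree to block every
-- branch, and a surviving branch is an uncovered point.

module Submission where

open import Defs
open import Axiom.ExcludedMiddle using (ExcludedMiddle)
open import Level using (0ℓ)
open import Data.Nat.Base as ℕ using (ℕ; zero; suc; _!; z≤n; s≤s)
import Data.Nat.Properties as ℕ
open import Data.Nat.Coprimality using (1-coprimeTo) renaming (sym to coprime-sym)
open import Data.Nat.DivMod using (_/_; m≡m%n+[m/n]*n; m%n<n; m/n*n≤m; /-monoˡ-≤; m*n/n≡m)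
import Data.Nat.Tactic.RingSolver as ℕRing
open import Data.Integer.Base as ℤ using (+_)
import Data.Integer.Properties as ℤ
import Data.Integer.Tactic.RingSolver as ℤRing
open import Data.Rational.Base as ℚ using (ℚ; mkℚ; 0ℚ; 1ℚ; ½)
import Data.Rational.Properties as ℚ
import Data.Rational.Unnormalised.Base as ℚᵘ
import Data.Rational.Unnormalised.Properties as ℚᵘ
open import Data.Fin.Base using (toℕ; fromℕ<)
open import Data.Fin.Properties using (toℕ-fromℕ<; toℕ<n)
open import Data.Product.Base using (Σ; ∃; ∃-syntax; _×_; _,_; proj₁; proj₂)
open import Data.Sum.Base using (_⊎_; inj₁; inj₂; [_,_]′)
open import Data.Empty using (⊥; ⊥-elim)
open import Function.Base using (_∘_; id)
open import Relation.Nullary using (¬_; Dec; yes; no)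
open import Relation.Nullary.Decidable using (toWitness)
open import Relation.Nullary.Decidable.Core using (dec⇒maybe)
open import Relation.Unary using (Pred; _∈_; _⊆_; ⋃; Empty)
open import Relation.Binary.Definitions using (Tri; tri<; tri≈; tri>)
open import Relation.Binary.PropositionalEquality
  using (_≡_; _≢_; refl; sym; trans; cong; cong₂; subst; subst₂)
open import Tactic.RingSolver using (solve-∀)
open import Tactic.RingSolver.Core.AlmostCommutativeRing
  using (AlmostCommutativeRing; fromCommutativeRing)

-- Both bounds are reduced to inequalities between natural numbers. The exponents that matter are
-- rational, s = p/q; a real s below D is compared with a rational one above it. Costs are estimated
-- through their q-th powers, so that real powers disappear from the combinatorics. In the upper
-- bound the exponent exceeds 1 by as little as 1/q. The sum over a digit v is therefore compared
-- with weights of order v log² v: their reciprocals are summable, and for large v they lie below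
-- v^(1 + 1/q) with a factor 2 to spare. One such factor is collected per group of digits, and since
-- any number of groups may be read before the cover is written down, these factors pay for every
-- constant and every required accuracy. The lower bound constructs no measure. Each set of a cover
-- is replaced by one node of the tree containing all tree points of that set, a node carries the
-- mass 2^(-F), and a greedy descent keeps the forbidden mass below the current node at no more than
-- half of the node's own mass.

ℚring : AlmostCommutativeRing 0ℓ 0ℓ
ℚring = fromCommutativeRing ℚ.+-*-commutativeRing (λ x → dec⇒maybe (0ℚ ℚ.≟ x))

-- Rational inequalities

0<½ : 0ℚ ℚ.< ½
0<½ = toWitness {a? = 0ℚ ℚ.<? ½} _

0<1 : 0ℚ ℚ.< 1ℚ
0<1 = toWitness {a? = 0ℚ ℚ.<? 1ℚ} _

0≤1 : 0ℚ ℚ.≤ 1ℚ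
0≤1 = ℚ.<⇒≤ 0<1

0≤-diff : ∀ {p q} → p ℚ.≤ q → 0ℚ ℚ.≤ q ℚ.- p
0≤-diff {p} {q} h = subst (ℚ._≤ q ℚ.- p) (ℚ.+-inverseʳ p) (ℚ.+-monoˡ-≤ (ℚ.- p) h)

≤-by : ∀ {p q} r → 0ℚ ℚ.≤ r → q ≡ p ℚ.+ r → p ℚ.≤ q
≤-by {p} r 0≤r eq =
  subst₂ ℚ._≤_ (ℚ.+-identityʳ p) (sym eq) (ℚ.+-monoʳ-≤ p 0≤r)

<-by : ∀ {p q} r → 0ℚ ℚ.< r → q ≡ p ℚ.+ r → p ℚ.< q
<-by {p} r 0<r eq =
  subst₂ ℚ._<_ (ℚ.+-identityʳ p) (sym eq) (ℚ.+-monoʳ-< p 0<r)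

0<-diff : ∀ {p q} → p ℚ.< q → 0ℚ ℚ.< q ℚ.- p
0<-diff {p} {q} h = subst (ℚ._< q ℚ.- p) (ℚ.+-inverseʳ p) (ℚ.+-monoˡ-< (ℚ.- p) h)

0<* : ∀ {p q} → 0ℚ ℚ.< p → 0ℚ ℚ.< q → 0ℚ ℚ.< p ℚ.* q
0<* {p} {q} 0<p 0<q = ℚ.positive⁻¹ (p ℚ.* q)
  {{ℚ.pos*pos⇒pos p {{ℚ.positive 0<p}} q {{ℚ.positive 0<q}}}}

0≤* : ∀ {p q} → 0ℚ ℚ.≤ p → 0ℚ ℚ.≤ q → 0ℚ ℚ.≤ p ℚ.* q
0≤* {p} {q} 0≤p 0≤q = ℚ.nonNegative⁻¹ (p ℚ.* q)
  {{ℚ.nonNeg*nonNeg⇒nonNeg p {{ℚ.nonNegative 0≤p}} q {{ℚ.nonNegative 0≤q}}}}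

0≤+ : ∀ {p q} → 0ℚ ℚ.≤ p → 0ℚ ℚ.≤ q → 0ℚ ℚ.≤ p ℚ.+ q
0≤+ = ℚ.+-mono-≤

*-mono-≤ : ∀ {p q r s} → 0ℚ ℚ.≤ p → 0ℚ ℚ.≤ r → p ℚ.≤ q → r ℚ.≤ s → p ℚ.* r ℚ.≤ q ℚ.* s
*-mono-≤ {p} {q} {r} {s} 0≤p 0≤r p≤q r≤s = ℚ.≤-trans
  (ℚ.*-monoˡ-≤-nonNeg p {{ℚ.nonNegative 0≤p}} r≤s)
  (ℚ.*-monoʳ-≤-nonNeg s {{ℚ.nonNegative (ℚ.≤-trans 0≤r r≤s)}} p≤q)

*-monoʳ-≤ : ∀ {p q} r → 0ℚ ℚ.≤ r → p ℚ.≤ q → r ℚ.* p ℚ.≤ r ℚ.* q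
*-monoʳ-≤ r 0≤r = ℚ.*-monoˡ-≤-nonNeg r {{ℚ.nonNegative 0≤r}}

*-monoˡ-≤ : ∀ {p q} r → 0ℚ ℚ.≤ r → p ℚ.≤ q → p ℚ.* r ℚ.≤ q ℚ.* r
*-monoˡ-≤ r 0≤r = ℚ.*-monoʳ-≤-nonNeg r {{ℚ.nonNegative 0≤r}}

*-cancelʳ-≤ : ∀ {p q} r → 0ℚ ℚ.< r → p ℚ.* r ℚ.≤ q ℚ.* r → p ℚ.≤ q
*-cancelʳ-≤ r 0<r = ℚ.*-cancelʳ-≤-pos r {{ℚ.positive 0<r}}

0<half : ∀ {ε} → 0ℚ ℚ.< ε → 0ℚ ℚ.< ε ℚ.* ½
0<half h = 0<* h 0<½

halves : ∀ ε → ε ℚ.* ½ ℚ.+ ε ℚ.* ½ ≡ ε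
halves = solve-∀ ℚring

half< : ∀ {ε} → 0ℚ ℚ.< ε → ε ℚ.* ½ ℚ.< ε
half< {ε} h = <-by (ε ℚ.* ½) (0<half h) (sym (halves ε))

half≤ : ∀ {ε} → 0ℚ ℚ.< ε → ε ℚ.* ½ ℚ.≤ ε
half≤ h = ℚ.<⇒≤ (half< h)

p≤∣p∣ : ∀ p → p ℚ.≤ ℚ.∣ p ∣
p≤∣p∣ p with ℚ.≤-total 0ℚ p
... | inj₁ 0≤p = ℚ.≤-reflexive (sym (ℚ.0≤p⇒∣p∣≡p 0≤p))
... | inj₂ p≤0 = ℚ.≤-trans p≤0 (ℚ.0≤∣p∣ p)

∣∣≤ : ∀ {p r} → p ℚ.≤ r → ℚ.- p ℚ.≤ r → ℚ.∣ p ∣ ℚ.≤ r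
∣∣≤ {p} {r} h₁ h₂ with ℚ.∣p∣≡p∨∣p∣≡-p p
... | inj₁ eq = subst (ℚ._≤ r) (sym eq) h₁
... | inj₂ eq = subst (ℚ._≤ r) (sym eq) h₂

∣-∣≤ : ∀ {p q r} → p ℚ.≤ q ℚ.+ r → q ℚ.≤ p ℚ.+ r → ℚ.∣ p ℚ.- q ∣ ℚ.≤ r
∣-∣≤ {p} {q} {r} h₁ h₂ = ∣∣≤ {p ℚ.- q} {r}
  (≤-by _ (0≤-diff h₁) (e₁ p q r)) (≤-by _ (0≤-diff h₂) (e₂ p q r))
  where
  e₁ : ∀ p q r → r ≡ (p ℚ.- q) ℚ.+ ((q ℚ.+ r) ℚ.- p)
  e₁ = solve-∀ ℚring
  e₂ : ∀ p q r → r ≡ (ℚ.- (p ℚ.- q)) ℚ.+ ((p ℚ.+ r) ℚ.- q)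
  e₂ = solve-∀ ℚring

∣-∣≤⇒≤ : ∀ p q {r} → ℚ.∣ p ℚ.- q ∣ ℚ.≤ r → p ℚ.≤ q ℚ.+ r
∣-∣≤⇒≤ p q {r} h = ≤-by _ (0≤-diff (ℚ.≤-trans (p≤∣p∣ (p ℚ.- q)) h)) (e p q r)
  where
  e : ∀ p q r → q ℚ.+ r ≡ p ℚ.+ (r ℚ.- (p ℚ.- q))
  e = solve-∀ ℚring

∣-∣-comm : ∀ p q → ℚ.∣ p ℚ.- q ∣ ≡ ℚ.∣ q ℚ.- p ∣
∣-∣-comm p q = trans (sym (ℚ.∣-p∣≡∣p∣ (p ℚ.- q))) (cong ℚ.∣_∣ (e p q))
  where
  e : ∀ p q → ℚ.- (p ℚ.- q) ≡ q ℚ.- p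
  e = solve-∀ ℚring

∣-∣-triangle : ∀ p q r → ℚ.∣ p ℚ.- r ∣ ℚ.≤ ℚ.∣ p ℚ.- q ∣ ℚ.+ ℚ.∣ q ℚ.- r ∣
∣-∣-triangle p q r = subst (λ z → ℚ.∣ z ∣ ℚ.≤ ℚ.∣ p ℚ.- q ∣ ℚ.+ ℚ.∣ q ℚ.- r ∣) (e p q r) (ℚ.∣p+q∣≤∣p∣+∣q∣ (p ℚ.- q) (q ℚ.- r))
  where
  e : ∀ p q r → (p ℚ.- q) ℚ.+ (q ℚ.- r) ≡ p ℚ.- r
  e = solve-∀ ℚring

≤-from-all-ε : ∀ {p q} → (∀ ε → 0ℚ ℚ.< ε → p ℚ.≤ q ℚ.+ ε) → p ℚ.≤ q
≤-from-all-ε {p} {q} h with q ℚ.<? p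
... | no q≮p  = ℚ.≮⇒≥ q≮p
... | yes q<p = ⊥-elim (ℚ.<-irrefl refl (ℚ.<-≤-trans mid (h ε 0<ε)))
  where
  ε = (p ℚ.- q) ℚ.* ½
  0<ε = 0<half (0<-diff q<p)
  e : ∀ p q → p ≡ (q ℚ.+ (p ℚ.- q) ℚ.* ½) ℚ.+ (p ℚ.- q) ℚ.* ½
  e = solve-∀ ℚring
  mid : q ℚ.+ ε ℚ.< p
  mid = <-by ε 0<ε (e p q)

-- Naturals and unit fractions as rationals

opaque
  -- Opaque, so that goals keep `ι n` as an atom instead of unfolding a normalised fraction; the two
  -- equations in this block are the only access to it.
  ι : ℕ → ℚ
  ι n = + n ℚ./ 1

  ι-def : ∀ n → ι n ≡ + n ℚ./ 1
  ι-def n = refl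

  ι-mkℚ : ∀ n → ι n ≡ mkℚ (+ n) 0 (coprime-sym (1-coprimeTo n))
  ι-mkℚ n = ℚ.normalize-coprime (coprime-sym (1-coprimeTo n))

ι0 : ι 0 ≡ 0ℚ
ι0 = ι-def 0

ι1 : ι 1 ≡ 1ℚ
ι1 = ι-def 1

ι-+ : ∀ m n → ι (m ℕ.+ n) ≡ ι m ℚ.+ ι n
ι-+ m n = sym (trans (cong₂ ℚ._+_ (ι-mkℚ m) (ι-mkℚ n))
  (trans (cong (ℚ._/ 1) (cong₂ ℤ._+_ (ℤ.*-identityʳ (+ m)) (ℤ.*-identityʳ (+ n))))
    (sym (ι-def (m ℕ.+ n)))))

ι-* : ∀ m n → ι (m ℕ.* n) ≡ ι m ℚ.* ι n
ι-* m n = sym (trans (cong₂ ℚ._*_ (ι-mkℚ m) (ι-mkℚ n))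
  (trans (cong (ℚ._/ 1) (sym (ℤ.pos-* m n))) (sym (ι-def (m ℕ.* n)))))

ι-mono-≤ : ∀ {m n} → m ℕ.≤ n → ι m ℚ.≤ ι n
ι-mono-≤ {m} {n} m≤n = subst₂ ℚ._≤_ (sym (ι-mkℚ m)) (sym (ι-mkℚ n))
  (ℚ.*≤* (ℤ.*-monoʳ-≤-nonNeg (+ 1) (ℤ.+≤+ m≤n)))

ι-mono-< : ∀ {m n} → m ℕ.< n → ι m ℚ.< ι n
ι-mono-< {m} {n} m<n = subst₂ ℚ._<_ (sym (ι-mkℚ m)) (sym (ι-mkℚ n))
  (ℚ.*<* (ℤ.*-monoʳ-<-pos (+ 1) (ℤ.+<+ m<n)))

ι-cancel-≤ : ∀ {m n} → ι m ℚ.≤ ι n → m ℕ.≤ n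
ι-cancel-≤ {m} {n} h with m ℕ.≤? n
... | yes m≤n = m≤n
... | no m≰n  = ⊥-elim (ℚ.<-irrefl refl (ℚ.<-≤-trans (ι-mono-< (ℕ.≰⇒> m≰n)) h))

0≤ι : ∀ n → 0ℚ ℚ.≤ ι n
0≤ι n = subst (ℚ._≤ ι n) ι0 (ι-mono-≤ {0} {n} z≤n)

0<ι : ∀ {n} → 1 ℕ.≤ n → 0ℚ ℚ.< ι n
0<ι {n} h = subst (ℚ._< ι n) ι0 (ι-mono-< {0} h)

recip-* : ∀ q → 0ℚ ℚ.< q → recip q ℚ.* q ≡ 1ℚ
recip-* (mkℚ (+ 0) _ _) (ℚ.*<* (ℤ.+<+ ()))
recip-* q@(mkℚ (+ (suc _)) _ _) _ = ℚ.*-inverseˡ q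
recip-* (mkℚ (ℤ.-[1+ _ ]) _ _) (ℚ.*<* ())

0<recip : ∀ {q} → 0ℚ ℚ.< q → 0ℚ ℚ.< recip q
0<recip {mkℚ (+ 0) _ _} (ℚ.*<* (ℤ.+<+ ()))
0<recip {q@(mkℚ (+ (suc _)) _ _)} 0<q =
  ℚ.positive⁻¹ _ {{ℚ.1/pos⇒pos q {{ℚ.positive 0<q}}}}
0<recip {mkℚ (ℤ.-[1+ _ ]) _ _} (ℚ.*<* ())

recip-unique : ∀ {q} r → 0ℚ ℚ.< q → r ℚ.* q ≡ 1ℚ → r ≡ recip q
recip-unique {q} r 0<q eq = trans (sym (ℚ.*-identityʳ r)) (trans
  (cong (r ℚ.*_) (sym (trans (ℚ.*-comm q (recip q)) (recip-* q 0<q)))) (trans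
  (sym (ℚ.*-assoc r q (recip q))) (trans (cong (ℚ._* recip q) eq) (ℚ.*-identityˡ (recip q)))))

recip-antimono : ∀ {p q} → 0ℚ ℚ.< p → p ℚ.≤ q → recip q ℚ.≤ recip p
recip-antimono {p} {q} 0<p p≤q = subst₂ ℚ._≤_ eq₁ eq₂
  (*-monoʳ-≤ (recip q ℚ.* recip p) (ℚ.<⇒≤ (0<* (0<recip 0<q) (0<recip 0<p))) p≤q)
  where
  0<q = ℚ.<-≤-trans 0<p p≤q
  e₁ : ∀ a b c → (a ℚ.* b) ℚ.* c ≡ a ℚ.* (b ℚ.* c)
  e₁ = solve-∀ ℚring
  e₂ : ∀ a b c → (a ℚ.* b) ℚ.* c ≡ b ℚ.* (a ℚ.* c)
  e₂ = solve-∀ ℚring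
  eq₁ : (recip q ℚ.* recip p) ℚ.* p ≡ recip q
  eq₁ = trans (e₁ (recip q) (recip p) p) (trans (cong (recip q ℚ.*_) (recip-* p 0<p)) (ℚ.*-identityʳ (recip q)))
  eq₂ : (recip q ℚ.* recip p) ℚ.* q ≡ recip p
  eq₂ = trans (e₂ (recip q) (recip p) q) (trans (cong (recip p ℚ.*_) (recip-* q 0<q)) (ℚ.*-identityʳ (recip p)))

-- Junk value: 1/ᵘ 0 = 0.
opaque
  1/ᵘ : ℕ → ℚ
  1/ᵘ n = recip (ι n)

  1/ᵘ-def : ∀ n → 1/ᵘ n ≡ recip (ι n)
  1/ᵘ-def n = refl

1/ᵘ-* : ∀ {n} → 1 ℕ.≤ n → 1/ᵘ n ℚ.* ι n ≡ 1ℚ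
1/ᵘ-* {n} 1≤n = trans (cong (ℚ._* ι n) (1/ᵘ-def n)) (recip-* (ι n) (0<ι 1≤n))

1/ᵘ-unique : ∀ {n} r → 1 ℕ.≤ n → r ℚ.* ι n ≡ 1ℚ → r ≡ 1/ᵘ n
1/ᵘ-unique {n} r 1≤n eq = trans (recip-unique r (0<ι 1≤n) eq) (sym (1/ᵘ-def n))

0<1/ᵘ : ∀ {n} → 1 ℕ.≤ n → 0ℚ ℚ.< 1/ᵘ n
0<1/ᵘ {n} 1≤n = subst (0ℚ ℚ.<_) (sym (1/ᵘ-def n)) (0<recip (0<ι 1≤n))

0≤1/ᵘ : ∀ n → 0ℚ ℚ.≤ 1/ᵘ n
0≤1/ᵘ zero    = ℚ.≤-reflexive (sym (trans (1/ᵘ-def 0) (cong recip ι0)))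
0≤1/ᵘ (suc n) = ℚ.<⇒≤ (0<1/ᵘ (s≤s z≤n))

1/ᵘ-antimono : ∀ {m n} → 1 ℕ.≤ m → m ℕ.≤ n → 1/ᵘ n ℚ.≤ 1/ᵘ m
1/ᵘ-antimono {m} {n} 1≤m m≤n = subst₂ ℚ._≤_ (sym (1/ᵘ-def n)) (sym (1/ᵘ-def m))
  (recip-antimono (0<ι 1≤m) (ι-mono-≤ m≤n))

1≤* : ∀ {m n} → 1 ℕ.≤ m → 1 ℕ.≤ n → 1 ℕ.≤ m ℕ.* n
1≤* = ℕ.*-mono-≤

1/ᵘ-mul : ∀ {m n} → 1 ℕ.≤ m → 1 ℕ.≤ n → 1/ᵘ (m ℕ.* n) ≡ 1/ᵘ m ℚ.* 1/ᵘ n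
1/ᵘ-mul {m} {n} 1≤m 1≤n = sym (1/ᵘ-unique _ (1≤* 1≤m 1≤n)
  (trans (cong ((1/ᵘ m ℚ.* 1/ᵘ n) ℚ.*_) (ι-* m n))
  (trans (e (1/ᵘ m) (1/ᵘ n) (ι m) (ι n)) (cong₂ ℚ._*_ (1/ᵘ-* 1≤m) (1/ᵘ-* 1≤n)))))
  where
  e : ∀ a b c d → (a ℚ.* b) ℚ.* (c ℚ.* d) ≡ (a ℚ.* c) ℚ.* (b ℚ.* d)
  e = solve-∀ ℚring

/-* : ∀ a n .{{_ : ℕ.NonZero n}} → (+ a ℚ./ n) ℚ.* ι n ≡ ι a
/-* a (suc n) = trans (cong ((+ a ℚ./ suc n) ℚ.*_) (ι-def (suc n))) (trans (ℚ.toℚᵘ-injective (begin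
  ℚ.toℚᵘ ((+ a ℚ./ suc n) ℚ.* (+ suc n ℚ./ 1))
    ≈⟨ ℚ.toℚᵘ-homo-* (+ a ℚ./ suc n) (+ suc n ℚ./ 1) ⟩
  ℚ.toℚᵘ (+ a ℚ./ suc n) ℚᵘ.* ℚ.toℚᵘ (+ suc n ℚ./ 1)
    ≈⟨ ℚᵘ.*-cong (ℚ.toℚᵘ-fromℚᵘ (ℚᵘ.mkℚᵘ (+ a) n)) (ℚ.toℚᵘ-fromℚᵘ (ℚᵘ.mkℚᵘ (+ suc n) 0)) ⟩
  ℚᵘ.mkℚᵘ (+ a) n ℚᵘ.* ℚᵘ.mkℚᵘ (+ suc n) 0
    ≈⟨ ℚᵘ.*≡* (trans (ℤ.*-identityʳ (+ a ℤ.* + suc n))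
         (cong (λ k → + a ℤ.* + k) (sym (ℕ.*-identityʳ (suc n))))) ⟩
  ℚᵘ.mkℚᵘ (+ a) 0
    ≈⟨ ℚ.toℚᵘ-fromℚᵘ (ℚᵘ.mkℚᵘ (+ a) 0) ⟨
  ℚ.toℚᵘ (+ a ℚ./ 1) ∎)) (sym (ι-def a)))
  where open ℚᵘ.≃-Reasoning

/≡ : ∀ a n .{{_ : ℕ.NonZero n}} → + a ℚ./ n ≡ ι a ℚ.* 1/ᵘ n
/≡ a n@(suc _) = trans (sym (ℚ.*-identityʳ x))
  (trans (cong (x ℚ.*_) (sym (trans (ℚ.*-comm (ι n) (1/ᵘ n)) (1/ᵘ-* (s≤s z≤n)))))
  (trans (sym (ℚ.*-assoc x (ι n) (1/ᵘ n))) (cong (ℚ._* 1/ᵘ n) (/-* a n))))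
  where x = + a ℚ./ n

ceiling : ∀ q → ∃[ n ] 1 ℕ.≤ n × q ℚ.≤ ι n
ceiling (mkℚ (+ n) d c) = suc n , s≤s z≤n ,
  subst (mkℚ (+ n) d c ℚ.≤_) (sym (ι-mkℚ (suc n))) (ℚ.*≤* (ℤ.≤-trans
    (ℤ.≤-reflexive (ℤ.*-identityʳ (+ n)))
    (ℤ.≤-trans (ℤ.+≤+ (ℕ.≤-trans (ℕ.n≤1+n n) (ℕ.m≤m*n (suc n) (suc d))))
      (ℤ.≤-reflexive (ℤ.pos-* (suc n) (suc d))))))
ceiling q@(mkℚ (ℤ.-[1+ n ]) d c) = 1 , s≤s z≤n ,
  ℚ.≤-trans (ℚ.<⇒≤ (ℚ.negative⁻¹ q)) (0≤ι 1)

archimedean : ∀ ε → 0ℚ ℚ.< ε → ∃[ n ] 1 ℕ.≤ n × 1/ᵘ n ℚ.≤ ε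
archimedean ε 0<ε = let (n , 1≤n , h) = ceiling (recip ε) in
  n , 1≤n , *-cancelʳ-≤ (ι n) (0<ι 1≤n) (subst (ℚ._≤ ε ℚ.* ι n) (sym (1/ᵘ-* 1≤n))
    (subst (ℚ._≤ ε ℚ.* ι n) (trans (ℚ.*-comm ε (recip ε)) (recip-* ε 0<ε))
      (*-monoʳ-≤ ε (ℚ.<⇒≤ 0<ε) h)))

-- Finite sums of rationals

sum : (ℕ → ℚ) → ℕ → ℚ
sum f zero    = 0ℚ
sum f (suc n) = sum f n ℚ.+ f n

sum-mono : ∀ {f g} n → (∀ i → f i ℚ.≤ g i) → sum f n ℚ.≤ sum g n
sum-mono zero    h = ℚ.≤-refl
sum-mono (suc n) h = ℚ.+-mono-≤ (sum-mono n h) (h n)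

sum-cong : ∀ {f g} n → (∀ i → f i ≡ g i) → sum f n ≡ sum g n
sum-cong zero    h = refl
sum-cong (suc n) h = cong₂ ℚ._+_ (sum-cong n h) (h n)

sum-nonneg : ∀ {f} n → (∀ i → 0ℚ ℚ.≤ f i) → 0ℚ ℚ.≤ sum f n
sum-nonneg zero    h = ℚ.≤-refl
sum-nonneg (suc n) h = 0≤+ (sum-nonneg n h) (h n)

sum-scale : ∀ c f n → sum (λ i → c ℚ.* f i) n ≡ c ℚ.* sum f n
sum-scale c f zero    = sym (ℚ.*-zeroʳ c)
sum-scale c f (suc n) = trans (cong (ℚ._+ c ℚ.* f n) (sum-scale c f n))
  (sym (ℚ.*-distribˡ-+ c (sum f n) (f n)))

sum-+ : ∀ f g n → sum (λ i → f i ℚ.+ g i) n ≡ sum f n ℚ.+ sum g n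
sum-+ f g zero    = refl
sum-+ f g (suc n) = trans (cong (ℚ._+ (f n ℚ.+ g n)) (sum-+ f g n)) (e (sum f n) (sum g n) (f n) (g n))
  where
  e : ∀ a b c d → (a ℚ.+ b) ℚ.+ (c ℚ.+ d) ≡ (a ℚ.+ c) ℚ.+ (b ℚ.+ d)
  e = solve-∀ ℚring

sum-grow : ∀ {f} → (∀ i → 0ℚ ℚ.≤ f i) → ∀ {m n} → m ℕ.≤ n → sum f m ℚ.≤ sum f n
sum-grow {f} h {m} {zero}  z≤n = ℚ.≤-refl
sum-grow {f} h {m} {suc n} m≤ with ℕ.m≤n⇒m<n∨m≡n m≤
... | inj₁ (s≤s m≤n) = ≤-by _ (0≤+ (0≤-diff (sum-grow h m≤n)) (h n)) (e (sum f n) (f n) (sum f m))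
  where
  e : ∀ a b c → a ℚ.+ b ≡ c ℚ.+ ((a ℚ.- c) ℚ.+ b)
  e = solve-∀ ℚring
... | inj₂ refl = ℚ.≤-refl

-- Order and arithmetic of ℝ

zipEv : ∀ {a b c} {P : ℕ → Set a} {Q : ℕ → Set b} {R : ℕ → Set c} →
        Eventually P → Eventually Q → (∀ n → P n → Q n → R n) → Eventually R
zipEv (M , p) (N , q) f = M ℕ.⊔ N , λ n h →
  f n (p n (ℕ.m⊔n≤o⇒m≤o M N h)) (q n (ℕ.m⊔n≤o⇒n≤o M N h))

mapEv : ∀ {a b} {P : ℕ → Set a} {Q : ℕ → Set b} →
        Eventually P → (∀ n → P n → Q n) → Eventually Q
mapEv (N , p) f = N , λ n h → f n (p n h)

always : ∀ {a} {P : ℕ → Set a} → (∀ n → P n) → Eventually P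
always p = 0 , λ n _ → p n

someEv : ∀ {a} {P : ℕ → Set a} → Eventually P → ∃ P
someEv (N , p) = N , p N ℕ.≤-refl

p≤p+ε : ∀ p {ε} → 0ℚ ℚ.≤ ε → p ℚ.≤ p ℚ.+ ε
p≤p+ε p {ε} h = ≤-by ε h refl

ev≤ : ∀ {x y} → Eventually (λ n → seq x n ℚ.≤ seq y n) → x ≤ y
ev≤ {x} {y} h ε 0<ε = mapEv h λ n le → ℚ.≤-trans le (p≤p+ε (seq y n) (ℚ.<⇒≤ 0<ε))

pw≤ : ∀ {x y} → (∀ n → seq x n ℚ.≤ seq y n) → x ≤ y
pw≤ {x} {y} h = ev≤ {x} {y} (always h)

≤-antisym : ∀ {x y} → x ≤ y → y ≤ x → x ≈ y
≤-antisym h₁ h₂ ε 0<ε = zipEv (h₁ _ (0<half 0<ε)) (h₂ _ (0<half 0<ε)) λ n a b →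
  ℚ.≤-<-trans (∣-∣≤ a b) (half< 0<ε)

≈⇒≤ : ∀ {x y} → x ≈ y → x ≤ y
≈⇒≤ {x} {y} h ε 0<ε = mapEv (h ε 0<ε) λ n a → ∣-∣≤⇒≤ (seq x n) (seq y n) (ℚ.<⇒≤ a)

≈-sym : ∀ {x y} → x ≈ y → y ≈ x
≈-sym {x} {y} h ε 0<ε = mapEv (h ε 0<ε) λ n → subst (ℚ._< ε) (∣-∣-comm (seq x n) (seq y n))

≈⇒≥ : ∀ {x y} → x ≈ y → y ≤ x
≈⇒≥ {x} {y} h = ≈⇒≤ {y} {x} (≈-sym {x} {y} h)

pw≈ : ∀ {x y} → (∀ n → seq x n ≡ seq y n) → x ≈ y
pw≈ {x} {y} h = ≤-antisym {x} {y} (pw≤ {x} {y} λ n → ℚ.≤-reflexive (h n))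
                                  (pw≤ {y} {x} λ n → ℚ.≤-reflexive (sym (h n)))

≤-refl : ∀ {x} → x ≤ x
≤-refl {x} = pw≤ {x} {x} λ n → ℚ.≤-refl

≈-refl : ∀ {x} → x ≈ x
≈-refl {x} = pw≈ {x} {x} λ n → refl

≤-trans : ∀ {x y z} → x ≤ y → y ≤ z → x ≤ z
≤-trans {x} {y} {z} h₁ h₂ ε 0<ε = zipEv (h₁ _ (0<half 0<ε)) (h₂ _ (0<half 0<ε)) λ n a b →
  ≤-by _ (0≤+ (0≤-diff a) (0≤-diff b)) (e (seq x n) (seq y n) (seq z n) ε)
  where
  e : ∀ x y z ε → z ℚ.+ ε ≡ x ℚ.+ ((y ℚ.+ ε ℚ.* ½ ℚ.- x) ℚ.+ (z ℚ.+ ε ℚ.* ½ ℚ.- y))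
  e = solve-∀ ℚring

≈-trans : ∀ {x y z} → x ≈ y → y ≈ z → x ≈ z
≈-trans {x} {y} {z} h₁ h₂ = ≤-antisym {x} {z}
  (≤-trans {x} {y} {z} (≈⇒≤ {x} {y} h₁) (≈⇒≤ {y} {z} h₂))
  (≤-trans {z} {y} {x} (≈⇒≥ {y} {z} h₂) (≈⇒≥ {x} {y} h₁))

<⇒≤ : ∀ {x y} → x < y → x ≤ y
<⇒≤ {x} {y} (ε , 0<ε , h) = ev≤ {x} {y} (mapEv h λ n → ℚ.≤-trans (p≤p+ε (seq x n) (ℚ.<⇒≤ 0<ε)))

<⇒≱ : ∀ {x y} → x < y → ¬ (y ≤ x)
<⇒≱ {x} {y} (ε , 0<ε , h) y≤x =
  let (n , a , b) = someEv (zipEv h (y≤x _ (0<half 0<ε)) λ n a b → a , b) in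
  ℚ.<-irrefl refl (ℚ.<-≤-trans (ℚ.+-monoʳ-< (seq x n) (half< 0<ε)) (ℚ.≤-trans a b))

<-≤-trans : ∀ {x y z} → x < y → y ≤ z → x < z
<-≤-trans {x} {y} {z} (ε , 0<ε , h) h₂ = ε ℚ.* ½ , 0<half 0<ε , zipEv h (h₂ _ (0<half 0<ε)) λ n a b →
  ≤-by _ (0≤+ (0≤-diff a) (0≤-diff b)) (e (seq x n) (seq y n) (seq z n) ε)
  where
  e : ∀ x y z ε → z ≡ (x ℚ.+ ε ℚ.* ½) ℚ.+ ((y ℚ.- (x ℚ.+ ε)) ℚ.+ (z ℚ.+ ε ℚ.* ½ ℚ.- y))
  e = solve-∀ ℚring

≤-<-trans : ∀ {x y z} → x ≤ y → y < z → x < z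
≤-<-trans {x} {y} {z} h₂ (ε , 0<ε , h) = ε ℚ.* ½ , 0<half 0<ε , zipEv h (h₂ _ (0<half 0<ε)) λ n a b →
  ≤-by _ (0≤+ (0≤-diff a) (0≤-diff b)) (e (seq x n) (seq y n) (seq z n) ε)
  where
  e : ∀ x y z ε → z ≡ (x ℚ.+ ε ℚ.* ½) ℚ.+ ((z ℚ.- (y ℚ.+ ε)) ℚ.+ (y ℚ.+ ε ℚ.* ½ ℚ.- x))
  e = solve-∀ ℚring

-- Holds without excluded middle: both sequences are compared at a single index K from which on each
-- of them moves by less than ε/8. Either the inequality at K persists with slack ε/2, or y exceeds
-- x by at least ε/4 from K on.
≮⇒≥ : ∀ {x y} → ¬ (x < y) → y ≤ x
≮⇒≥ {x} {y} x≮y ε 0<ε with cauchy x η 0<η | cauchy y η 0<η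
  where
  η = ε ℚ.* ½ ℚ.* ½ ℚ.* ½
  0<η = 0<half (0<half (0<half 0<ε))
... | M , hx | N , hy with seq y (M ℕ.⊔ N) ℚ.≤? seq x (M ℕ.⊔ N) ℚ.+ ε ℚ.* ½
... | yes y≤x = K , λ n K≤n → ≤-by _
        (0≤+ (0≤+ (0≤-diff (∣-∣≤⇒≤ (seq y n) (seq y K) (ℚ.<⇒≤ (hy n K (ℕ.m⊔n≤o⇒n≤o M N K≤n) (ℕ.m≤n⊔m M N)))))
                  (0≤-diff (∣-∣≤⇒≤ (seq x K) (seq x n) (ℚ.<⇒≤ (hx K n (ℕ.m≤m⊔n M N) (ℕ.m⊔n≤o⇒m≤o M N K≤n))))))
             (0≤+ (0≤-diff y≤x) (ℚ.<⇒≤ (0<half (0<half 0<ε)))))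
        (e (seq y n) (seq x n) (seq y K) (seq x K) ε)
  where
  K = M ℕ.⊔ N
  e : ∀ yn xn yK xK ε → xn ℚ.+ ε ≡ yn ℚ.+
      (((yK ℚ.+ ε ℚ.* ½ ℚ.* ½ ℚ.* ½ ℚ.- yn) ℚ.+ (xn ℚ.+ ε ℚ.* ½ ℚ.* ½ ℚ.* ½ ℚ.- xK))
       ℚ.+ ((xK ℚ.+ ε ℚ.* ½ ℚ.- yK) ℚ.+ ε ℚ.* ½ ℚ.* ½))
  e = solve-∀ ℚring
... | no y≰x = ⊥-elim (x≮y (ε ℚ.* ½ ℚ.* ½ , 0<half (0<half 0<ε) , K , λ n K≤n → ≤-by _
        (0≤+ (0≤+ (0≤-diff (∣-∣≤⇒≤ (seq y K) (seq y n) (ℚ.<⇒≤ (hy K n (ℕ.m≤n⊔m M N) (ℕ.m⊔n≤o⇒n≤o M N K≤n)))))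
                  (0≤-diff (∣-∣≤⇒≤ (seq x n) (seq x K) (ℚ.<⇒≤ (hx n K (ℕ.m⊔n≤o⇒m≤o M N K≤n) (ℕ.m≤m⊔n M N))))))
             (0≤-diff (ℚ.<⇒≤ (ℚ.≰⇒> y≰x))))
        (e (seq y n) (seq x n) (seq y K) (seq x K) ε)))
  where
  K = M ℕ.⊔ N
  e : ∀ yn xn yK xK ε → yn ≡ (xn ℚ.+ ε ℚ.* ½ ℚ.* ½) ℚ.+
      (((yn ℚ.+ ε ℚ.* ½ ℚ.* ½ ℚ.* ½ ℚ.- yK) ℚ.+ (xK ℚ.+ ε ℚ.* ½ ℚ.* ½ ℚ.* ½ ℚ.- xn))
       ℚ.+ (yK ℚ.- (xK ℚ.+ ε ℚ.* ½)))
  e = solve-∀ ℚring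

dense : ∀ {x y} → x < y → ∃[ r ] x < fromℚ r × fromℚ r < y
dense {x} {y} (ε , 0<ε , h) with cauchy x (ε ℚ.* ½ ℚ.* ½) (0<half (0<half 0<ε))
... | N , hx = r ,
  (η , 0<half (0<half 0<ε) , N , λ n N≤n →
    ≤-by _ (0≤-diff (∣-∣≤⇒≤ (seq x n) (seq x N) (ℚ.<⇒≤ (hx n N N≤n ℕ.≤-refl)))) (e₁ (seq x n) (seq x N) ε)) ,
  (η , 0<half (0<half 0<ε) , zipEv h (N , λ _ → id) λ n a N≤n →
    ≤-by _ (0≤+ (0≤-diff a) (0≤-diff (∣-∣≤⇒≤ (seq x N) (seq x n) (ℚ.<⇒≤ (hx N n ℕ.≤-refl N≤n)))))
      (e₂ (seq x n) (seq x N) (seq y n) ε))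
  where
  η = ε ℚ.* ½ ℚ.* ½
  r = seq x N ℚ.+ ε ℚ.* ½
  e₁ : ∀ xn xN ε → xN ℚ.+ ε ℚ.* ½ ≡ (xn ℚ.+ ε ℚ.* ½ ℚ.* ½) ℚ.+ (xN ℚ.+ ε ℚ.* ½ ℚ.* ½ ℚ.- xn)
  e₁ = solve-∀ ℚring
  e₂ : ∀ xn xN yn ε → yn ≡ ((xN ℚ.+ ε ℚ.* ½) ℚ.+ ε ℚ.* ½ ℚ.* ½) ℚ.+
        ((yn ℚ.- (xn ℚ.+ ε)) ℚ.+ (xn ℚ.+ ε ℚ.* ½ ℚ.* ½ ℚ.- xN))
  e₂ = solve-∀ ℚring

fromℚ-mono : ∀ {p q} → p ℚ.≤ q → fromℚ p ≤ fromℚ q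
fromℚ-mono {p} {q} h = pw≤ {fromℚ p} {fromℚ q} λ _ → h

fromℚ-mono-< : ∀ {p q} → p ℚ.< q → fromℚ p < fromℚ q
fromℚ-mono-< {p} {q} h = q ℚ.- p , 0<-diff h , always λ _ → ℚ.≤-reflexive (e p q)
  where
  e : ∀ p q → p ℚ.+ (q ℚ.- p) ≡ q
  e = solve-∀ ℚring

fromℚ-cancel-≤ : ∀ {p q} → fromℚ p ≤ fromℚ q → p ℚ.≤ q
fromℚ-cancel-≤ h = ≤-from-all-ε λ ε 0<ε → proj₂ (someEv (h ε 0<ε))

fromℚ-cancel-< : ∀ {p q} → fromℚ p < fromℚ q → p ℚ.< q
fromℚ-cancel-< {p} {q} h = ℚ.≰⇒> λ q≤p → <⇒≱ {fromℚ p} {fromℚ q} h (fromℚ-mono q≤p)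

+-mono-≤ : ∀ {x y z w} → x ≤ y → z ≤ w → x + z ≤ y + w
+-mono-≤ {x} {y} {z} {w} h₁ h₂ ε 0<ε = zipEv (h₁ _ (0<half 0<ε)) (h₂ _ (0<half 0<ε)) λ n a b →
  ≤-by _ (0≤+ (0≤-diff a) (0≤-diff b)) (e (seq x n) (seq y n) (seq z n) (seq w n) ε)
  where
  e : ∀ x y z w ε → (y ℚ.+ w) ℚ.+ ε ≡ (x ℚ.+ z) ℚ.+ ((y ℚ.+ ε ℚ.* ½ ℚ.- x) ℚ.+ (w ℚ.+ ε ℚ.* ½ ℚ.- z))
  e = solve-∀ ℚring

neg-antimono : ∀ {x y} → x ≤ y → - y ≤ - x
neg-antimono {x} {y} h ε 0<ε = mapEv (h ε 0<ε) λ n a → ≤-by _ (0≤-diff a) (e (seq x n) (seq y n) ε)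
  where
  e : ∀ x y ε → (ℚ.- x) ℚ.+ ε ≡ (ℚ.- y) ℚ.+ (y ℚ.+ ε ℚ.- x)
  e = solve-∀ ℚring

0≤-diffℝ : ∀ {x y} → x ≤ y → 0ℝ ≤ y - x
0≤-diffℝ {x} {y} h ε 0<ε = mapEv (h ε 0<ε) λ n a → ≤-by _ (0≤-diff a) (e (seq x n) (seq y n) ε)
  where
  e : ∀ x y ε → (y ℚ.- x) ℚ.+ ε ≡ 0ℚ ℚ.+ (y ℚ.+ ε ℚ.- x)
  e = solve-∀ ℚring

diff-≤ : ∀ {x y} → 0ℝ ≤ y - x → x ≤ y
diff-≤ {x} {y} h ε 0<ε = mapEv (h ε 0<ε) λ n a → ≤-by _ (0≤-diff a) (e (seq x n) (seq y n) ε)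
  where
  e : ∀ x y ε → y ℚ.+ ε ≡ x ℚ.+ ((y ℚ.- x) ℚ.+ ε ℚ.- 0ℚ)
  e = solve-∀ ℚring

0<-diffℝ : ∀ {x y} → x < y → 0ℝ < y - x
0<-diffℝ {x} {y} (ε , 0<ε , h) = ε , 0<ε , mapEv h λ n a → ≤-by _ (0≤-diff a) (e (seq x n) (seq y n) ε)
  where
  e : ∀ x y ε → y ℚ.- x ≡ (0ℚ ℚ.+ ε) ℚ.+ (y ℚ.- (x ℚ.+ ε))
  e = solve-∀ ℚring

≤-all-ε : ∀ {x y} → (∀ ε → 0ℚ ℚ.< ε → x ≤ y + fromℚ ε) → x ≤ y
≤-all-ε {x} {y} h ε 0<ε = mapEv (h _ (0<half 0<ε) _ (0<half 0<ε)) λ n →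
  subst (seq x n ℚ.≤_) (e (seq y n) ε)
  where
  e : ∀ y ε → (y ℚ.+ ε ℚ.* ½) ℚ.+ ε ℚ.* ½ ≡ y ℚ.+ ε
  e = solve-∀ ℚring

bounded : ∀ x → ∃[ B ] 1 ℕ.≤ B × Eventually λ n → ℚ.∣ seq x n ∣ ℚ.≤ ι B
bounded x with cauchy x 1ℚ 0<1
... | N , h with ceiling (ℚ.∣ seq x N ∣ ℚ.+ 1ℚ)
... | B , 1≤B , hB = B , 1≤B , N , λ n N≤n → ℚ.≤-trans
  (subst (λ z → ℚ.∣ z ∣ ℚ.≤ ℚ.∣ seq x N ∣ ℚ.+ 1ℚ) (e (seq x n) (seq x N))
    (ℚ.≤-trans (ℚ.∣p+q∣≤∣p∣+∣q∣ (seq x N) (seq x n ℚ.- seq x N))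
      (ℚ.+-monoʳ-≤ ℚ.∣ seq x N ∣ (ℚ.<⇒≤ (h n N N≤n ℕ.≤-refl))))) hB
  where
  e : ∀ a b → b ℚ.+ (a ℚ.- b) ≡ a
  e = solve-∀ ℚring

abs-mul-≤ : ∀ {a b r s} → ℚ.∣ a ∣ ℚ.≤ r → ℚ.∣ b ∣ ℚ.≤ s → ℚ.∣ a ℚ.* b ∣ ℚ.≤ r ℚ.* s
abs-mul-≤ {a} {b} {r} {s} h₁ h₂ = subst (ℚ._≤ r ℚ.* s) (sym (ℚ.∣p*q∣≡∣p∣*∣q∣ a b))
  (*-mono-≤ (ℚ.0≤∣p∣ a) (ℚ.0≤∣p∣ b) h₁ h₂)

*-congʳ : ∀ {x y z} → y ≈ z → x * y ≈ x * z
*-congʳ {x} {y} {z} h ε 0<ε = let (B , 1≤B , hB) = bounded x in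
  zipEv hB (h (ε ℚ.* ½ ℚ.* 1/ᵘ B) (0<* {ε ℚ.* ½} {1/ᵘ B} (0<half 0<ε) (0<1/ᵘ 1≤B))) λ n a b →
  ℚ.≤-<-trans (close n (ε ℚ.* ½ ℚ.* 1/ᵘ B) (ε ℚ.* ½) B (eq B 1≤B) a (ℚ.<⇒≤ b)) (half< {ε} 0<ε)
  where
  e : ∀ x y z → x ℚ.* (y ℚ.- z) ≡ x ℚ.* y ℚ.- x ℚ.* z
  e = solve-∀ ℚring
  e₂ : ∀ a b c → a ℚ.* (b ℚ.* c) ≡ (c ℚ.* a) ℚ.* b
  e₂ = solve-∀ ℚring
  eq : ∀ B → 1 ℕ.≤ B → ι B ℚ.* (ε ℚ.* ½ ℚ.* 1/ᵘ B) ≡ ε ℚ.* ½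
  eq B 1≤B = trans (e₂ (ι B) (ε ℚ.* ½) (1/ᵘ B))
    (trans (cong (ℚ._* (ε ℚ.* ½)) (1/ᵘ-* 1≤B)) (ℚ.*-identityˡ (ε ℚ.* ½)))
  close : ∀ n δ η B → ι B ℚ.* δ ≡ η → ℚ.∣ seq x n ∣ ℚ.≤ ι B → ℚ.∣ seq y n ℚ.- seq z n ∣ ℚ.≤ δ →
          ℚ.∣ seq x n ℚ.* seq y n ℚ.- seq x n ℚ.* seq z n ∣ ℚ.≤ η
  close n δ η B eq a b = subst₂ (λ p q → ℚ.∣ p ∣ ℚ.≤ q) (e (seq x n) (seq y n) (seq z n)) eq
    (abs-mul-≤ {seq x n} {seq y n ℚ.- seq z n} {ι B} {δ} a b)

*-commℝ : ∀ x y → x * y ≈ y * x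
*-commℝ x y = pw≈ {x * y} {y * x} λ n → ℚ.*-comm (seq x n) (seq y n)

*-cong : ∀ {x y z w} → x ≈ y → z ≈ w → x * z ≈ y * w
*-cong {x} {y} {z} {w} h₁ h₂ = ≈-trans {x * z} {x * w} {y * w} (*-congʳ {x} {z} {w} h₂)
  (≈-trans {x * w} {w * x} {y * w} (*-commℝ x w)
    (≈-trans {w * x} {w * y} {y * w} (*-congʳ {w} {x} {y} h₁) (*-commℝ w y)))

nonneg⇒≈∣∣ : ∀ {x} → 0ℝ ≤ x → ∣ x ∣ ≈ x
nonneg⇒≈∣∣ {x} h = ≤-antisym {∣ x ∣} {x} le (pw≤ {x} {∣ x ∣} λ n → p≤∣p∣ (seq x n))
  where
  e : ∀ x ε → x ℚ.+ ε ≡ (ℚ.- x) ℚ.+ ((x ℚ.+ ε ℚ.* ½ ℚ.- 0ℚ) ℚ.+ (x ℚ.+ ε ℚ.* ½ ℚ.- 0ℚ))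
  e = solve-∀ ℚring
  le : ∣ x ∣ ≤ x
  le ε 0<ε = mapEv (h _ (0<half 0<ε)) λ n a → ∣∣≤ (p≤p+ε (seq x n) (ℚ.<⇒≤ 0<ε))
    (≤-by _ (0≤+ (0≤-diff a) (0≤-diff a)) (e (seq x n) ε))

-- A nonnegative real may have negative approximants, so the product is compared with
-- `∣ x ∣ * ∣ y ∣`, whose approximants are nonnegative.
*-nonneg : ∀ {x y} → 0ℝ ≤ x → 0ℝ ≤ y → 0ℝ ≤ x * y
*-nonneg {x} {y} h₁ h₂ = ≤-trans {0ℝ} {∣ x ∣ * ∣ y ∣} {x * y}
  (pw≤ {0ℝ} {∣ x ∣ * ∣ y ∣} λ n → 0≤* (ℚ.0≤∣p∣ (seq x n)) (ℚ.0≤∣p∣ (seq y n)))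
  (≈⇒≤ {∣ x ∣ * ∣ y ∣} {x * y}
    (*-cong {∣ x ∣} {x} {∣ y ∣} {y} (nonneg⇒≈∣∣ {x} h₁) (nonneg⇒≈∣∣ {y} h₂)))

*-monoʳ-≤ℝ : ∀ {x y z} → 0ℝ ≤ x → y ≤ z → x * y ≤ x * z
*-monoʳ-≤ℝ {x} {y} {z} h₁ h₂ = diff-≤ {x * y} {x * z} (≤-trans {0ℝ} {x * (z - y)} {x * z - x * y}
  (*-nonneg {x} {z - y} h₁ (0≤-diffℝ {y} {z} h₂))
  (pw≤ {x * (z - y)} {x * z - x * y} λ n → ℚ.≤-reflexive (e (seq x n) (seq y n) (seq z n))))
  where
  e : ∀ x y z → x ℚ.* (z ℚ.- y) ≡ x ℚ.* z ℚ.- x ℚ.* y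
  e = solve-∀ ℚring

*-mono-≤ℝ : ∀ {x y z w} → 0ℝ ≤ x → 0ℝ ≤ w → x ≤ y → z ≤ w → x * z ≤ y * w
*-mono-≤ℝ {x} {y} {z} {w} 0≤x 0≤w h₁ h₂ = ≤-trans {x * z} {x * w} {y * w} (*-monoʳ-≤ℝ {x} {z} {w} 0≤x h₂)
  (≤-trans {x * w} {w * x} {y * w} (≈⇒≤ {x * w} {w * x} (*-commℝ x w))
    (≤-trans {w * x} {w * y} {y * w} (*-monoʳ-≤ℝ {w} {x} {y} 0≤w h₁) (≈⇒≤ {w * y} {y * w} (*-commℝ w y))))

-- Limits

∣-∣-upper : ∀ x y → x ≤ y + ∣ x - y ∣
∣-∣-upper x y = pw≤ {x} {y + ∣ x - y ∣} λ n → ∣-∣≤⇒≤ (seq x n) (seq y n) ℚ.≤-refl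

∣-∣-lower : ∀ x y → y ≤ x + ∣ x - y ∣
∣-∣-lower x y = pw≤ {y} {x + ∣ x - y ∣} λ n →
  ∣-∣≤⇒≤ (seq y n) (seq x n) (ℚ.≤-reflexive (∣-∣-comm (seq y n) (seq x n)))

≤-shift : ∀ {x y r} → x ≤ y + r → x - y ≤ r
≤-shift {x} {y} {r} h ε 0<ε = mapEv (h ε 0<ε) λ n a →
  ≤-by _ (0≤-diff a) (e (seq x n) (seq y n) (seq r n) ε)
  where
  e : ∀ x y r ε → r ℚ.+ ε ≡ (x ℚ.- y) ℚ.+ ((y ℚ.+ r) ℚ.+ ε ℚ.- x)
  e = solve-∀ ℚring

diff-mono : ∀ {x y z w} → x ≤ y → z ≤ w → x - w ≤ y - z
diff-mono {x} {y} {z} {w} h₁ h₂ = +-mono-≤ {x} {y} { - w} { - z} h₁ (neg-antimono {z} {w} h₂)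

lim-≤ : ∀ {u x y} → u ⟶ fin x → Eventually (λ n → u n ≤ y) → x ≤ y
lim-≤ {u} {x} {y} lim h = ≮⇒≥ {y} {x} λ y<x →
  let (n , a , b) = someEv (zipEv (lim (x - y) (0<-diffℝ {y} {x} y<x)) h λ _ a b → a , b) in
  <⇒≱ {∣ u n - x ∣} {x - y} a
    (≤-trans {x - y} {x - u n} {∣ u n - x ∣} (diff-mono {x} {x} {u n} {y} (≤-refl {x}) b)
      (≤-shift {x} {u n} {∣ u n - x ∣} (∣-∣-lower (u n) x)))

lim-≥ : ∀ {u x y} → u ⟶ fin x → Eventually (λ n → y ≤ u n) → y ≤ x
lim-≥ {u} {x} {y} lim h = ≮⇒≥ {x} {y} λ x<y →
  let (n , a , b) = someEv (zipEv (lim (y - x) (0<-diffℝ {x} {y} x<y)) h λ _ a b → a , b) in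
  <⇒≱ {∣ u n - x ∣} {y - x} a
    (≤-trans {y - x} {u n - x} {∣ u n - x ∣} (diff-mono {y} {u n} {x} {x} b (≤-refl {x}))
      (≤-shift {u n} {x} {∣ u n - x ∣} (∣-∣-upper (u n) x)))

lim-< : ∀ {u x y} → u ⟶ fin x → x < y → Eventually (λ n → u n ≤ y)
lim-< {u} {x} {y} lim x<y = mapEv (lim (y - x) (0<-diffℝ {x} {y} x<y)) λ n h →
  ≤-trans {u n} {x + ∣ u n - x ∣} {y} (∣-∣-upper (u n) x)
    (≤-trans {x + ∣ u n - x ∣} {x + (y - x)} {y}
      (+-mono-≤ {x} {x} {∣ u n - x ∣} {y - x} (≤-refl {x}) (<⇒≤ {∣ u n - x ∣} {y - x} h))
      (pw≤ {x + (y - x)} {y} λ n → ℚ.≤-reflexive (e (seq x n) (seq y n))))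
  where
  e : ∀ x y → x ℚ.+ (y ℚ.- x) ≡ y
  e = solve-∀ ℚring

lim-unique-≤ : ∀ {u x y} → u ⟶ fin x → u ⟶ fin y → y ≤ x
lim-unique-≤ {u} {x} {y} hx hy = ≮⇒≥ {x} {y} λ x<y →
  let (r , x<r , r<y) = dense {x} {y} x<y in
  <⇒≱ {fromℚ r} {y} r<y (lim-≤ {u} {y} {fromℚ r} hy (lim-< {u} {x} {fromℚ r} hx x<r))

lim-unique : ∀ {u x y} → u ⟶ fin x → u ⟶ fin y → x ≈ y
lim-unique {u} {x} {y} hx hy = ≤-antisym {x} {y} (lim-unique-≤ {u} {y} {x} hy hx) (lim-unique-≤ {u} {x} {y} hx hy)

cauchy⇒⟶ : ∀ v (c : IsCauchy v) → (λ n → fromℚ (v n)) ⟶ fin (mkℝ v c)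
cauchy⇒⟶ v c ε (e , 0<e , h) =
  let (N , hc) = c (e ℚ.* ½) (0<half 0<e) in
  N , λ n N≤n → e ℚ.* ½ , 0<half 0<e , zipEv h (N , λ _ → id) λ m a N≤m →
    ≤-by _ (0≤+ (0≤-diff a) (0≤-diff (ℚ.<⇒≤ (hc n m N≤n N≤m)))) (eq ℚ.∣ v n ℚ.- v m ∣ (seq ε m) e)
  where
  eq : ∀ a x e → x ≡ (a ℚ.+ e ℚ.* ½) ℚ.+ ((x ℚ.- (0ℚ ℚ.+ e)) ℚ.+ (e ℚ.* ½ ℚ.- a))
  eq = solve-∀ ℚring

archimedeanℝ : ∀ x → ∃[ n ] 1 ℕ.≤ n × x ≤ fromℚ (ι n)
archimedeanℝ x = let (B , 1≤B , h) = bounded x in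
  B , 1≤B , ev≤ {x} {fromℚ (ι B)} (mapEv h λ n → ℚ.≤-trans (p≤∣p∣ (seq x n)))

-- Classical principles, and suprema of bounded increasing sequences

module Classical (em : ∀ ℓ → ExcludedMiddle ℓ) where

  ¬∀⇒∃ : ∀ {a b} {A : Set a} {P : A → Set b} → ¬ (∀ x → P x) → ∃[ x ] ¬ P x
  ¬∀⇒∃ {a} {b} {A} {P} h with em (a Level.⊔ b) {∃[ x ] ¬ P x}
  ... | yes p = p
  ... | no np = ⊥-elim (h λ x → byEM x (em b))
    where
    byEM : ∀ x → Dec (P x) → P x
    byEM x (yes p) = p
    byEM x (no ¬p) = ⊥-elim (np (x , ¬p))

  by-contradiction : ∀ {a} {A : Set a} → ¬ ¬ A → A
  by-contradiction {a} {A} h with em a {A}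
  ... | yes x = x
  ... | no ¬x = ⊥-elim (h ¬x)

  ≤⊎< : ∀ x y → x ≤ y ⊎ y < x
  ≤⊎< x y with em 0ℓ {y < x}
  ... | yes y<x = inj₂ y<x
  ... | no y≮x  = inj₁ (≮⇒≥ {y} {x} y≮x)

module MonotoneSup (em : ∀ ℓ → ExcludedMiddle ℓ) (u : ℕ → ℝ)
  (mono : ∀ n → u n ≤ u (suc n)) (B : ℝ) (u≤B : ∀ n → u n ≤ B) where

  open Classical em

  Stable : ℚ → ℕ → Set
  Stable ε N = ∀ n → u n ≤ u N + fromℚ ε

  climb : ∀ ε → 0ℚ ℚ.< ε → ¬ (∃ (Stable ε)) → ∀ j → ∃[ n ] u 0 + fromℚ (ι j ℚ.* ε) ≤ u n
  climb ε 0<ε ns zero = 0 , pw≤ {u 0 + fromℚ (ι 0 ℚ.* ε)} {u 0} λ n →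
    ℚ.≤-reflexive (trans (cong (λ z → seq (u 0) n ℚ.+ z ℚ.* ε) ι0) (e (seq (u 0) n) ε))
    where
    e : ∀ a b → a ℚ.+ 0ℚ ℚ.* b ≡ a
    e = solve-∀ ℚring
  climb ε 0<ε ns (suc j) =
    let (n , h) = climb ε 0<ε ns j
        (m , h′) = ¬∀⇒∃ λ st → ns (n , st)
        um> : u n + fromℚ ε ≤ u m
        um> = <⇒≤ {u n + fromℚ ε} {u m} (strict (u m) (u n + fromℚ ε) h′)
    in m , ≤-trans {u 0 + fromℚ (ι (suc j) ℚ.* ε)} {(u 0 + fromℚ (ι j ℚ.* ε)) + fromℚ ε} {u m}
             (pw≤ {u 0 + fromℚ (ι (suc j) ℚ.* ε)} {(u 0 + fromℚ (ι j ℚ.* ε)) + fromℚ ε} λ k →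
               ℚ.≤-reflexive (trans (cong (λ z → seq (u 0) k ℚ.+ z ℚ.* ε) (trans (ι-+ 1 j) (cong (ℚ._+ ι j) ι1)))
                 (e (seq (u 0) k) (ι j) ε)))
             (≤-trans {(u 0 + fromℚ (ι j ℚ.* ε)) + fromℚ ε} {u n + fromℚ ε} {u m}
               (+-mono-≤ {u 0 + fromℚ (ι j ℚ.* ε)} {u n} {fromℚ ε} {fromℚ ε} h (≤-refl {fromℚ ε})) um>)
    where
    e : ∀ a j ε → a ℚ.+ (1ℚ ℚ.+ j) ℚ.* ε ≡ (a ℚ.+ j ℚ.* ε) ℚ.+ ε
    e = solve-∀ ℚring
    strict : ∀ x y → ¬ (x ≤ y) → y < x
    strict x y h with ≤⊎< x y
    ... | inj₁ le = ⊥-elim (h le)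
    ... | inj₂ lt = lt

  -- Otherwise `climb` yields for every j a term at least jε above `u 0`. With 1/M ≤ ε and B - u 0 ≤
  -- K, the choice j = (K + 1) M contradicts the bound `B`.
  stabilises : ∀ ε → 0ℚ ℚ.< ε → ∃ (Stable ε)
  stabilises ε 0<ε = by-contradiction λ ns →
    let (K , _ , B-u0≤K) = archimedeanℝ (B - u 0)
        (M , 1≤M , 1/M≤ε) = archimedean ε 0<ε
        (n , h) = climb ε 0<ε ns (suc K ℕ.* M)
        K+1≤ : ι (suc K) ℚ.≤ ι (suc K ℕ.* M) ℚ.* ε
        K+1≤ = subst₂ ℚ._≤_
                 (trans (cong (ι (suc K) ℚ.*_) (trans (ℚ.*-comm (ι M) (1/ᵘ M)) (1/ᵘ-* 1≤M))) (ℚ.*-identityʳ (ι (suc K))))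
                 (trans (sym (ℚ.*-assoc (ι (suc K)) (ι M) ε)) (cong (ℚ._* ε) (sym (ι-* (suc K) M))))
                 (*-monoʳ-≤ (ι (suc K)) (0≤ι (suc K)) (*-monoʳ-≤ (ι M) (0≤ι M) 1/M≤ε))
        X = fromℚ (ι (suc K ℕ.* M) ℚ.* ε)
        X≤ : X ≤ u n - u 0
        X≤ = ≤-trans {X} {(u 0 + X) - u 0} {u n - u 0}
               (pw≤ {X} {(u 0 + X) - u 0} λ k → ℚ.≤-reflexive (e (seq (u 0) k) (seq X k)))
               (diff-mono {u 0 + X} {u n} {u 0} {u 0} h (≤-refl {u 0}))
        bad : fromℚ (ι (suc K)) ≤ fromℚ (ι K)
        bad = ≤-trans {fromℚ (ι (suc K))} {X} {fromℚ (ι K)} (fromℚ-mono K+1≤)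
                (≤-trans {X} {u n - u 0} {fromℚ (ι K)} X≤
                  (≤-trans {u n - u 0} {B - u 0} {fromℚ (ι K)}
                    (diff-mono {u n} {B} {u 0} {u 0} (u≤B n) (≤-refl {u 0})) B-u0≤K))
    in ℕ.<-irrefl refl (ι-cancel-≤ (fromℚ-cancel-≤ bad))
    where
    e : ∀ a x → x ≡ (a ℚ.+ x) ℚ.- a
    e = solve-∀ ℚring

  η : ℕ → ℚ
  η k = 1/ᵘ (suc k)

  0<η : ∀ k → 0ℚ ℚ.< η k
  0<η k = 0<1/ᵘ (s≤s z≤n)

  N : ℕ → ℕ
  N k = proj₁ (stabilises (η k) (0<η k))

  -- Rational approximations to the terms `u (N k)`, above which the sequence never rises by more
  -- than `η k`; they form the Cauchy sequence of the supremum.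
  v : ℕ → ℚ
  v k = seq (u (N k)) (proj₁ (cauchy (u (N k)) (η k) (0<η k)))

  v-upper : ∀ k → fromℚ (v k) ≤ u (N k) + fromℚ (η k)
  v-upper k = let (M , h) = cauchy (u (N k)) (η k) (0<η k) in
    ev≤ {fromℚ (v k)} {u (N k) + fromℚ (η k)} (M , λ n M≤n → ∣-∣≤⇒≤ (v k) (seq (u (N k)) n) (ℚ.<⇒≤ (h M n ℕ.≤-refl M≤n)))

  v-lower : ∀ k → u (N k) ≤ fromℚ (v k) + fromℚ (η k)
  v-lower k = let (M , h) = cauchy (u (N k)) (η k) (0<η k) in
    ev≤ {u (N k)} {fromℚ (v k) + fromℚ (η k)} (M , λ n M≤n → ∣-∣≤⇒≤ (seq (u (N k)) n) (v k) (ℚ.<⇒≤ (h n M M≤n ℕ.≤-refl)))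

  u≤v : ∀ n k → u n ≤ fromℚ (v k ℚ.+ (η k ℚ.+ η k))
  u≤v n k = ≤-trans {u n} {u (N k) + fromℚ (η k)} {fromℚ (v k ℚ.+ (η k ℚ.+ η k))}
    (proj₂ (stabilises (η k) (0<η k)) n)
    (≤-trans {u (N k) + fromℚ (η k)} {(fromℚ (v k) + fromℚ (η k)) + fromℚ (η k)} {fromℚ (v k ℚ.+ (η k ℚ.+ η k))}
      (+-mono-≤ {u (N k)} {fromℚ (v k) + fromℚ (η k)} {fromℚ (η k)} {fromℚ (η k)} (v-lower k) (≤-refl {fromℚ (η k)}))
      (fromℚ-mono (ℚ.≤-reflexive (ℚ.+-assoc (v k) (η k) (η k)))))

  v≤v : ∀ j k → v j ℚ.≤ v k ℚ.+ (η j ℚ.+ (η k ℚ.+ η k))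
  v≤v j k = subst (v j ℚ.≤_) (e (v k) (η j) (η k)) (fromℚ-cancel-≤
    (≤-trans {fromℚ (v j)} {u (N j) + fromℚ (η j)} {fromℚ (v k ℚ.+ (η k ℚ.+ η k)) + fromℚ (η j)} (v-upper j)
      (+-mono-≤ {u (N j)} {fromℚ (v k ℚ.+ (η k ℚ.+ η k))} {fromℚ (η j)} {fromℚ (η j)} (u≤v (N j) k) (≤-refl {fromℚ (η j)}))))
    where
    e : ∀ v j k → (v ℚ.+ (k ℚ.+ k)) ℚ.+ j ≡ v ℚ.+ (j ℚ.+ (k ℚ.+ k))
    e = solve-∀ ℚring

  η-small : ∀ ε → 0ℚ ℚ.< ε → Eventually λ k → η k ℚ.≤ ε
  η-small ε 0<ε = let (n , 1≤n , h) = archimedean ε 0<ε in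
    n , λ k n≤k → ℚ.≤-trans (1/ᵘ-antimono 1≤n (ℕ.≤-trans n≤k (ℕ.n≤1+n k))) h

  v-cauchy : IsCauchy v
  v-cauchy ε 0<ε =
    let (K , h) = η-small _ (0<half (0<half (0<half 0<ε))) in
    K , λ m n K≤m K≤n → ℚ.≤-<-trans (∣-∣≤ {v m} {v n} {ε ℚ.* ½}
      (≤-by _ (0≤+ (0≤-diff (v≤v m n)) (0≤+ (0≤+ (0≤-diff (h m K≤m)) (0≤-diff (h n K≤n)))
        (0≤+ (0≤-diff (h n K≤n)) (ℚ.<⇒≤ (0<half (0<half (0<half 0<ε))))))) (e (v m) (v n) (η m) (η n) ε))
      (≤-by _ (0≤+ (0≤-diff (v≤v n m)) (0≤+ (0≤+ (0≤-diff (h n K≤n)) (0≤-diff (h m K≤m)))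
        (0≤+ (0≤-diff (h m K≤m)) (ℚ.<⇒≤ (0<half (0<half (0<half 0<ε))))))) (e (v n) (v m) (η n) (η m) ε)))
      (half< 0<ε)
    where
    e : ∀ a b j k ε → let d = ε ℚ.* ½ ℚ.* ½ ℚ.* ½ in b ℚ.+ ε ℚ.* ½ ≡ a ℚ.+ ((b ℚ.+ (j ℚ.+ (k ℚ.+ k)) ℚ.- a) ℚ.+
      (((d ℚ.- j) ℚ.+ (d ℚ.- k)) ℚ.+ ((d ℚ.- k) ℚ.+ d)))
    e = solve-∀ ℚring

  limit : ℝ
  limit = mkℝ v v-cauchy

  sup-upper : ∀ n → u n ≤ limit
  sup-upper n = lim-≥′ λ ε 0<ε → mapEv (η-small _ (0<half 0<ε)) λ k h →
    ≤-trans {u n} {fromℚ (v k ℚ.+ (η k ℚ.+ η k))} {fromℚ (v k ℚ.+ ε)} (u≤v n k)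
      (fromℚ-mono (≤-by _ (0≤+ (0≤-diff h) (0≤-diff h)) (e (v k) (η k) ε)))
    where
    e : ∀ v k ε → v ℚ.+ ε ≡ (v ℚ.+ (k ℚ.+ k)) ℚ.+ ((ε ℚ.* ½ ℚ.- k) ℚ.+ (ε ℚ.* ½ ℚ.- k))
    e = solve-∀ ℚring
    lim-≥′ : (∀ ε → 0ℚ ℚ.< ε → Eventually λ k → u n ≤ fromℚ (v k ℚ.+ ε)) → u n ≤ limit
    lim-≥′ h = ≤-all-ε {u n} {limit} λ ε 0<ε →
      lim-≥ {λ k → fromℚ (v k ℚ.+ ε)} {limit + fromℚ ε} {u n}
        (cauchy⇒⟶ (λ k → v k ℚ.+ ε) (cauchy (limit + fromℚ ε))) (h ε 0<ε)

  sup-least : ∀ b → (∀ n → u n ≤ b) → limit ≤ b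
  sup-least b h = ≤-all-ε {limit} {b} λ ε 0<ε →
    lim-≤ {λ k → fromℚ (v k)} {limit} {b + fromℚ ε} (cauchy⇒⟶ v v-cauchy)
      (mapEv (η-small ε 0<ε) λ k hk → ≤-trans {fromℚ (v k)} {u (N k) + fromℚ (η k)} {b + fromℚ ε} (v-upper k)
        (+-mono-≤ {u (N k)} {b} {fromℚ (η k)} {fromℚ ε} (h (N k)) (fromℚ-mono hk)))

-- The exponential series on ℚ

infixr 8 _^ℚ_
_^ℚ_ : ℚ → ℕ → ℚ
x ^ℚ zero  = 1ℚ
x ^ℚ suc k = x ℚ.* (x ^ℚ k)

seq-^ : ∀ x k n → seq (x ^ k) n ≡ seq x n ^ℚ k
seq-^ x zero    n = refl
seq-^ x (suc k) n = cong (seq x n ℚ.*_) (seq-^ x k n)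

1≤! : ∀ k → 1 ℕ.≤ k !
1≤! zero    = s≤s z≤n
1≤! (suc k) = 1≤* {suc k} {k !} (s≤s z≤n) (1≤! k)

term : ℚ → ℕ → ℚ
term x k = x ^ℚ k ℚ.* 1/ᵘ (k !)

expSum : ℕ → ℚ → ℚ
expSum n x = sum (term x) n

seq-partialSum : ∀ u N n →
  seq (partialSum (λ k → (u ^ k) * fromℚ ((+ 1 ℚ./ (k !)) {{k ℕ.!≢0}})) N) n ≡ expSum N (seq u n)
seq-partialSum u zero    n = refl
seq-partialSum u (suc N) n = cong₂ ℚ._+_ (seq-partialSum u N n)
  (cong₂ ℚ._*_ (seq-^ u N n) (trans (/≡ 1 (N !) {{N ℕ.!≢0}})
    (trans (cong (ℚ._* 1/ᵘ (N !)) ι1) (ℚ.*-identityˡ (1/ᵘ (N !))))))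

-- conv f g n = Σ_{i+j=n} f i · g j
conv : (ℕ → ℚ) → (ℕ → ℚ) → ℕ → ℚ
conv f g zero    = f 0 ℚ.* g 0
conv f g (suc n) = f 0 ℚ.* g (suc n) ℚ.+ conv (f ∘ suc) g n

-- Coefficients of the formal derivative of the power series with coefficients `f`; `product-rule`
-- is its Leibniz rule.
deriv : (ℕ → ℚ) → ℕ → ℚ
deriv f i = ι (suc i) ℚ.* f (suc i)

conv-cong : ∀ {f f′ g g′} n → (∀ i → f i ≡ f′ i) → (∀ i → g i ≡ g′ i) → conv f g n ≡ conv f′ g′ n
conv-cong zero    p q = cong₂ ℚ._*_ (p 0) (q 0)
conv-cong (suc n) p q = cong₂ ℚ._+_ (cong₂ ℚ._*_ (p 0) (q (suc n))) (conv-cong n (p ∘ suc) q)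

conv-+ˡ : ∀ f f′ g n → conv (λ i → f i ℚ.+ f′ i) g n ≡ conv f g n ℚ.+ conv f′ g n
conv-+ˡ f f′ g zero    = ℚ.*-distribʳ-+ (g 0) (f 0) (f′ 0)
conv-+ˡ f f′ g (suc n) = trans (cong ((f 0 ℚ.+ f′ 0) ℚ.* g (suc n) ℚ.+_) (conv-+ˡ (f ∘ suc) (f′ ∘ suc) g n))
  (e (f 0) (f′ 0) (g (suc n)) (conv (f ∘ suc) g n) (conv (f′ ∘ suc) g n))
  where
  e : ∀ a b g c d → (a ℚ.+ b) ℚ.* g ℚ.+ (c ℚ.+ d) ≡ (a ℚ.* g ℚ.+ c) ℚ.+ (b ℚ.* g ℚ.+ d)
  e = solve-∀ ℚring

conv-*ˡ : ∀ c f g n → conv (λ i → c ℚ.* f i) g n ≡ c ℚ.* conv f g n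
conv-*ˡ c f g zero    = ℚ.*-assoc c (f 0) (g 0)
conv-*ˡ c f g (suc n) = trans (cong ((c ℚ.* f 0) ℚ.* g (suc n) ℚ.+_) (conv-*ˡ c (f ∘ suc) g n))
  (e c (f 0) (g (suc n)) (conv (f ∘ suc) g n))
  where
  e : ∀ c f g d → (c ℚ.* f) ℚ.* g ℚ.+ c ℚ.* d ≡ c ℚ.* (f ℚ.* g ℚ.+ d)
  e = solve-∀ ℚring

conv-*ʳ : ∀ c f g n → conv f (λ i → c ℚ.* g i) n ≡ c ℚ.* conv f g n
conv-*ʳ c f g zero    = e c (f 0) (g 0)
  where
  e : ∀ c f g → f ℚ.* (c ℚ.* g) ≡ c ℚ.* (f ℚ.* g)
  e = solve-∀ ℚring
conv-*ʳ c f g (suc n) = trans (cong (f 0 ℚ.* (c ℚ.* g (suc n)) ℚ.+_) (conv-*ʳ c (f ∘ suc) g n))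
  (e c (f 0) (g (suc n)) (conv (f ∘ suc) g n))
  where
  e : ∀ c f g d → f ℚ.* (c ℚ.* g) ℚ.+ c ℚ.* d ≡ c ℚ.* (f ℚ.* g ℚ.+ d)
  e = solve-∀ ℚring

product-rule : ∀ f g n → ι (suc n) ℚ.* conv f g (suc n) ≡ conv (deriv f) g n ℚ.+ conv f (deriv g) n
product-rule f g zero = e (ι 1) (f 0) (f 1) (g 0) (g 1)
  where
  e : ∀ i f₀ f₁ g₀ g₁ → i ℚ.* (f₀ ℚ.* g₁ ℚ.+ f₁ ℚ.* g₀) ≡ (i ℚ.* f₁) ℚ.* g₀ ℚ.+ f₀ ℚ.* (i ℚ.* g₁)
  e = solve-∀ ℚring
product-rule f g (suc m) = trans
  (cong (ℚ._* (f 0 ℚ.* g (suc (suc m)) ℚ.+ (f 1 ℚ.* g (suc m) ℚ.+ C))) (trans (ι-+ 1 (suc m)) (cong (ℚ._+ ι (suc m)) ι1)))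
  (trans (e₁ (f 0) (g (suc (suc m))) (f 1 ℚ.* g (suc m) ℚ.+ C) (ι (suc m)))
  (trans (cong (λ z → (1ℚ ℚ.+ ι (suc m)) ℚ.* (f 0 ℚ.* g (suc (suc m))) ℚ.+ ((f 1 ℚ.* g (suc m) ℚ.+ C) ℚ.+ z)) (product-rule (f ∘ suc) g m))
  (trans (cong (λ z → z ℚ.* (f 0 ℚ.* g (suc (suc m))) ℚ.+ ((f 1 ℚ.* g (suc m) ℚ.+ C) ℚ.+ (conv (deriv (f ∘ suc)) g m ℚ.+ conv (f ∘ suc) (deriv g) m)))
            (sym (trans (ι-+ 1 (suc m)) (cong (ℚ._+ ι (suc m)) ι1))))
  (trans (e₂ (ι (suc (suc m))) (f 0) (g (suc (suc m))) (f 1 ℚ.* g (suc m)) C (conv (deriv (f ∘ suc)) g m) (conv (f ∘ suc) (deriv g) m))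
    (cong₂ (λ a b → (a ℚ.+ b) ℚ.+ (f 0 ℚ.* (ι (suc (suc m)) ℚ.* g (suc (suc m))) ℚ.+ conv (f ∘ suc) (deriv g) m))
      (cong (ℚ._* g (suc m)) (trans (sym (ℚ.*-identityˡ (f 1))) (cong (ℚ._* f 1) (sym ι1))))
      (sym (trans (conv-cong m shift (λ _ → refl)) (conv-+ˡ (f ∘ suc ∘ suc) (deriv (f ∘ suc)) g m))))))))
  where
  C = conv (f ∘ suc ∘ suc) g m
  e₁ : ∀ f g r i → (1ℚ ℚ.+ i) ℚ.* (f ℚ.* g ℚ.+ r) ≡ (1ℚ ℚ.+ i) ℚ.* (f ℚ.* g) ℚ.+ (r ℚ.+ i ℚ.* r)
  e₁ = solve-∀ ℚring
  e₂ : ∀ i f g a c d b → i ℚ.* (f ℚ.* g) ℚ.+ ((a ℚ.+ c) ℚ.+ (d ℚ.+ b)) ≡ (a ℚ.+ (c ℚ.+ d)) ℚ.+ (f ℚ.* (i ℚ.* g) ℚ.+ b)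
  e₂ = solve-∀ ℚring
  e₃ : ∀ i f → (1ℚ ℚ.+ i) ℚ.* f ≡ f ℚ.+ i ℚ.* f
  e₃ = solve-∀ ℚring
  shift : ∀ i → deriv f (suc i) ≡ f (suc (suc i)) ℚ.+ deriv (f ∘ suc) i
  shift i = trans (cong (ℚ._* f (suc (suc i))) (trans (ι-+ 1 (suc i)) (cong (ℚ._+ ι (suc i)) ι1)))
    (e₃ (ι (suc i)) (f (suc (suc i))))

deriv-term : ∀ x k → deriv (term x) k ≡ x ℚ.* term x k
deriv-term x k = trans (cong (λ z → ι (suc k) ℚ.* ((x ℚ.* x ^ℚ k) ℚ.* z)) (1/ᵘ-mul {suc k} {k !} (s≤s z≤n) (1≤! k)))
  (trans (e (ι (suc k)) (1/ᵘ (suc k)) x (x ^ℚ k) (1/ᵘ (k !)))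
    (trans (cong (ℚ._* (x ℚ.* (x ^ℚ k ℚ.* 1/ᵘ (k !)))) (1/ᵘ-* {suc k} (s≤s z≤n))) (ℚ.*-identityˡ (x ℚ.* (x ^ℚ k ℚ.* 1/ᵘ (k !))))))
  where
  e : ∀ i j x p u → i ℚ.* ((x ℚ.* p) ℚ.* (j ℚ.* u)) ≡ (j ℚ.* i) ℚ.* (x ℚ.* (p ℚ.* u))
  e = solve-∀ ℚring

ι-cancel : ∀ n {p q} → ι (suc n) ℚ.* p ≡ ι (suc n) ℚ.* q → p ≡ q
ι-cancel n {p} {q} h = trans (sym (undo p)) (trans (cong (1/ᵘ (suc n) ℚ.*_) h) (undo q))
  where
  undo : ∀ r → 1/ᵘ (suc n) ℚ.* (ι (suc n) ℚ.* r) ≡ r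
  undo r = trans (sym (ℚ.*-assoc (1/ᵘ (suc n)) (ι (suc n)) r))
    (trans (cong (ℚ._* r) (1/ᵘ-* {suc n} (s≤s z≤n))) (ℚ.*-identityˡ r))

term-zero : ∀ x → term x 0 ≡ 1ℚ
term-zero x = trans (ℚ.*-identityˡ (1/ᵘ 1)) (trans (sym (ℚ.*-identityʳ (1/ᵘ 1)))
  (trans (cong (1/ᵘ 1 ℚ.*_) (sym ι1)) (1/ᵘ-* {1} (s≤s z≤n))))

-- Both sides satisfy the recursion (n + 1) c(n + 1) = (x + y) c(n): the right one by `deriv-term`,
-- the left one by the product rule together with `deriv-term`.
binomial : ∀ x y n → conv (term x) (term y) n ≡ term (x ℚ.+ y) n
binomial x y zero    = trans (cong₂ ℚ._*_ (term-zero x) (term-zero y))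
  (trans (ℚ.*-identityˡ 1ℚ) (sym (term-zero (x ℚ.+ y))))
binomial x y (suc n) = ι-cancel n (trans (product-rule (term x) (term y) n)
  (trans (cong₂ ℚ._+_ (trans (conv-cong n (deriv-term x) (λ _ → refl)) (conv-*ˡ x (term x) (term y) n))
                      (trans (conv-cong n (λ _ → refl) (deriv-term y)) (conv-*ʳ y (term x) (term y) n)))
  (trans (sym (ℚ.*-distribʳ-+ (conv (term x) (term y) n) x y))
  (trans (cong ((x ℚ.+ y) ℚ.*_) (binomial x y n)) (sym (deriv-term (x ℚ.+ y) n))))))

conv-sum : ∀ f g n → conv f (λ j → sum g (suc j)) (suc n) ≡ conv f (λ j → sum g (suc j)) n ℚ.+ conv f g (suc n)
conv-sum f g zero = e (f 0) (f 1) (g 0) (g 1)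
  where
  e : ∀ f₀ f₁ g₀ g₁ → f₀ ℚ.* ((0ℚ ℚ.+ g₀) ℚ.+ g₁) ℚ.+ f₁ ℚ.* (0ℚ ℚ.+ g₀)
      ≡ f₀ ℚ.* (0ℚ ℚ.+ g₀) ℚ.+ (f₀ ℚ.* g₁ ℚ.+ f₁ ℚ.* g₀)
  e = solve-∀ ℚring
conv-sum f g (suc m) = trans (cong (f 0 ℚ.* (sum g (suc (suc m)) ℚ.+ g (suc (suc m))) ℚ.+_) (conv-sum (f ∘ suc) g m))
  (e (f 0) (sum g (suc (suc m))) (g (suc (suc m))) (conv (f ∘ suc) (λ j → sum g (suc j)) m) (conv (f ∘ suc) g (suc m)))
  where
  e : ∀ f s g a b → f ℚ.* (s ℚ.+ g) ℚ.+ (a ℚ.+ b) ≡ (f ℚ.* s ℚ.+ a) ℚ.+ (f ℚ.* g ℚ.+ b)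
  e = solve-∀ ℚring

conv-expSum : ∀ x y n → conv (term x) (λ j → expSum (suc j) y) n ≡ expSum (suc n) (x ℚ.+ y)
conv-expSum x y zero    = trans (e (term x 0) (term y 0)) (cong (0ℚ ℚ.+_) (binomial x y 0))
  where
  e : ∀ a b → a ℚ.* (0ℚ ℚ.+ b) ≡ 0ℚ ℚ.+ a ℚ.* b
  e = solve-∀ ℚring
conv-expSum x y (suc n) = trans (conv-sum (term x) (term y) n)
  (cong₂ ℚ._+_ (conv-expSum x y n) (binomial x y (suc n)))

sum-shift : ∀ f n → sum f (suc n) ≡ f 0 ℚ.+ sum (f ∘ suc) n
sum-shift f zero    = ℚ.+-comm 0ℚ (f 0)
sum-shift f (suc n) = trans (cong (ℚ._+ f (suc n)) (sum-shift f n)) (ℚ.+-assoc (f 0) (sum (f ∘ suc) n) (f (suc n)))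

-- Serves to write the error of a product of partial sums as a convolution with tails: if `K` is a
-- partial sum and the `g j` are its truncations, then K - g j is a tail.
conv-const : ∀ f K g n → conv f (λ j → K ℚ.- g j) n ≡ sum f (suc n) ℚ.* K ℚ.- conv f g n
conv-const f K g zero    = e (f 0) K (g 0)
  where
  e : ∀ f k g → f ℚ.* (k ℚ.- g) ≡ (0ℚ ℚ.+ f) ℚ.* k ℚ.- f ℚ.* g
  e = solve-∀ ℚring
conv-const f K g (suc n) = trans (cong (f 0 ℚ.* (K ℚ.- g (suc n)) ℚ.+_) (conv-const (f ∘ suc) K g n))
  (trans (e (f 0) K (g (suc n)) (sum (f ∘ suc) (suc n)) (conv (f ∘ suc) g n))
    (cong (λ z → z ℚ.* K ℚ.- conv f g (suc n)) (sym (sum-shift f (suc n)))))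
  where
  e : ∀ f k g s c → f ℚ.* (k ℚ.- g) ℚ.+ (s ℚ.* k ℚ.- c) ≡ (f ℚ.+ s) ℚ.* k ℚ.- (f ℚ.* g ℚ.+ c)
  e = solve-∀ ℚring

conv-bound : ∀ f g (C D r : ℚ) n → 0ℚ ℚ.≤ C → 0ℚ ℚ.≤ r →
  (∀ i → ℚ.∣ f i ∣ ℚ.≤ C ℚ.* r ^ℚ i) → (∀ j → j ℕ.≤ n → ℚ.∣ g j ∣ ℚ.≤ D ℚ.* r ^ℚ j) →
  ℚ.∣ conv f g n ∣ ℚ.≤ ι (suc n) ℚ.* ((C ℚ.* D) ℚ.* r ^ℚ n)
conv-bound f g C D r zero 0≤C 0≤r hf hg =
  subst (ℚ.∣ f 0 ℚ.* g 0 ∣ ℚ.≤_) (trans (e C D) (cong (ℚ._* ((C ℚ.* D) ℚ.* 1ℚ)) (sym ι1)))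
    (abs-mul-≤ {f 0} {g 0} (hf 0) (hg 0 z≤n))
  where
  e : ∀ c d → (c ℚ.* 1ℚ) ℚ.* (d ℚ.* 1ℚ) ≡ 1ℚ ℚ.* ((c ℚ.* d) ℚ.* 1ℚ)
  e = solve-∀ ℚring
conv-bound f g C D r (suc n) 0≤C 0≤r hf hg = ℚ.≤-trans
  (ℚ.∣p+q∣≤∣p∣+∣q∣ (f 0 ℚ.* g (suc n)) (conv (f ∘ suc) g n))
  (subst (ℚ.∣ f 0 ℚ.* g (suc n) ∣ ℚ.+ ℚ.∣ conv (f ∘ suc) g n ∣ ℚ.≤_)
    (trans (e C D r (r ^ℚ n) (ι (suc n))) (cong (ℚ._* ((C ℚ.* D) ℚ.* (r ℚ.* r ^ℚ n)))
      (sym (trans (ι-+ 1 (suc n)) (cong (ℚ._+ ι (suc n)) ι1)))))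
    (ℚ.+-mono-≤ (abs-mul-≤ {f 0} {g (suc n)} (hf 0) (hg (suc n) ℕ.≤-refl))
      (conv-bound (f ∘ suc) g (C ℚ.* r) D r n (0≤* {C} {r} 0≤C 0≤r) 0≤r
        (λ i → subst (ℚ.∣ f (suc i) ∣ ℚ.≤_) (sym (ℚ.*-assoc C r (r ^ℚ i))) (hf (suc i)))
        (λ j j≤n → hg j (ℕ.m≤n⇒m≤1+n j≤n)))))
  where
  e : ∀ c d r p i → (c ℚ.* 1ℚ) ℚ.* (d ℚ.* (r ℚ.* p)) ℚ.+ i ℚ.* (((c ℚ.* r) ℚ.* d) ℚ.* p)
      ≡ (1ℚ ℚ.+ i) ℚ.* ((c ℚ.* d) ℚ.* (r ℚ.* p))
  e = solve-∀ ℚring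

ι-suc : ∀ n → ι (suc n) ≡ 1ℚ ℚ.+ ι n
ι-suc n = trans (ι-+ 1 n) (cong (ℚ._+ ι n) ι1)

1≤^ : ∀ {m} k → 1 ℕ.≤ m → 1 ℕ.≤ m ℕ.^ k
1≤^ {m} k 1≤m = ℕ.m^n>0 m {{ℕ.>-nonZero 1≤m}} k

frac-≤ : ∀ {a b c d} → 1 ℕ.≤ b → 1 ℕ.≤ d → a ℕ.* d ℕ.≤ c ℕ.* b → ι a ℚ.* 1/ᵘ b ℚ.≤ ι c ℚ.* 1/ᵘ d
frac-≤ {a} {b} {c} {d} 1≤b 1≤d h = subst₂ ℚ._≤_ (clear a b d 1≤d) (trans (cong (ι (c ℕ.* b) ℚ.*_) (ℚ.*-comm (1/ᵘ b) (1/ᵘ d))) (clear c d b 1≤b))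
  (*-monoˡ-≤ (1/ᵘ b ℚ.* 1/ᵘ d) (0≤* {1/ᵘ b} {1/ᵘ d} (0≤1/ᵘ b) (0≤1/ᵘ d)) (ι-mono-≤ h))
  where
  e : ∀ a d u v → (a ℚ.* d) ℚ.* (u ℚ.* v) ≡ (v ℚ.* d) ℚ.* (a ℚ.* u)
  e = solve-∀ ℚring
  clear : ∀ a b d → 1 ℕ.≤ d → ι (a ℕ.* d) ℚ.* (1/ᵘ b ℚ.* 1/ᵘ d) ≡ ι a ℚ.* 1/ᵘ b
  clear a b d 1≤d = trans (cong (ℚ._* (1/ᵘ b ℚ.* 1/ᵘ d)) (ι-* a d))
    (trans (e (ι a) (ι d) (1/ᵘ b) (1/ᵘ d))
      (trans (cong (ℚ._* (ι a ℚ.* 1/ᵘ b)) (1/ᵘ-* 1≤d)) (ℚ.*-identityˡ (ι a ℚ.* 1/ᵘ b))))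

*-^ : ∀ m n k → (m ℕ.* n) ℕ.^ k ≡ m ℕ.^ k ℕ.* n ℕ.^ k
*-^ m n zero    = refl
*-^ m n (suc k) = trans (cong (m ℕ.* n ℕ.*_) (*-^ m n k)) (e m n (m ℕ.^ k) (n ℕ.^ k))
  where
  e : ∀ a b c d → a ℕ.* b ℕ.* (c ℕ.* d) ≡ a ℕ.* c ℕ.* (b ℕ.* d)
  e = ℕRing.solve-∀

1/ᵘ-one : 1/ᵘ 1 ≡ 1ℚ
1/ᵘ-one = sym (1/ᵘ-unique {1} 1ℚ (s≤s z≤n) (trans (ℚ.*-identityˡ (ι 1)) ι1))

1/ᵘ-^ : ∀ m k → 1 ℕ.≤ m → 1/ᵘ m ^ℚ k ≡ 1/ᵘ (m ℕ.^ k)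
1/ᵘ-^ m zero    1≤m = sym 1/ᵘ-one
1/ᵘ-^ m (suc k) 1≤m = trans (cong (1/ᵘ m ℚ.*_) (1/ᵘ-^ m k 1≤m)) (sym (1/ᵘ-mul 1≤m (1≤^ k 1≤m)))

½≡ : ½ ≡ 1/ᵘ 2
½≡ = 1/ᵘ-unique {2} ½ (s≤s z≤n) (trans (cong (½ ℚ.*_) (ι-def 2)) refl)

¼ : ℚ
¼ = 1/ᵘ 4

¼≡ : ¼ ≡ ½ ℚ.* ½
¼≡ = sym (1/ᵘ-unique {4} (½ ℚ.* ½) (s≤s z≤n) (trans (cong ((½ ℚ.* ½) ℚ.*_) (ι-def 4)) refl))

½^ : ∀ k → ½ ^ℚ k ≡ 1/ᵘ (2 ℕ.^ k)
½^ k = trans (cong (_^ℚ k) ½≡) (1/ᵘ-^ 2 k (s≤s z≤n))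

0≤^ℚ : ∀ {r} k → 0ℚ ℚ.≤ r → 0ℚ ℚ.≤ r ^ℚ k
0≤^ℚ zero    h = 0≤1
0≤^ℚ {r} (suc k) h = 0≤* {r} {r ^ℚ k} h (0≤^ℚ k h)

0≤½ : 0ℚ ℚ.≤ ½
0≤½ = ℚ.<⇒≤ 0<½

0≤¼ : 0ℚ ℚ.≤ ¼
0≤¼ = 0≤1/ᵘ 4

¼≤½ : ¼ ℚ.≤ ½
¼≤½ = subst (ℚ._≤ ½) (sym ¼≡) (half≤ 0<½)

n<2^n : ∀ n → n ℕ.< 2 ℕ.^ n
n<2^n zero    = s≤s z≤n
n<2^n (suc n) = ℕ.≤-trans (s≤s (n<2^n n)) (subst (suc (2 ℕ.^ n) ℕ.≤_) (cong (2 ℕ.^ n ℕ.+_) (sym (ℕ.+-identityʳ (2 ℕ.^ n))))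
  (ℕ.+-monoˡ-≤ (2 ℕ.^ n) (1≤^ {2} n (s≤s z≤n))))

^-split : ∀ k → 4 ℕ.^ k ≡ 2 ℕ.^ k ℕ.* 2 ℕ.^ k
^-split k = trans (ℕ.^-*-assoc 2 2 k) (trans (cong (2 ℕ.^_) (cong (k ℕ.+_) (ℕ.+-identityʳ k))) (ℕ.^-distribˡ-+-* 2 k k))

linear*¼^≤½^ : ∀ c k → c ℕ.≤ 2 ℕ.^ k → ι c ℚ.* ¼ ^ℚ k ℚ.≤ ½ ^ℚ k
linear*¼^≤½^ c k h = subst₂ ℚ._≤_ (cong (ι c ℚ.*_) (sym (1/ᵘ-^ 4 k (s≤s z≤n))))
  (trans (cong (ℚ._* 1/ᵘ (2 ℕ.^ k)) ι1) (trans (ℚ.*-identityˡ (1/ᵘ (2 ℕ.^ k))) (sym (½^ k))))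
  (frac-≤ {c} {4 ℕ.^ k} {1} {2 ℕ.^ k} (1≤^ {4} k (s≤s z≤n)) (1≤^ {2} k (s≤s z≤n))
    (subst (c ℕ.* 2 ℕ.^ k ℕ.≤_) (trans (sym (^-split k)) (sym (ℕ.*-identityˡ (4 ℕ.^ k)))) (ℕ.*-monoˡ-≤ (2 ℕ.^ k) h)))

½^-small : ∀ K ε → 0ℚ ℚ.< ε → Eventually λ n → K ℚ.* ½ ^ℚ n ℚ.≤ ε
½^-small K ε 0<ε =
  let (k , 1≤k , K≤k) = ceiling K
      (M , 1≤M , 1/M≤ε) = archimedean ε 0<ε
  in k ℕ.* M , λ n kM≤n → ℚ.≤-trans
    (*-monoˡ-≤ (½ ^ℚ n) (0≤^ℚ n 0≤½) K≤k)
    (ℚ.≤-trans (subst (λ z → ι k ℚ.* z ℚ.≤ ι 1 ℚ.* 1/ᵘ M) (sym (½^ n))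
      (frac-≤ {k} {2 ℕ.^ n} {1} {M} (1≤^ {2} n (s≤s z≤n)) 1≤M
        (ℕ.≤-trans kM≤n (ℕ.≤-trans (ℕ.<⇒≤ (n<2^n n)) (ℕ.≤-reflexive (sym (ℕ.*-identityˡ (2 ℕ.^ n))))))))
      (subst (ℚ._≤ ε) (sym (trans (cong (ℚ._* 1/ᵘ M) ι1) (ℚ.*-identityˡ (1/ᵘ M)))) 1/M≤ε))

-- Since r ≤ 1/2, each power r^i is at most 2 (r^i - r^(i+1)), and these differences telescope.
tail-bound : ∀ f (C r : ℚ) → 0ℚ ℚ.≤ C → 0ℚ ℚ.≤ r → r ℚ.≤ ½ → (∀ i → ℚ.∣ f i ∣ ℚ.≤ C ℚ.* r ^ℚ i) →
  ∀ m d → ℚ.∣ sum f (d ℕ.+ m) ℚ.- sum f m ∣ ℚ.≤ (C ℚ.+ C) ℚ.* (r ^ℚ m ℚ.- r ^ℚ (d ℕ.+ m))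
tail-bound f C r 0≤C 0≤r r≤½ h m zero = subst₂ ℚ._≤_ (cong ℚ.∣_∣ (sym (ℚ.+-inverseʳ (sum f m)))) (e C (r ^ℚ m)) ℚ.≤-refl
  where
  e : ∀ c x → 0ℚ ≡ (c ℚ.+ c) ℚ.* (x ℚ.- x)
  e = solve-∀ ℚring
tail-bound f C r 0≤C 0≤r r≤½ h m (suc d) = ℚ.≤-trans
  (subst (λ z → ℚ.∣ z ∣ ℚ.≤ ℚ.∣ sum f (d ℕ.+ m) ℚ.- sum f m ∣ ℚ.+ ℚ.∣ f (d ℕ.+ m) ∣)
    (e₁ (sum f (d ℕ.+ m)) (sum f m) (f (d ℕ.+ m)))
    (ℚ.∣p+q∣≤∣p∣+∣q∣ (sum f (d ℕ.+ m) ℚ.- sum f m) (f (d ℕ.+ m))))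
  (ℚ.≤-trans (ℚ.+-mono-≤ (tail-bound f C r 0≤C 0≤r r≤½ h m d) (h (d ℕ.+ m)))
    (≤-by ((C ℚ.* r ^ℚ (d ℕ.+ m)) ℚ.* ((½ ℚ.- r) ℚ.+ (½ ℚ.- r)))
      (0≤* {C ℚ.* r ^ℚ (d ℕ.+ m)} {(½ ℚ.- r) ℚ.+ (½ ℚ.- r)} (0≤* {C} {r ^ℚ (d ℕ.+ m)} 0≤C (0≤^ℚ (d ℕ.+ m) 0≤r)) (0≤+ {½ ℚ.- r} {½ ℚ.- r} (0≤-diff r≤½) (0≤-diff r≤½)))
      (e₂ C r (r ^ℚ m) (r ^ℚ (d ℕ.+ m)))))
  where
  e₁ : ∀ a b c → (a ℚ.- b) ℚ.+ c ≡ (a ℚ.+ c) ℚ.- b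
  e₁ = solve-∀ ℚring
  e₂ : ∀ c r x y → (c ℚ.+ c) ℚ.* (x ℚ.- r ℚ.* y) ≡
       ((c ℚ.+ c) ℚ.* (x ℚ.- y) ℚ.+ c ℚ.* y) ℚ.+ (c ℚ.* y) ℚ.* ((½ ℚ.- r) ℚ.+ (½ ℚ.- r))
  e₂ = solve-∀ ℚring

tail-bound′ : ∀ f (C r : ℚ) → 0ℚ ℚ.≤ C → 0ℚ ℚ.≤ r → r ℚ.≤ ½ → (∀ i → ℚ.∣ f i ∣ ℚ.≤ C ℚ.* r ^ℚ i) →
  ∀ {m n} → m ℕ.≤ n → ℚ.∣ sum f n ℚ.- sum f m ∣ ℚ.≤ (C ℚ.+ C) ℚ.* r ^ℚ m
tail-bound′ f C r 0≤C 0≤r r≤½ h {m} {n} m≤n = ℚ.≤-trans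
  (subst (λ k → ℚ.∣ sum f k ℚ.- sum f m ∣ ℚ.≤ (C ℚ.+ C) ℚ.* (r ^ℚ m ℚ.- r ^ℚ k)) (ℕ.m∸n+n≡m m≤n)
    (tail-bound f C r 0≤C 0≤r r≤½ h m (n ℕ.∸ m)))
  (≤-by ((C ℚ.+ C) ℚ.* r ^ℚ n) (0≤* {C ℚ.+ C} {r ^ℚ n} (0≤+ {C} {C} 0≤C 0≤C) (0≤^ℚ n 0≤r)) (e C (r ^ℚ m) (r ^ℚ n)))
  where
  e : ∀ c x y → (c ℚ.+ c) ℚ.* x ≡ (c ℚ.+ c) ℚ.* (x ℚ.- y) ℚ.+ (c ℚ.+ c) ℚ.* y
  e = solve-∀ ℚring

-- As long as k ≤ M the power is at most M^M; from then on each new factor M on the left meets a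
-- larger factor of the factorial.
power≤factorial : ∀ M k → 1 ℕ.≤ M → M ℕ.^ k ℕ.≤ M ℕ.^ M ℕ.* k !
power≤factorial M zero    1≤M = 1≤* (1≤^ M 1≤M) (s≤s z≤n)
power≤factorial M (suc k) 1≤M with suc k ℕ.≤? M
... | yes k<M = ℕ.≤-trans (ℕ.^-monoʳ-≤ M {{ℕ.>-nonZero 1≤M}} k<M)
                  (ℕ.m≤m*n (M ℕ.^ M) (suc k !) {{ℕ.>-nonZero (1≤! (suc k))}})
... | no k≮M  = ℕ.≤-trans (ℕ.*-mono-≤ (ℕ.<⇒≤ (ℕ.≰⇒> k≮M)) (power≤factorial M k 1≤M))
                  (ℕ.≤-reflexive (e (suc k) (M ℕ.^ M) (k !)))
  where
  e : ∀ a b c → a ℕ.* (b ℕ.* c) ≡ b ℕ.* (a ℕ.* c)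
  e = ℕRing.solve-∀

∣^∣≤ : ∀ {x B} k → ℚ.∣ x ∣ ℚ.≤ ι B → ℚ.∣ x ^ℚ k ∣ ℚ.≤ ι (B ℕ.^ k)
∣^∣≤ zero    h = ℚ.≤-reflexive (sym ι1)
∣^∣≤ {x} {B} (suc k) h = subst (ℚ.∣ x ℚ.* x ^ℚ k ∣ ℚ.≤_) (sym (ι-* B (B ℕ.^ k)))
  (abs-mul-≤ {x} {x ^ℚ k} h (∣^∣≤ k h))

module ExpBound (B : ℕ) (1≤B : 1 ℕ.≤ B) where

  -- With C = (4B)^{4B} one has B^k / k! ≤ C / 4^k for all k.
  Cℕ : ℕ
  Cℕ = (4 ℕ.* B) ℕ.^ (4 ℕ.* B)

  C : ℚ
  C = ι Cℕ

  0≤C : 0ℚ ℚ.≤ C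
  0≤C = 0≤ι Cℕ

  0≤2C : 0ℚ ℚ.≤ C ℚ.+ C
  0≤2C = 0≤+ {C} {C} 0≤C 0≤C

  -- The rate 1/4 leaves room for the linear factors k in `term-lipschitz` and n + 1 in
  -- `expSum-product`, which `linear*¼^≤½^` absorbs at the price of the rate 1/2.
  coefficient-bound : ∀ k → ι (B ℕ.^ k) ℚ.* 1/ᵘ (k !) ℚ.≤ C ℚ.* ¼ ^ℚ k
  coefficient-bound k = subst (λ z → ι (B ℕ.^ k) ℚ.* 1/ᵘ (k !) ℚ.≤ C ℚ.* z) (sym (1/ᵘ-^ 4 k (s≤s z≤n)))
    (frac-≤ {B ℕ.^ k} {k !} {Cℕ} {4 ℕ.^ k} (1≤! k) (1≤^ {4} k (s≤s z≤n))
      (subst (ℕ._≤ Cℕ ℕ.* k !) (trans (*-^ 4 B k) (ℕ.*-comm (4 ℕ.^ k) (B ℕ.^ k)))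
        (power≤factorial (4 ℕ.* B) k (1≤* {4} (s≤s z≤n) 1≤B))))

  term-bound : ∀ {x} → ℚ.∣ x ∣ ℚ.≤ ι B → ∀ k → ℚ.∣ term x k ∣ ℚ.≤ C ℚ.* ¼ ^ℚ k
  term-bound {x} h k = ℚ.≤-trans
    (abs-mul-≤ {x ^ℚ k} {1/ᵘ (k !)} (∣^∣≤ k h) (ℚ.≤-reflexive (ℚ.0≤p⇒∣p∣≡p (0≤1/ᵘ (k !)))))
    (coefficient-bound k)

  expSum-tail : ∀ {x} → ℚ.∣ x ∣ ℚ.≤ ι B → ∀ {m n} → m ℕ.≤ n →
    ℚ.∣ expSum n x ℚ.- expSum m x ∣ ℚ.≤ (C ℚ.+ C) ℚ.* ¼ ^ℚ m
  expSum-tail {x} h = tail-bound′ (term x) C ¼ 0≤C 0≤¼ ¼≤½ (term-bound h)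

  power-lipschitz : ∀ {x y} → ℚ.∣ x ∣ ℚ.≤ ι B → ℚ.∣ y ∣ ℚ.≤ ι B → ∀ k →
    ℚ.∣ x ^ℚ k ℚ.- y ^ℚ k ∣ ℚ.≤ ι (k ℕ.* B ℕ.^ k) ℚ.* ℚ.∣ x ℚ.- y ∣
  power-lipschitz {x} {y} hx hy zero = ℚ.≤-reflexive (trans (e ℚ.∣ x ℚ.- y ∣)
    (cong (ℚ._* ℚ.∣ x ℚ.- y ∣) (sym ι0)))
    where
    e : ∀ z → 0ℚ ≡ 0ℚ ℚ.* z
    e = solve-∀ ℚring
  power-lipschitz {x} {y} hx hy (suc k) = ℚ.≤-trans
    (subst (λ z → ℚ.∣ z ∣ ℚ.≤ ℚ.∣ x ℚ.* (x ^ℚ k ℚ.- y ^ℚ k) ∣ ℚ.+ ℚ.∣ y ^ℚ k ℚ.* (x ℚ.- y) ∣) (e₁ x y (x ^ℚ k) (y ^ℚ k))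
      (ℚ.∣p+q∣≤∣p∣+∣q∣ (x ℚ.* (x ^ℚ k ℚ.- y ^ℚ k)) (y ^ℚ k ℚ.* (x ℚ.- y))))
    (ℚ.≤-trans (ℚ.+-mono-≤
      (abs-mul-≤ {x} {x ^ℚ k ℚ.- y ^ℚ k} hx (power-lipschitz hx hy k))
      (abs-mul-≤ {y ^ℚ k} {x ℚ.- y} (∣^∣≤ k hy) ℚ.≤-refl))
      (subst (ℚ._≤ ι (suc k ℕ.* B ℕ.^ suc k) ℚ.* ℚ.∣ x ℚ.- y ∣)
        (trans (cong (ℚ._* ℚ.∣ x ℚ.- y ∣) (trans (ι-+ (B ℕ.* (k ℕ.* B ℕ.^ k)) (B ℕ.^ k)) (cong (ℚ._+ ι (B ℕ.^ k)) (ι-* B (k ℕ.* B ℕ.^ k)))))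
          (e₂ (ι B) (ι (k ℕ.* B ℕ.^ k)) (ι (B ℕ.^ k)) ℚ.∣ x ℚ.- y ∣))
        (*-monoˡ-≤ ℚ.∣ x ℚ.- y ∣ (ℚ.0≤∣p∣ (x ℚ.- y)) (ι-mono-≤ nat))))
    where
    e₁ : ∀ x y p q → x ℚ.* (p ℚ.- q) ℚ.+ q ℚ.* (x ℚ.- y) ≡ x ℚ.* p ℚ.- y ℚ.* q
    e₁ = solve-∀ ℚring
    e₂ : ∀ b k p z → (b ℚ.* k ℚ.+ p) ℚ.* z ≡ b ℚ.* (k ℚ.* z) ℚ.+ p ℚ.* z
    e₂ = solve-∀ ℚring
    e₃ : ∀ b k p → b ℕ.* (k ℕ.* p) ℕ.+ b ℕ.* p ≡ (1 ℕ.+ k) ℕ.* (b ℕ.* p)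
    e₃ = ℕRing.solve-∀
    nat : B ℕ.* (k ℕ.* B ℕ.^ k) ℕ.+ B ℕ.^ k ℕ.≤ suc k ℕ.* B ℕ.^ suc k
    nat = ℕ.≤-trans (ℕ.+-monoʳ-≤ (B ℕ.* (k ℕ.* B ℕ.^ k)) (ℕ.m≤n*m (B ℕ.^ k) B {{ℕ.>-nonZero 1≤B}}))
            (ℕ.≤-reflexive (e₃ B k (B ℕ.^ k)))

  term-lipschitz : ∀ {x y} → ℚ.∣ x ∣ ℚ.≤ ι B → ℚ.∣ y ∣ ℚ.≤ ι B → ∀ k →
    ℚ.∣ term x k ℚ.- term y k ∣ ℚ.≤ (C ℚ.* ℚ.∣ x ℚ.- y ∣) ℚ.* ½ ^ℚ k
  term-lipschitz {x} {y} hx hy k = ℚ.≤-trans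
    (subst (λ z → ℚ.∣ z ∣ ℚ.≤ (ι (k ℕ.* B ℕ.^ k) ℚ.* ℚ.∣ x ℚ.- y ∣) ℚ.* 1/ᵘ (k !)) (e₁ (x ^ℚ k) (y ^ℚ k) (1/ᵘ (k !)))
      (abs-mul-≤ {x ^ℚ k ℚ.- y ^ℚ k} {1/ᵘ (k !)} (power-lipschitz hx hy k) (ℚ.≤-reflexive (ℚ.0≤p⇒∣p∣≡p (0≤1/ᵘ (k !))))))
    (subst₂ ℚ._≤_
      (trans (e₂ (ι k) (ι (B ℕ.^ k)) (1/ᵘ (k !)) ℚ.∣ x ℚ.- y ∣) (cong (λ z → (z ℚ.* ℚ.∣ x ℚ.- y ∣) ℚ.* 1/ᵘ (k !)) (sym (ι-* k (B ℕ.^ k)))))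
      (e₃ C ℚ.∣ x ℚ.- y ∣ (½ ^ℚ k))
      (*-monoʳ-≤ ℚ.∣ x ℚ.- y ∣ (ℚ.0≤∣p∣ (x ℚ.- y))
        (ℚ.≤-trans (*-monoʳ-≤ (ι k) (0≤ι k) (coefficient-bound k))
          (subst (ℚ._≤ C ℚ.* ½ ^ℚ k) (e₄ C (ι k) (¼ ^ℚ k))
            (*-monoʳ-≤ C 0≤C (linear*¼^≤½^ k k (ℕ.<⇒≤ (n<2^n k))))))))
    where
    e₁ : ∀ p q u → (p ℚ.- q) ℚ.* u ≡ p ℚ.* u ℚ.- q ℚ.* u
    e₁ = solve-∀ ℚring
    e₂ : ∀ k b u z → z ℚ.* (k ℚ.* (b ℚ.* u)) ≡ ((k ℚ.* b) ℚ.* z) ℚ.* u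
    e₂ = solve-∀ ℚring
    e₃ : ∀ c z h → z ℚ.* (c ℚ.* h) ≡ (c ℚ.* z) ℚ.* h
    e₃ = solve-∀ ℚring
    e₄ : ∀ c k h → c ℚ.* (k ℚ.* h) ≡ k ℚ.* (c ℚ.* h)
    e₄ = solve-∀ ℚring

  sum-diff : ∀ f g n → sum (λ k → f k ℚ.- g k) n ≡ sum f n ℚ.- sum g n
  sum-diff f g zero    = refl
  sum-diff f g (suc n) = trans (cong (ℚ._+ (f n ℚ.- g n)) (sum-diff f g n)) (e (sum f n) (sum g n) (f n) (g n))
    where
    e : ∀ a b c d → (a ℚ.- b) ℚ.+ (c ℚ.- d) ≡ (a ℚ.+ c) ℚ.- (b ℚ.+ d)
    e = solve-∀ ℚring

  expSum-lipschitz : ∀ {x y} → ℚ.∣ x ∣ ℚ.≤ ι B → ℚ.∣ y ∣ ℚ.≤ ι B → ∀ n →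
    ℚ.∣ expSum n x ℚ.- expSum n y ∣ ℚ.≤ (C ℚ.+ C) ℚ.* ℚ.∣ x ℚ.- y ∣
  expSum-lipschitz {x} {y} hx hy n = subst₂ ℚ._≤_
    (cong ℚ.∣_∣ (trans (e₁ (sum (λ k → term x k ℚ.- term y k) n)) (sum-diff (term x) (term y) n)))
    (e₂ C ℚ.∣ x ℚ.- y ∣)
    (tail-bound′ (λ k → term x k ℚ.- term y k) (C ℚ.* ℚ.∣ x ℚ.- y ∣) ½
      (0≤* {C} {ℚ.∣ x ℚ.- y ∣} 0≤C (ℚ.0≤∣p∣ (x ℚ.- y))) 0≤½ ℚ.≤-refl (term-lipschitz hx hy) {0} {n} z≤n)
    where
    e₁ : ∀ a → a ℚ.- 0ℚ ≡ a
    e₁ = solve-∀ ℚring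
    e₂ : ∀ c z → (c ℚ.* z ℚ.+ c ℚ.* z) ℚ.* 1ℚ ≡ (c ℚ.+ c) ℚ.* z
    e₂ = solve-∀ ℚring

  -- The difference is the sum over i ≤ n of x^i / i! times a tail of the series of y beginning
  -- after order n - i, and each of these n + 1 products is at most a constant times 4^(-n).
  expSum-product : ∀ {x y} → ℚ.∣ x ∣ ℚ.≤ ι B → ℚ.∣ y ∣ ℚ.≤ ι B → ∀ n →
    ℚ.∣ expSum (suc n) x ℚ.* expSum (suc n) y ℚ.- expSum (suc n) (x ℚ.+ y) ∣ ℚ.≤ (C ℚ.* (C ℚ.+ C)) ℚ.* ½ ^ℚ n
  expSum-product {x} {y} hx hy n = ℚ.≤-trans
    (subst (λ z → ℚ.∣ z ∣ ℚ.≤ ι (suc n) ℚ.* ((C ℚ.* (C ℚ.+ C)) ℚ.* ¼ ^ℚ n))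
      (trans (conv-const (term x) (expSum (suc n) y) (λ j → expSum (suc j) y) n)
        (cong (λ z → expSum (suc n) x ℚ.* expSum (suc n) y ℚ.- z) (conv-expSum x y n)))
      (conv-bound (term x) (λ j → expSum (suc n) y ℚ.- expSum (suc j) y) C (C ℚ.+ C) ¼ n 0≤C 0≤¼ (term-bound hx)
        (λ j j≤n → ℚ.≤-trans (expSum-tail hy (s≤s j≤n)) (*-monoʳ-≤ (C ℚ.+ C) 0≤2C (shrink j)))))
    (subst (ℚ._≤ (C ℚ.* (C ℚ.+ C)) ℚ.* ½ ^ℚ n) (e₁ (C ℚ.* (C ℚ.+ C)) (ι (suc n)) (¼ ^ℚ n))
      (*-monoʳ-≤ (C ℚ.* (C ℚ.+ C)) (0≤* {C} {C ℚ.+ C} 0≤C 0≤2C) (linear*¼^≤½^ (suc n) n (n<2^n n))))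
    where
    e₁ : ∀ c i h → c ℚ.* (i ℚ.* h) ≡ i ℚ.* (c ℚ.* h)
    e₁ = solve-∀ ℚring
    ¼≤1 : ¼ ℚ.≤ 1ℚ
    ¼≤1 = ℚ.≤-trans ¼≤½ (toWitness {a? = ½ ℚ.≤? 1ℚ} _)
    shrink : ∀ j → ¼ ^ℚ suc j ℚ.≤ ¼ ^ℚ j
    shrink j = subst (¼ ℚ.* ¼ ^ℚ j ℚ.≤_) (ℚ.*-identityˡ (¼ ^ℚ j)) (*-monoˡ-≤ (¼ ^ℚ j) (0≤^ℚ j 0≤¼) ¼≤1)

-- The relations _≤_ and _≈_ on ℝ unfold to Π-types, from which Agda cannot
-- recover the two sides; the records _⊑_ and _≋_ are injective copies of them.

infix 4 _⊑_ _≋_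

record _⊑_ (x y : ℝ) : Set where
  constructor ⟨_⟩
  field un⊑ : x ≤ y
open _⊑_

record _≋_ (x y : ℝ) : Set where
  constructor ⟪_⟫
  field un≋ : x ≈ y

≋-refl : ∀ {x} → x ≋ x
≋-refl {x} = ⟪ ≈-refl {x} ⟫

≋-sym : ∀ {x y} → x ≋ y → y ≋ x
≋-sym {x} {y} ⟪ h ⟫ = ⟪ ≈-sym {x} {y} h ⟫

≋-trans : ∀ {x y z} → x ≋ y → y ≋ z → x ≋ z
≋-trans {x} {y} {z} ⟪ h ⟫ ⟪ k ⟫ = ⟪ ≈-trans {x} {y} {z} h k ⟫

≋⇒⊑ : ∀ {x y} → x ≋ y → x ⊑ y
≋⇒⊑ {x} {y} ⟪ h ⟫ = ⟨ ≈⇒≤ {x} {y} h ⟩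

⊑-trans : ∀ {x y z} → x ⊑ y → y ⊑ z → x ⊑ z
⊑-trans {x} {y} {z} ⟨ h ⟩ ⟨ k ⟩ = ⟨ ≤-trans {x} {y} {z} h k ⟩

⊑-refl : ∀ {x} → x ⊑ x
⊑-refl {x} = ⟨ ≤-refl {x} ⟩

<⇒⊑ : ∀ x y → x < y → x ⊑ y
<⇒⊑ x y h = ⟨ <⇒≤ {x} {y} h ⟩

*-≋ : ∀ {x y z w} → x ≋ y → z ≋ w → x * z ≋ y * w
*-≋ {x} {y} {z} {w} ⟪ h ⟫ ⟪ k ⟫ = ⟪ *-cong {x} {y} {z} {w} h k ⟫

*-⊑ : ∀ {x y z w} → 0ℝ ⊑ x → 0ℝ ⊑ w → x ⊑ y → z ⊑ w → x * z ⊑ y * w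
*-⊑ {x} {y} {z} {w} ⟨ a ⟩ ⟨ b ⟩ ⟨ h ⟩ ⟨ k ⟩ = ⟨ *-mono-≤ℝ {x} {y} {z} {w} a b h k ⟩

+-⊑ : ∀ {x y z w} → x ⊑ y → z ⊑ w → x + z ⊑ y + w
+-⊑ {x} {y} {z} {w} ⟨ h ⟩ ⟨ k ⟩ = ⟨ +-mono-≤ {x} {y} {z} {w} h k ⟩

pw≋ : ∀ {x y} → (∀ n → seq x n ≡ seq y n) → x ≋ y
pw≋ {x} {y} h = ⟪ pw≈ {x} {y} h ⟫

pw⊑ : ∀ {x y} → (∀ n → seq x n ℚ.≤ seq y n) → x ⊑ y
pw⊑ {x} {y} h = ⟨ pw≤ {x} {y} h ⟩

fromℚ-⊑ : ∀ {p q} → p ℚ.≤ q → fromℚ p ⊑ fromℚ q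
fromℚ-⊑ h = ⟨ fromℚ-mono h ⟩

*-nonneg⊑ : ∀ {x y} → 0ℝ ⊑ x → 0ℝ ⊑ y → 0ℝ ⊑ x * y
*-nonneg⊑ {x} {y} ⟨ h ⟩ ⟨ k ⟩ = ⟨ *-nonneg {x} {y} h k ⟩

^-nonneg : ∀ {x} n → 0ℝ ⊑ x → 0ℝ ⊑ x ^ n
^-nonneg zero    h = fromℚ-⊑ 0≤1
^-nonneg (suc n) h = *-nonneg⊑ h (^-nonneg n h)

^-mono : ∀ {x y} n → 0ℝ ⊑ x → x ⊑ y → x ^ n ⊑ y ^ n
^-mono zero    h k = ⊑-refl
^-mono (suc n) h k = *-⊑ h (^-nonneg n (⊑-trans h k)) k (^-mono n h k)

-- The real exponential

⊔-bound : ∀ (x y : ℝ) → ∃[ B ] 1 ℕ.≤ B × Eventually λ n → ℚ.∣ seq x n ∣ ℚ.≤ ι B × ℚ.∣ seq y n ∣ ℚ.≤ ι B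
⊔-bound x y = let (A , 1≤A , hA) = bounded x; (B , 1≤B , hB) = bounded y in
  A ℕ.⊔ B , ℕ.≤-trans 1≤A (ℕ.m≤m⊔n A B) , zipEv hA hB λ n a b →
    ℚ.≤-trans a (ι-mono-≤ (ℕ.m≤m⊔n A B)) , ℚ.≤-trans b (ι-mono-≤ (ℕ.m≤n⊔m A B))

¼^≤½^ : ∀ n → ¼ ^ℚ n ℚ.≤ ½ ^ℚ n
¼^≤½^ n = subst (ℚ._≤ ½ ^ℚ n) (trans (cong (ℚ._* ¼ ^ℚ n) ι1) (ℚ.*-identityˡ (¼ ^ℚ n))) (linear*¼^≤½^ 1 n (1≤^ {2} n (s≤s z≤n)))

¼^-small : ∀ K ε → 0ℚ ℚ.≤ K → 0ℚ ℚ.< ε → Eventually λ n → K ℚ.* ¼ ^ℚ n ℚ.≤ ε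
¼^-small K ε 0≤K 0<ε = mapEv (½^-small K ε 0<ε) λ n → ℚ.≤-trans (*-monoʳ-≤ K 0≤K (¼^≤½^ n))

scale-small : ∀ K ε → 0ℚ ℚ.≤ K → 0ℚ ℚ.< ε → ∃[ δ ] 0ℚ ℚ.< δ × (∀ z → z ℚ.≤ δ → K ℚ.* z ℚ.≤ ε)
scale-small K ε 0≤K 0<ε = let (k , 1≤k , K≤k) = ceiling K in
  1/ᵘ k ℚ.* ε , 0<* {1/ᵘ k} {ε} (0<1/ᵘ 1≤k) 0<ε , λ z h →
    ℚ.≤-trans (*-monoʳ-≤ K 0≤K h)
      (ℚ.≤-trans (*-monoˡ-≤ (1/ᵘ k ℚ.* ε) (ℚ.<⇒≤ (0<* {1/ᵘ k} {ε} (0<1/ᵘ 1≤k) 0<ε)) K≤k)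
        (ℚ.≤-reflexive (trans (e (ι k) (1/ᵘ k) ε) (trans (cong (ℚ._* ε) (1/ᵘ-* 1≤k)) (ℚ.*-identityˡ ε)))))
  where
  e : ∀ k u ε → k ℚ.* (u ℚ.* ε) ≡ (u ℚ.* k) ℚ.* ε
  e = solve-∀ ℚring

expSum-close : ∀ (u : ℝ) ε → 0ℚ ℚ.< ε →
  ∃[ K ] ∀ m n k → K ℕ.≤ m → K ℕ.≤ n → K ℕ.≤ k → ℚ.∣ expSum m (seq u k) ℚ.- expSum n (seq u k) ∣ ℚ.≤ ε
expSum-close u ε 0<ε =
  let (B , 1≤B , L , hB) = bounded u
      open ExpBound B 1≤B
      (K , small) = ¼^-small (C ℚ.+ C) (ε ℚ.* ½) 0≤2C (0<half 0<ε)
      near : ∀ m k → L ℕ.⊔ K ℕ.≤ m → L ℕ.⊔ K ℕ.≤ k →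
             ℚ.∣ expSum m (seq u k) ℚ.- expSum K (seq u k) ∣ ℚ.≤ ε ℚ.* ½
      near m k hm hk = ℚ.≤-trans (expSum-tail (hB k (ℕ.m⊔n≤o⇒m≤o L K hk)) (ℕ.m⊔n≤o⇒n≤o L K hm)) (small K ℕ.≤-refl)
  in L ℕ.⊔ K , λ m n k hm hn hk →
    ℚ.≤-trans (∣-∣-triangle (expSum m (seq u k)) (expSum K (seq u k)) (expSum n (seq u k)))
      (subst (ℚ.∣ expSum m (seq u k) ℚ.- expSum K (seq u k) ∣ ℚ.+ ℚ.∣ expSum K (seq u k) ℚ.- expSum n (seq u k) ∣ ℚ.≤_) (halves ε)
        (ℚ.+-mono-≤ (near m k hm hk)
          (subst (ℚ._≤ ε ℚ.* ½) (∣-∣-comm (expSum n (seq u k)) (expSum K (seq u k))) (near n k hn hk))))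

opaque
  exp-cauchy : ∀ u → IsCauchy (λ n → expSum n (seq u n))
  exp-cauchy u ε 0<ε =
    let (K , close) = expSum-close u (ε ℚ.* ½ ℚ.* ½) (0<half (0<half 0<ε))
        (B , 1≤B , L , hB) = bounded u
        open ExpBound B 1≤B
        (δ , 0<δ , small) = scale-small (C ℚ.+ C) (ε ℚ.* ½ ℚ.* ½) 0≤2C (0<half (0<half 0<ε))
        (M , hu) = cauchy u δ 0<δ
    in K ℕ.⊔ (L ℕ.⊔ M) , λ m n hm hn →
      let Km = ℕ.m⊔n≤o⇒m≤o K (L ℕ.⊔ M) hm
          Kn = ℕ.m⊔n≤o⇒m≤o K (L ℕ.⊔ M) hn
          LMm = ℕ.m⊔n≤o⇒n≤o K (L ℕ.⊔ M) hm
          LMn = ℕ.m⊔n≤o⇒n≤o K (L ℕ.⊔ M) hn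
      in ℚ.≤-<-trans
        (ℚ.≤-trans (∣-∣-triangle (expSum m (seq u m)) (expSum n (seq u m)) (expSum n (seq u n)))
          (subst (ℚ.∣ expSum m (seq u m) ℚ.- expSum n (seq u m) ∣ ℚ.+ ℚ.∣ expSum n (seq u m) ℚ.- expSum n (seq u n) ∣ ℚ.≤_) (halves (ε ℚ.* ½))
            (ℚ.+-mono-≤ (close m n m Km Kn Km)
              (ℚ.≤-trans (expSum-lipschitz (hB m (ℕ.m⊔n≤o⇒m≤o L M LMm)) (hB n (ℕ.m⊔n≤o⇒m≤o L M LMn)) n)
                (small ℚ.∣ seq u m ℚ.- seq u n ∣
                  (ℚ.<⇒≤ (hu m n (ℕ.m⊔n≤o⇒n≤o L M LMm) (ℕ.m⊔n≤o⇒n≤o L M LMn))))))))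
        (half< {ε} 0<ε)

Exp : ℝ → ℝ
Exp u = mkℝ (λ n → expSum n (seq u n)) (exp-cauchy u)

Exp-isExp : ∀ u → IsExp u (Exp u)
Exp-isExp u ε (e , 0<e , h) =
  let (K , close) = expSum-close u (e ℚ.* ½) (0<half 0<e) in
  K , λ N K≤N → e ℚ.* ½ , 0<half 0<e , zipEv h (K , λ _ → id) λ n a K≤n →
    subst (λ z → ℚ.∣ z ℚ.- expSum n (seq u n) ∣ ℚ.+ e ℚ.* ½ ℚ.≤ seq ε n) (sym (seq-partialSum u N n))
      (≤-by ((seq ε n ℚ.- (0ℚ ℚ.+ e)) ℚ.+ (e ℚ.* ½ ℚ.- ℚ.∣ expSum N (seq u n) ℚ.- expSum n (seq u n) ∣))
        (0≤+ {seq ε n ℚ.- (0ℚ ℚ.+ e)} (0≤-diff a) (0≤-diff (close N n n K≤N K≤n K≤n)))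
        (eq (seq ε n) e ℚ.∣ expSum N (seq u n) ℚ.- expSum n (seq u n) ∣))
  where
  eq : ∀ x e a → x ≡ (a ℚ.+ e ℚ.* ½) ℚ.+ ((x ℚ.- (0ℚ ℚ.+ e)) ℚ.+ (e ℚ.* ½ ℚ.- a))
  eq = solve-∀ ℚring

expSeries : ℝ → ℕ → ℝ
expSeries u = partialSum (λ k → (u ^ k) * fromℚ ((+ 1 ℚ./ (k !)) {{k ℕ.!≢0}}))

Exp-unique : ∀ {u y} → IsExp u y → y ≋ Exp u
Exp-unique {u} {y} h = ⟪ lim-unique {expSeries u} {y} {Exp u} h (Exp-isExp u) ⟫

Exp-cong : ∀ {x y} → x ≋ y → Exp x ≋ Exp y
Exp-cong {x} {y} ⟪ h ⟫ = ⟪ (λ ε 0<ε →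
  let (B , 1≤B , hB) = ⊔-bound x y
      open ExpBound B 1≤B
      (δ , 0<δ , small) = scale-small (C ℚ.+ C) (ε ℚ.* ½) 0≤2C (0<half 0<ε)
  in zipEv hB (h δ 0<δ) λ n b d → ℚ.≤-<-trans
    (ℚ.≤-trans (expSum-lipschitz (proj₁ b) (proj₂ b) n) (small ℚ.∣ seq x n ℚ.- seq y n ∣ (ℚ.<⇒≤ d)))
    (half< {ε} 0<ε)) ⟫

Exp-+ : ∀ x y → Exp (x + y) ≋ Exp x * Exp y
Exp-+ x y = ≋-sym ⟪ (λ ε 0<ε →
  let (B , 1≤B , N , hB) = ⊔-bound x y
      open ExpBound B 1≤B
      (M , small) = ½^-small (C ℚ.* (C ℚ.+ C)) (ε ℚ.* ½) (0<half 0<ε)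
  in suc (N ℕ.⊔ M) , λ where
    (suc n) (s≤s h) →
      let b = hB (suc n) (ℕ.m≤n⇒m≤1+n (ℕ.m⊔n≤o⇒m≤o N M h)) in
      ℚ.≤-<-trans (ℚ.≤-trans (expSum-product (proj₁ b) (proj₂ b) n) (small n (ℕ.m⊔n≤o⇒n≤o N M h))) (half< {ε} 0<ε)) ⟫

0≤term : ∀ {x} → 0ℚ ℚ.≤ x → ∀ k → 0ℚ ℚ.≤ term x k
0≤term {x} h k = 0≤* {x ^ℚ k} {1/ᵘ (k !)} (0≤^ℚ k h) (0≤1/ᵘ (k !))

1≤expSum : ∀ {x} → 0ℚ ℚ.≤ x → ∀ n → 1ℚ ℚ.≤ expSum (suc n) x
1≤expSum {x} h n = ℚ.≤-trans (ℚ.≤-reflexive (trans (sym (term-zero x)) (sym (ℚ.+-identityˡ (term x 0)))))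
  (sum-grow (0≤term h) {1} {suc n} (s≤s z≤n))

Exp-≥1 : ∀ {x} → 0ℝ ⊑ x → 1ℝ ⊑ Exp x
Exp-≥1 {x} ⟨ h ⟩ = ⊑-trans {y = Exp ∣ x ∣}
  ⟨ ev≤ {1ℝ} {Exp ∣ x ∣} (1 , λ { (suc n) _ → 1≤expSum (ℚ.0≤∣p∣ (seq x (suc n))) n }) ⟩
  (≋⇒⊑ (Exp-cong {∣ x ∣} {x} ⟪ nonneg⇒≈∣∣ {x} h ⟫))

-- `Exp x` is the square of `Exp (½ℝ * x)`, and squares have nonnegative approximants.
Exp-nonneg : ∀ x → 0ℝ ⊑ Exp x
Exp-nonneg x = ⊑-trans {y = Exp (½ℝ * x) * Exp (½ℝ * x)}
  (pw⊑ λ n → 0≤square (seq (Exp (½ℝ * x)) n))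
  (≋⇒⊑ (≋-trans (≋-sym (Exp-+ (½ℝ * x) (½ℝ * x))) (Exp-cong (pw≋ λ n → e (seq x n)))))
  where
  e : ∀ x → ½ ℚ.* x ℚ.+ ½ ℚ.* x ≡ x
  e = solve-∀ ℚring
  square : ∀ p → ℚ.∣ p ∣ ℚ.* ℚ.∣ p ∣ ≡ p ℚ.* p
  square p with ℚ.∣p∣≡p∨∣p∣≡-p p
  ... | inj₁ eq = cong₂ ℚ._*_ eq eq
  ... | inj₂ eq = trans (cong₂ ℚ._*_ eq eq) (e₂ p)
    where
    e₂ : ∀ p → (ℚ.- p) ℚ.* (ℚ.- p) ≡ p ℚ.* p
    e₂ = solve-∀ ℚring
  0≤square : ∀ p → 0ℚ ℚ.≤ p ℚ.* p
  0≤square p = subst (0ℚ ℚ.≤_) (square p) (0≤* {ℚ.∣ p ∣} {ℚ.∣ p ∣} (ℚ.0≤∣p∣ p) (ℚ.0≤∣p∣ p))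

*-identityʳ≋ : ∀ x → x * 1ℝ ≋ x
*-identityʳ≋ x = pw≋ λ n → ℚ.*-identityʳ (seq x n)

-- Exp y = Exp x · Exp (y - x), where the second factor is at least 1.
Exp-mono : ∀ {x y} → x ⊑ y → Exp x ⊑ Exp y
Exp-mono {x} {y} ⟨ h ⟩ = ⊑-trans (≋⇒⊑ (≋-sym (*-identityʳ≋ (Exp x))))
  (⊑-trans (*-⊑ (Exp-nonneg x) (Exp-nonneg (y - x)) ⊑-refl (Exp-≥1 ⟨ 0≤-diffℝ {x} {y} h ⟩))
    (≋⇒⊑ (≋-trans (≋-sym (Exp-+ x (y - x))) (Exp-cong (pw≋ λ n → e (seq x n) (seq y n))))))
  where
  e : ∀ x y → x ℚ.+ (y ℚ.- x) ≡ y
  e = solve-∀ ℚring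

Exp-0 : ∀ {x} → x ≋ 0ℝ → Exp x ≋ 1ℝ
Exp-0 {x} h = ≋-trans (Exp-cong h) ⟪ ≤-antisym {Exp 0ℝ} {1ℝ}
  (ev≤ {Exp 0ℝ} {1ℝ} (1 , λ { (suc n) _ → ℚ.≤-reflexive (at0 n) }))
  (ev≤ {1ℝ} {Exp 0ℝ} (1 , λ { (suc n) _ → ℚ.≤-reflexive (sym (at0 n)) })) ⟫
  where
  e : ∀ p u → 1ℚ ℚ.+ (0ℚ ℚ.* p) ℚ.* u ≡ 1ℚ
  e = solve-∀ ℚring
  at0 : ∀ n → expSum (suc n) 0ℚ ≡ 1ℚ
  at0 zero    = trans (ℚ.+-identityˡ (term 0ℚ 0)) (term-zero 0ℚ)
  at0 (suc n) = trans (cong (ℚ._+ term 0ℚ (suc n)) (at0 n)) (e (0ℚ ^ℚ n) (1/ᵘ (suc n !)))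

Exp-ι* : ∀ n x → Exp (fromℚ (ι n) * x) ≋ Exp x ^ n
Exp-ι* zero    x = Exp-0 (pw≋ λ n → trans (cong (ℚ._* seq x n) ι0) (ℚ.*-zeroˡ (seq x n)))
Exp-ι* (suc k) x = ≋-trans
  (Exp-cong {fromℚ (ι (suc k)) * x} {x + fromℚ (ι k) * x} (pw≋ λ n → trans (cong (ℚ._* seq x n) (ι-suc k)) (e (ι k) (seq x n))))
  (≋-trans (Exp-+ x (fromℚ (ι k) * x)) (*-≋ ≋-refl (Exp-ι* k x)))
  where
  e : ∀ k x → (1ℚ ℚ.+ k) ℚ.* x ≡ x ℚ.+ k ℚ.* x
  e = solve-∀ ℚring

-- Continued fractions

Positive : (ℕ → ℕ) → Set
Positive a = ∀ n → 1 ℕ.≤ n → 1 ℕ.≤ a n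

tail : (ℕ → ℕ) → ℕ → ℕ
tail a k = a (suc k)

tail-positive : ∀ {a} → Positive a → Positive (tail a)
tail-positive h n _ = h (suc n) (s≤s z≤n)

convergent-suc : ∀ a n → convergent a (suc n) ≡ recip (ι (a 1) ℚ.+ convergent (tail a) n)
convergent-suc a n = cong (λ z → recip (z ℚ.+ convergent (tail a) n)) (sym (ι-def (a 1)))

mutual
  0≤convergent : ∀ {a} → Positive a → ∀ n → 0ℚ ℚ.≤ convergent a n
  0≤convergent h zero    = ℚ.≤-refl
  0≤convergent {a} h (suc n) = subst (0ℚ ℚ.≤_) (sym (convergent-suc a n)) (ℚ.<⇒≤ (0<recip (0<denominator h n)))

  digit≤denominator : ∀ {a} → Positive a → ∀ n → ι (a 1) ℚ.≤ ι (a 1) ℚ.+ convergent (tail a) n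
  digit≤denominator {a} h n = p≤p+ε (ι (a 1)) (0≤convergent (tail-positive h) n)

  0<denominator : ∀ {a} → Positive a → ∀ n → 0ℚ ℚ.< ι (a 1) ℚ.+ convergent (tail a) n
  0<denominator h n = ℚ.<-≤-trans (0<ι (h 1 (s≤s z≤n))) (digit≤denominator h n)

recip≤1/ᵘ : ∀ {m q} → 1 ℕ.≤ m → ι m ℚ.≤ q → recip q ℚ.≤ 1/ᵘ m
recip≤1/ᵘ {m} {q} 1≤m h = subst (recip q ℚ.≤_) (sym (1/ᵘ-def m)) (recip-antimono (0<ι 1≤m) h)

1/ᵘ≤recip : ∀ {m q} → 0ℚ ℚ.< q → q ℚ.≤ ι m → 1/ᵘ m ℚ.≤ recip q
1/ᵘ≤recip {m} {q} 0<q h = subst (ℚ._≤ recip q) (sym (1/ᵘ-def m)) (recip-antimono 0<q h)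

convergent≤1/ᵘ : ∀ {a} → Positive a → ∀ n → convergent a n ℚ.≤ 1/ᵘ (a 1)
convergent≤1/ᵘ {a} h zero    = 0≤1/ᵘ (a 1)
convergent≤1/ᵘ {a} h (suc n) = subst (ℚ._≤ 1/ᵘ (a 1)) (sym (convergent-suc a n))
  (recip≤1/ᵘ (h 1 (s≤s z≤n)) (digit≤denominator h n))

convergent≤1 : ∀ {a} → Positive a → ∀ n → convergent a n ℚ.≤ 1ℚ
convergent≤1 {a} h n = ℚ.≤-trans (convergent≤1/ᵘ h n)
  (subst (1/ᵘ (a 1) ℚ.≤_) 1/ᵘ-one (1/ᵘ-antimono (s≤s z≤n) (h 1 (s≤s z≤n))))

denominator≤ : ∀ {a} → Positive a → ∀ n → ι (a 1) ℚ.+ convergent (tail a) n ℚ.≤ ι (suc (a 1))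
denominator≤ {a} h n = subst (ι (a 1) ℚ.+ convergent (tail a) n ℚ.≤_)
  (trans (ℚ.+-comm (ι (a 1)) 1ℚ) (sym (ι-suc (a 1))))
  (ℚ.+-monoʳ-≤ (ι (a 1)) (convergent≤1 (tail-positive h) n))

1/ᵘ≤convergent : ∀ {a} → Positive a → ∀ n → 1/ᵘ (suc (a 1)) ℚ.≤ convergent a (suc n)
1/ᵘ≤convergent {a} h n = subst (1/ᵘ (suc (a 1)) ℚ.≤_) (sym (convergent-suc a n))
  (1/ᵘ≤recip {suc (a 1)} (0<denominator h n) (denominator≤ h n))

recip-diff : ∀ p q → 0ℚ ℚ.< p → 0ℚ ℚ.< q → recip p ℚ.- recip q ≡ (q ℚ.- p) ℚ.* (recip p ℚ.* recip q)
recip-diff p q 0<p 0<q = trans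
  (cong₂ ℚ._-_ (sym (trans (cong (recip p ℚ.*_) (recip-* q 0<q)) (ℚ.*-identityʳ (recip p))))
               (sym (trans (cong (recip q ℚ.*_) (recip-* p 0<p)) (ℚ.*-identityʳ (recip q)))))
  (e p q (recip p) (recip q))
  where
  e : ∀ p q r t → r ℚ.* (t ℚ.* q) ℚ.- t ℚ.* (r ℚ.* p) ≡ (q ℚ.- p) ℚ.* (r ℚ.* t)
  e = solve-∀ ℚring

∣recip-diff∣ : ∀ p q → 0ℚ ℚ.< p → 0ℚ ℚ.< q →
  ℚ.∣ recip p ℚ.- recip q ∣ ≡ ℚ.∣ p ℚ.- q ∣ ℚ.* (recip p ℚ.* recip q)
∣recip-diff∣ p q 0<p 0<q = trans (cong ℚ.∣_∣ (recip-diff p q 0<p 0<q))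
  (trans (ℚ.∣p*q∣≡∣p∣*∣q∣ (q ℚ.- p) (recip p ℚ.* recip q))
    (cong₂ ℚ._*_ (∣-∣-comm q p) (ℚ.0≤p⇒∣p∣≡p (ℚ.<⇒≤ (0<* {recip p} {recip q} (0<recip 0<p) (0<recip 0<q))))))

+-cancel-diff : ∀ a x y → (a ℚ.+ x) ℚ.- (a ℚ.+ y) ≡ x ℚ.- y
+-cancel-diff = solve-∀ ℚring

-- Distances between continued fractions with a common prefix

digitProduct : (ℕ → ℕ) → ℕ → ℕ
digitProduct a zero    = 1
digitProduct a (suc k) = a 1 ℕ.* digitProduct (tail a) k

AgreeUpTo : ℕ → (ℕ → ℕ) → (ℕ → ℕ) → Set
AgreeUpTo k a b = ∀ j → 1 ℕ.≤ j → j ℕ.≤ k → a j ≡ b j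

1≤digitProduct : ∀ {a} → Positive a → ∀ k → 1 ℕ.≤ digitProduct a k
1≤digitProduct h zero    = s≤s z≤n
1≤digitProduct h (suc k) = 1≤* (h 1 (s≤s z≤n)) (1≤digitProduct (tail-positive h) k)

square* : ∀ a b → (a ℕ.* a) ℕ.* (b ℕ.* b) ≡ (a ℕ.* b) ℕ.* (a ℕ.* b)
square* = ℕRing.solve-∀

1/ᵘ-square* : ∀ {m n} → 1 ℕ.≤ m → 1 ℕ.≤ n →
  1/ᵘ ((m ℕ.* n) ℕ.* (m ℕ.* n)) ≡ 1/ᵘ (n ℕ.* n) ℚ.* (1/ᵘ m ℚ.* 1/ᵘ m)
1/ᵘ-square* {m} {n} 1≤m 1≤n = trans (cong 1/ᵘ (trans (sym (square* m n)) (ℕ.*-comm (m ℕ.* m) (n ℕ.* n))))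
  (trans (1/ᵘ-mul (1≤* 1≤n 1≤n) (1≤* 1≤m 1≤m)) (cong (1/ᵘ (n ℕ.* n) ℚ.*_) (1/ᵘ-mul 1≤m 1≤m)))

-- In |1/p - 1/q| = |p - q| / (p q) both denominators are at least the common first digit, so each
-- common digit contributes at most its inverse square.
convergents-close : ∀ {a b} → Positive a → Positive b → ∀ k → AgreeUpTo k a b → ∀ m n → k ℕ.≤ m → k ℕ.≤ n →
  ℚ.∣ convergent a m ℚ.- convergent b n ∣ ℚ.≤ 1/ᵘ (digitProduct a k ℕ.* digitProduct a k)
convergents-close {a} {b} ha hb zero _ m n _ _ = ∣-∣≤ {convergent a m} {convergent b n} (bound ha hb m n) (bound hb ha n m)
  where
  bound : ∀ {a b} → Positive a → Positive b → ∀ m n → convergent a m ℚ.≤ convergent b n ℚ.+ 1/ᵘ 1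
  bound {a} {b} ha hb m n = ℚ.≤-trans (convergent≤1 ha m)
    (subst₂ ℚ._≤_ 1/ᵘ-one (ℚ.+-comm (1/ᵘ 1) (convergent b n)) (p≤p+ε (1/ᵘ 1) (0≤convergent hb n)))
convergents-close {a} {b} ha hb (suc k) agree (suc m) (suc n) (s≤s k≤m) (s≤s k≤n) = subst₂ ℚ._≤_
  (sym (trans (cong₂ (λ y z → ℚ.∣ y ℚ.- z ∣) (convergent-suc a m)
                (trans (convergent-suc b n) (cong (λ z → recip (ι z ℚ.+ y′)) (sym a₁≡b₁))))
       (trans (∣recip-diff∣ p q 0<p 0<q) (cong (λ z → ℚ.∣ z ∣ ℚ.* (recip p ℚ.* recip q)) (+-cancel-diff (ι (a 1)) x′ y′)))))
  (sym (1/ᵘ-square* 1≤a₁ (1≤digitProduct (tail-positive ha) k)))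
  (*-mono-≤ {ℚ.∣ x′ ℚ.- y′ ∣} {1/ᵘ (digitProduct (tail a) k ℕ.* digitProduct (tail a) k)} {recip p ℚ.* recip q} {1/ᵘ (a 1) ℚ.* 1/ᵘ (a 1)}
    (ℚ.0≤∣p∣ (x′ ℚ.- y′)) (ℚ.<⇒≤ (0<* {recip p} {recip q} (0<recip 0<p) (0<recip 0<q)))
    (convergents-close (tail-positive ha) (tail-positive hb) k (λ j 1≤j j≤k → agree (suc j) (s≤s z≤n) (s≤s j≤k)) m n k≤m k≤n)
    (*-mono-≤ {recip p} {1/ᵘ (a 1)} {recip q} {1/ᵘ (a 1)} (ℚ.<⇒≤ (0<recip 0<p)) (ℚ.<⇒≤ (0<recip 0<q))
      (recip≤1/ᵘ 1≤a₁ (p≤p+ε (ι (a 1)) 0≤x′)) (recip≤1/ᵘ 1≤a₁ (p≤p+ε (ι (a 1)) 0≤y′))))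
  where
  a₁≡b₁ = agree 1 (s≤s z≤n) (s≤s z≤n)
  1≤a₁ = ha 1 (s≤s z≤n)
  x′ = convergent (tail a) m
  y′ = convergent (tail b) n
  0≤x′ = 0≤convergent (tail-positive ha) m
  0≤y′ = 0≤convergent (tail-positive hb) n
  p = ι (a 1) ℚ.+ x′
  q = ι (a 1) ℚ.+ y′
  0<p : 0ℚ ℚ.< p
  0<p = 0<denominator ha m
  0<q : 0ℚ ℚ.< q
  0<q = ℚ.<-≤-trans (0<ι 1≤a₁) (p≤p+ε (ι (a 1)) 0≤y′)

separation : (ℕ → ℕ) → ℕ → ℚ
separation B k = ½ ℚ.* 1/ᵘ (digitProduct B k ℕ.* digitProduct B k)

-- The factor ½ is 1 minus the maximal value of a tail whose digits are ≥ 2.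
first-digits-separate : ∀ {a b} B → Positive a → Positive b → 2 ℕ.≤ a 2 → a 1 ℕ.< b 1 → suc (a 1) ℕ.≤ B → suc (b 1) ℕ.≤ B →
  ∀ m n → ½ ℚ.* (1/ᵘ B ℚ.* 1/ᵘ B) ℚ.≤ ℚ.∣ convergent a (suc m) ℚ.- convergent b (suc n) ∣
first-digits-separate {a} {b} B ha hb 2≤a₂ a₁<b₁ a₁<B b₁<B m n =
  subst (½ ℚ.* (1/ᵘ B ℚ.* 1/ᵘ B) ℚ.≤_)
    (sym (trans (cong₂ (λ y z → ℚ.∣ y ℚ.- z ∣) (convergent-suc a m) (convergent-suc b n)) (∣recip-diff∣ p q 0<p 0<q)))
    (*-mono-≤ {½} {ℚ.∣ p ℚ.- q ∣} {1/ᵘ B ℚ.* 1/ᵘ B} {recip p ℚ.* recip q} 0≤½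
      (0≤* {1/ᵘ B} {1/ᵘ B} (0≤1/ᵘ B) (0≤1/ᵘ B))
      (ℚ.≤-trans gap (subst (q ℚ.- p ℚ.≤_) (∣-∣-comm q p) (p≤∣p∣ (q ℚ.- p))))
      (*-mono-≤ {1/ᵘ B} {recip p} {1/ᵘ B} {recip q} (0≤1/ᵘ B) (0≤1/ᵘ B)
        (1/ᵘ≤recip {B} 0<p (ℚ.≤-trans (denominator≤ ha m) (ι-mono-≤ a₁<B)))
        (1/ᵘ≤recip {B} 0<q (ℚ.≤-trans (denominator≤ hb n) (ι-mono-≤ b₁<B)))))
  where
  x′ = convergent (tail a) m
  y′ = convergent (tail b) n
  p = ι (a 1) ℚ.+ x′
  q = ι (b 1) ℚ.+ y′
  0<p : 0ℚ ℚ.< p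
  0<p = 0<denominator ha m
  0<q : 0ℚ ℚ.< q
  0<q = 0<denominator hb n
  x′≤½ : x′ ℚ.≤ ½
  x′≤½ = ℚ.≤-trans (convergent≤1/ᵘ (tail-positive ha) m)
    (subst (1/ᵘ (a 2) ℚ.≤_) (sym ½≡) (1/ᵘ-antimono (s≤s z≤n) 2≤a₂))
  e : ∀ a b x y → (b ℚ.+ y) ℚ.- (a ℚ.+ x) ≡ ½ ℚ.+ (((b ℚ.- (1ℚ ℚ.+ a)) ℚ.+ y) ℚ.+ (½ ℚ.- x))
  e = solve-∀ ℚring
  gap : ½ ℚ.≤ q ℚ.- p
  gap = ≤-by (((ι (b 1) ℚ.- (1ℚ ℚ.+ ι (a 1))) ℚ.+ y′) ℚ.+ (½ ℚ.- x′))
    (0≤+ {(ι (b 1) ℚ.- (1ℚ ℚ.+ ι (a 1))) ℚ.+ y′} {½ ℚ.- x′}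
      (0≤+ {ι (b 1) ℚ.- (1ℚ ℚ.+ ι (a 1))} {y′} (0≤-diff (subst (ℚ._≤ ι (b 1)) (ι-suc (a 1)) (ι-mono-≤ a₁<b₁))) (0≤convergent (tail-positive hb) n))
      (0≤-diff x′≤½))
    (e (ι (a 1)) (ι (b 1)) x′ y′)

-- Removing a common first digit multiplies the distance by the product of the two denominators,
-- each at most that digit plus 1 and hence at most `B 1`. The recursion ends with
-- `first-digits-separate`.
convergents-separate : ∀ {a b} B → Positive a → Positive b → (∀ j → 2 ℕ.≤ j → 2 ℕ.≤ a j × 2 ℕ.≤ b j) →
  ∀ k → (∀ j → 1 ℕ.≤ j → j ℕ.≤ suc k → suc (a j) ℕ.≤ B j × suc (b j) ℕ.≤ B j) →
  AgreeUpTo k a b → a (suc k) ≢ b (suc k) → ∀ m n → k ℕ.≤ m → k ℕ.≤ n →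
  separation B (suc k) ℚ.≤ ℚ.∣ convergent a (suc m) ℚ.- convergent b (suc n) ∣
convergents-separate {a} {b} B ha hb h2 zero hB _ a₁≢b₁ m n _ _ = subst (ℚ._≤ ℚ.∣ convergent a (suc m) ℚ.- convergent b (suc n) ∣)
  (cong (½ ℚ.*_) (trans (sym (1/ᵘ-mul 1≤B 1≤B)) (cong 1/ᵘ (cong₂ ℕ._*_ (sym (ℕ.*-identityʳ (B 1))) (sym (ℕ.*-identityʳ (B 1)))))))
  (by-order (ℕ.<-cmp (a 1) (b 1)))
  where
  ab = hB 1 (s≤s z≤n) (s≤s z≤n)
  1≤B : 1 ℕ.≤ B 1
  1≤B = ℕ.≤-trans (s≤s z≤n) (proj₁ ab)
  by-order : Tri (a 1 ℕ.< b 1) (a 1 ≡ b 1) (b 1 ℕ.< a 1) →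
    ½ ℚ.* (1/ᵘ (B 1) ℚ.* 1/ᵘ (B 1)) ℚ.≤ ℚ.∣ convergent a (suc m) ℚ.- convergent b (suc n) ∣
  by-order (tri< lt _ _) = first-digits-separate (B 1) ha hb (proj₁ (h2 2 ℕ.≤-refl)) lt (proj₁ ab) (proj₂ ab) m n
  by-order (tri≈ _ eq _) = ⊥-elim (a₁≢b₁ eq)
  by-order (tri> _ _ gt) = subst (½ ℚ.* (1/ᵘ (B 1) ℚ.* 1/ᵘ (B 1)) ℚ.≤_) (∣-∣-comm (convergent b (suc n)) (convergent a (suc m)))
    (first-digits-separate (B 1) hb ha (proj₂ (h2 2 ℕ.≤-refl)) gt (proj₂ ab) (proj₁ ab) n m)
convergents-separate {a} {b} B ha hb h2 (suc k) hB agree a≢b (suc m) (suc n) (s≤s k≤m) (s≤s k≤n) = subst₂ ℚ._≤_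
  (trans (ℚ.*-assoc ½ (1/ᵘ (D ℕ.* D)) (1/ᵘ (B 1) ℚ.* 1/ᵘ (B 1))) (cong (½ ℚ.*_) (sym (1/ᵘ-square* 1≤B 1≤D))))
  (sym (trans (cong₂ (λ y z → ℚ.∣ y ℚ.- z ∣) (convergent-suc a (suc m))
                (trans (convergent-suc b (suc n)) (cong (λ z → recip (ι z ℚ.+ y′)) (sym a₁≡b₁))))
       (trans (∣recip-diff∣ p q 0<p 0<q) (cong (λ z → ℚ.∣ z ∣ ℚ.* (recip p ℚ.* recip q)) (+-cancel-diff (ι (a 1)) x′ y′)))))
  (*-mono-≤ {separation (tail B) (suc k)} {ℚ.∣ x′ ℚ.- y′ ∣} {1/ᵘ (B 1) ℚ.* 1/ᵘ (B 1)} {recip p ℚ.* recip q}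
    (0≤* {½} {1/ᵘ (D ℕ.* D)} 0≤½ (0≤1/ᵘ (D ℕ.* D)))
    (0≤* {1/ᵘ (B 1)} {1/ᵘ (B 1)} (0≤1/ᵘ (B 1)) (0≤1/ᵘ (B 1)))
    (convergents-separate (tail B) (tail-positive ha) (tail-positive hb) (λ j 2≤j → h2 (suc j) (ℕ.m≤n⇒m≤1+n 2≤j)) k
      (λ j 1≤j j≤k → hB (suc j) (s≤s z≤n) (s≤s j≤k))
      (λ j 1≤j j≤k → agree (suc j) (s≤s z≤n) (s≤s j≤k)) a≢b m n k≤m k≤n)
    (*-mono-≤ {1/ᵘ (B 1)} {recip p} {1/ᵘ (B 1)} {recip q} (0≤1/ᵘ (B 1)) (0≤1/ᵘ (B 1))
      (1/ᵘ≤recip {B 1} 0<p (ℚ.≤-trans (denominator≤ ha (suc m)) (ι-mono-≤ a₁<B)))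
      (1/ᵘ≤recip {B 1} 0<q (ℚ.≤-trans (subst (λ z → ι z ℚ.+ y′ ℚ.≤ ι (suc z)) (sym a₁≡b₁) (denominator≤ hb (suc n))) (ι-mono-≤ a₁<B)))))
  where
  D = digitProduct (tail B) (suc k)
  x′ = convergent (tail a) (suc m)
  y′ = convergent (tail b) (suc n)
  a₁≡b₁ = agree 1 (s≤s z≤n) (s≤s z≤n)
  a₁<B : suc (a 1) ℕ.≤ B 1
  a₁<B = proj₁ (hB 1 (s≤s z≤n) (s≤s z≤n))
  p = ι (a 1) ℚ.+ x′
  q = ι (a 1) ℚ.+ y′
  0<p : 0ℚ ℚ.< p
  0<p = 0<denominator ha (suc m)
  0<q : 0ℚ ℚ.< q
  0<q = ℚ.<-≤-trans (0<ι (ha 1 (s≤s z≤n))) (p≤p+ε (ι (a 1)) (0≤convergent (tail-positive hb) (suc n)))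
  1≤B = ℕ.≤-trans (s≤s z≤n) a₁<B
  product≥1 : ∀ C l → (∀ j → 1 ℕ.≤ j → j ℕ.≤ l → 1 ℕ.≤ C j) → 1 ℕ.≤ digitProduct C l
  product≥1 C zero    h = s≤s z≤n
  product≥1 C (suc l) h = 1≤* (h 1 (s≤s z≤n) (s≤s z≤n)) (product≥1 (tail C) l λ j 1≤j j≤l → h (suc j) (s≤s z≤n) (s≤s j≤l))
  1≤D : 1 ℕ.≤ D
  1≤D = product≥1 (tail B) (suc k) λ j 1≤j j≤k → ℕ.≤-trans (s≤s z≤n) (proj₁ (hB (suc j) (s≤s z≤n) (s≤s j≤k)))

digitProduct-snoc : ∀ a k → digitProduct a (suc k) ≡ digitProduct a k ℕ.* a (suc k)
digitProduct-snoc a zero    = ℕ.*-comm (a 1) 1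
digitProduct-snoc a (suc k) = trans (cong (a 1 ℕ.*_) (digitProduct-snoc (tail a) k)) (sym (ℕ.*-assoc (a 1) (digitProduct (tail a) k) (a (suc (suc k)))))

2^≤digitProduct : ∀ {a} → (∀ j → 1 ℕ.≤ j → 2 ℕ.≤ a j) → ∀ k → 2 ℕ.^ k ℕ.≤ digitProduct a k
2^≤digitProduct h zero    = s≤s z≤n
2^≤digitProduct h (suc k) = ℕ.*-mono-≤ (h 1 (s≤s z≤n)) (2^≤digitProduct (λ j _ → h (suc j) (s≤s z≤n)) k)

lim-∣-∣-≥ : ∀ {u v x y d} → u ⟶ fin x → v ⟶ fin y → Eventually (λ n → d ⊑ ∣ u n - v n ∣) → d ⊑ ∣ x - y ∣
lim-∣-∣-≥ {u} {v} {x} {y} {d} hu hv h = ⟨ ≤-all-ε {d} {∣ x - y ∣} (λ ε 0<ε →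
  let E = fromℚ (ε ℚ.* ½)
      (n , (a , b) , c) = someEv (zipEv (zipEv (hu E (fromℚ-mono-< (0<half 0<ε))) (hv E (fromℚ-mono-< (0<half 0<ε))) (λ _ → _,_)) h (λ _ → _,_))
  in un⊑ {d} {∣ x - y ∣ + fromℚ ε} (⊑-trans c (⊑-trans (triangle n)
       (⊑-trans (+-⊑ (+-⊑ (<⇒⊑ (∣ u n - x ∣) E a) ⊑-refl) (<⇒⊑ (∣ v n - y ∣) E b))
         (pw⊑ λ k → ℚ.≤-reflexive (e ε (seq (∣ x - y ∣) k))))))) ⟩
  where
  e : ∀ ε a → (ε ℚ.* ½ ℚ.+ a) ℚ.+ ε ℚ.* ½ ≡ a ℚ.+ ε
  e = solve-∀ ℚring
  triangle : ∀ n → ∣ u n - v n ∣ ⊑ (∣ u n - x ∣ + ∣ x - y ∣) + ∣ v n - y ∣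
  triangle n = pw⊑ λ k → let p = seq (u n) k; q = seq (v n) k; r = seq x k; s = seq y k in
    ℚ.≤-trans (∣-∣-triangle p s q)
      (ℚ.+-mono-≤ (∣-∣-triangle p r s) (ℚ.≤-reflexive (∣-∣-comm s q)))

partialQuotients-separate : ∀ {a b x y} B → ArePartialQuotients a x → ArePartialQuotients b y →
  (∀ j → 2 ℕ.≤ j → 2 ℕ.≤ a j × 2 ℕ.≤ b j) →
  ∀ k → (∀ j → 1 ℕ.≤ j → j ℕ.≤ suc k → suc (a j) ℕ.≤ B j × suc (b j) ℕ.≤ B j) →
  AgreeUpTo k a b → a (suc k) ≢ b (suc k) → fromℚ (separation B (suc k)) ⊑ ∣ x - y ∣
partialQuotients-separate {a} {b} {x} {y} B (ha , la) (hb , lb) h2 k hB agree a≢b =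
  lim-∣-∣-≥ {λ n → fromℚ (convergent a n)} {λ n → fromℚ (convergent b n)} {x} {y} la lb
    (suc k , λ { (suc n) (s≤s k≤n) → pw⊑ λ _ → convergents-separate B ha hb h2 k hB agree a≢b n n k≤n k≤n })

partialQuotients-close : ∀ {a w x} → ArePartialQuotients a x → Positive w → ∀ k → AgreeUpTo k w a →
  let r = 1/ᵘ (digitProduct w k ℕ.* digitProduct w k) in
  x ⊑ fromℚ (convergent w k ℚ.+ r) × fromℚ (convergent w k) ⊑ x + fromℚ r
partialQuotients-close {a} {w} {x} (ha , la) hw k agree =
  ⟨ lim-≤ {λ n → fromℚ (convergent a n)} {x} {fromℚ (convergent w k ℚ.+ r)} la (k , λ n k≤n → un⊑ (fromℚ-⊑
    (∣-∣≤⇒≤ (convergent a n) (convergent w k) (subst (ℚ._≤ r) (∣-∣-comm (convergent w k) (convergent a n))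
      (convergents-close hw ha k agree k n ℕ.≤-refl k≤n))))) ⟩ ,
  ⊑-trans (pw⊑ {fromℚ (convergent w k)} {fromℚ (convergent w k ℚ.- r) + fromℚ r} λ _ → ℚ.≤-reflexive (e (convergent w k) r))
    (+-⊑ ⟨ lim-≥ {λ n → fromℚ (convergent a n)} {x} {fromℚ (convergent w k ℚ.- r)} la (k , λ n k≤n → un⊑ (fromℚ-⊑
      (≤-by (convergent a n ℚ.+ r ℚ.- convergent w k)
        (0≤-diff (∣-∣≤⇒≤ (convergent w k) (convergent a n) (convergents-close hw ha k agree k n ℕ.≤-refl k≤n)))
        (e₂ (convergent w k) (convergent a n) r)))) ⟩ ⊑-refl)
  where
  r = 1/ᵘ (digitProduct w k ℕ.* digitProduct w k)
  e : ∀ t r → t ≡ (t ℚ.- r) ℚ.+ r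
  e = solve-∀ ℚring
  e₂ : ∀ t c r → c ≡ (t ℚ.- r) ℚ.+ (c ℚ.+ r ℚ.- t)
  e₂ = solve-∀ ℚring

-- Infinite continued fractions are irrational: the tail of a rational limit
-- is rational with a smaller denominator.

_⟶ℚ_ : (ℕ → ℚ) → ℚ → Set
v ⟶ℚ q = ∀ ε → 0ℚ ℚ.< ε → Eventually λ n → ℚ.∣ v n ℚ.- q ∣ ℚ.≤ ε

⟶ℚ-≤ : ∀ {v q r} → v ⟶ℚ q → Eventually (λ n → v n ℚ.≤ r) → q ℚ.≤ r
⟶ℚ-≤ {v} {q} {r} lim h = ≤-from-all-ε λ ε 0<ε →
  let (n , a , b) = someEv (zipEv (lim ε 0<ε) h λ _ → _,_) in
  ℚ.≤-trans (∣-∣≤⇒≤ q (v n) (subst (ℚ._≤ ε) (∣-∣-comm (v n) q) a)) (ℚ.+-monoˡ-≤ ε b)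

⟶ℚ-≥ : ∀ {v q r} → v ⟶ℚ q → Eventually (λ n → r ℚ.≤ v n) → r ℚ.≤ q
⟶ℚ-≥ {v} {q} {r} lim h = ≤-from-all-ε λ ε 0<ε →
  let (n , a , b) = someEv (zipEv (lim ε 0<ε) h λ _ → _,_) in
  ℚ.≤-trans b (∣-∣≤⇒≤ (v n) q a)

⟶ℚ-recip : ∀ {v q} L → 1 ℕ.≤ L → v ⟶ℚ q → Eventually (λ n → 1/ᵘ L ℚ.≤ v n) → (λ n → recip (v n)) ⟶ℚ recip q
⟶ℚ-recip {v} {q} L 1≤L lim h ε 0<ε =
  zipEv h (lim (ε ℚ.* (1/ᵘ L ℚ.* 1/ᵘ L)) (0<* {ε} {1/ᵘ L ℚ.* 1/ᵘ L} 0<ε (0<* {1/ᵘ L} {1/ᵘ L} (0<1/ᵘ 1≤L) (0<1/ᵘ 1≤L)))) λ n L≤v close →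
    subst (ℚ._≤ ε) (sym (∣recip-diff∣ (v n) q (0<v L≤v) (0<v L≤q)))
      (subst (ℚ.∣ v n ℚ.- q ∣ ℚ.* (recip (v n) ℚ.* recip q) ℚ.≤_) eq
        (*-mono-≤ {ℚ.∣ v n ℚ.- q ∣} {ε ℚ.* (1/ᵘ L ℚ.* 1/ᵘ L)} {recip (v n) ℚ.* recip q} {ι L ℚ.* ι L}
          (ℚ.0≤∣p∣ (v n ℚ.- q)) (0≤* {recip (v n)} {recip q} (0≤r L≤v) (0≤r L≤q)) close
          (*-mono-≤ {recip (v n)} {ι L} {recip q} {ι L} (0≤r L≤v) (0≤r L≤q) (recip≤ L≤v) (recip≤ L≤q))))
  where
  L≤q = ⟶ℚ-≥ {v} {q} lim h
  0<v : ∀ {p} → 1/ᵘ L ℚ.≤ p → 0ℚ ℚ.< p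
  0<v = ℚ.<-≤-trans (0<1/ᵘ 1≤L)
  0≤r : ∀ {p} → 1/ᵘ L ℚ.≤ p → 0ℚ ℚ.≤ recip p
  0≤r h = ℚ.<⇒≤ (0<recip (0<v h))
  recip≤ : ∀ {p} → 1/ᵘ L ℚ.≤ p → recip p ℚ.≤ ι L
  recip≤ {p} h = subst (recip p ℚ.≤_) (sym (recip-unique (ι L) (0<1/ᵘ 1≤L) (trans (ℚ.*-comm (ι L) (1/ᵘ L)) (1/ᵘ-* 1≤L))))
    (recip-antimono (0<1/ᵘ 1≤L) h)
  e : ∀ ε u l → (ε ℚ.* (u ℚ.* u)) ℚ.* (l ℚ.* l) ≡ ε ℚ.* ((u ℚ.* l) ℚ.* (u ℚ.* l))
  e = solve-∀ ℚring
  eq : (ε ℚ.* (1/ᵘ L ℚ.* 1/ᵘ L)) ℚ.* (ι L ℚ.* ι L) ≡ ε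
  eq = trans (e ε (1/ᵘ L) (ι L)) (trans (cong (λ z → ε ℚ.* (z ℚ.* z)) (1/ᵘ-* 1≤L)) (trans (cong (ε ℚ.*_) (ℚ.*-identityˡ 1ℚ)) (ℚ.*-identityʳ ε)))

recip-recip : ∀ {q} → 0ℚ ℚ.< q → recip (recip q) ≡ q
recip-recip {q} 0<q = sym (recip-unique q (0<recip 0<q) (trans (ℚ.*-comm q (recip q)) (recip-* q 0<q)))

tail-limit : ∀ {a q} → Positive a → convergent a ⟶ℚ q → convergent (tail a) ⟶ℚ (recip q ℚ.- ι (a 1))
tail-limit {a} {q} h lim ε 0<ε =
  let (N , r) = ⟶ℚ-recip {convergent a} {q} (suc (a 1)) (s≤s z≤n) lim (1 , λ { (suc n) _ → 1/ᵘ≤convergent h n }) ε 0<ε in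
  N , λ n N≤n → subst (λ z → ℚ.∣ z ∣ ℚ.≤ ε)
    (trans (cong (ℚ._- recip q) (trans (cong recip (convergent-suc a n)) (recip-recip (0<denominator h n))))
      (e (ι (a 1)) (convergent (tail a) n) (recip q))) (r (suc n) (ℕ.m≤n⇒m≤1+n N≤n))
  where
  e : ∀ a x r → (a ℚ.+ x) ℚ.- r ≡ x ℚ.- (r ℚ.- a)
  e = solve-∀ ℚring

-- The estimate 1/a₁ does not exclude the limit 1 when a₁ = 1; strictness comes from the tail, which
-- is at least 1/(a₂ + 1).
limit<1 : ∀ {a q} → Positive a → convergent a ⟶ℚ q → q ℚ.< 1ℚ
limit<1 {a} {q} h lim = ℚ.≤-<-trans
  (⟶ℚ-≤ {convergent a} {q} lim (2 , λ { (suc (suc n)) (s≤s (s≤s _)) → subst (ℚ._≤ recip D) (sym (convergent-suc a (suc n)))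
    (recip-antimono 0<D (ℚ.+-mono-≤ (subst (ℚ._≤ ι (a 1)) ι1 (ι-mono-≤ (h 1 (s≤s z≤n)))) (1/ᵘ≤convergent (tail-positive h) n))) }))
  (<-by (u ℚ.* recip D) (0<* {u} {recip D} 0<u (0<recip 0<D)) (trans (sym (recip-* D 0<D)) (e (recip D) u)))
  where
  u = 1/ᵘ (suc (a 2))
  0<u : 0ℚ ℚ.< u
  0<u = 0<1/ᵘ (s≤s z≤n)
  D = 1ℚ ℚ.+ u
  0<D : 0ℚ ℚ.< D
  0<D = ℚ.<-≤-trans 0<1 (p≤p+ε 1ℚ (ℚ.<⇒≤ 0<u))
  e : ∀ r u → r ℚ.* (1ℚ ℚ.+ u) ≡ r ℚ.+ u ℚ.* r
  e = solve-∀ ℚring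

fraction : ℕ → ℕ → ℚ
fraction c d = ι c ℚ.* 1/ᵘ d

no-rational-limit : ∀ N c d → d ℕ.≤ N → 1 ℕ.≤ d → ∀ {a} → Positive a → ¬ (convergent a ⟶ℚ fraction c d)
no-rational-limit zero c (suc d) () 1≤d
no-rational-limit (suc N) c d d≤N 1≤d {a} h lim = no-rational-limit N (d ℕ.∸ a 1 ℕ.* c) c (ℕ.≤-pred (ℕ.≤-trans c<d d≤N)) 1≤c (tail-positive h)
  (subst (convergent (tail a) ⟶ℚ_) tail≡ (tail-limit {a} {q} h lim))
  where
  q = fraction c d
  0<q : 0ℚ ℚ.< q
  0<q = ℚ.<-≤-trans (0<1/ᵘ (s≤s z≤n)) (⟶ℚ-≥ {convergent a} {q} lim (1 , λ { (suc n) _ → 1/ᵘ≤convergent h n }))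
  q*d : q ℚ.* ι d ≡ ι c
  q*d = trans (ℚ.*-assoc (ι c) (1/ᵘ d) (ι d)) (trans (cong (ι c ℚ.*_) (1/ᵘ-* 1≤d)) (ℚ.*-identityʳ (ι c)))
  c<d : c ℕ.< d
  c<d = ℕ.≰⇒> λ d≤c → ℚ.<-irrefl refl (ℚ.<-≤-trans (subst₂ ℚ._<_ q*d (ℚ.*-identityˡ (ι d))
    (ℚ.*-monoˡ-<-pos (ι d) {{ℚ.positive (0<ι 1≤d)}} (limit<1 {a} {q} h lim))) (ι-mono-≤ d≤c))
  1≤c : 1 ℕ.≤ c
  1≤c = ℕ.≰⇒> λ c≤0 → ℚ.<-irrefl (sym (trans (cong (λ z → ι z ℚ.* 1/ᵘ d) (ℕ.n≤0⇒n≡0 c≤0)) (trans (cong (ℚ._* 1/ᵘ d) ι0) (ℚ.*-zeroˡ (1/ᵘ d))))) 0<q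
  recip-q : recip q ≡ ι d ℚ.* 1/ᵘ c
  recip-q = sym (recip-unique (ι d ℚ.* 1/ᵘ c) 0<q (trans (e₁ (ι d) (1/ᵘ c) (ι c) (1/ᵘ d))
    (trans (cong₂ ℚ._*_ (1/ᵘ-* 1≤c) (1/ᵘ-* 1≤d)) (ℚ.*-identityˡ 1ℚ))))
    where
    e₁ : ∀ d u c v → (d ℚ.* u) ℚ.* (c ℚ.* v) ≡ (u ℚ.* c) ℚ.* (v ℚ.* d)
    e₁ = solve-∀ ℚring
  ac≤d : a 1 ℕ.* c ℕ.≤ d
  ac≤d = ι-cancel-≤ (subst₂ ℚ._≤_ (sym (ι-* (a 1) c))
    (trans (cong (ℚ._* ι c) recip-q) (trans (ℚ.*-assoc (ι d) (1/ᵘ c) (ι c)) (trans (cong (ι d ℚ.*_) (1/ᵘ-* 1≤c)) (ℚ.*-identityʳ (ι d)))))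
    (*-monoˡ-≤ {ι (a 1)} {recip q} (ι c) (0≤ι c) (≤-by {ι (a 1)} {recip q} (recip q ℚ.- ι (a 1))
      (⟶ℚ-≥ {convergent (tail a)} {recip q ℚ.- ι (a 1)} (tail-limit {a} {q} h lim) (always (0≤convergent (tail-positive h))))
      (e₂ (recip q) (ι (a 1))))))
    where
    e₂ : ∀ r a → r ≡ a ℚ.+ (r ℚ.- a)
    e₂ = solve-∀ ℚring
  tail≡ : recip q ℚ.- ι (a 1) ≡ fraction (d ℕ.∸ a 1 ℕ.* c) c
  tail≡ = trans (cong (ℚ._- ι (a 1)) (trans recip-q (cong (ℚ._* 1/ᵘ c) (trans (cong ι (sym (ℕ.m∸n+n≡m ac≤d)))
      (trans (ι-+ (d ℕ.∸ a 1 ℕ.* c) (a 1 ℕ.* c)) (cong (ι (d ℕ.∸ a 1 ℕ.* c) ℚ.+_) (ι-* (a 1) c)))))))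
    (trans (e₃ (ι (d ℕ.∸ a 1 ℕ.* c)) (ι (a 1)) (ι c) (1/ᵘ c))
      (trans (cong (λ z → ι (d ℕ.∸ a 1 ℕ.* c) ℚ.* 1/ᵘ c ℚ.+ (ι (a 1) ℚ.* z ℚ.- ι (a 1))) (1/ᵘ-* 1≤c))
        (e₄ (ι (d ℕ.∸ a 1 ℕ.* c) ℚ.* 1/ᵘ c) (ι (a 1)))))
    where
    e₃ : ∀ m a c u → (m ℚ.+ a ℚ.* c) ℚ.* u ℚ.- a ≡ m ℚ.* u ℚ.+ (a ℚ.* (u ℚ.* c) ℚ.- a)
    e₃ = solve-∀ ℚring
    e₄ : ∀ m a → m ℚ.+ (a ℚ.* 1ℚ ℚ.- a) ≡ m
    e₄ = solve-∀ ℚring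

nonneg⇒fraction : ∀ q → 0ℚ ℚ.≤ q → ∃[ c ] ∃[ d ] 1 ℕ.≤ d × q ≡ fraction c d
nonneg⇒fraction q@(mkℚ (+ c) d-1 _) _ = c , suc d-1 , s≤s z≤n , trans (sym (ℚ.↥p/↧p≡p q)) (/≡ c (suc d-1))
nonneg⇒fraction (mkℚ (ℤ.-[1+ _ ]) _ _) (ℚ.*≤* ())

irrational : ∀ {a x} → ArePartialQuotients a x → IsIrrational x
irrational {a} {x} (h , lim) q x≈q = no-rational-limit d c d ℕ.≤-refl 1≤d h (subst (convergent a ⟶ℚ_) q≡ limℚ)
  where
  limℚ : convergent a ⟶ℚ q
  limℚ ε 0<ε = mapEv (lim (fromℚ ε) (fromℚ-mono-< 0<ε)) λ n hn →
    fromℚ-cancel-≤ (un⊑ {fromℚ (ℚ.∣ convergent a n ℚ.- q ∣)} {fromℚ ε} (⊑-trans {y = ∣ fromℚ (convergent a n) - x ∣} (≋⇒⊑ ⟪ ∣∣-cong n ⟫) (<⇒⊑ (∣ fromℚ (convergent a n) - x ∣) (fromℚ ε) hn)))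
    where
    ∣∣-cong : ∀ n → fromℚ (ℚ.∣ convergent a n ℚ.- q ∣) ≈ ∣ fromℚ (convergent a n) - x ∣
    ∣∣-cong n = ≤-antisym {fromℚ (ℚ.∣ convergent a n ℚ.- q ∣)} {∣ fromℚ (convergent a n) - x ∣}
      (λ ε 0<ε → mapEv (x≈q ε 0<ε) λ k hk → ℚ.≤-trans (∣-∣-triangle (convergent a n) (seq x k) q) (ℚ.+-monoʳ-≤ ℚ.∣ convergent a n ℚ.- seq x k ∣ (ℚ.<⇒≤ hk)))
      (λ ε 0<ε → mapEv (x≈q ε 0<ε) λ k hk → ℚ.≤-trans (∣-∣-triangle (convergent a n) q (seq x k)) (ℚ.+-monoʳ-≤ ℚ.∣ convergent a n ℚ.- q ∣
         (ℚ.≤-trans (ℚ.≤-reflexive (∣-∣-comm q (seq x k))) (ℚ.<⇒≤ hk))))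
  0≤q : 0ℚ ℚ.≤ q
  0≤q = ⟶ℚ-≥ {convergent a} {q} limℚ (always (0≤convergent h))
  c = proj₁ (nonneg⇒fraction q 0≤q)
  d = proj₁ (proj₂ (nonneg⇒fraction q 0≤q))
  1≤d = proj₁ (proj₂ (proj₂ (nonneg⇒fraction q 0≤q)))
  q≡ = proj₂ (proj₂ (proj₂ (nonneg⇒fraction q 0≤q)))

module FromDigits (a : ℕ → ℕ) (2≤a : ∀ j → 1 ℕ.≤ j → 2 ℕ.≤ a j) where

  positive : Positive a
  positive n 1≤n = ℕ.≤-trans (s≤s z≤n) (2≤a n 1≤n)

  opaque
    -- Digits of at least 2 have products of at least 2^N, so the convergents from index N on lie
    -- within 1/N of each other.
    convergent-cauchy : IsCauchy (convergent a)
    convergent-cauchy ε 0<ε = let (N , 1≤N , h) = archimedean (ε ℚ.* ½) (0<half 0<ε) in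
      N , λ m n N≤m N≤n → ℚ.≤-<-trans
        (ℚ.≤-trans (convergents-close positive positive N (λ _ _ _ → refl) m n N≤m N≤n)
          (ℚ.≤-trans (1/ᵘ-antimono 1≤N (N≤ N)) h)) (half< {ε} 0<ε)
      where
      N≤ : ∀ N → N ℕ.≤ digitProduct a N ℕ.* digitProduct a N
      N≤ N = ℕ.≤-trans (ℕ.<⇒≤ (n<2^n N)) (ℕ.≤-trans (2^≤digitProduct 2≤a N)
        (ℕ.m≤m*n (digitProduct a N) (digitProduct a N) {{ℕ.>-nonZero (1≤digitProduct positive N)}}))

  value : ℝ
  value = mkℝ (convergent a) convergent-cauchy

  partialQuotients : ArePartialQuotients a value
  partialQuotients = positive , cauchy⇒⟶ (convergent a) convergent-cauchy

  0<value : 0ℝ < value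
  0<value = 1/ᵘ (suc (a 1)) , 0<1/ᵘ (s≤s z≤n) , 1 , λ { (suc n) _ →
    subst (ℚ._≤ convergent a (suc n)) (sym (ℚ.+-identityˡ (1/ᵘ (suc (a 1))))) (1/ᵘ≤convergent positive n) }

  value<1 : value < 1ℝ
  value<1 = ½ , 0<½ , 0 , λ n _ → ℚ.+-monoˡ-≤ ½ (ℚ.≤-trans (convergent≤1/ᵘ positive n)
    (subst (1/ᵘ (a 1) ℚ.≤_) (sym ½≡) (1/ᵘ-antimono (s≤s z≤n) (2≤a 1 (s≤s z≤n)))))

  point𝕀 : 𝕀
  point𝕀 = mk𝕀 value (<⇒≤ {0ℝ} {value} 0<value) (<⇒≤ {value} {1ℝ} value<1)

  inJ : IncreasingFrom1 a → point𝕀 ∈ J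
  inJ increasing = 0<value , value<1 , irrational {a} {value} partialQuotients , a , partialQuotients , increasing

-- Intervals of diameter e^{-m}

neg : ℕ → ℝ
neg m = fromℚ (ι m) * fromℚ (ℚ.- 1ℚ)

-- A positive diameter d enters `IsPower` through a real u with exp u = d. For d = e^(-m) that u is
-- -m, so covering sets of these diameters require no logarithm.
width : ℕ → ℝ
width m = Exp (neg m)

Exp1≥2 : fromℚ (ι 2) ⊑ Exp 1ℝ
Exp1≥2 = ⟨ ev≤ {fromℚ (ι 2)} {Exp 1ℝ} (2 , λ n 2≤n → subst (ℚ._≤ expSum n 1ℚ) two (sum-grow (0≤term {1ℚ} 0≤1) {2} {n} 2≤n)) ⟩
  where
  e : ∀ u → (1ℚ ℚ.* 1ℚ) ℚ.* u ≡ u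
  e = solve-∀ ℚring
  two : expSum 2 1ℚ ≡ ι 2
  two = trans (cong₂ ℚ._+_ (trans (ℚ.+-identityˡ (term 1ℚ 0)) (term-zero 1ℚ)) (trans (e (1/ᵘ 1)) 1/ᵘ-one)) (sym (ι-def 2))

expBound : ℕ
expBound = proj₁ (archimedeanℝ (Exp 1ℝ))

neg-suc : ∀ m → neg m ≋ neg (suc m) + 1ℝ
neg-suc m = pw≋ λ _ → trans (e (ι m)) (cong (λ z → z ℚ.* (ℚ.- 1ℚ) ℚ.+ 1ℚ) (sym (ι-suc m)))
  where
  e : ∀ m → m ℚ.* (ℚ.- 1ℚ) ≡ (1ℚ ℚ.+ m) ℚ.* (ℚ.- 1ℚ) ℚ.+ 1ℚ
  e = solve-∀ ℚring

width-suc : ∀ m → width m ≋ width (suc m) * Exp 1ℝ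
width-suc m = ≋-trans (Exp-cong (neg-suc m)) (Exp-+ (neg (suc m)) 1ℝ)

width≤ : ∀ m → width m ⊑ width (suc m) * fromℚ (ι expBound)
width≤ m = ⊑-trans (≋⇒⊑ (width-suc m)) (*-⊑ (Exp-nonneg (neg (suc m))) (fromℚ-⊑ (0≤ι expBound)) ⊑-refl
  ⟨ proj₂ (proj₂ (archimedeanℝ (Exp 1ℝ))) ⟩)

width-halves : ∀ m → width (suc m) ⊑ width m * ½ℝ
width-halves m = ⊑-trans {y = (width (suc m) * fromℚ (ι 2)) * ½ℝ}
  (pw⊑ λ n → ℚ.≤-reflexive (trans (e (seq (width (suc m)) n)) (cong (λ z → (seq (width (suc m)) n ℚ.* z) ℚ.* ½) (sym (ι-def 2)))))
  (*-⊑ {z = ½ℝ} {w = ½ℝ} (*-nonneg⊑ (Exp-nonneg (neg (suc m))) (fromℚ-⊑ (0≤ι 2))) (fromℚ-⊑ 0≤½)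
    (⊑-trans (*-⊑ (Exp-nonneg (neg (suc m))) (Exp-nonneg 1ℝ) ⊑-refl Exp1≥2) (≋⇒⊑ (≋-sym (width-suc m)))) ⊑-refl)
  where
  e : ∀ x → x ≡ (x ℚ.* (+ 2 ℚ./ 1)) ℚ.* ½
  e x = trans (sym (ℚ.*-identityʳ x)) (sym (ℚ.*-assoc x (+ 2 ℚ./ 1) ½))

width-0 : width 0 ≋ 1ℝ
width-0 = Exp-0 {neg 0} (pw≋ λ _ → trans (cong (ℚ._* (ℚ.- 1ℚ)) ι0) refl)

width≤½^ : ∀ m → width m ⊑ fromℚ (½ ^ℚ m)
width≤½^ zero    = ≋⇒⊑ width-0
width≤½^ (suc m) = ⊑-trans (width-halves m)
  (⊑-trans (*-⊑ {z = ½ℝ} {w = ½ℝ} (Exp-nonneg (neg m)) (fromℚ-⊑ 0≤½) (width≤½^ m) ⊑-refl)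
    (pw⊑ λ _ → ℚ.≤-reflexive (ℚ.*-comm (½ ^ℚ m) ½)))

∣-∣⊑ : ∀ {x y d} → x ⊑ y + d → y ⊑ x + d → ∣ x - y ∣ ⊑ d
∣-∣⊑ {x} {y} {d} ⟨ h ⟩ ⟨ k ⟩ = ⟨ (λ ε 0<ε → zipEv (h ε 0<ε) (k ε 0<ε) λ n a b →
  ∣-∣≤ {seq x n} {seq y n} (subst (seq x n ℚ.≤_) (ℚ.+-assoc (seq y n) (seq d n) ε) a)
                           (subst (seq y n ℚ.≤_) (ℚ.+-assoc (seq x n) (seq d n) ε) b)) ⟩

Interval : (lo d : ℝ) → Pred 𝕀 0ℓ
Interval lo d x = lo ≤ point x × point x ≤ lo + d

interval-diameter : ∀ lo d → 0ℝ ⊑ lo → 0ℝ ⊑ d → lo + d ⊑ 1ℝ → IsDiameter (Interval lo d) d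
interval-diameter lo d 0≤lo 0≤d hi≤1 =
  (λ { t (x , y , (lx , ux) , (ly , uy) , ⟪dist⟫) → un⊑ (⊑-trans {t} {dist x y} {d} ⟨ ≈⇒≤ {t} {dist x y} ⟪dist⟫ ⟩
    (∣-∣⊑ {point x} {point y} {d}
      (⊑-trans {point x} {lo + d} {point y + d} ⟨ ux ⟩ (+-⊑ {lo} {point y} {d} {d} ⟨ ly ⟩ ⊑-refl))
      (⊑-trans {point y} {lo + d} {point x + d} ⟨ uy ⟩ (+-⊑ {lo} {point x} {d} {d} ⟨ lx ⟩ ⊑-refl)))) }) ,
  λ b h → un⊑ (⊑-trans {d} {dist hi low} {b}
    (pw⊑ {d} {dist hi low} λ n → subst (ℚ._≤ ℚ.∣ seq lo n ℚ.+ seq d n ℚ.- seq lo n ∣) (e (seq lo n) (seq d n)) (p≤∣p∣ (seq lo n ℚ.+ seq d n ℚ.- seq lo n)))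
    ⟨ h (dist hi low) (hi , low , (un⊑ lo≤hi , ≤-refl {lo + d}) , (≤-refl {lo} , un⊑ lo≤hi) , ≈-refl {dist hi low}) ⟩)
  where
  e : ∀ l d → l ℚ.+ d ℚ.- l ≡ d
  e = solve-∀ ℚring
  lo≤hi : lo ⊑ lo + d
  lo≤hi = ⊑-trans {lo} {lo + 0ℝ} {lo + d} (pw⊑ λ n → ℚ.≤-reflexive (sym (ℚ.+-identityʳ (seq lo n)))) (+-⊑ {lo} {lo} {0ℝ} {d} ⊑-refl 0≤d)
  hi low : 𝕀
  hi = mk𝕀 (lo + d) (un⊑ (⊑-trans 0≤lo lo≤hi)) (un⊑ hi≤1)
  low = mk𝕀 lo (un⊑ 0≤lo) (un⊑ (⊑-trans lo≤hi hi≤1))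

module SmallIntervals (em : ∀ ℓ → ExcludedMiddle ℓ) where
  open Classical em

  last-above : ∀ (P : ℕ → Set) → P 0 → ∀ M → ¬ P M → ∃[ m ] P m × ¬ P (suc m)
  last-above P p₀ zero    ¬p = ⊥-elim (¬p p₀)
  last-above P p₀ (suc M) ¬p with em 0ℓ {P M}
  ... | yes p = M , p , ¬p
  ... | no ¬p′ = last-above P p₀ M ¬p′

  -- For the last m with r ≤ e^(-m) one has e^(-(m+1)) < r, and going back one step costs the factor
  -- e ≤ `expBound`.
  choose-width : ∀ r → 0ℚ ℚ.< r → r ℚ.≤ 1ℚ → ∃[ m ] fromℚ r ⊑ width m × width m ⊑ fromℚ (r ℚ.* ι expBound)
  choose-width r 0<r r≤1 =
    let (M , h) = ½^-small 1ℚ (r ℚ.* ½) (0<half 0<r)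
        ½^M<r : ½ ^ℚ M ℚ.< r
        ½^M<r = ℚ.≤-<-trans (subst (ℚ._≤ r ℚ.* ½) (ℚ.*-identityˡ (½ ^ℚ M)) (h M ℕ.≤-refl)) (half< {r} 0<r)
        (m , yes-m , no-m) = last-above (λ m → fromℚ r ≤ width m)
          (un⊑ (⊑-trans {fromℚ r} {1ℝ} {width 0} (fromℚ-⊑ r≤1) (≋⇒⊑ (≋-sym width-0))))
          M (λ bad → ℚ.<-irrefl refl (ℚ.<-≤-trans ½^M<r (fromℚ-cancel-≤ (un⊑ (⊑-trans {fromℚ r} {width M} {fromℚ (½ ^ℚ M)} ⟨ bad ⟩ (width≤½^ M))))))
        below : width (suc m) ⊑ fromℚ r
        below = [_,_]′ (λ le → ⊥-elim (no-m le)) (<⇒⊑ (width (suc m)) (fromℚ r)) (≤⊎< (fromℚ r) (width (suc m)))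
    in m , ⟨ yes-m ⟩ , ⊑-trans (width≤ m) (⊑-trans {y = fromℚ r * fromℚ (ι expBound)}
         (*-⊑ {z = fromℚ (ι expBound)} {w = fromℚ (ι expBound)} (Exp-nonneg (neg (suc m))) (fromℚ-⊑ (0≤ι expBound)) below ⊑-refl)
         (pw⊑ λ _ → ℚ.≤-refl))

  -- The diameter is exactly d only if the interval lies in [0,1]; when t + d exceeds 1 it is moved
  -- left to [1 - d, 1], which loses no point of [0,1].
  place : ∀ t d → 0ℝ ⊑ t → 0ℝ ⊑ d → d ⊑ 1ℝ →
    ∃[ lo ] 0ℝ ⊑ lo × lo + d ⊑ 1ℝ × (∀ x → t ⊑ point x → point x ⊑ t + d → x ∈ Interval lo d)
  place t d 0≤t 0≤d d≤1 = [_,_]′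
    (λ le → t , 0≤t , ⟨ le ⟩ , λ x h k → un⊑ h , un⊑ k)
    (λ 1<t+d → 1ℝ - d , ⟨ 0≤-diffℝ {d} {1ℝ} (un⊑ d≤1) ⟩ ,
      pw⊑ (λ n → ℚ.≤-reflexive (e (seq d n))) ,
      λ x h k → un⊑ (⊑-trans {1ℝ - d} {t} {point x} ⟨ ≤-shift {1ℝ} {d} {t} (un⊑ (⊑-trans {1ℝ} {t + d} {d + t} (<⇒⊑ 1ℝ (t + d) 1<t+d)
                  (pw⊑ λ n → ℚ.≤-reflexive (ℚ.+-comm (seq t n) (seq d n))))) ⟩ h) ,
                un⊑ (⊑-trans {point x} {1ℝ} {(1ℝ - d) + d} ⟨ point≤1 x ⟩ (pw⊑ λ n → ℚ.≤-reflexive (sym (e (seq d n))))))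
    (≤⊎< (t + d) 1ℝ)
    where
    e : ∀ d → (1ℚ ℚ.- d) ℚ.+ d ≡ 1ℚ
    e = solve-∀ ℚring

-- Comparison through integer powers

^ℚ-mono : ∀ {x y} k → 0ℚ ℚ.≤ x → x ℚ.≤ y → x ^ℚ k ℚ.≤ y ^ℚ k
^ℚ-mono zero    0≤x x≤y = ℚ.≤-refl
^ℚ-mono {x} {y} (suc k) 0≤x x≤y = *-mono-≤ {x} {y} {x ^ℚ k} {y ^ℚ k} 0≤x (0≤^ℚ k 0≤x) x≤y (^ℚ-mono k 0≤x x≤y)

0<^ℚ : ∀ {x} k → 0ℚ ℚ.< x → 0ℚ ℚ.< x ^ℚ k
0<^ℚ zero    h = 0<1
0<^ℚ {x} (suc k) h = 0<* {x} {x ^ℚ k} h (0<^ℚ k h)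

^ℚ-mono-< : ∀ {x y} k → 0ℚ ℚ.≤ x → x ℚ.< y → x ^ℚ suc k ℚ.< y ^ℚ suc k
^ℚ-mono-< {x} {y} k 0≤x x<y = ℚ.≤-<-trans
  (*-monoʳ-≤ {x ^ℚ k} {y ^ℚ k} x 0≤x (^ℚ-mono k 0≤x (ℚ.<⇒≤ x<y)))
  (ℚ.*-monoˡ-<-pos (y ^ℚ k) {{ℚ.positive (0<^ℚ k (ℚ.≤-<-trans 0≤x x<y))}} x<y)

fromℚ-^ : ∀ r k → fromℚ r ^ k ≋ fromℚ (r ^ℚ k)
fromℚ-^ r k = pw≋ λ n → seq-^ (fromℚ r) k n

root-⊑ : ∀ {x v} k → 0ℚ ℚ.≤ v → x ^ suc k ⊑ fromℚ (v ^ℚ suc k) → x ⊑ fromℚ v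
root-⊑ {x} {v} k 0≤v h = ⟨ ≮⇒≥ {fromℚ v} {x} (λ v<x →
  let (r , v<r , r<x) = dense {fromℚ v} {x} v<x
      v<r′ = fromℚ-cancel-< {v} {r} v<r
  in ℚ.<-irrefl refl (ℚ.<-≤-trans (^ℚ-mono-< k 0≤v v<r′) (fromℚ-cancel-≤ (un⊑
       (⊑-trans {fromℚ (r ^ℚ suc k)} {fromℚ r ^ suc k} {fromℚ (v ^ℚ suc k)} (≋⇒⊑ (≋-sym (fromℚ-^ r (suc k))))
         (⊑-trans (^-mono (suc k) (fromℚ-⊑ (ℚ.≤-trans 0≤v (ℚ.<⇒≤ v<r′))) (<⇒⊑ (fromℚ r) x r<x)) h)))))) ⟩

-- Enumeration of ℕ × ℕ along antidiagonals

next : ℕ × ℕ → ℕ × ℕ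
next (i , zero)  = zero , suc i
next (i , suc j) = suc i , j

unpair : ℕ → ℕ × ℕ
unpair zero    = 0 , 0
unpair (suc k) = next (unpair k)

walk : ∀ m {i j} k → unpair k ≡ (i , m ℕ.+ j) → unpair (m ℕ.+ k) ≡ (m ℕ.+ i , j)
walk zero    k eq = eq
walk (suc m) {i} {j} k eq = subst₂ (λ x y → unpair x ≡ (y , j)) (ℕ.+-suc m k) (ℕ.+-suc m i)
  (walk m (suc k) (cong next eq))

triangle : ℕ → ℕ
triangle zero    = 0
triangle (suc d) = suc (d ℕ.+ triangle d)

unpair-triangle : ∀ d → unpair (triangle d) ≡ (0 , d)
unpair-triangle zero    = refl
unpair-triangle (suc d) = cong next (trans
  (walk d {0} {0} (triangle d) (trans (unpair-triangle d) (cong (0 ,_) (sym (ℕ.+-identityʳ d)))))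
  (cong (_, 0) (ℕ.+-identityʳ d)))

unpair-surjective : ∀ i j → ∃[ k ] unpair k ≡ (i , j)
unpair-surjective i j = i ℕ.+ triangle (i ℕ.+ j) ,
  trans (walk i (triangle (i ℕ.+ j)) (unpair-triangle (i ℕ.+ j))) (cong (_, j) (ℕ.+-identityʳ i))

n≤triangle : ∀ n → n ℕ.≤ triangle n
n≤triangle zero    = z≤n
n≤triangle (suc n) = s≤s (ℕ.m≤m+n n (triangle n))

antidiagonal : (ℕ → ℕ → ℚ) → ℕ → ℚ
antidiagonal f zero    = f 0 0
antidiagonal f (suc d) = f 0 (suc d) ℚ.+ antidiagonal (f ∘ suc) d

flatten : (ℕ → ℕ → ℚ) → ℕ → ℚ
flatten f k = f (proj₁ (unpair k)) (proj₂ (unpair k))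

sum-walk : ∀ f g j i k → unpair k ≡ (i , j) → (∀ a b → g a b ≡ f (a ℕ.+ i) b) →
  sum (flatten f) (suc j ℕ.+ k) ≡ sum (flatten f) k ℚ.+ antidiagonal g j
sum-walk f g zero i k eq h = cong (sum (flatten f) k ℚ.+_) (trans (cong (λ z → f (proj₁ z) (proj₂ z)) eq) (sym (h 0 0)))
sum-walk f g (suc j) i k eq h = trans (cong (sum (flatten f)) (sym (ℕ.+-suc (suc j) k)))
  (trans (sum-walk f (g ∘ suc) j (suc i) (suc k) (cong next eq) (λ a b → trans (h (suc a) b) (cong (λ z → f z b) (sym (ℕ.+-suc a i)))))
    (trans (ℚ.+-assoc (sum (flatten f) k) (flatten f k) (antidiagonal (g ∘ suc) j))
      (cong (λ z → sum (flatten f) k ℚ.+ (z ℚ.+ antidiagonal (g ∘ suc) j))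
        (trans (cong (λ z → f (proj₁ z) (proj₂ z)) eq) (sym (h 0 (suc j)))))))

sum-triangle : ∀ f d → sum (flatten f) (triangle d) ≡ sum (antidiagonal f) d
sum-triangle f zero    = refl
sum-triangle f (suc d) = trans (sum-walk f f d 0 (triangle d) (unpair-triangle d) (λ a b → cong (λ z → f z b) (sym (ℕ.+-identityʳ a))))
  (cong (ℚ._+ antidiagonal f d) (sum-triangle f d))

sum-antidiagonal-shift : ∀ f d → sum (antidiagonal f) (suc d) ≡ sum (f 0) (suc d) ℚ.+ sum (antidiagonal (f ∘ suc)) d
sum-antidiagonal-shift f zero    = sym (ℚ.+-identityʳ (0ℚ ℚ.+ f 0 0))
sum-antidiagonal-shift f (suc d) = trans (cong (ℚ._+ (f 0 (suc d) ℚ.+ antidiagonal (f ∘ suc) d)) (sum-antidiagonal-shift f d))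
  (e (sum (f 0) (suc d)) (sum (antidiagonal (f ∘ suc)) d) (f 0 (suc d)) (antidiagonal (f ∘ suc) d))
  where
  e : ∀ a b c d → (a ℚ.+ b) ℚ.+ (c ℚ.+ d) ≡ (a ℚ.+ c) ℚ.+ (b ℚ.+ d)
  e = solve-∀ ℚring

sum-antidiagonal≤ : ∀ f (E : ℕ → ℚ) → (∀ i n → sum (f i) n ℚ.≤ E i) → ∀ d → sum (antidiagonal f) d ℚ.≤ sum E d
sum-antidiagonal≤ f E h zero    = ℚ.≤-refl
sum-antidiagonal≤ f E h (suc d) = subst₂ ℚ._≤_ (sym (sum-antidiagonal-shift f d)) (sym (sum-shift E d))
  (ℚ.+-mono-≤ (h 0 (suc d)) (sum-antidiagonal≤ (f ∘ suc) (E ∘ suc) (λ i → h (suc i)) d))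

-- As n ≤ triangle n, the first n pairs lie on the first n antidiagonals, and these meet only the
-- first n rows.
sum-flatten≤ : ∀ f (E : ℕ → ℚ) → (∀ i j → 0ℚ ℚ.≤ f i j) → (∀ i n → sum (f i) n ℚ.≤ E i) → ∀ n → sum (flatten f) n ℚ.≤ sum E n
sum-flatten≤ f E 0≤f h n = ℚ.≤-trans (sum-grow {flatten f} (λ k → 0≤f (proj₁ (unpair k)) (proj₂ (unpair k))) (n≤triangle n))
  (ℚ.≤-trans (ℚ.≤-reflexive (sum-triangle f n)) (sum-antidiagonal≤ f E h n))

-- Covers with small s-dimensional cost

ι-^ : ∀ m k → ι m ^ℚ k ≡ ι (m ℕ.^ k)
ι-^ m zero    = sym ι1
ι-^ m (suc k) = trans (cong (ι m ℚ.*_) (ι-^ m k)) (sym (ι-* m (m ℕ.^ k)))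

*-^ℚ : ∀ x y k → (x ℚ.* y) ^ℚ k ≡ x ^ℚ k ℚ.* y ^ℚ k
*-^ℚ x y zero    = refl
*-^ℚ x y (suc k) = trans (cong ((x ℚ.* y) ℚ.*_) (*-^ℚ x y k)) (e x y (x ^ℚ k) (y ^ℚ k))
  where
  e : ∀ a b c d → (a ℚ.* b) ℚ.* (c ℚ.* d) ≡ (a ℚ.* c) ℚ.* (b ℚ.* d)
  e = solve-∀ ℚring

once : ℚ → ℕ → ℚ
once x zero    = x
once x (suc _) = 0ℚ

empty-sum : ∀ n → sum (λ _ → 0ℚ) n ≡ 0ℚ
empty-sum zero    = refl
empty-sum (suc n) = cong (ℚ._+ 0ℚ) (empty-sum n)

module Covers (em : ∀ ℓ → ExcludedMiddle ℓ) (p q-1 : ℕ) (δ : ℝ) (δ₀ : ℚ) (δ₀≤δ : fromℚ δ₀ ⊑ δ) where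
  open SmallIntervals em
  open Classical em

  q : ℕ
  q = suc q-1

  s : ℝ
  s = fromℚ (fraction p q)

  -- Each real cost travels with a rational bound, so that countable unions reduce to rational sums;
  -- a real infinite sum is formed only in `cov⇒CoverSum`. The budget 1/E has an integer E, which is
  -- multiplied by a weight when the budget is shared among parts.
  record Cov (A : Pred 𝕀 0ℓ) (E : ℕ) : Set₁ where
    field
      set     : ℕ → Pred 𝕀 0ℓ
      cost    : ℕ → ℝ
      bound   : ℕ → ℚ
      covers  : A ⊆ ⋃ ℕ set
      isTerm  : ∀ i → IsTerm s δ (set i) (cost i)
      0≤cost  : ∀ i → 0ℝ ⊑ cost i
      cost≤   : ∀ i → cost i ⊑ fromℚ (bound i)
      0≤bound : ∀ i → 0ℚ ℚ.≤ bound i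
      total≤  : ∀ n → sum bound n ℚ.≤ 1/ᵘ E
  open Cov

  cov-empty : ∀ {A} E → Empty A → Cov A E
  cov-empty E none = record
    { set = λ _ _ → ⊥ ; cost = λ _ → 0ℝ ; bound = λ _ → 0ℚ
    ; covers = λ {x} x∈A → ⊥-elim (none x x∈A)
    ; isTerm = λ _ → inj₁ ((λ _ ()) , ≈-refl {0ℝ})
    ; 0≤cost = λ _ → ⊑-refl ; cost≤ = λ _ → ⊑-refl ; 0≤bound = λ _ → ℚ.≤-refl
    ; total≤ = λ n → subst (ℚ._≤ 1/ᵘ E) (sym (empty-sum n)) (0≤1/ᵘ E) }

  cov-union : ∀ {A E} (A′ : ℕ → Pred 𝕀 0ℓ) (ρ : ℕ → ℕ) → 1 ℕ.≤ E → (∀ i → 1 ℕ.≤ ρ i) →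
    (∀ n → sum (1/ᵘ ∘ ρ) n ℚ.≤ 1ℚ) → A ⊆ ⋃ ℕ A′ → (∀ i → Cov (A′ i) (E ℕ.* ρ i)) → Cov A E
  cov-union {A} {E} A′ ρ 1≤E 1≤ρ Σρ≤1 A⊆ C = record
    { set = λ k → set (C (proj₁ (unpair k))) (proj₂ (unpair k))
    ; cost = λ k → cost (C (proj₁ (unpair k))) (proj₂ (unpair k))
    ; bound = flatten (λ i → bound (C i))
    ; covers = λ {x} x∈A → let (i , x∈Ai) = A⊆ x∈A
                               (j , x∈U) = covers (C i) x∈Ai
                               (k , eq) = unpair-surjective i j
                           in k , subst (λ z → x ∈ set (C (proj₁ z)) (proj₂ z)) (sym eq) x∈U
    ; isTerm = λ k → isTerm (C (proj₁ (unpair k))) (proj₂ (unpair k))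
    ; 0≤cost = λ k → 0≤cost (C (proj₁ (unpair k))) (proj₂ (unpair k))
    ; cost≤ = λ k → cost≤ (C (proj₁ (unpair k))) (proj₂ (unpair k))
    ; 0≤bound = λ k → 0≤bound (C (proj₁ (unpair k))) (proj₂ (unpair k))
    ; total≤ = λ n → ℚ.≤-trans (sum-flatten≤ (λ i → bound (C i)) (λ i → 1/ᵘ (E ℕ.* ρ i)) (λ i → 0≤bound (C i)) (λ i → total≤ (C i)) n)
        (subst₂ ℚ._≤_ (trans (sym (sum-scale (1/ᵘ E) (1/ᵘ ∘ ρ) n)) (sum-cong n λ i → sym (1/ᵘ-mul 1≤E (1≤ρ i))))
          (ℚ.*-identityʳ (1/ᵘ E)) (*-monoʳ-≤ (1/ᵘ E) (0≤1/ᵘ E) (Σρ≤1 n))) }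

  -- Since q (s u) = p u, the cost e^(su) can be compared with rationals by means of integer powers
  -- only.
  cost-power : ∀ u → Exp (s * u) ^ q ≋ Exp u ^ p
  cost-power u = ≋-trans (≋-sym (Exp-ι* q (s * u))) (≋-trans
    (Exp-cong {fromℚ (ι q) * (s * u)} {fromℚ (ι p) * u} (pw≋ λ n → trans (e (ι q) (ι p) (1/ᵘ q) (seq u n))
      (trans (cong (ℚ._* (ι p ℚ.* seq u n)) (1/ᵘ-* {q} (s≤s z≤n))) (ℚ.*-identityˡ (ι p ℚ.* seq u n)))))
    (Exp-ι* p u))
    where
    e : ∀ q p v u → q ℚ.* ((p ℚ.* v) ℚ.* u) ≡ (v ℚ.* q) ℚ.* (p ℚ.* u)
    e = solve-∀ ℚring

  cov-interval : ∀ {A} t r E → 0ℚ ℚ.≤ t → 0ℚ ℚ.< r → r ℚ.≤ 1ℚ → r ℚ.* ι expBound ℚ.≤ δ₀ →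
    (r ℚ.* ι expBound) ^ℚ p ℚ.≤ 1/ᵘ E ^ℚ q →
    (∀ x → x ∈ A → fromℚ t ⊑ point x × point x ⊑ fromℚ (t ℚ.+ r)) → Cov A E
  cov-interval {A} t r E 0≤t 0<r r≤1 rK≤δ small A⊆ =
    let (m , r≤w , w≤rK) = choose-width r 0<r r≤1
        u = neg m
        c = Exp (s * u)
        0≤w = Exp-nonneg u
        w≤1 = ⊑-trans (width≤½^ m) (fromℚ-⊑ (½^≤1 m))
        (lo , 0≤lo , hi≤1 , contains) = place (fromℚ t) (Exp u) (fromℚ-⊑ 0≤t) 0≤w w≤1
        c^q≤ : c ^ q ⊑ fromℚ (1/ᵘ E ^ℚ q)
        c^q≤ = ⊑-trans (≋⇒⊑ (cost-power u)) (⊑-trans (^-mono p 0≤w w≤rK)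
                 (⊑-trans (≋⇒⊑ (fromℚ-^ (r ℚ.* ι expBound) p)) (fromℚ-⊑ small)))
        c≤ : c ⊑ fromℚ (1/ᵘ E)
        c≤ = root-⊑ q-1 (0≤1/ᵘ E) c^q≤
    in record
      { set = λ { zero → Interval lo (Exp u) ; (suc _) → λ _ → ⊥ }
      ; cost = λ { zero → c ; (suc _) → 0ℝ }
      ; bound = once (1/ᵘ E)
      ; covers = λ {x} x∈A → 0 , contains x (proj₁ (A⊆ x x∈A))
          (⊑-trans (proj₂ (A⊆ x x∈A)) (⊑-trans {y = fromℚ t + fromℚ r} (pw⊑ λ _ → ℚ.≤-refl) (+-⊑ {fromℚ t} {fromℚ t} ⊑-refl r≤w)))
      ; isTerm = λ { zero → inj₂ (Exp u , interval-diameter lo (Exp u) 0≤lo 0≤w hi≤1 ,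
                       un⊑ (⊑-trans w≤rK (⊑-trans (fromℚ-⊑ rK≤δ) δ₀≤δ)) ,
                       inj₂ (inj₂ (u , Exp-isExp u , Exp-isExp (s * u))))
                   ; (suc _) → inj₁ ((λ _ ()) , ≈-refl {0ℝ}) }
      ; 0≤cost = λ { zero → Exp-nonneg (s * u) ; (suc _) → ⊑-refl }
      ; cost≤ = λ { zero → c≤ ; (suc _) → ⊑-refl }
      ; 0≤bound = λ { zero → 0≤1/ᵘ E ; (suc _) → ℚ.≤-refl }
      ; total≤ = λ n → total n }
    where
    ½^≤1 : ∀ m → ½ ^ℚ m ℚ.≤ 1ℚ
    ½^≤1 m = subst₂ ℚ._≤_ (sym (½^ m)) 1/ᵘ-one (1/ᵘ-antimono (s≤s z≤n) (1≤^ {2} m (s≤s z≤n)))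
    f : ℕ → ℚ
    f = once (1/ᵘ E)
    total : ∀ n → sum f n ℚ.≤ 1/ᵘ E
    total zero    = 0≤1/ᵘ E
    total (suc n) = ℚ.≤-reflexive (trans (sum-shift f n) (trans (cong (1/ᵘ E ℚ.+_) (empty-sum n)) (ℚ.+-identityʳ (1/ᵘ E))))

  -- A cylinder within 1/n of its centre needs length 2/n, and rounding this length up to some
  -- e^(-m) costs the factor `expBound`; `c₀` is the p-th power of that total loss.
  c₀ : ℕ
  c₀ = (2 ℕ.* expBound) ℕ.^ p

  cov-cylinder : ∀ {A} t₀ n E → 0ℚ ℚ.≤ t₀ → 2 ℕ.≤ n → 1 ℕ.≤ E → ι (2 ℕ.* expBound) ℚ.* 1/ᵘ n ℚ.≤ δ₀ → c₀ ℕ.* E ℕ.^ q ℕ.≤ n ℕ.^ p →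
    (∀ x → x ∈ A → point x ⊑ fromℚ (t₀ ℚ.+ 1/ᵘ n) × fromℚ t₀ ⊑ point x + fromℚ (1/ᵘ n)) → Cov A E
  cov-cylinder {A} t₀ n E 0≤t₀ 2≤n 1≤E fine small A⊆ = cov-interval t r E 0≤t 0<r r≤1
    (subst (ℚ._≤ δ₀) (sym rK≡) fine)
    (subst₂ ℚ._≤_ (sym (trans (cong (_^ℚ p) rK≡) (trans (*-^ℚ (ι (2 ℕ.* expBound)) u p) (cong₂ ℚ._*_ (ι-^ (2 ℕ.* expBound) p) (1/ᵘ-^ n p 1≤n)))))
      (trans (cong (ℚ._* 1/ᵘ (E ℕ.^ q)) ι1) (trans (ℚ.*-identityˡ (1/ᵘ (E ℕ.^ q))) (sym (1/ᵘ-^ E q 1≤E))))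
      (frac-≤ {c₀} {n ℕ.^ p} {1} {E ℕ.^ q} (1≤^ p 1≤n) (1≤^ q 1≤E) (ℕ.≤-trans small (ℕ.≤-reflexive (sym (ℕ.*-identityˡ (n ℕ.^ p)))))))
    λ x x∈A → lower x (proj₂ (A⊆ x x∈A)) , upper x (proj₁ (A⊆ x x∈A))
    where
    1≤n = ℕ.≤-trans (s≤s z≤n) 2≤n
    u r t : ℚ
    u = 1/ᵘ n
    r = u ℚ.+ u
    -- The left end is cut off at 0 because the covering interval has to lie in [0,1].
    t = 0ℚ ℚ.⊔ (t₀ ℚ.- u)
    0≤t : 0ℚ ℚ.≤ t
    0≤t = ℚ.p≤p⊔q 0ℚ (t₀ ℚ.- u)
    0<u : 0ℚ ℚ.< u
    0<u = 0<1/ᵘ 1≤n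
    0<r : 0ℚ ℚ.< r
    0<r = ℚ.<-≤-trans 0<u (p≤p+ε u (ℚ.<⇒≤ 0<u))
    u≤½ : u ℚ.≤ ½
    u≤½ = subst (u ℚ.≤_) (sym ½≡) (1/ᵘ-antimono (s≤s z≤n) 2≤n)
    r≤1 : r ℚ.≤ 1ℚ
    r≤1 = ℚ.+-mono-≤ u≤½ u≤½
    e₁ : ∀ u k → (u ℚ.+ u) ℚ.* k ≡ ((1ℚ ℚ.+ 1ℚ) ℚ.* k) ℚ.* u
    e₁ = solve-∀ ℚring
    rK≡ : r ℚ.* ι expBound ≡ ι (2 ℕ.* expBound) ℚ.* u
    rK≡ = trans (e₁ u (ι expBound)) (cong (ℚ._* u) (trans (cong (ℚ._* ι expBound) (sym (ι-def 2))) (sym (ι-* 2 expBound))))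
    e₂ : ∀ t u → t ℚ.+ u ≡ (t ℚ.- u) ℚ.+ (u ℚ.+ u)
    e₂ = solve-∀ ℚring
    e₃ : ∀ t u ε x → x ℚ.+ ε ≡ (t ℚ.- u) ℚ.+ (((x ℚ.+ u) ℚ.+ ε) ℚ.- t)
    e₃ = solve-∀ ℚring
    upper : ∀ x → point x ⊑ fromℚ (t₀ ℚ.+ u) → point x ⊑ fromℚ (t ℚ.+ r)
    upper x h = ⊑-trans h (fromℚ-⊑ (ℚ.≤-trans (ℚ.≤-reflexive (e₂ t₀ u)) (ℚ.+-monoˡ-≤ r (ℚ.p≤q⊔p 0ℚ (t₀ ℚ.- u)))))
    lower : ∀ x → fromℚ t₀ ⊑ point x + fromℚ u → fromℚ t ⊑ point x
    lower x ⟨ h ⟩ = [_,_]′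
      (λ eq → subst (λ z → fromℚ z ⊑ point x) (sym eq) ⟨ 0≤point x ⟩)
      (λ eq → subst (λ z → fromℚ z ⊑ point x) (sym eq)
        ⟨ (λ ε 0<ε → mapEv (h ε 0<ε) λ k a → ≤-by (((seq (point x) k ℚ.+ u) ℚ.+ ε) ℚ.- t₀) (0≤-diff a) (e₃ t₀ u ε (seq (point x) k))) ⟩)
      (ℚ.⊔-sel 0ℚ (t₀ ℚ.- u))

  cov⇒CoverSum : ∀ {A E} → Cov A E → ∃[ t ] CoverSum s δ A (fin t) × t ⊑ fromℚ (1/ᵘ E)
  cov⇒CoverSum {A} {E} C = limit , (set C , cost C , covers C , isTerm C , isSup) , ⟨ sup-least (fromℚ (1/ᵘ E)) (λ n → un⊑ (bounded-sum n)) ⟩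
    where
    partial≤ : ∀ n → partialSum (cost C) n ⊑ fromℚ (sum (bound C) n)
    partial≤ zero    = ⊑-refl
    partial≤ (suc n) = ⊑-trans (+-⊑ (partial≤ n) (cost≤ C n)) (pw⊑ {y = fromℚ (sum (bound C) (suc n))} λ _ → ℚ.≤-refl)
    bounded-sum : ∀ n → partialSum (cost C) n ⊑ fromℚ (1/ᵘ E)
    bounded-sum n = ⊑-trans (partial≤ n) (fromℚ-⊑ (total≤ C n))
    increasing : ∀ n → partialSum (cost C) n ⊑ partialSum (cost C) (suc n)
    increasing n = ⊑-trans {y = partialSum (cost C) n + 0ℝ} (pw⊑ λ k → ℚ.≤-reflexive (sym (ℚ.+-identityʳ (seq (partialSum (cost C) n) k))))
      (+-⊑ {partialSum (cost C) n} ⊑-refl (0≤cost C n))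
    open MonotoneSup em (partialSum (cost C)) (λ n → un⊑ (increasing n)) (fromℚ (1/ᵘ E)) (λ n → un⊑ (bounded-sum n))
    least : ∀ b → (∀ t → (∃[ n ] t ≡ fin (partialSum (cost C) n)) → t ≤∞ b) → fin limit ≤∞ b
    least (fin y) h = fin≤fin (sup-least y λ n → fin≤ (h _ (n , refl)))
      where
      fin≤ : ∀ {x y} → fin x ≤∞ fin y → x ≤ y
      fin≤ (fin≤fin h) = h
    least ∞ h = ≤-top
    isSup : IsSup _≤∞_ (λ r → ∃[ n ] r ≡ fin (partialSum (cost C) n)) (fin limit)
    isSup = (λ { _ (n , refl) → fin≤fin (sup-upper n) }) , least

small⇒≤0 : ∀ {x} → (∀ E → 1 ℕ.≤ E → x ⊑ fromℚ (1/ᵘ E)) → x ≤ 0ℝ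
small⇒≤0 {x} h = ≤-all-ε {x} {0ℝ} λ ε 0<ε → let (E , 1≤E , small) = archimedean ε 0<ε in
  un⊑ (⊑-trans {x} {fromℚ (1/ᵘ E)} {0ℝ + fromℚ ε} (h E 1≤E) (pw⊑ λ _ → ℚ.≤-trans small (ℚ.≤-reflexive (sym (ℚ.+-identityˡ ε)))))

cheap-covers⇒null : ∀ {A} s →
  (∀ δ → 0ℝ < δ → ∀ E → 1 ℕ.≤ E → ∃[ t ] CoverSum s δ A (fin t) × t ⊑ fromℚ (1/ᵘ E)) → IsHausdorffMeasure s A (fin 0ℝ)
cheap-covers⇒null {A} s cheap =
  (λ { t (δ , 0<δ , below , _) → bounded-by t δ 0<δ below }) ,
  -- The premeasure for δ = 1 is exactly 0: every cover sum is at least its empty partial sum. Hence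
  -- every upper bound of the premeasures is at least 0.
  λ b h → h (fin 0ℝ) (1ℝ , fromℚ-mono-< 0<1 , (λ { t (_ , _ , _ , _ , upper , _) → upper (fin 0ℝ) (0 , refl) }) ,
                      λ b′ below → bounded-by b′ 1ℝ (fromℚ-mono-< 0<1) below)
  where
  bounded-by : ∀ t δ → 0ℝ < δ → (∀ t′ → t′ ∈ CoverSum s δ A → t ≤∞ t′) → t ≤∞ fin 0ℝ
  bounded-by ∞ δ 0<δ below with below _ (proj₁ (proj₂ (cheap δ 0<δ 1 (s≤s z≤n))))
  ... | ()
  bounded-by (fin x) δ 0<δ below = fin≤fin (small⇒≤0 λ E 1≤E →
    let (t , isCover , t≤) = cheap δ 0<δ E 1≤E in ⊑-trans (lower (below (fin t) isCover)) t≤)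
    where
    lower : ∀ {t} → fin x ≤∞ fin t → x ⊑ t
    lower (fin≤fin h) = ⟨ h ⟩

-- Summable digit weights

-- dyadic i = (l , r) with suc i = 2^l + r and r < 2^l.
dyadic-step : ∀ l r → Dec (suc r ℕ.< 2 ℕ.^ l) → ℕ × ℕ
dyadic-step l r (yes _) = l , suc r
dyadic-step l r (no _)  = suc l , 0

dyadic : ℕ → ℕ × ℕ
dyadic zero    = 0 , 0
dyadic (suc i) = dyadic-step (proj₁ (dyadic i)) (proj₂ (dyadic i)) (_ ℕ.<? _)

level : ℕ → ℕ
level i = proj₁ (dyadic i)

dyadic-spec : ∀ i → suc i ≡ 2 ℕ.^ level i ℕ.+ proj₂ (dyadic i) × proj₂ (dyadic i) ℕ.< 2 ℕ.^ level i
dyadic-spec zero    = refl , s≤s z≤n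
dyadic-spec (suc i) = go (level i) (proj₂ (dyadic i)) (dyadic-spec i) (_ ℕ.<? _)
  where
  go : ∀ l r → suc i ≡ 2 ℕ.^ l ℕ.+ r × r ℕ.< 2 ℕ.^ l → (d : Dec (suc r ℕ.< 2 ℕ.^ l)) →
    suc (suc i) ≡ 2 ℕ.^ proj₁ (dyadic-step l r d) ℕ.+ proj₂ (dyadic-step l r d) × proj₂ (dyadic-step l r d) ℕ.< 2 ℕ.^ proj₁ (dyadic-step l r d)
  go l r (eq , _) (yes lt) = trans (cong suc eq) (sym (ℕ.+-suc (2 ℕ.^ l) r)) , lt
  go l r (eq , r<) (no ¬lt) = trans (cong suc eq) (trans (sym (ℕ.+-suc (2 ℕ.^ l) r))
    (trans (cong (2 ℕ.^ l ℕ.+_) (ℕ.≤-antisym r< (ℕ.≮⇒≥ ¬lt)))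
      (trans (cong (2 ℕ.^ l ℕ.+_) (sym (ℕ.+-identityʳ (2 ℕ.^ l)))) (sym (ℕ.+-identityʳ _))))) , 1≤^ {2} (suc l) (s≤s z≤n)

-- At i + 1 of size about 2^l this is of order i log² i. The 2^l indices of level l contribute
-- 1/((l+1)(l+2)) together, so that the sum over the levels telescopes.
dyadicWeight : ℕ → ℕ
dyadicWeight l = 2 ℕ.^ l ℕ.* (suc l ℕ.* suc (suc l))

weight : ℕ → ℕ
weight i = dyadicWeight (level i)

1≤dyadicWeight : ∀ l → 1 ℕ.≤ dyadicWeight l
1≤dyadicWeight l = 1≤* (1≤^ {2} l (s≤s z≤n)) (s≤s z≤n)

-- The part of the total weight 1 that is left when r indices of level l have been used: 1/(l+1) is
-- left at the start of the level.
remainder : ℕ → ℕ → ℚ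
remainder l r = 1/ᵘ (suc l) ℚ.- ι r ℚ.* 1/ᵘ (dyadicWeight l)

remainder-suc : ∀ l r → 1/ᵘ (dyadicWeight l) ℚ.+ remainder l (suc r) ≡ remainder l r
remainder-suc l r = trans (cong (λ z → w ℚ.+ (1/ᵘ (suc l) ℚ.- z ℚ.* w)) (ι-suc r)) (e (1/ᵘ (suc l)) w (ι r))
  where
  w = 1/ᵘ (dyadicWeight l)
  e : ∀ a w r → w ℚ.+ (a ℚ.- (1ℚ ℚ.+ r) ℚ.* w) ≡ a ℚ.- r ℚ.* w
  e = solve-∀ ℚring

-- 1/(l+1) − 1/((l+1)(l+2)) = 1/(l+2)
remainder-full : ∀ l → remainder l (2 ℕ.^ l) ≡ remainder (suc l) 0
remainder-full l = ι-cancel (suc l) (trans (e (ι (suc (suc l))) (1/ᵘ (suc l)) (ι (2 ℕ.^ l) ℚ.* 1/ᵘ (dyadicWeight l)))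
  (trans (cong (λ z → ι (suc (suc l)) ℚ.* 1/ᵘ (suc l) ℚ.- ι (suc (suc l)) ℚ.* z) block)
  (trans (cong (λ z → z ℚ.* 1/ᵘ (suc l) ℚ.- ι (suc (suc l)) ℚ.* (1/ᵘ (suc l) ℚ.* 1/ᵘ (suc (suc l)))) (ι-suc (suc l)))
  (trans (cong₂ (λ y z → y ℚ.- z) (trans (ℚ.*-distribʳ-+ (1/ᵘ (suc l)) 1ℚ (ι (suc l))) (cong₂ ℚ._+_ (ℚ.*-identityˡ (1/ᵘ (suc l))) (trans (ℚ.*-comm (ι (suc l)) (1/ᵘ (suc l))) (1/ᵘ-* {suc l} (s≤s z≤n)))))
      (trans (e₂ (ι (suc (suc l))) (1/ᵘ (suc l)) (1/ᵘ (suc (suc l)))) (trans (cong (ℚ._* 1/ᵘ (suc l)) (1/ᵘ-* {suc (suc l)} (s≤s z≤n))) (ℚ.*-identityˡ (1/ᵘ (suc l))))))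
  (trans (e₃ (1/ᵘ (suc l))) (trans (sym (1/ᵘ-* {suc (suc l)} (s≤s z≤n)))
    (trans (e₄ (1/ᵘ (suc (suc l))) (ι (suc (suc l))) (1/ᵘ (dyadicWeight (suc l)))) (cong (λ z → ι (suc (suc l)) ℚ.* (1/ᵘ (suc (suc l)) ℚ.- z ℚ.* 1/ᵘ (dyadicWeight (suc l)))) (sym ι0)))))))))
  where
  e : ∀ k a b → k ℚ.* (a ℚ.- b) ≡ k ℚ.* a ℚ.- k ℚ.* b
  e = solve-∀ ℚring
  e₂ : ∀ k a b → k ℚ.* (a ℚ.* b) ≡ (b ℚ.* k) ℚ.* a
  e₂ = solve-∀ ℚring
  e₃ : ∀ a → (a ℚ.+ 1ℚ) ℚ.- a ≡ 1ℚ
  e₃ = solve-∀ ℚring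
  e₄ : ∀ a k w → a ℚ.* k ≡ k ℚ.* (a ℚ.- 0ℚ ℚ.* w)
  e₄ = solve-∀ ℚring
  block : ι (2 ℕ.^ l) ℚ.* 1/ᵘ (dyadicWeight l) ≡ 1/ᵘ (suc l) ℚ.* 1/ᵘ (suc (suc l))
  block = trans (cong (ι (2 ℕ.^ l) ℚ.*_) (1/ᵘ-mul {2 ℕ.^ l} {suc l ℕ.* suc (suc l)} (1≤^ {2} l (s≤s z≤n)) (s≤s z≤n)))
    (trans (e₅ (ι (2 ℕ.^ l)) (1/ᵘ (2 ℕ.^ l)) (1/ᵘ (suc l ℕ.* suc (suc l))))
    (trans (cong (ℚ._* 1/ᵘ (suc l ℕ.* suc (suc l))) (1/ᵘ-* (1≤^ {2} l (s≤s z≤n))))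
    (trans (ℚ.*-identityˡ _) (1/ᵘ-mul {suc l} {suc (suc l)} (s≤s z≤n) (s≤s z≤n)))))
    where
    e₅ : ∀ a b c → a ℚ.* (b ℚ.* c) ≡ (b ℚ.* a) ℚ.* c
    e₅ = solve-∀ ℚring

sum-weights : ∀ n → sum (1/ᵘ ∘ weight) n ℚ.+ remainder (level n) (proj₂ (dyadic n)) ≡ 1ℚ
sum-weights zero    = trans (cong₂ (λ y z → 0ℚ ℚ.+ (y ℚ.- z ℚ.* 1/ᵘ (dyadicWeight 0))) 1/ᵘ-one ι0) (e (1/ᵘ (dyadicWeight 0)))
  where
  e : ∀ w → 0ℚ ℚ.+ (1ℚ ℚ.- 0ℚ ℚ.* w) ≡ 1ℚ
  e = solve-∀ ℚring
sum-weights (suc i) = trans (ℚ.+-assoc (sum (1/ᵘ ∘ weight) i) (1/ᵘ (weight i)) (remainder (level (suc i)) (proj₂ (dyadic (suc i)))))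
  (trans (cong (sum (1/ᵘ ∘ weight) i ℚ.+_) (go (level i) (proj₂ (dyadic i)) (proj₂ (dyadic-spec i)) (_ ℕ.<? _))) (sum-weights i))
  where
  go : ∀ l r → r ℕ.< 2 ℕ.^ l → (d : Dec (suc r ℕ.< 2 ℕ.^ l)) →
    1/ᵘ (dyadicWeight l) ℚ.+ remainder (proj₁ (dyadic-step l r d)) (proj₂ (dyadic-step l r d)) ≡ remainder l r
  go l r r< (yes _) = remainder-suc l r
  go l r r< (no ¬lt) = trans (cong (1/ᵘ (dyadicWeight l) ℚ.+_)
    (trans (sym (remainder-full l)) (cong (remainder l) (ℕ.≤-antisym (ℕ.≮⇒≥ ¬lt) r<)))) (remainder-suc l r)

0≤remainder : ∀ l r → r ℕ.≤ 2 ℕ.^ l → 0ℚ ℚ.≤ remainder l r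
0≤remainder l r h = 0≤-diff (subst (ι r ℚ.* 1/ᵘ (dyadicWeight l) ℚ.≤_)
  (trans (cong (ℚ._* 1/ᵘ (suc l)) ι1) (ℚ.*-identityˡ (1/ᵘ (suc l))))
  (frac-≤ {r} {dyadicWeight l} {1} {suc l} (1≤dyadicWeight l) (s≤s z≤n)
    (ℕ.≤-trans (ℕ.*-mono-≤ h (ℕ.m≤m*n (suc l) (suc (suc l)))) (ℕ.≤-reflexive (sym (ℕ.*-identityˡ (dyadicWeight l)))))))

Σweight≤1 : ∀ n → sum (1/ᵘ ∘ weight) n ℚ.≤ 1ℚ
Σweight≤1 n = ≤-by (remainder (level n) (proj₂ (dyadic n)))
  (0≤remainder (level n) (proj₂ (dyadic n)) (ℕ.<⇒≤ (proj₂ (dyadic-spec n)))) (sym (sum-weights n))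

geometric : ℕ → ℕ
geometric i = 2 ℕ.^ suc i

Σgeometric≤1 : ∀ n → sum (1/ᵘ ∘ geometric) n ℚ.≤ 1ℚ
Σgeometric≤1 n = ≤-by (½ ^ℚ n) (0≤^ℚ n 0≤½) (sym (exact n))
  where
  e₀ : ∀ s h → (s ℚ.+ ½ ℚ.* h) ℚ.+ ½ ℚ.* h ≡ s ℚ.+ h
  e₀ = solve-∀ ℚring
  exact : ∀ n → sum (1/ᵘ ∘ geometric) n ℚ.+ ½ ^ℚ n ≡ 1ℚ
  exact zero    = ℚ.+-identityˡ 1ℚ
  exact (suc n) = trans (cong (λ z → (sum (1/ᵘ ∘ geometric) n ℚ.+ z) ℚ.+ ½ ^ℚ suc n) (sym (½^ (suc n))))
    (trans (e₀ (sum (1/ᵘ ∘ geometric) n) (½ ^ℚ n)) (exact n))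

-- At m = 3c it follows from c (3c + 1) ≤ (c + 1)³ ≤ 8^c; afterwards the right side doubles at each
-- step while the left side grows by c.
linear≤2^ : ∀ c m → 3 ℕ.* c ℕ.≤ m → c ℕ.* suc m ℕ.≤ 2 ℕ.^ m
linear≤2^ c m h = subst (λ z → c ℕ.* suc z ℕ.≤ 2 ℕ.^ z) (ℕ.m∸n+n≡m h) (from (m ℕ.∸ 3 ℕ.* c))
  where
  e₁ : ∀ c → suc c ℕ.* (suc c ℕ.* (suc c ℕ.* 1)) ≡ c ℕ.* suc (3 ℕ.* c) ℕ.+ (c ℕ.* (c ℕ.* c) ℕ.+ 2 ℕ.* c ℕ.+ 1)
  e₁ = ℕRing.solve-∀
  e₂ : ∀ c m → c ℕ.* suc (suc m) ≡ c ℕ.* 1 ℕ.+ c ℕ.* suc m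
  e₂ = ℕRing.solve-∀
  from : ∀ d → c ℕ.* suc (d ℕ.+ 3 ℕ.* c) ℕ.≤ 2 ℕ.^ (d ℕ.+ 3 ℕ.* c)
  from zero    = ℕ.≤-trans (subst (c ℕ.* suc (3 ℕ.* c) ℕ.≤_) (sym (e₁ c)) (ℕ.m≤m+n _ _))
    (ℕ.≤-trans (ℕ.^-monoˡ-≤ 3 (n<2^n c)) (ℕ.≤-reflexive (trans (ℕ.^-*-assoc 2 c 3) (cong (2 ℕ.^_) (ℕ.*-comm c 3)))))
  from (suc d) = subst₂ ℕ._≤_ (sym (e₂ c (d ℕ.+ 3 ℕ.* c))) (cong (2 ℕ.^ (d ℕ.+ 3 ℕ.* c) ℕ.+_) (sym (ℕ.+-identityʳ _)))
    (ℕ.+-mono-≤ (ℕ.≤-trans (ℕ.*-monoʳ-≤ c (s≤s z≤n)) (from d)) (from d))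

-- With m the integer part of l/Q, l + 2 ≤ (Q + 2)(m + 1) ≤ 2^m for large l, and the Q-th power of
-- the right side is at most 2^l.
polynomial≤2^ : ∀ Q → 1 ℕ.≤ Q → ∃[ L ] ∀ l → L ℕ.≤ l → suc (suc l) ℕ.^ Q ℕ.≤ 2 ℕ.^ l
polynomial≤2^ Q@(suc _) 1≤Q = Q ℕ.* (3 ℕ.* (2 ℕ.+ Q)) , bound
  where
  e₁ : ∀ m → suc (suc (Q ℕ.+ m ℕ.* Q)) ℕ.+ (m ℕ.+ m) ≡ (2 ℕ.+ Q) ℕ.* suc m
  e₁ m = e Q m
    where
    e : ∀ Q m → suc (suc (Q ℕ.+ m ℕ.* Q)) ℕ.+ (m ℕ.+ m) ≡ (2 ℕ.+ Q) ℕ.* suc m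
    e = ℕRing.solve-∀
  bound : ∀ l → Q ℕ.* (3 ℕ.* (2 ℕ.+ Q)) ℕ.≤ l → suc (suc l) ℕ.^ Q ℕ.≤ 2 ℕ.^ l
  bound l h = ℕ.≤-trans (ℕ.^-monoˡ-≤ Q (ℕ.≤-trans l≤ (linear≤2^ (2 ℕ.+ Q) m m≥)))
    (ℕ.≤-trans (ℕ.≤-reflexive (ℕ.^-*-assoc 2 m Q)) (ℕ.^-monoʳ-≤ 2 (m/n*n≤m l Q)))
    where
    m = l / Q
    m≥ : 3 ℕ.* (2 ℕ.+ Q) ℕ.≤ m
    m≥ = subst (ℕ._≤ m) (m*n/n≡m (3 ℕ.* (2 ℕ.+ Q)) Q) (/-monoˡ-≤ Q (subst (ℕ._≤ l) (ℕ.*-comm Q (3 ℕ.* (2 ℕ.+ Q))) h))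
    l≤ : suc (suc l) ℕ.≤ (2 ℕ.+ Q) ℕ.* suc m
    l≤ = ℕ.≤-trans (s≤s (s≤s (ℕ.≤-trans (ℕ.≤-reflexive (m≡m%n+[m/n]*n l Q)) (ℕ.+-monoˡ-≤ (m ℕ.* Q) (ℕ.<⇒≤ (m%n<n l Q))))))
      (ℕ.≤-trans (ℕ.m≤m+n _ (m ℕ.+ m)) (ℕ.≤-reflexive (e₁ m)))

-- Twice a weight of level l is at most 2^l (l + 2)³. The q-th power of the cubic factor is at most
-- 2^l for large l, which the one surplus factor i + 1 on the right pays for. The factor 2^q on the
-- left is the gain collected once per group.
weight-small : ∀ q → 1 ℕ.≤ q → ∃[ A ] ∀ i → A ℕ.≤ suc i → weight i ℕ.^ q ℕ.* 2 ℕ.^ q ℕ.≤ suc i ℕ.^ suc q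
weight-small q 1≤q = 2 ℕ.^ L , λ i h → small i (level-large i h)
  where
  Q = 3 ℕ.* q
  L = proj₁ (polynomial≤2^ Q (ℕ.≤-trans 1≤q (ℕ.m≤n*m q 3)))
  level-large : ∀ i → 2 ℕ.^ L ℕ.≤ suc i → L ℕ.≤ level i
  level-large i h = ℕ.≮⇒≥ λ l<L → ℕ.<-irrefl refl (ℕ.<-≤-trans (subst (ℕ._< 2 ℕ.^ suc (level i)) (sym (proj₁ (dyadic-spec i)))
    (subst (2 ℕ.^ level i ℕ.+ proj₂ (dyadic i) ℕ.<_) (cong (2 ℕ.^ level i ℕ.+_) (sym (ℕ.+-identityʳ _))) (ℕ.+-monoʳ-< (2 ℕ.^ level i) (proj₂ (dyadic-spec i)))))
    (ℕ.≤-trans (ℕ.^-monoʳ-≤ 2 l<L) h))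
  e₁ : ∀ l → suc l ℕ.* suc (suc l) ℕ.* 2 ℕ.+ (suc (suc l) ℕ.* (l ℕ.* l ℕ.+ 2 ℕ.* l ℕ.+ 2)) ≡ suc (suc l) ℕ.* (suc (suc l) ℕ.* (suc (suc l) ℕ.* 1))
  e₁ = ℕRing.solve-∀
  small : ∀ i → L ℕ.≤ level i → weight i ℕ.^ q ℕ.* 2 ℕ.^ q ℕ.≤ suc i ℕ.^ suc q
  small i L≤l = ℕ.≤-trans (ℕ.≤-reflexive (trans (sym (*-^ (weight i) 2 q)) (trans (cong (ℕ._^ q) (ℕ.*-assoc (2 ℕ.^ l) (suc l ℕ.* suc (suc l)) 2)) (*-^ (2 ℕ.^ l) (suc l ℕ.* suc (suc l) ℕ.* 2) q))))
    (ℕ.≤-trans (ℕ.*-monoʳ-≤ ((2 ℕ.^ l) ℕ.^ q) (ℕ.≤-trans (ℕ.^-monoˡ-≤ q (ℕ.≤-trans (ℕ.m≤m+n _ _) (ℕ.≤-reflexive (e₁ l))))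
        (ℕ.≤-trans (ℕ.≤-reflexive (ℕ.^-*-assoc (suc (suc l)) 3 q)) (proj₂ (polynomial≤2^ Q (ℕ.≤-trans 1≤q (ℕ.m≤n*m q 3))) l L≤l))))
      (ℕ.≤-trans (ℕ.≤-reflexive (ℕ.*-comm ((2 ℕ.^ l) ℕ.^ q) (2 ℕ.^ l)))
        (ℕ.^-monoˡ-≤ (suc q) (subst (2 ℕ.^ l ℕ.≤_) (sym (proj₁ (dyadic-spec i))) (ℕ.m≤m+n _ _)))))
    where l = level i

-- Uniqueness of partial quotients

-- Digits equal to 1 are allowed here, so a tail is kept away from 1 only by its next digit: it is
-- at most 1/(1 + 1/(a₃ + 1)). Hence the gap depends on a digit beyond the first difference, and the
-- indices start at 3 + k.
convergents-gap : ∀ {a b} → Positive a → Positive b → ∀ k → AgreeUpTo k a b → a (suc k) ℕ.< b (suc k) →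
  ∃[ δ ] 0ℚ ℚ.< δ × (∀ m n → 3 ℕ.+ k ℕ.≤ m → 3 ℕ.+ k ℕ.≤ n → δ ℚ.≤ ℚ.∣ convergent a m ℚ.- convergent b n ∣)
convergents-gap {a} {b} ha hb zero _ a₁<b₁ = δ , 0<δ , gap
  where
  B C : ℕ
  B = suc (b 1)
  C = suc (a 3)
  u D η δ : ℚ
  u = 1/ᵘ C
  D = 1ℚ ℚ.+ u
  η = u ℚ.* recip D
  δ = η ℚ.* (1/ᵘ B ℚ.* 1/ᵘ B)
  0<u : 0ℚ ℚ.< u
  0<u = 0<1/ᵘ (s≤s z≤n)
  0<D : 0ℚ ℚ.< D
  0<D = ℚ.<-≤-trans 0<1 (p≤p+ε 1ℚ (ℚ.<⇒≤ 0<u))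
  0<η : 0ℚ ℚ.< η
  0<η = 0<* {u} {recip D} 0<u (0<recip 0<D)
  0<δ : 0ℚ ℚ.< δ
  0<δ = 0<* {η} {1/ᵘ B ℚ.* 1/ᵘ B} 0<η (0<* {1/ᵘ B} {1/ᵘ B} (0<1/ᵘ (s≤s z≤n)) (0<1/ᵘ (s≤s z≤n)))
  ha′ : Positive (tail a)
  ha′ = tail-positive ha
  hb′ : Positive (tail b)
  hb′ = tail-positive hb
  e₁ : ∀ r u → r ℚ.* (1ℚ ℚ.+ u) ≡ r ℚ.+ u ℚ.* r
  e₁ = solve-∀ ℚring
  e₂ : ∀ a b x y r η → (b ℚ.+ y) ℚ.- (a ℚ.+ x) ≡ η ℚ.+ ((((b ℚ.- (1ℚ ℚ.+ a)) ℚ.+ y) ℚ.+ (r ℚ.- x)) ℚ.+ (1ℚ ℚ.- (r ℚ.+ η)))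
  e₂ = solve-∀ ℚring
  tail≤ : ∀ m → convergent (tail a) (suc (suc m)) ℚ.≤ recip D
  tail≤ m = subst (ℚ._≤ recip D) (sym (convergent-suc (tail a) (suc m)))
    (recip-antimono 0<D (ℚ.+-mono-≤ (subst (ℚ._≤ ι (a 2)) ι1 (ι-mono-≤ (ha 2 (s≤s z≤n)))) (1/ᵘ≤convergent (tail-positive ha′) m)))
  gap : ∀ m n → 3 ℕ.≤ m → 3 ℕ.≤ n → δ ℚ.≤ ℚ.∣ convergent a m ℚ.- convergent b n ∣
  gap (suc (suc (suc m))) (suc (suc (suc n))) (s≤s (s≤s (s≤s _))) (s≤s (s≤s (s≤s _))) = subst (δ ℚ.≤_)
    (sym (trans (cong₂ (λ y z → ℚ.∣ y ℚ.- z ∣) (convergent-suc a (suc (suc m))) (convergent-suc b (suc (suc n)))) (∣recip-diff∣ P Q 0<P 0<Q)))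
    (*-mono-≤ {η} {ℚ.∣ P ℚ.- Q ∣} {1/ᵘ B ℚ.* 1/ᵘ B} {recip P ℚ.* recip Q} (ℚ.<⇒≤ 0<η)
      (0≤* {1/ᵘ B} {1/ᵘ B} (0≤1/ᵘ B) (0≤1/ᵘ B))
      (ℚ.≤-trans η≤ (subst (Q ℚ.- P ℚ.≤_) (∣-∣-comm Q P) (p≤∣p∣ (Q ℚ.- P))))
      (*-mono-≤ {1/ᵘ B} {recip P} {1/ᵘ B} {recip Q} (0≤1/ᵘ B) (0≤1/ᵘ B)
        (1/ᵘ≤recip {B} 0<P (ℚ.≤-trans (denominator≤ ha (suc (suc m))) (ι-mono-≤ (s≤s (ℕ.<⇒≤ a₁<b₁)))))
        (1/ᵘ≤recip {B} 0<Q (denominator≤ hb (suc (suc n))))))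
    where
    x = convergent (tail a) (suc (suc m))
    y = convergent (tail b) (suc (suc n))
    P = ι (a 1) ℚ.+ x
    Q = ι (b 1) ℚ.+ y
    0<P : 0ℚ ℚ.< P
    0<P = 0<denominator ha (suc (suc m))
    0<Q : 0ℚ ℚ.< Q
    0<Q = 0<denominator hb (suc (suc n))
    η≤ : η ℚ.≤ Q ℚ.- P
    η≤ = ≤-by ((((ι (b 1) ℚ.- (1ℚ ℚ.+ ι (a 1))) ℚ.+ y) ℚ.+ (recip D ℚ.- x)) ℚ.+ (1ℚ ℚ.- (recip D ℚ.+ η)))
      (0≤+ {((ι (b 1) ℚ.- (1ℚ ℚ.+ ι (a 1))) ℚ.+ y) ℚ.+ (recip D ℚ.- x)} {1ℚ ℚ.- (recip D ℚ.+ η)}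
        (0≤+ {(ι (b 1) ℚ.- (1ℚ ℚ.+ ι (a 1))) ℚ.+ y} {recip D ℚ.- x}
          (0≤+ {ι (b 1) ℚ.- (1ℚ ℚ.+ ι (a 1))} {y} (0≤-diff (subst (ℚ._≤ ι (b 1)) (ι-suc (a 1)) (ι-mono-≤ a₁<b₁))) (0≤convergent hb′ (suc (suc n))))
          (0≤-diff (tail≤ m)))
        (0≤-diff (ℚ.≤-reflexive (trans (sym (e₁ (recip D) u)) (recip-* D 0<D)))))
      (e₂ (ι (a 1)) (ι (b 1)) x y (recip D) η)
convergents-gap {a} {b} ha hb (suc k) agree a<b =
  let (δ , 0<δ , gap) = convergents-gap ha′ hb′ k (λ j 1≤j j≤k → agree (suc j) (s≤s z≤n) (s≤s j≤k)) a<b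
  in δ ℚ.* (1/ᵘ B ℚ.* 1/ᵘ B) , 0<* {δ} {1/ᵘ B ℚ.* 1/ᵘ B} 0<δ (0<* {1/ᵘ B} {1/ᵘ B} (0<1/ᵘ (s≤s z≤n)) (0<1/ᵘ (s≤s z≤n))) , λ where
    (suc m) (suc n) (s≤s hm) (s≤s hn) → step δ 0<δ m n (gap m n hm hn)
  where
  B : ℕ
  B = suc (a 1)
  ha′ : Positive (tail a)
  ha′ = tail-positive ha
  hb′ : Positive (tail b)
  hb′ = tail-positive hb
  a₁≡b₁ : a 1 ≡ b 1
  a₁≡b₁ = agree 1 (s≤s z≤n) (s≤s z≤n)
  step : ∀ δ → 0ℚ ℚ.< δ → ∀ m n → δ ℚ.≤ ℚ.∣ convergent (tail a) m ℚ.- convergent (tail b) n ∣ →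
    δ ℚ.* (1/ᵘ B ℚ.* 1/ᵘ B) ℚ.≤ ℚ.∣ convergent a (suc m) ℚ.- convergent b (suc n) ∣
  step δ 0<δ m n h = subst (δ ℚ.* (1/ᵘ B ℚ.* 1/ᵘ B) ℚ.≤_)
    (sym (trans (cong₂ (λ y z → ℚ.∣ y ℚ.- z ∣) (convergent-suc a m)
                  (trans (convergent-suc b n) (cong (λ z → recip (ι z ℚ.+ y)) (sym a₁≡b₁))))
         (trans (∣recip-diff∣ P Q 0<P 0<Q) (cong (λ z → ℚ.∣ z ∣ ℚ.* (recip P ℚ.* recip Q)) (+-cancel-diff (ι (a 1)) x y)))))
    (*-mono-≤ {δ} {ℚ.∣ x ℚ.- y ∣} {1/ᵘ B ℚ.* 1/ᵘ B} {recip P ℚ.* recip Q} (ℚ.<⇒≤ 0<δ)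
      (0≤* {1/ᵘ B} {1/ᵘ B} (0≤1/ᵘ B) (0≤1/ᵘ B)) h
      (*-mono-≤ {1/ᵘ B} {recip P} {1/ᵘ B} {recip Q} (0≤1/ᵘ B) (0≤1/ᵘ B)
        (1/ᵘ≤recip {B} 0<P (denominator≤ ha m))
        (1/ᵘ≤recip {B} 0<Q (subst (λ z → ι z ℚ.+ y ℚ.≤ ι (suc z)) (sym a₁≡b₁) (denominator≤ hb n)))))
    where
    x = convergent (tail a) m
    y = convergent (tail b) n
    P = ι (a 1) ℚ.+ x
    Q = ι (a 1) ℚ.+ y
    0<P : 0ℚ ℚ.< P
    0<P = 0<denominator ha m
    0<Q : 0ℚ ℚ.< Q
    0<Q = ℚ.<-≤-trans (0<ι (ha 1 (s≤s z≤n))) (p≤p+ε (ι (a 1)) (0≤convergent hb′ n))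

agree-suc : ∀ {a b} k → AgreeUpTo k a b → a (suc k) ≡ b (suc k) → AgreeUpTo (suc k) a b
agree-suc k agree eq j 1≤j j≤ with ℕ.m≤n⇒m<n∨m≡n j≤
... | inj₁ (s≤s j≤k) = agree j 1≤j j≤k
... | inj₂ refl      = eq

-- After a first difference the two sequences of convergents would stay a fixed distance apart,
-- although both tend to x.
partialQuotients-unique : ∀ {a b x} → ArePartialQuotients a x → ArePartialQuotients b x → ∀ k → AgreeUpTo k a b
partialQuotients-unique {a} {b} {x} A B zero j 1≤j j≤0 = ⊥-elim (ℕ.<-irrefl refl (ℕ.≤-trans 1≤j j≤0))
partialQuotients-unique {a} {b} {x} A B (suc k) = agree-suc k agree (ℕ.≤-antisym (ℕ.≮⇒≥ (differ B A agree′)) (ℕ.≮⇒≥ (differ A B agree)))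
  where
  agree : AgreeUpTo k a b
  agree = partialQuotients-unique {a} {b} {x} A B k
  agree′ : AgreeUpTo k b a
  agree′ j 1≤j j≤k = sym (agree j 1≤j j≤k)
  differ : ∀ {a b} → ArePartialQuotients a x → ArePartialQuotients b x → AgreeUpTo k a b → ¬ (a (suc k) ℕ.< b (suc k))
  differ {a} {b} (ha , la) (hb , lb) agree a<b =
    let (δ , 0<δ , gap) = convergents-gap ha hb k agree a<b
        δ≤ : fromℚ δ ⊑ ∣ x - x ∣
        δ≤ = lim-∣-∣-≥ {λ n → fromℚ (convergent a n)} {λ n → fromℚ (convergent b n)} {x} {x} la lb
               (3 ℕ.+ k , λ n h → pw⊑ λ _ → gap n n h h)
        x-x : ∣ x - x ∣ ⊑ 0ℝ
        x-x = pw⊑ λ n → ℚ.≤-reflexive (cong ℚ.∣_∣ (ℚ.+-inverseʳ (seq x n)))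
    in ℚ.<-irrefl refl (ℚ.<-≤-trans 0<δ (fromℚ-cancel-≤ (un⊑ (⊑-trans {fromℚ δ} {∣ x - x ∣} {0ℝ} δ≤ x-x))))

-- Digit products of increasing sequences

digitProduct-+ : ∀ a k i → digitProduct a (k ℕ.+ i) ≡ digitProduct a k ℕ.* digitProduct (λ j → a (k ℕ.+ j)) i
digitProduct-+ a zero    i = sym (ℕ.*-identityˡ (digitProduct a i))
digitProduct-+ a (suc k) i = trans (cong (a 1 ℕ.*_) (digitProduct-+ (tail a) k i)) (sym (ℕ.*-assoc (a 1) (digitProduct (tail a) k) (digitProduct (λ j → a (suc k ℕ.+ j)) i)))

digitProduct-≤ : ∀ a M l → (∀ j → 1 ℕ.≤ j → j ℕ.≤ l → a j ℕ.≤ M) → digitProduct a l ℕ.≤ M ℕ.^ l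
digitProduct-≤ a M zero    h = ℕ.≤-refl
digitProduct-≤ a M (suc l) h = ℕ.*-mono-≤ (h 1 (s≤s z≤n) (s≤s z≤n)) (digitProduct-≤ (tail a) M l λ j 1≤j j≤l → h (suc j) (s≤s z≤n) (s≤s j≤l))

digitProduct-≥ : ∀ a M l → (∀ j → 1 ℕ.≤ j → j ℕ.≤ l → M ℕ.≤ a j) → M ℕ.^ l ℕ.≤ digitProduct a l
digitProduct-≥ a M zero    h = ℕ.≤-refl
digitProduct-≥ a M (suc l) h = ℕ.*-mono-≤ (h 1 (s≤s z≤n) (s≤s z≤n)) (digitProduct-≥ (tail a) M l λ j 1≤j j≤l → h (suc j) (s≤s z≤n) (s≤s j≤l))

n≤digit : ∀ {a} → Positive a → IncreasingFrom1 a → ∀ n → 1 ℕ.≤ n → n ℕ.≤ a n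
n≤digit pos inc (suc zero)    _ = pos 1 (s≤s z≤n)
n≤digit pos inc (suc (suc n)) _ = ℕ.≤-trans (s≤s (n≤digit pos inc (suc n) (s≤s z≤n))) (inc (suc n) (s≤s z≤n))

increasing-≤ : ∀ {a} → IncreasingFrom1 a → ∀ {i j} → 1 ℕ.≤ i → i ℕ.≤ j → a i ℕ.≤ a j
increasing-≤ inc {i} {zero}  1≤i z≤n = ℕ.≤-refl
increasing-≤ inc {i} {suc j} 1≤i i≤j with ℕ.m≤n⇒m<n∨m≡n i≤j
... | inj₁ (s≤s i≤j′) = ℕ.≤-trans (increasing-≤ inc 1≤i i≤j′) (ℕ.<⇒≤ (inc j (ℕ.≤-trans 1≤i i≤j′)))
... | inj₂ refl       = ℕ.≤-refl

n≤digitProduct : ∀ {a} → Positive a → IncreasingFrom1 a → ∀ n → n ℕ.≤ digitProduct a n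
n≤digitProduct pos inc zero    = z≤n
n≤digitProduct {a} pos inc (suc n) = subst (suc n ℕ.≤_) (sym (digitProduct-snoc a n))
  (ℕ.≤-trans (n≤digit pos inc (suc n) (s≤s z≤n)) (ℕ.m≤n*m (a (suc n)) (digitProduct a n) {{ℕ.>-nonZero (1≤digitProduct pos n)}}))

^-cancel-≤ : ∀ {x y} f → 1 ℕ.≤ f → x ℕ.^ f ℕ.≤ y ℕ.^ f → x ℕ.≤ y
^-cancel-≤ {x} {y} f 1≤f h = ℕ.≮⇒≥ λ y<x → ℕ.<-irrefl refl (ℕ.<-≤-trans (ℕ.^-monoˡ-< f {{ℕ.>-nonZero 1≤f}} y<x) h)

-- k further digits, each at least M, outweigh the f digits of product V ≤ M^f
-- that precede them by the factor (f + k)/f in the exponent.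
group-inequality : ∀ {P Q f k M V D} → 1 ℕ.≤ f → 1 ℕ.≤ V → V ℕ.≤ M ℕ.^ f → M ℕ.^ k ℕ.≤ D →
  Q ℕ.* f ℕ.≤ P ℕ.* (f ℕ.+ k) → V ℕ.^ Q ℕ.≤ (V ℕ.* D) ℕ.^ P
group-inequality {P} {Q} {f} {k} {M} {V} {D} 1≤f 1≤V V≤ ≤D h = ^-cancel-≤ f 1≤f (begin
  (V ℕ.^ Q) ℕ.^ f                    ≡⟨ ℕ.^-*-assoc V Q f ⟩
  V ℕ.^ (Q ℕ.* f)                    ≤⟨ ℕ.^-monoʳ-≤ V {{ℕ.>-nonZero 1≤V}} h ⟩
  V ℕ.^ (P ℕ.* (f ℕ.+ k))            ≡⟨ cong (V ℕ.^_) (ℕ.*-comm P (f ℕ.+ k)) ⟩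
  V ℕ.^ ((f ℕ.+ k) ℕ.* P)            ≡⟨ ℕ.^-*-assoc V (f ℕ.+ k) P ⟨
  (V ℕ.^ (f ℕ.+ k)) ℕ.^ P            ≡⟨ cong (ℕ._^ P) (ℕ.^-distribˡ-+-* V f k) ⟩
  (V ℕ.^ f ℕ.* V ℕ.^ k) ℕ.^ P        ≤⟨ ℕ.^-monoˡ-≤ P (ℕ.*-monoʳ-≤ (V ℕ.^ f) V^k≤) ⟩
  (V ℕ.^ f ℕ.* D ℕ.^ f) ℕ.^ P        ≡⟨ cong (ℕ._^ P) (*-^ V D f) ⟨
  ((V ℕ.* D) ℕ.^ f) ℕ.^ P            ≡⟨ trans (ℕ.^-*-assoc (V ℕ.* D) f P) (trans (cong ((V ℕ.* D) ℕ.^_) (ℕ.*-comm f P)) (sym (ℕ.^-*-assoc (V ℕ.* D) P f))) ⟩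
  ((V ℕ.* D) ℕ.^ P) ℕ.^ f            ∎)
  where
  open ℕ.≤-Reasoning
  V^k≤ : V ℕ.^ k ℕ.≤ D ℕ.^ f
  V^k≤ = begin
    V ℕ.^ k            ≤⟨ ℕ.^-monoˡ-≤ k V≤ ⟩
    (M ℕ.^ f) ℕ.^ k    ≡⟨ trans (ℕ.^-*-assoc M f k) (trans (cong (M ℕ.^_) (ℕ.*-comm f k)) (sym (ℕ.^-*-assoc M k f))) ⟩
    (M ℕ.^ k) ℕ.^ f    ≤⟨ ℕ.^-monoˡ-≤ f ≤D ⟩
    D ℕ.^ f            ∎

-- Upper bound

-- A node of the covering tree is a predicate on whole digit sequences; fixing one more digit then
-- amounts to a conjunction, as in `split`.
Pts : ((ℕ → ℕ) → Set) → Pred 𝕀 0ℓ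
Pts 𝒜 x = ∃[ a ] ArePartialQuotients a (point x) × 𝒜 a

module Blocks (σ : ℕ → ℕ) (1≤σ : ∀ n → 1 ℕ.≤ n → 0 ℕ.< σ n) (σ-inc : IncreasingFrom1 σ)
  (σ-gap : ∀ n → 1 ℕ.≤ n → n ℕ.≤ σ (suc n) ℕ.∸ σ n) where

  -- blockEnd k is the last position of the progression number k + 1; the
  -- following freeCount k digits, up to and including the first two of
  -- progression number k + 2, are free, and the next k are then determined.
  blockEnd : ℕ → ℕ
  blockEnd k = σ (suc k) ℕ.+ k

  freeCount : ℕ → ℕ
  freeCount k = suc (σ (suc (suc k))) ℕ.∸ blockEnd k

  -- The gap hypothesis makes consecutive progressions disjoint: number k + 1 has k + 1 terms and
  -- ends before number k + 2 begins.
  blockEnd<σ : ∀ k → blockEnd k ℕ.< σ (suc (suc k))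
  blockEnd<σ k = subst₂ ℕ._≤_ (ℕ.+-suc (σ (suc k)) k) (ℕ.m+[n∸m]≡n (ℕ.<⇒≤ (σ-inc (suc k) (s≤s z≤n))))
    (ℕ.+-monoʳ-≤ (σ (suc k)) (σ-gap (suc k) (s≤s z≤n)))

  blockEnd+freeCount : ∀ k → blockEnd k ℕ.+ freeCount k ≡ suc (σ (suc (suc k)))
  blockEnd+freeCount k = ℕ.m+[n∸m]≡n (ℕ.m≤n⇒m≤1+n (ℕ.<⇒≤ (blockEnd<σ k)))

  blockEnd-suc : ∀ k → blockEnd k ℕ.+ freeCount k ℕ.+ k ≡ blockEnd (suc k)
  blockEnd-suc k = trans (cong (ℕ._+ k) (blockEnd+freeCount k)) (sym (ℕ.+-suc (σ (suc (suc k))) k))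

  1≤freeCount : ∀ k → 1 ℕ.≤ freeCount k
  1≤freeCount k = ℕ.m<n⇒0<n∸m (ℕ.m≤n⇒m≤1+n (blockEnd<σ k))

  k≤blockEnd : ∀ k → k ℕ.≤ blockEnd k
  k≤blockEnd k = ℕ.m≤n+m k (σ (suc k))

  -- The recursion a(i+2) = 2 a(i+1) - a(i) replaces the unknown first term and difference, so a
  -- digit is visibly a function of its two predecessors.
  Progressions : ℕ → (ℕ → ℕ) → Set
  Progressions N a = ∀ k → N ℕ.≤ k → ∀ i → 2 ℕ.+ i ℕ.≤ k →
    a (σ (suc k) ℕ.+ suc (suc i)) ≡ (a (σ (suc k) ℕ.+ suc i) ℕ.+ a (σ (suc k) ℕ.+ suc i)) ℕ.∸ a (σ (suc k) ℕ.+ i)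

  Valid : ℕ → (ℕ → ℕ) → Set
  Valid N a = Positive a × IncreasingFrom1 a × Progressions N a

  determined : ∀ {N a b} k → N ℕ.≤ k → Valid N a → Valid N b → ∀ m → m ℕ.≤ k →
    AgreeUpTo (suc (σ (suc (suc k)))) a b → AgreeUpTo (suc (σ (suc (suc k))) ℕ.+ m) a b
  determined {N} {a} {b} k N≤k va vb zero m≤k agree = subst (λ z → AgreeUpTo z a b) (sym (ℕ.+-identityʳ (suc (σ (suc (suc k)))))) agree
  determined {N} {a} {b} k N≤k va@(_ , _ , pa) vb@(_ , _ , pb) (suc m) m≤k agree =
    subst (λ z → AgreeUpTo z a b) (sym (ℕ.+-suc (suc S) m))
      (agree-suc (suc S ℕ.+ m) IH (subst (λ z → a z ≡ b z) (trans (ℕ.+-suc S (suc m)) (cong suc (ℕ.+-suc S m)))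
        (trans (pa (suc k) (ℕ.m≤n⇒m≤1+n N≤k) m (s≤s m≤k)) (trans
          (cong₂ ℕ._∸_ (cong₂ ℕ._+_ last last) (IH (S ℕ.+ m) (ℕ.≤-trans (1≤σ (suc (suc k)) (s≤s z≤n)) (ℕ.m≤m+n S m)) (ℕ.n≤1+n (S ℕ.+ m))))
          (sym (pb (suc k) (ℕ.m≤n⇒m≤1+n N≤k) m (s≤s m≤k)))))))
    where
    S = σ (suc (suc k))
    IH : AgreeUpTo (suc S ℕ.+ m) a b
    IH = determined k N≤k va vb m (ℕ.<⇒≤ m≤k) agree
    last : a (S ℕ.+ suc m) ≡ b (S ℕ.+ suc m)
    last = IH (S ℕ.+ suc m) (ℕ.≤-trans (s≤s z≤n) (ℕ.m≤n+m (suc m) S)) (ℕ.≤-reflexive (ℕ.+-suc S m))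

  -- For s = p/q the hypothesis `exponent` reads 2s (f + k)/f ≥ 1 + 1/q: together with the digits
  -- they determine, free digits of product V contribute at most V^(-(1 + 1/q)).
  module _ (em : ∀ ℓ → ExcludedMiddle ℓ) (p q-1 : ℕ) (δ : ℝ) (δ₀ : ℚ) (0<δ₀ : 0ℚ ℚ.< δ₀) (δ₀≤δ : fromℚ δ₀ ⊑ δ)
    (N₀ : ℕ) (exponent : ∀ k → N₀ ℕ.≤ k → suc (suc q-1) ℕ.* freeCount k ℕ.≤ (p ℕ.+ p) ℕ.* (freeCount k ℕ.+ k)) where

    open Covers em p q-1 δ δ₀ δ₀≤δ

    threshold : ℕ
    threshold = proj₁ (weight-small q (s≤s z≤n))

    fineness : ∃[ M ] 2 ℕ.≤ M × (∀ W → M ℕ.≤ W → ι (2 ℕ.* expBound) ℚ.* 1/ᵘ (W ℕ.* W) ℚ.≤ δ₀)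
    fineness =
      let (η , 0<η , small) = scale-small (ι (2 ℕ.* expBound)) δ₀ (0≤ι (2 ℕ.* expBound)) 0<δ₀
          (M , 1≤M , 1/M≤η) = archimedean η 0<η
      in suc M , s≤s 1≤M , λ W M<W → small (1/ᵘ (W ℕ.* W)) (ℚ.≤-trans (1/ᵘ-antimono 1≤M
           (ℕ.≤-trans (ℕ.<⇒≤ M<W) (ℕ.m≤m*n W W {{ℕ.>-nonZero (ℕ.≤-trans (s≤s z≤n) M<W)}}))) 1/M≤η)

    N : ℕ
    N = N₀ ℕ.⊔ (threshold ℕ.⊔ proj₁ fineness)

    N₀≤N : N₀ ℕ.≤ N
    N₀≤N = ℕ.m≤m⊔n N₀ _

    threshold≤N : threshold ℕ.≤ N
    threshold≤N = ℕ.≤-trans (ℕ.m≤m⊔n threshold (proj₁ fineness)) (ℕ.m≤n⊔m N₀ _)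

    fineness≤N : proj₁ fineness ℕ.≤ N
    fineness≤N = ℕ.≤-trans (ℕ.m≤n⊔m threshold (proj₁ fineness)) (ℕ.m≤n⊔m N₀ _)

    module _ (N′ : ℕ) (N≤N′ : N ℕ.≤ N′) where

      AllAgree : ((ℕ → ℕ) → Set) → ℕ → Set
      AllAgree 𝒜 k = ∀ a b → 𝒜 a → 𝒜 b → AgreeUpTo k a b

      -- All members share their first k digits, so the whole set lies within W^(-2) of the
      -- convergent of any one of them. Excluded middle provides such a member or shows that the set
      -- is empty.
      cov-leaf : ∀ 𝒜 k E → N ℕ.≤ k → 1 ℕ.≤ E → (∀ a → 𝒜 a → Valid N′ a) → AllAgree 𝒜 k →
        (∀ a → 𝒜 a → c₀ ℕ.* E ℕ.^ q ℕ.≤ digitProduct a k ℕ.^ (p ℕ.+ p)) → Cov (Pts 𝒜) E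
      cov-leaf 𝒜 k E N≤k 1≤E valid agree cheap = cases (em 0ℓ {∃[ x ] x ∈ Pts 𝒜})
        where
        cases : Dec (∃[ x ] x ∈ Pts 𝒜) → Cov (Pts 𝒜) E
        cases (no none) = cov-empty E λ x x∈ → none (x , x∈)
        cases (yes (_ , w , _ , w∈)) = cov-cylinder (convergent w k) (W ℕ.* W) E (0≤convergent pos k)
          (ℕ.≤-trans (proj₁ (proj₂ fineness)) (ℕ.≤-trans M≤W (ℕ.m≤m*n W W {{ℕ.>-nonZero (1≤digitProduct pos k)}})))
          1≤E (proj₂ (proj₂ fineness) W M≤W)
          (ℕ.≤-trans (cheap w w∈) (ℕ.≤-reflexive (trans (ℕ.^-distribˡ-+-* W p p) (sym (*-^ W W p)))))
          (λ { x (a , pq , a∈) → partialQuotients-close {a} {w} {point x} pq pos k (agree w a w∈ a∈) })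
          where
          pos : Positive w
          pos = proj₁ (valid w w∈)
          W = digitProduct w k
          M≤W : proj₁ fineness ℕ.≤ W
          M≤W = ℕ.≤-trans (ℕ.≤-trans fineness≤N N≤k) (n≤digitProduct pos (proj₁ (proj₂ (valid w w∈))) k)

      split : ((ℕ → ℕ) → Set) → ℕ → ℕ → (ℕ → ℕ) → Set
      split 𝒜 k v a = 𝒜 a × a (suc k) ≡ v

      split-agree : ∀ {𝒜} k v → AllAgree 𝒜 k → AllAgree (split 𝒜 k v) (suc k)
      split-agree k v agree a b (a∈ , av) (b∈ , bv) = agree-suc k (agree a b a∈ b∈) (trans av (sym bv))

      -- The free digits of the group after block k, of which t have been fixed;
      -- g is the gain of 2^q kept back until the first of them is chosen.
      module _ (k : ℕ) (N′≤k : N′ ℕ.≤ k) (Z : ℕ)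
        (continue : ∀ 𝒜 E → 1 ℕ.≤ E → (∀ a → 𝒜 a → Valid N′ a) → AllAgree 𝒜 (blockEnd (suc k)) →
          (∀ a → 𝒜 a → c₀ ℕ.* E ℕ.^ q ℕ.≤ digitProduct a (blockEnd (suc k)) ℕ.^ (p ℕ.+ p) ℕ.* Z) → Cov (Pts 𝒜) E) where

        V : (ℕ → ℕ) → ℕ → ℕ
        V a t = digitProduct (λ j → a (blockEnd k ℕ.+ j)) t

        W : (ℕ → ℕ) → ℕ
        W a = digitProduct a (blockEnd k) ℕ.^ (p ℕ.+ p)

        -- The budget while a group is being read. Digits before the group count with their true
        -- exponent 2p, in `W`; its free digits count with q + 1, as if the digits they determine
        -- had already been read; `Z` is the gain still to come from later groups.
        Affordable : ((ℕ → ℕ) → Set) → ℕ → ℕ → ℕ → Set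
        Affordable 𝒜 E t g = ∀ a → 𝒜 a → c₀ ℕ.* E ℕ.^ q ℕ.≤ V a t ℕ.^ suc q ℕ.* W a ℕ.* (g ℕ.* Z)

        affordable-step : ∀ 𝒜 E t g i → weight i ℕ.^ q ℕ.* g ℕ.≤ suc i ℕ.^ suc q →
          Affordable 𝒜 E t g → Affordable (split 𝒜 (blockEnd k ℕ.+ t) (suc i)) (E ℕ.* weight i) (suc t) 1
        affordable-step 𝒜 E t g i small afford a (a∈ , av) = begin
          c₀ ℕ.* (E ℕ.* weight i) ℕ.^ q                               ≡⟨ cong (c₀ ℕ.*_) (*-^ E (weight i) q) ⟩
          c₀ ℕ.* (E ℕ.^ q ℕ.* weight i ℕ.^ q)                         ≡⟨ ℕ.*-assoc c₀ (E ℕ.^ q) (weight i ℕ.^ q) ⟨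
          c₀ ℕ.* E ℕ.^ q ℕ.* weight i ℕ.^ q                           ≤⟨ ℕ.*-monoˡ-≤ (weight i ℕ.^ q) (afford a a∈) ⟩
          V a t ℕ.^ suc q ℕ.* W a ℕ.* (g ℕ.* Z) ℕ.* weight i ℕ.^ q    ≡⟨ e (V a t ℕ.^ suc q) (W a) g Z (weight i ℕ.^ q) ⟩
          V a t ℕ.^ suc q ℕ.* W a ℕ.* Z ℕ.* (weight i ℕ.^ q ℕ.* g)    ≤⟨ ℕ.*-monoʳ-≤ (V a t ℕ.^ suc q ℕ.* W a ℕ.* Z) small ⟩
          V a t ℕ.^ suc q ℕ.* W a ℕ.* Z ℕ.* suc i ℕ.^ suc q           ≡⟨ e₂ (V a t ℕ.^ suc q) (W a) Z (suc i ℕ.^ suc q) ⟩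
          V a t ℕ.^ suc q ℕ.* suc i ℕ.^ suc q ℕ.* W a ℕ.* (1 ℕ.* Z)   ≡⟨ cong (λ z → z ℕ.* W a ℕ.* (1 ℕ.* Z)) V-suc ⟩
          V a (suc t) ℕ.^ suc q ℕ.* W a ℕ.* (1 ℕ.* Z)                 ∎
          where
          open ℕ.≤-Reasoning
          e : ∀ v w g z y → v ℕ.* w ℕ.* (g ℕ.* z) ℕ.* y ≡ v ℕ.* w ℕ.* z ℕ.* (y ℕ.* g)
          e = ℕRing.solve-∀
          e₂ : ∀ v w z y → v ℕ.* w ℕ.* z ℕ.* y ≡ v ℕ.* y ℕ.* w ℕ.* (1 ℕ.* z)
          e₂ = ℕRing.solve-∀
          V-suc : V a t ℕ.^ suc q ℕ.* suc i ℕ.^ suc q ≡ V a (suc t) ℕ.^ suc q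
          V-suc = trans (sym (*-^ (V a t) (suc i) (suc q))) (cong (ℕ._^ suc q) (sym (trans (digitProduct-snoc (λ j → a (blockEnd k ℕ.+ j)) t)
            (cong (V a t ℕ.*_) (trans (cong a (ℕ.+-suc (blockEnd k) t)) av)))))

        threshold≤position : ∀ t → threshold ℕ.≤ suc (blockEnd k ℕ.+ t)
        threshold≤position t = ℕ.≤-trans threshold≤N (ℕ.≤-trans N≤N′ (ℕ.≤-trans N′≤k (ℕ.≤-trans (k≤blockEnd k) (ℕ.m≤n⇒m≤1+n (ℕ.m≤m+n (blockEnd k) t)))))

        -- Child i fixes the digit i + 1 and receives the share 1/`weight i` of the budget. Digits
        -- below `threshold` do not occur: the n-th digit of an increasing sequence is at least n,
        -- and the position is already beyond `threshold`.
        cov-digit : ∀ 𝒜 E t g → g ℕ.≤ 2 ℕ.^ q → 1 ℕ.≤ E → (∀ a → 𝒜 a → Valid N′ a) → AllAgree 𝒜 (blockEnd k ℕ.+ t) → Affordable 𝒜 E t g →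
          (∀ 𝒜 E → 1 ℕ.≤ E → (∀ a → 𝒜 a → Valid N′ a) → AllAgree 𝒜 (blockEnd k ℕ.+ suc t) → Affordable 𝒜 E (suc t) 1 → Cov (Pts 𝒜) E) →
          Cov (Pts 𝒜) E
        cov-digit 𝒜 E t g g≤ 1≤E valid agree afford rest =
          cov-union (λ i → Pts (split 𝒜 pos (suc i))) weight 1≤E (λ i → 1≤dyadicWeight (level i)) Σweight≤1
            (λ { {x} (a , pq , a∈) → first-digit a (proj₁ (valid a a∈) (suc pos) (s≤s z≤n)) {x} pq a∈ })
            λ i → child i (threshold ℕ.≤? suc i)
          where
          pos = blockEnd k ℕ.+ t
          first-digit : ∀ a → 1 ℕ.≤ a (suc pos) → ∀ {x} → ArePartialQuotients a (point x) → 𝒜 a → ∃[ i ] x ∈ Pts (split 𝒜 pos (suc i))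
          first-digit a 1≤ pq a∈ = ℕ.pred (a (suc pos)) , a , pq , a∈ , sym (ℕ.suc-pred (a (suc pos)) {{ℕ.>-nonZero 1≤}})
          child : ∀ i → Dec (threshold ℕ.≤ suc i) → Cov (Pts (split 𝒜 pos (suc i))) (E ℕ.* weight i)
          child i (yes large) = rest (split 𝒜 pos (suc i)) (E ℕ.* weight i) (1≤* 1≤E (1≤dyadicWeight (level i))) (λ a → valid a ∘ proj₁)
            (subst (AllAgree (split 𝒜 pos (suc i))) (sym (ℕ.+-suc (blockEnd k) t)) (split-agree pos (suc i) agree))
            (affordable-step 𝒜 E t g i (ℕ.≤-trans (ℕ.*-monoʳ-≤ (weight i ℕ.^ q) g≤) (proj₂ (weight-small q (s≤s z≤n)) i large)) afford)
          child i (no small) = cov-empty _ λ { x (a , pq , a∈ , av) → small (ℕ.≤-trans (threshold≤position t)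
            (subst (suc pos ℕ.≤_) av (n≤digit (proj₁ (valid a a∈)) (proj₁ (proj₂ (valid a a∈))) (suc pos) (s≤s z≤n)))) }

        -- `group-inequality`, with the last free digit as M, trades the exponent q + 1 on the free
        -- digits for the true exponent 2p on the free and determined digits together.
        finish : ∀ 𝒜 E → 1 ℕ.≤ E → (∀ a → 𝒜 a → Valid N′ a) → AllAgree 𝒜 (blockEnd k ℕ.+ freeCount k) → Affordable 𝒜 E (freeCount k) 1 → Cov (Pts 𝒜) E
        finish 𝒜 E 1≤E valid agree afford = continue 𝒜 E 1≤E valid
          (λ a b a∈ b∈ → subst (λ z → AgreeUpTo z a b) (trans (cong (ℕ._+ k) (sym (blockEnd+freeCount k))) (blockEnd-suc k))
            (determined k N′≤k (valid a a∈) (valid b b∈) k ℕ.≤-refl (subst (λ z → AgreeUpTo z a b) (blockEnd+freeCount k) (agree a b a∈ b∈))))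
          afford′
          where
          afford′ : ∀ a → 𝒜 a → c₀ ℕ.* E ℕ.^ q ℕ.≤ digitProduct a (blockEnd (suc k)) ℕ.^ (p ℕ.+ p) ℕ.* Z
          afford′ a a∈ = begin
            c₀ ℕ.* E ℕ.^ q                                          ≤⟨ afford a a∈ ⟩
            V a f ℕ.^ suc q ℕ.* W a ℕ.* (1 ℕ.* Z)                   ≤⟨ ℕ.*-monoˡ-≤ (1 ℕ.* Z) (ℕ.*-monoˡ-≤ (W a) ineq) ⟩
            (V a f ℕ.* D) ℕ.^ (p ℕ.+ p) ℕ.* W a ℕ.* (1 ℕ.* Z)       ≡⟨ cong₂ ℕ._*_ (trans (ℕ.*-comm _ (W a)) (sym (*-^ (digitProduct a (blockEnd k)) (V a f ℕ.* D) (p ℕ.+ p)))) (ℕ.*-identityˡ Z) ⟩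
            (digitProduct a (blockEnd k) ℕ.* (V a f ℕ.* D)) ℕ.^ (p ℕ.+ p) ℕ.* Z ≡⟨ cong (λ z → z ℕ.^ (p ℕ.+ p) ℕ.* Z) product ⟩
            digitProduct a (blockEnd (suc k)) ℕ.^ (p ℕ.+ p) ℕ.* Z   ∎
            where
            open ℕ.≤-Reasoning
            f = freeCount k
            D = digitProduct (λ j → a (blockEnd k ℕ.+ f ℕ.+ j)) k
            M = a (blockEnd k ℕ.+ f)
            inc = proj₁ (proj₂ (valid a a∈))
            pos = proj₁ (valid a a∈)
            ineq : V a f ℕ.^ suc q ℕ.≤ (V a f ℕ.* D) ℕ.^ (p ℕ.+ p)
            ineq = group-inequality {p ℕ.+ p} {suc q} {f} {k} {M} (1≤freeCount k) (1≤digitProduct (λ j 1≤j → pos _ (ℕ.≤-trans 1≤j (ℕ.m≤n+m j (blockEnd k)))) f)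
              (digitProduct-≤ _ M f λ j 1≤j j≤f → increasing-≤ inc (ℕ.≤-trans 1≤j (ℕ.m≤n+m j (blockEnd k))) (ℕ.+-monoʳ-≤ (blockEnd k) j≤f))
              (digitProduct-≥ _ M k λ j 1≤j j≤k → increasing-≤ inc (ℕ.≤-trans (1≤freeCount k) (ℕ.m≤n+m f (blockEnd k))) (ℕ.m≤m+n (blockEnd k ℕ.+ f) j))
              (exponent k (ℕ.≤-trans N₀≤N (ℕ.≤-trans N≤N′ N′≤k)))
            product : digitProduct a (blockEnd k) ℕ.* (V a f ℕ.* D) ≡ digitProduct a (blockEnd (suc k))
            product = trans (sym (ℕ.*-assoc (digitProduct a (blockEnd k)) (V a f) D))
              (trans (cong (ℕ._* D) (sym (digitProduct-+ a (blockEnd k) f)))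
                (trans (sym (digitProduct-+ a (blockEnd k ℕ.+ f) k)) (cong (digitProduct a) (blockEnd-suc k))))

        cov-free : ∀ i t → i ℕ.+ t ≡ freeCount k → ∀ 𝒜 E → 1 ℕ.≤ E → (∀ a → 𝒜 a → Valid N′ a) → AllAgree 𝒜 (blockEnd k ℕ.+ t) → Affordable 𝒜 E t 1 → Cov (Pts 𝒜) E
        cov-free zero    t refl 𝒜 E = finish 𝒜 E
        cov-free (suc i) t eq 𝒜 E 1≤E valid agree afford = cov-digit 𝒜 E t 1 (1≤^ {2} q (s≤s z≤n)) 1≤E valid agree afford
          (cov-free i (suc t) (trans (ℕ.+-suc i t) eq))

        cov-group : ∀ 𝒜 E → 1 ℕ.≤ E → (∀ a → 𝒜 a → Valid N′ a) → AllAgree 𝒜 (blockEnd k) →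
          (∀ a → 𝒜 a → c₀ ℕ.* E ℕ.^ q ℕ.≤ W a ℕ.* (2 ℕ.^ q ℕ.* Z)) → Cov (Pts 𝒜) E
        cov-group 𝒜 E 1≤E valid agree afford = cov-digit 𝒜 E 0 (2 ℕ.^ q) ℕ.≤-refl 1≤E valid
          (subst (AllAgree 𝒜) (sym (ℕ.+-identityʳ (blockEnd k))) agree)
          (λ a a∈ → subst (c₀ ℕ.* E ℕ.^ q ℕ.≤_) (cong (ℕ._* (2 ℕ.^ q ℕ.* Z)) (sym (trans (cong (ℕ._* W a) (ℕ.^-zeroˡ (suc q))) (ℕ.*-identityˡ (W a))))) (afford a a∈))
          (cov-free (ℕ.pred (freeCount k)) 1 (trans (ℕ.+-comm (ℕ.pred (freeCount k)) 1) (ℕ.suc-pred (freeCount k) {{ℕ.>-nonZero (1≤freeCount k)}})))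

      cov-groups : ∀ R k → N′ ℕ.≤ k → ∀ 𝒜 E → 1 ℕ.≤ E → (∀ a → 𝒜 a → Valid N′ a) → AllAgree 𝒜 (blockEnd k) →
        (∀ a → 𝒜 a → c₀ ℕ.* E ℕ.^ q ℕ.≤ digitProduct a (blockEnd k) ℕ.^ (p ℕ.+ p) ℕ.* (2 ℕ.^ q) ℕ.^ R) → Cov (Pts 𝒜) E
      cov-groups zero    k N′≤k 𝒜 E 1≤E valid agree afford = cov-leaf 𝒜 (blockEnd k) E
        (ℕ.≤-trans N≤N′ (ℕ.≤-trans N′≤k (k≤blockEnd k))) 1≤E valid agree
        (λ a a∈ → subst (c₀ ℕ.* E ℕ.^ q ℕ.≤_) (ℕ.*-identityʳ _) (afford a a∈))
      cov-groups (suc R) k N′≤k = cov-group k N′≤k ((2 ℕ.^ q) ℕ.^ R) (cov-groups R (suc k) (ℕ.m≤n⇒m≤1+n N′≤k))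

      -- Reading c₀ + E groups collects (2^q)^(c₀ + E), which exceeds c₀ E^q whatever the digits
      -- before the first group are.
      cov-anchored : ∀ 𝒜 E → 1 ℕ.≤ E → (∀ a → 𝒜 a → Valid N′ a) → AllAgree 𝒜 (blockEnd N′) → Cov (Pts 𝒜) E
      cov-anchored 𝒜 E 1≤E valid agree = cov-groups (c₀ ℕ.+ E) N′ ℕ.≤-refl 𝒜 E 1≤E valid agree λ a a∈ → begin
        c₀ ℕ.* E ℕ.^ q                        ≤⟨ ℕ.*-mono-≤ c₀≤ (ℕ.^-monoˡ-≤ q (ℕ.<⇒≤ (n<2^n E))) ⟩
        (2 ℕ.^ c₀) ℕ.^ q ℕ.* (2 ℕ.^ E) ℕ.^ q  ≡⟨ *-^ (2 ℕ.^ c₀) (2 ℕ.^ E) q ⟨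
        (2 ℕ.^ c₀ ℕ.* 2 ℕ.^ E) ℕ.^ q          ≡⟨ cong (ℕ._^ q) (ℕ.^-distribˡ-+-* 2 c₀ E) ⟨
        (2 ℕ.^ (c₀ ℕ.+ E)) ℕ.^ q              ≡⟨ trans (ℕ.^-*-assoc 2 (c₀ ℕ.+ E) q) (trans (cong (2 ℕ.^_) (ℕ.*-comm (c₀ ℕ.+ E) q)) (sym (ℕ.^-*-assoc 2 q (c₀ ℕ.+ E)))) ⟩
        (2 ℕ.^ q) ℕ.^ (c₀ ℕ.+ E)              ≤⟨ ℕ.m≤n*m _ (digitProduct a (blockEnd N′) ℕ.^ (p ℕ.+ p)) {{ℕ.>-nonZero (1≤^ (p ℕ.+ p) (1≤digitProduct (proj₁ (valid a a∈)) (blockEnd N′)))}} ⟩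
        digitProduct a (blockEnd N′) ℕ.^ (p ℕ.+ p) ℕ.* (2 ℕ.^ q) ℕ.^ (c₀ ℕ.+ E) ∎
        where
        open ℕ.≤-Reasoning
        c₀≤ : c₀ ℕ.≤ (2 ℕ.^ c₀) ℕ.^ q
        c₀≤ = ℕ.≤-trans (ℕ.<⇒≤ (n<2^n c₀)) (ℕ.m≤m*n (2 ℕ.^ c₀) ((2 ℕ.^ c₀) ℕ.^ q-1) {{ℕ.>-nonZero (1≤^ q-1 (1≤^ {2} c₀ (s≤s z≤n)))}})

      -- Since `cov-anchored` meets every budget, the finitely many initial digits may split it in
      -- any summable way, regardless of their size.
      cov-prefix : ∀ m k → m ℕ.+ k ≡ blockEnd N′ → ∀ 𝒜 E → 1 ℕ.≤ E → (∀ a → 𝒜 a → Valid N′ a) → AllAgree 𝒜 k → Cov (Pts 𝒜) E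
      cov-prefix zero    k refl 𝒜 E 1≤E valid agree = cov-anchored 𝒜 E 1≤E valid agree
      cov-prefix (suc m) k eq 𝒜 E 1≤E valid agree =
        cov-union (λ i → Pts (split 𝒜 k i)) geometric 1≤E (λ i → 1≤^ {2} (suc i) (s≤s z≤n)) Σgeometric≤1
          (λ { (a , pq , a∈) → a (suc k) , a , pq , a∈ , refl })
          λ i → cov-prefix m (suc k) (trans (ℕ.+-suc m k) eq) (split 𝒜 k i) (E ℕ.* geometric i) (1≤* 1≤E (1≤^ {2} (suc i) (s≤s z≤n)))
            (λ a → valid a ∘ proj₁) (split-agree k i agree)

      cov-valid : ∀ E → 1 ℕ.≤ E → Cov (Pts (Valid N′)) E
      cov-valid E 1≤E = cov-prefix (blockEnd N′) 0 (ℕ.+-identityʳ _) (Valid N′) E 1≤E (λ _ v → v)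
        (λ a b _ _ j 1≤j j≤0 → ⊥-elim (ℕ.<-irrefl refl (ℕ.≤-trans 1≤j j≤0)))

    -- One part for each index from which the progressions hold, shifted by `N` so that every part
    -- starts late enough. The digit sequence witnessing membership in `J` and the one carrying the
    -- progressions agree by uniqueness.
    G⊆ : G σ ⊆ ⋃ ℕ (λ i → Pts (Valid (i ℕ.+ N)))
    G⊆ {x} ((_ , _ , _ , a , pqa , inc) , b , pqb , M , progression) = M , a , pqa , proj₁ pqa , inc , rule
      where
      same : ∀ j → 1 ℕ.≤ j → a j ≡ b j
      same j 1≤j = partialQuotients-unique {a} {b} {point x} pqa pqb j j 1≤j ℕ.≤-refl
      rule : Progressions (M ℕ.+ N) a
      rule k M≤k i i<k = trans (at (suc (suc i)))
        (trans (progression-rule (λ j → b (σ (suc k) ℕ.+ j)) (progression (suc k) (ℕ.m≤n⇒m≤1+n (ℕ.≤-trans (ℕ.m≤m+n M N) M≤k)) (s≤s z≤n)) i (s≤s i<k))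
          (sym (cong₂ ℕ._∸_ (cong₂ ℕ._+_ (at (suc i)) (at (suc i))) (at i))))
        where
        at : ∀ i → a (σ (suc k) ℕ.+ i) ≡ b (σ (suc k) ℕ.+ i)
        at i = same _ (ℕ.≤-trans (1≤σ (suc k) (s≤s z≤n)) (ℕ.m≤m+n (σ (suc k)) i))
        progression-rule : ∀ (c : ℕ → ℕ) {n} → IsArithmeticProgression {n} (λ i → c (toℕ i)) → ∀ i → suc (suc i) ℕ.< n →
          c (suc (suc i)) ≡ (c (suc i) ℕ.+ c (suc i)) ℕ.∸ c i
        progression-rule c {n} (s , d , h) i i<n = sym (trans (cong (ℕ._∸ c i) (ℤ.+-injective sum≡)) (ℕ.m+n∸n≡m (c (suc (suc i))) (c i)))
          where
          term-at : ∀ j → j ℕ.< n → + c j ≡ s ℤ.+ + j ℤ.* d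
          term-at j j<n = subst (λ z → + c z ≡ s ℤ.+ + z ℤ.* d) (toℕ-fromℕ< j<n) (h (fromℕ< j<n))
          e : ∀ s d i → (s ℤ.+ (+ 1 ℤ.+ i) ℤ.* d) ℤ.+ (s ℤ.+ (+ 1 ℤ.+ i) ℤ.* d) ≡ (s ℤ.+ (+ 2 ℤ.+ i) ℤ.* d) ℤ.+ (s ℤ.+ i ℤ.* d)
          e = ℤRing.solve-∀
          sum≡ : + (c (suc i) ℕ.+ c (suc i)) ≡ + (c (suc (suc i)) ℕ.+ c i)
          sum≡ = trans (cong₂ ℤ._+_ (term-at (suc i) (ℕ.<⇒≤ i<n)) (term-at (suc i) (ℕ.<⇒≤ i<n)))
            (trans (e s d (+ i)) (sym (cong₂ ℤ._+_ (term-at (suc (suc i)) i<n) (term-at i (ℕ.<⇒≤ (ℕ.<⇒≤ i<n))))))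

    cov-G : ∀ E → 1 ℕ.≤ E → Cov (G σ) E
    cov-G E 1≤E = cov-union (λ i → Pts (Valid (i ℕ.+ N))) geometric 1≤E (λ i → 1≤^ {2} (suc i) (s≤s z≤n)) Σgeometric≤1 (λ {x} → G⊆ {x})
      λ i → cov-valid (i ℕ.+ N) (ℕ.m≤n+m N i) (E ℕ.* geometric i) (1≤* 1≤E (1≤^ {2} (suc i) (s≤s z≤n)))

  null-above : (∀ ℓ → ExcludedMiddle ℓ) → ∀ p q-1 N₀ →
    (∀ k → N₀ ℕ.≤ k → suc (suc q-1) ℕ.* freeCount k ℕ.≤ (p ℕ.+ p) ℕ.* (freeCount k ℕ.+ k)) →
    IsHausdorffMeasure (fromℚ (fraction p (suc q-1))) (G σ) (fin 0ℝ)
  null-above em p q-1 N₀ exponent = cheap-covers⇒null (fromℚ (fraction p (suc q-1))) λ δ 0<δ E 1≤E →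
    let (δ₀ , 0<δ₀ , δ₀<δ) = dense {0ℝ} {δ} 0<δ
        δ₀≤δ = <⇒⊑ (fromℚ δ₀) δ δ₀<δ
    in Covers.cov⇒CoverSum em p q-1 δ δ₀ δ₀≤δ (cov-G em p q-1 δ δ₀ (fromℚ-cancel-< {0ℚ} {δ₀} 0<δ₀) δ₀≤δ N₀ exponent E 1≤E)

-- Avoiding countably many cylinders

sum-single : ∀ f v₀ c → 0ℚ ℚ.≤ c → f v₀ ℚ.≤ c → (∀ v → v ≢ v₀ → f v ≡ 0ℚ) → ∀ n → sum f n ℚ.≤ c
sum-single f v₀ c 0≤c fv₀≤c off n = go n (n ℕ.≤? v₀)
  where
  zeros : ∀ n → n ℕ.≤ v₀ → sum f n ≡ 0ℚ
  zeros zero    _ = refl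
  zeros (suc n) h = trans (cong₂ ℚ._+_ (zeros n (ℕ.<⇒≤ h)) (off n (ℕ.<⇒≢ h))) (ℚ.+-identityʳ 0ℚ)
  go : ∀ n → Dec (n ℕ.≤ v₀) → sum f n ℚ.≤ c
  go n (yes h) = subst (ℚ._≤ c) (sym (zeros n h)) 0≤c
  go zero (no h) = 0≤c
  go (suc n) (no h) with n ℕ.≟ v₀
  ... | yes refl = subst (ℚ._≤ c) (sym (trans (cong (ℚ._+ f v₀) (zeros v₀ ℕ.≤-refl)) (ℚ.+-identityˡ (f v₀)))) fv₀≤c
  ... | no n≢v₀  = subst (ℚ._≤ c) (sym (trans (cong (sum f n ℚ.+_) (off n n≢v₀)) (ℚ.+-identityʳ (sum f n))))
                     (go n (no λ n≤v₀ → h (ℕ.≤∧≢⇒< n≤v₀ n≢v₀)))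

sum-swap : ∀ (f : ℕ → ℕ → ℚ) m n → sum (λ i → sum (f i) n) m ≡ sum (λ j → sum (λ i → f i j) m) n
sum-swap f zero    n = sym (empty-sum n)
sum-swap f (suc m) n = trans (cong (ℚ._+ sum (f m) n) (sum-swap f m n)) (sym (sum-+ (λ j → sum (λ i → f i j) m) (f m) n))

sum-<-nonempty : ∀ f c n → 1 ℕ.≤ n → (∀ i → i ℕ.< n → c ℚ.< f i) → ι n ℚ.* c ℚ.< sum f n
sum-<-nonempty f c (suc zero) _ h = subst₂ ℚ._<_ (sym (trans (cong (ℚ._* c) ι1) (ℚ.*-identityˡ c))) (sym (ℚ.+-identityˡ (f 0))) (h 0 (s≤s z≤n))
sum-<-nonempty f c (suc (suc n)) _ h = subst (ℚ._< sum f (suc (suc n))) (trans (e (ι (suc n)) c) (cong (ℚ._* c) (sym (ι-suc (suc n)))))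
  (ℚ.+-mono-< (sum-<-nonempty f c (suc n) (s≤s z≤n) (λ i i<n → h i (ℕ.m≤n⇒m≤1+n i<n))) (h (suc n) ℕ.≤-refl))
  where
  e : ∀ n c → n ℚ.* c ℚ.+ c ≡ (1ℚ ℚ.+ n) ℚ.* c
  e = solve-∀ ℚring

sumℕ : (ℕ → ℕ) → ℕ → ℕ
sumℕ b zero    = 0
sumℕ b (suc k) = sumℕ b k ℕ.+ b (suc k)

update : (ℕ → ℕ) → ℕ → ℕ → ℕ → ℕ
update g k v j with j ℕ.≟ k
... | yes _ = v
... | no _  = g j

update-same : ∀ g k v → update g k v k ≡ v
update-same g k v with k ℕ.≟ k
... | yes _ = refl
... | no k≢k = ⊥-elim (k≢k refl)

update-other : ∀ g k v j → j ≢ k → update g k v j ≡ g j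
update-other g k v j j≢k with j ℕ.≟ k
... | yes eq = ⊥-elim (j≢k eq)
... | no _   = refl

update-below : ∀ g k v → AgreeUpTo k (update g (suc k) v) g
update-below g k v j _ j≤k = update-other g (suc k) v j λ { refl → ℕ.<-irrefl refl j≤k }

AgreeUpTo-trans : ∀ {k a b c} → AgreeUpTo k a b → AgreeUpTo k b c → AgreeUpTo k a c
AgreeUpTo-trans h h′ j 1≤j j≤k = trans (h j 1≤j j≤k) (h′ j 1≤j j≤k)

AgreeUpTo-sym : ∀ {k a b} → AgreeUpTo k a b → AgreeUpTo k b a
AgreeUpTo-sym h j 1≤j j≤k = sym (h j 1≤j j≤k)

AgreeUpTo-≤ : ∀ {k l a b} → k ℕ.≤ l → AgreeUpTo l a b → AgreeUpTo k a b
AgreeUpTo-≤ k≤l h j 1≤j j≤k = h j 1≤j (ℕ.≤-trans j≤k k≤l)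

WithinBounds : (ℕ → ℕ) → (ℕ → ℕ) → Set
WithinBounds b g = ∀ j → 1 ℕ.≤ j → g j ℕ.< 2 ℕ.^ b j

-- A path through the tree with 2^(b k) branches at level k that leaves the
-- prefix f i before level κ i, for every i: descend so that the mass of the
-- forbidden prefixes below the current node stays at most half its own mass.
module Avoid (em : ∀ ℓ → ExcludedMiddle ℓ) (b : ℕ → ℕ) (κ : ℕ → ℕ) (f : ℕ → ℕ → ℕ)
  (light : ∀ n → sum (λ i → 1/ᵘ (2 ℕ.^ sumℕ b (κ i))) n ℚ.≤ ½) where

  open Classical em

  mass : ℕ → ℚ
  mass k = 1/ᵘ (2 ℕ.^ sumℕ b k)

  Live : ℕ → (ℕ → ℕ) → ℕ → Set
  Live k g i = k ℕ.≤ κ i × AgreeUpTo k g (f i)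

  decided : ∀ {P : Set} → Dec P → ℚ → ℚ
  decided (yes _) x = x
  decided (no _)  x = 0ℚ

  decided-yes : ∀ {P : Set} (d : Dec P) x → P → decided d x ≡ x
  decided-yes (yes _) x p = refl
  decided-yes (no ¬p) x p = ⊥-elim (¬p p)

  decided-no : ∀ {P : Set} (d : Dec P) x → ¬ P → decided d x ≡ 0ℚ
  decided-no (yes p) x ¬p = ⊥-elim (¬p p)
  decided-no (no _)  x ¬p = refl

  0≤decided : ∀ {P : Set} (d : Dec P) x → 0ℚ ℚ.≤ x → 0ℚ ℚ.≤ decided d x
  0≤decided (yes _) x h = h
  0≤decided (no _)  x h = ℚ.≤-refl

  decided≤ : ∀ {P : Set} (d : Dec P) x → 0ℚ ℚ.≤ x → decided d x ℚ.≤ x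
  decided≤ (yes _) x h = ℚ.≤-refl
  decided≤ (no _)  x h = h

  0≤mass : ∀ k → 0ℚ ℚ.≤ mass k
  0≤mass k = 0≤1/ᵘ _

  burden : ℕ → (ℕ → ℕ) → ℕ → ℚ
  burden k g i = decided (em 0ℓ {Live k g i}) (mass (κ i))

  0≤burden : ∀ k g i → 0ℚ ℚ.≤ burden k g i
  0≤burden k g i = 0≤decided (em 0ℓ {Live k g i}) (mass (κ i)) (0≤mass (κ i))

  Light : ℕ → (ℕ → ℕ) → Set
  Light k g = ∀ n → sum (burden k g) n ℚ.≤ ½ ℚ.* mass k

  child : (ℕ → ℕ) → ℕ → ℕ → ℕ → ℕ
  child g k v = update g (suc k) v

  -- Among the children only v = f i (k + 1) can still agree with the prefix `f i`.
  children-burden : ∀ g k i n → sum (λ v → burden (suc k) (child g k v) i) n ℚ.≤ burden k g i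
  children-burden g k i n = sum-single (λ v → burden (suc k) (child g k v) i) (f i (suc k)) (burden k g i) (0≤burden k g i)
    (one (em 0ℓ {Live (suc k) (child g k (f i (suc k))) i}))
    (λ v v≢ → decided-no (em 0ℓ {Live (suc k) (child g k v) i}) (mass (κ i))
      λ (_ , agree) → v≢ (trans (sym (update-same g (suc k) v)) (agree (suc k) (s≤s z≤n) ℕ.≤-refl))) n
    where
    one : (d : Dec (Live (suc k) (child g k (f i (suc k))) i)) → decided d (mass (κ i)) ℚ.≤ burden k g i
    one (no _) = 0≤burden k g i
    one (yes (k<κ , agree)) = ℚ.≤-reflexive (sym (decided-yes (em 0ℓ {Live k g i}) (mass (κ i))
      (ℕ.<⇒≤ k<κ , AgreeUpTo-trans (AgreeUpTo-sym (update-below g k (f i (suc k)))) (AgreeUpTo-≤ (ℕ.n≤1+n k) agree))))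

  mass-suc : ∀ k → ι (2 ℕ.^ b (suc k)) ℚ.* (½ ℚ.* mass (suc k)) ≡ ½ ℚ.* mass k
  mass-suc k = trans (cong (λ z → ι B ℚ.* (½ ℚ.* z)) (trans (cong 1/ᵘ (ℕ.^-distribˡ-+-* 2 (sumℕ b k) (b (suc k))))
      (1/ᵘ-mul (1≤^ {2} (sumℕ b k) (s≤s z≤n)) 1≤B)))
    (trans (e (ι B) (mass k) (1/ᵘ B)) (trans (cong (ℚ._* (½ ℚ.* mass k)) (1/ᵘ-* 1≤B)) (ℚ.*-identityˡ (½ ℚ.* mass k))))
    where
    B = 2 ℕ.^ b (suc k)
    1≤B : 1 ℕ.≤ B
    1≤B = 1≤^ {2} (b (suc k)) (s≤s z≤n)
    e : ∀ b m u → b ℚ.* (½ ℚ.* (m ℚ.* u)) ≡ (u ℚ.* b) ℚ.* (½ ℚ.* m)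
    e = solve-∀ ℚring

  maximum : (ℕ → ℕ) → ℕ → ℕ
  maximum h zero    = 0
  maximum h (suc n) = maximum h n ℕ.⊔ h n

  ≤maximum : ∀ h n i → i ℕ.< n → h i ℕ.≤ maximum h n
  ≤maximum h (suc n) i (s≤s i≤n) with ℕ.m≤n⇒m<n∨m≡n i≤n
  ... | inj₁ i<n = ℕ.≤-trans (≤maximum h n i i<n) (ℕ.m≤m⊔n (maximum h n) (h n))
  ... | inj₂ refl = ℕ.m≤n⊔m (maximum h n) (h n)

  -- If every child carried more than half its own mass in forbidden prefixes, these burdens would
  -- add up to more than half the mass of the parent, while no prefix is counted at two children.
  light-child : ∀ k g → Light k g → ∃[ v ] v ℕ.< 2 ℕ.^ b (suc k) × Light (suc k) (child g k v)
  light-child k g light-g = by-contradiction λ none → ℚ.<-irrefl refl (ℚ.<-≤-trans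
    (too-heavy (heavy none)) (light-g (maximum (λ v → proj₁ (heavy none v)) B)))
    where
    B = 2 ℕ.^ b (suc k)
    Heavy : ℕ → Set
    Heavy v = ∃[ n ] (v ℕ.< B → ½ ℚ.* mass (suc k) ℚ.< sum (burden (suc k) (child g k v)) n)
    heavy : ¬ (∃[ v ] v ℕ.< B × Light (suc k) (child g k v)) → ∀ v → Heavy v
    heavy none v with v ℕ.<? B
    ... | no v≮B  = 0 , λ v<B → ⊥-elim (v≮B v<B)
    ... | yes v<B = let (n , h) = ¬∀⇒∃ {A = ℕ} (λ l → none (v , v<B , l)) in n , λ _ → ℚ.≰⇒> h
    too-heavy : (h : ∀ v → Heavy v) → ½ ℚ.* mass k ℚ.< sum (burden k g) (maximum (λ v → proj₁ (h v)) B)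
    too-heavy h = ℚ.<-≤-trans
      (subst (ℚ._< sum (λ v → sum (burden (suc k) (child g k v)) n) B) (mass-suc k)
        (sum-<-nonempty (λ v → sum (burden (suc k) (child g k v)) n) (½ ℚ.* mass (suc k)) B (1≤^ {2} (b (suc k)) (s≤s z≤n))
          (λ v v<B → ℚ.<-≤-trans (proj₂ (h v) v<B) (sum-grow (0≤burden (suc k) (child g k v)) (≤maximum (λ v → proj₁ (h v)) B v v<B)))))
      (ℚ.≤-trans (ℚ.≤-reflexive (sum-swap (λ v → burden (suc k) (child g k v)) B n)) (sum-mono n λ i → children-burden g k i B))
      -- One length for all children: partial sums only grow, so every child that is heavy at its
      -- own length is heavy at the maximum.
      where n = maximum (λ v → proj₁ (h v)) B

  root-light : Light 0 (λ _ → 0)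
  root-light n = ℚ.≤-trans (sum-mono n λ i → decided≤ (em 0ℓ {Live 0 (λ _ → 0) i}) (mass (κ i)) (0≤mass (κ i)))
    (ℚ.≤-trans (light n) (ℚ.≤-reflexive (trans (sym (ℚ.*-identityʳ ½)) (cong (½ ℚ.*_) (sym 1/ᵘ-one)))))

  descend : ∀ k → Σ (ℕ → ℕ) (Light k)
  descend zero    = (λ _ → 0) , root-light
  descend (suc k) = let (g , l) = descend k; (v , _ , l′) = light-child k g l in child g k v , l′

  path : ℕ → ℕ
  path j = proj₁ (descend j) j

  path-agrees : ∀ k → AgreeUpTo k path (proj₁ (descend k))
  path-agrees zero    j 1≤j j≤0 = ⊥-elim (ℕ.<-irrefl refl (ℕ.≤-trans 1≤j j≤0))
  path-agrees (suc k) = agree-suc k (AgreeUpTo-trans (path-agrees k) (AgreeUpTo-sym (update-below (proj₁ (descend k)) k _))) refl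

  path-bounded : WithinBounds b path
  path-bounded (suc k) _ = let (v , v<B , _) = light-child k (proj₁ (descend k)) (proj₂ (descend k)) in
    subst (ℕ._< 2 ℕ.^ b (suc k)) (sym (update-same (proj₁ (descend k)) (suc k) v)) v<B

  -- At level κ i an agreeing prefix would burden the node with its whole mass, whereas at most half
  -- is allowed.
  path-avoids : ∀ i → ¬ AgreeUpTo (κ i) path (f i)
  path-avoids i agree = ℚ.<-irrefl refl (ℚ.<-≤-trans
    (subst (½ ℚ.* mass k ℚ.<_) (ℚ.*-identityˡ (mass k)) (ℚ.*-monoˡ-<-pos (mass k) {{ℚ.positive (0<1/ᵘ (1≤^ {2} (sumℕ b k) (s≤s z≤n)))}} ½<1))
    (ℚ.≤-trans (ℚ.≤-trans (ℚ.≤-reflexive (sym (decided-yes (em 0ℓ {Live k g i}) (mass k) (ℕ.≤-refl , AgreeUpTo-trans (AgreeUpTo-sym (path-agrees k)) agree))))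
      (≤-by (sum (burden k g) i) (sum-nonneg i (0≤burden k g)) (ℚ.+-comm (sum (burden k g) i) (burden k g i))))
      (proj₂ (descend k) (suc i))))
    where
    k = κ i
    g = proj₁ (descend k)
    ½<1 : ½ ℚ.< 1ℚ
    ½<1 = toWitness {a? = ½ ℚ.<? 1ℚ} _

-- A Cantor set inside G σ

-- The product of the caps 2·4^j over j ≤ k is 2^(k² + 2k); squaring it and adding the factor ½ of
-- `separation` gives this exponent.
gapExponent : ℕ → ℕ
gapExponent k = suc (2 ℕ.* (k ℕ.* k) ℕ.+ 4 ℕ.* k)

digitCap : ℕ → ℕ
digitCap j = 2 ℕ.* 4 ℕ.^ j

digitProduct-cap : ∀ k → digitProduct digitCap k ≡ 2 ℕ.^ (k ℕ.* k ℕ.+ 2 ℕ.* k)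
digitProduct-cap zero    = refl
digitProduct-cap (suc k) = trans (digitProduct-snoc digitCap k) (trans
  (cong₂ ℕ._*_ (digitProduct-cap k) (cong (2 ℕ.*_) (ℕ.^-*-assoc 2 2 (suc k))))
  (trans (sym (ℕ.^-distribˡ-+-* 2 (k ℕ.* k ℕ.+ 2 ℕ.* k) (suc (2 ℕ.* suc k)))) (cong (2 ℕ.^_) (e k))))
  where
  e : ∀ k → k ℕ.* k ℕ.+ 2 ℕ.* k ℕ.+ suc (2 ℕ.* suc k) ≡ suc k ℕ.* suc k ℕ.+ 2 ℕ.* suc k
  e = ℕRing.solve-∀

separation-cap : ∀ k → separation digitCap k ≡ 1/ᵘ (2 ℕ.^ gapExponent k)
separation-cap k = trans (cong₂ ℚ._*_ ½≡ (cong 1/ᵘ (trans (cong₂ ℕ._*_ (digitProduct-cap k) (digitProduct-cap k))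
    (trans (sym (ℕ.^-distribˡ-+-* 2 (k ℕ.* k ℕ.+ 2 ℕ.* k) (k ℕ.* k ℕ.+ 2 ℕ.* k))) (cong (2 ℕ.^_) (e k))))))
  (sym (1/ᵘ-mul {2} {2 ℕ.^ (2 ℕ.* (k ℕ.* k) ℕ.+ 4 ℕ.* k)} (s≤s z≤n) (1≤^ {2} (2 ℕ.* (k ℕ.* k) ℕ.+ 4 ℕ.* k) (s≤s z≤n))))
  where
  e : ∀ k → k ℕ.* k ℕ.+ 2 ℕ.* k ℕ.+ (k ℕ.* k ℕ.+ 2 ℕ.* k) ≡ 2 ℕ.* (k ℕ.* k) ℕ.+ 4 ℕ.* k
  e = ℕRing.solve-∀

1/2^-antimono : ∀ {m n} → m ℕ.≤ n → 1/ᵘ (2 ℕ.^ n) ℚ.≤ 1/ᵘ (2 ℕ.^ m)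
1/2^-antimono {m} h = 1/ᵘ-antimono (1≤^ {2} m (s≤s z≤n)) (ℕ.^-monoʳ-≤ 2 h)

gapExponent-mono : ∀ {m n} → m ℕ.≤ n → gapExponent m ℕ.≤ gapExponent n
gapExponent-mono h = s≤s (ℕ.+-mono-≤ (ℕ.*-monoʳ-≤ 2 (ℕ.*-mono-≤ h h)) (ℕ.*-monoʳ-≤ 4 h))

n≤gapExponent : ∀ n → n ℕ.≤ gapExponent n
n≤gapExponent n = ℕ.m≤n⇒m≤1+n (ℕ.≤-trans (ℕ.m≤n*m n 4) (ℕ.m≤n+m (4 ℕ.* n) (2 ℕ.* (n ℕ.* n))))

module CantorSet (em : ∀ ℓ → ExcludedMiddle ℓ) (σ : ℕ → ℕ) (1≤σ : ∀ n → 1 ℕ.≤ n → 0 ℕ.< σ n) where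

  -- With the difference fixed to 1 only the first term of a progression is free, so the determined
  -- positions begin right after σ (k + 1).
  Determined : ℕ → Set
  Determined j = ∃[ k ] σ (suc k) ℕ.< j × j ℕ.≤ σ (suc k) ℕ.+ k

  determined? : ∀ j → Dec (Determined j)
  determined? j = em 0ℓ

  -- The j-th digit admits 2 ^ branching j choices: at free positions it ranges
  -- over [4^j, 2·4^j), at the others it exceeds its predecessor by one.
  branching′ : ∀ j → Dec (Determined j) → ℕ
  branching′ j (yes _) = 0
  branching′ j (no _)  = 2 ℕ.* j

  branching : ℕ → ℕ
  branching j = branching′ j (determined? j)

  digit′ : ∀ j → Dec (Determined j) → (previous choice : ℕ) → ℕ
  digit′ j (yes _) previous choice = suc previous
  digit′ j (no _)  previous choice = 4 ℕ.^ j ℕ.+ choice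

  digits : (ℕ → ℕ) → ℕ → ℕ
  digits g zero    = 0
  digits g (suc j) = digit′ (suc j) (determined? (suc j)) (digits g j) (g (suc j))

  choice-bound : ∀ j (d : Dec (Determined j)) {c} → c ℕ.< 2 ℕ.^ branching′ j d → c ℕ.< 4 ℕ.^ j
  choice-bound j (yes _) h = ℕ.<-≤-trans h (1≤^ {4} j (s≤s z≤n))
  choice-bound j (no _) {c} h = subst (c ℕ.<_) (sym (ℕ.^-*-assoc 2 2 j)) h

  digits<cap : ∀ {g} → WithinBounds branching g → ∀ j → suc (digits g j) ℕ.≤ digitCap j
  digits<cap {g} hg zero    = s≤s z≤n
  digits<cap {g} hg (suc j) = go (determined? (suc j)) (choice-bound (suc j) (determined? (suc j)) (hg (suc j) (s≤s z≤n)))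
    where
    go : ∀ d → g (suc j) ℕ.< 4 ℕ.^ suc j → suc (digit′ (suc j) d (digits g j) (g (suc j))) ℕ.≤ digitCap (suc j)
    go (yes _) h = ℕ.≤-trans (s≤s (digits<cap hg j)) (ℕ.≤-trans (ℕ.+-monoˡ-≤ (digitCap j) (ℕ.≤-trans (1≤^ {4} j (s≤s z≤n)) (ℕ.m≤n*m (4 ℕ.^ j) 6)))
      (ℕ.≤-reflexive (e (4 ℕ.^ j))))
      where
      e : ∀ x → 6 ℕ.* x ℕ.+ 2 ℕ.* x ≡ 2 ℕ.* (4 ℕ.* x)
      e = ℕRing.solve-∀
    go (no _) h = ℕ.≤-trans (ℕ.≤-reflexive (sym (ℕ.+-suc (4 ℕ.^ suc j) (g (suc j))))) (ℕ.≤-trans (ℕ.+-monoʳ-≤ (4 ℕ.^ suc j) h)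
      (ℕ.≤-reflexive (cong (4 ℕ.^ suc j ℕ.+_) (sym (ℕ.+-identityʳ (4 ℕ.^ suc j))))))

  -- The base 4 ensures this: every digit at j lies below 2·4^j, and a free digit at j + 1 is at
  -- least 4^(j+1).
  digits-step : ∀ {g} → WithinBounds branching g → ∀ j → digits g j ℕ.< digits g (suc j)
  digits-step {g} hg j = go (determined? (suc j))
    where
    go : ∀ d → digits g j ℕ.< digit′ (suc j) d (digits g j) (g (suc j))
    go (yes _) = ℕ.≤-refl
    go (no _)  = ℕ.≤-trans (digits<cap hg j) (ℕ.≤-trans (ℕ.*-monoˡ-≤ (4 ℕ.^ j) {2} {4} (s≤s (s≤s z≤n))) (ℕ.m≤m+n (4 ℕ.^ suc j) (g (suc j))))

  2≤digits : ∀ {g} → WithinBounds branching g → ∀ j → 1 ℕ.≤ j → 2 ℕ.≤ digits g j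
  2≤digits {g} hg (suc zero) _ = go (determined? 1)
    where
    go : ∀ d → 2 ℕ.≤ digit′ 1 d 0 (g 1)
    -- Position 1 is free because all σ n are positive, so the recursion never builds on the
    -- placeholder value 0 of the digit at position 0.
    go (yes (k , σ<1 , _)) = ⊥-elim (ℕ.<-irrefl refl (ℕ.<-≤-trans σ<1 (1≤σ (suc k) (s≤s z≤n))))
    go (no _) = ℕ.≤-trans (s≤s (s≤s z≤n)) (ℕ.m≤m+n 4 (g 1))
  2≤digits hg (suc (suc j)) _ = ℕ.≤-trans (2≤digits hg (suc j) (s≤s z≤n)) (ℕ.<⇒≤ (digits-step hg (suc j)))

  module Point g (hg : WithinBounds branching g) = FromDigits (digits g) (2≤digits hg)

  progression : ∀ g k i → i ℕ.≤ k → digits g (σ (suc k) ℕ.+ i) ≡ digits g (σ (suc k)) ℕ.+ i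
  progression g k zero    _ = trans (cong (digits g) (ℕ.+-identityʳ (σ (suc k)))) (sym (ℕ.+-identityʳ _))
  progression g k (suc i) h = trans (cong (digits g) (ℕ.+-suc (σ (suc k)) i))
    (trans (go (determined? (suc (σ (suc k) ℕ.+ i)))) (trans (cong suc (progression g k i (ℕ.<⇒≤ h))) (sym (ℕ.+-suc (digits g (σ (suc k))) i))))
    where
    go : ∀ d → digit′ (suc (σ (suc k) ℕ.+ i)) d (digits g (σ (suc k) ℕ.+ i)) (g (suc (σ (suc k) ℕ.+ i))) ≡ suc (digits g (σ (suc k) ℕ.+ i))
    go (yes _) = refl
    go (no ¬d) = ⊥-elim (¬d (k , s≤s (ℕ.m≤m+n (σ (suc k)) i) , subst (ℕ._≤ σ (suc k) ℕ.+ k) (ℕ.+-suc (σ (suc k)) i) (ℕ.+-monoʳ-≤ (σ (suc k)) h)))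

  digits-agree : ∀ {g g′} k → AgreeUpTo k g g′ → AgreeUpTo k (digits g) (digits g′)
  digits-agree zero    agree j 1≤j j≤0 = ⊥-elim (ℕ.<-irrefl refl (ℕ.≤-trans 1≤j j≤0))
  digits-agree {g} {g′} (suc k) agree = agree-suc k IH (cong₂ (digit′ (suc k) (determined? (suc k))) (last k IH) (agree (suc k) (s≤s z≤n) ℕ.≤-refl))
    where
    IH : AgreeUpTo k (digits g) (digits g′)
    IH = digits-agree k (AgreeUpTo-≤ (ℕ.n≤1+n k) agree)
    last : ∀ k → AgreeUpTo k (digits g) (digits g′) → digits g k ≡ digits g′ k
    last zero    _ = refl
    last (suc k) h = h (suc k) (s≤s z≤n) ℕ.≤-refl

  digits-differ : ∀ {g g′} → WithinBounds branching g → WithinBounds branching g′ → ∀ k → g (suc k) ≢ g′ (suc k) → AgreeUpTo k g g′ →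
    digits g (suc k) ≢ digits g′ (suc k)
  digits-differ {g} {g′} hg hg′ k g≢ agree = go (determined? (suc k)) (hg (suc k) (s≤s z≤n)) (hg′ (suc k) (s≤s z≤n))
    where
    go : ∀ d → g (suc k) ℕ.< 2 ℕ.^ branching′ (suc k) d → g′ (suc k) ℕ.< 2 ℕ.^ branching′ (suc k) d →
      digit′ (suc k) d (digits g k) (g (suc k)) ≢ digit′ (suc k) d (digits g′ k) (g′ (suc k))
    go (yes _) h h′ _ = g≢ (trans (ℕ.n<1⇒n≡0 h) (sym (ℕ.n<1⇒n≡0 h′)))
    go (no _) h h′ eq = g≢ (ℕ.+-cancelˡ-≡ (4 ℕ.^ suc k) _ _ eq)

  opaque
    point-of : ∀ g → WithinBounds branching g → 𝕀
    point-of g hg = Point.point𝕀 g hg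

    point∈G : ∀ g (hg : WithinBounds branching g) → point-of g hg ∈ G σ
    point∈G g hg = Point.inJ g hg (λ j _ → digits-step hg j) , digits g , Point.partialQuotients g hg , 0 ,
      λ { (suc k) _ _ → + digits g (σ (suc k)) , + 1 , λ i →
        trans (cong +_ (progression g k (toℕ i) (ℕ.≤-pred (toℕ<n i))))
          (cong (λ z → + digits g (σ (suc k)) ℤ.+ z) (sym (ℤ.*-identityʳ (+ toℕ i)))) }

    points-separate : ∀ g g′ (hg : WithinBounds branching g) (hg′ : WithinBounds branching g′) k → g (suc k) ≢ g′ (suc k) → AgreeUpTo k g g′ →
      fromℚ (1/ᵘ (2 ℕ.^ gapExponent (suc k))) ⊑ dist (point-of g hg) (point-of g′ hg′)
    points-separate g g′ hg hg′ k g≢ agree = subst (λ z → fromℚ z ⊑ dist (point-of g hg) (point-of g′ hg′)) (separation-cap (suc k))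
      (partialQuotients-separate {digits g} {digits g′} {Point.value g hg} {Point.value g′ hg′} digitCap (Point.partialQuotients g hg) (Point.partialQuotients g′ hg′)
        (λ j 2≤j → 2≤digits hg j (ℕ.<⇒≤ 2≤j) , 2≤digits hg′ j (ℕ.<⇒≤ 2≤j)) k
        (λ j _ _ → digits<cap hg j , digits<cap hg′ j) (digits-agree k agree) (digits-differ hg hg′ k g≢ agree))

  -- At a first difference on some level k + 1 ≤ κ the points would be at least the gap of that
  -- level apart, which is no smaller than the gap of level κ.
  close-points-agree : ∀ g g′ (hg : WithinBounds branching g) (hg′ : WithinBounds branching g′) κ →
    dist (point-of g hg) (point-of g′ hg′) < fromℚ (1/ᵘ (2 ℕ.^ gapExponent κ)) → AgreeUpTo κ g g′
  close-points-agree g g′ hg hg′ κ close = upTo κ ℕ.≤-refl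
    where
    upTo : ∀ k → k ℕ.≤ κ → AgreeUpTo k g g′
    upTo zero    _ j 1≤j j≤0 = ⊥-elim (ℕ.<-irrefl refl (ℕ.≤-trans 1≤j j≤0))
    upTo (suc k) k<κ = agree-suc k IH (same (g (suc k) ℕ.≟ g′ (suc k)))
      where
      IH = upTo k (ℕ.<⇒≤ k<κ)
      same : Dec (g (suc k) ≡ g′ (suc k)) → g (suc k) ≡ g′ (suc k)
      same (yes eq) = eq
      same (no g≢) = ⊥-elim (<⇒≱ {dist (point-of g hg) (point-of g′ hg′)} {fromℚ (1/ᵘ (2 ℕ.^ gapExponent κ))} close
        (un⊑ (⊑-trans {fromℚ (1/ᵘ (2 ℕ.^ gapExponent κ))} {fromℚ (1/ᵘ (2 ℕ.^ gapExponent (suc k)))} {dist (point-of g hg) (point-of g′ hg′)}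
          (fromℚ-⊑ (1/2^-antimono (gapExponent-mono k<κ))) (points-separate g g′ hg hg′ k g≢ IH))))

-- Lower bound

root-⊒ : ∀ {x v} k → 0ℝ ⊑ x → fromℚ (v ^ℚ suc k) ⊑ x ^ suc k → fromℚ v ⊑ x
root-⊒ {x} {v} k 0≤x h = ⟨ ≮⇒≥ {x} {fromℚ v} (λ x<v →
  let (r , x<r , r<v) = dense {x} {fromℚ v} x<v
      0≤r : 0ℚ ℚ.≤ r
      0≤r = fromℚ-cancel-≤ (un⊑ (⊑-trans {0ℝ} {x} {fromℚ r} 0≤x (<⇒⊑ x (fromℚ r) x<r)))
  in ℚ.<-irrefl refl (ℚ.<-≤-trans (^ℚ-mono-< k 0≤r (fromℚ-cancel-< {r} {v} r<v)) (fromℚ-cancel-≤ (un⊑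
       (⊑-trans {fromℚ (v ^ℚ suc k)} {x ^ suc k} {fromℚ (r ^ℚ suc k)} h
         (⊑-trans (^-mono (suc k) 0≤x (<⇒⊑ x (fromℚ r) x<r)) (≋⇒⊑ (fromℚ-^ r (suc k))))))))) ⟩

dyadic-^ : ∀ F k → 1/ᵘ (2 ℕ.^ F) ^ℚ k ≡ 1/ᵘ (2 ℕ.^ (F ℕ.* k))
dyadic-^ F k = trans (1/ᵘ-^ (2 ℕ.^ F) k (1≤^ {2} F (s≤s z≤n))) (cong 1/ᵘ (ℕ.^-*-assoc 2 F k))

1/ᵘ≤1 : ∀ {n} → 1 ℕ.≤ n → 1/ᵘ n ℚ.≤ 1ℚ
1/ᵘ≤1 {n} h = subst (1/ᵘ n ℚ.≤_) 1/ᵘ-one (1/ᵘ-antimono (s≤s z≤n) h)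

module _ (em : ∀ ℓ → ExcludedMiddle ℓ) where
  open Classical em

  -- If u > 0 the power is at least 1. If u ≤ 0, then s ≤ p/q gives q s u ≥ p u, and the claim
  -- follows by comparing q-th powers.
  power-lower : ∀ {s u d c} p q-1 F M → 0ℝ ⊑ s → s ⊑ fromℚ (fraction p (suc q-1)) → IsExp u d → IsExp (s * u) c →
    fromℚ (1/ᵘ (2 ℕ.^ M)) ⊑ d → p ℕ.* M ℕ.≤ suc q-1 ℕ.* F → fromℚ (1/ᵘ (2 ℕ.^ F)) ⊑ c
  power-lower {s} {u} {d} {c} p q-1 F M 0≤s s≤ expU expSU M≤d h = ⊑-trans
    ([_,_]′ negative positive (≤⊎< u 0ℝ)) (≋⇒⊑ (≋-sym (Exp-unique {s * u} {c} expSU)))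
    where
    q = suc q-1
    positive : 0ℝ < u → fromℚ (1/ᵘ (2 ℕ.^ F)) ⊑ Exp (s * u)
    positive 0<u = ⊑-trans (fromℚ-⊑ (1/ᵘ≤1 (1≤^ {2} F (s≤s z≤n)))) (Exp-≥1 (*-nonneg⊑ 0≤s (<⇒⊑ 0ℝ u 0<u)))
    0≤p-qs : 0ℝ ⊑ fromℚ (ι p) - fromℚ (ι q) * s
    0≤p-qs = ⟨ 0≤-diffℝ {fromℚ (ι q) * s} {fromℚ (ι p)} (un⊑ (⊑-trans {fromℚ (ι q) * s} {fromℚ (ι q) * fromℚ (fraction p q)} {fromℚ (ι p)}
      (*-⊑ {fromℚ (ι q)} {fromℚ (ι q)} (fromℚ-⊑ (0≤ι q)) (fromℚ-⊑ (0≤* {ι p} {1/ᵘ q} (0≤ι p) (0≤1/ᵘ q))) ⊑-refl s≤)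
      (pw⊑ λ _ → ℚ.≤-reflexive (trans (e (ι q) (ι p) (1/ᵘ q)) (trans (cong (ℚ._* ι p) (1/ᵘ-* {q} (s≤s z≤n))) (ℚ.*-identityˡ (ι p))))))) ⟩
      where
      e : ∀ q p u → q ℚ.* (p ℚ.* u) ≡ (u ℚ.* q) ℚ.* p
      e = solve-∀ ℚring
    exponents : u ≤ 0ℝ → fromℚ (ι p) * u ⊑ fromℚ (ι q) * (s * u)
    exponents u≤0 = ⟨ diff-≤ {fromℚ (ι p) * u} {fromℚ (ι q) * (s * u)} (un⊑ (⊑-trans
      (*-nonneg⊑ {fromℚ (ι p) - fromℚ (ι q) * s} {0ℝ - u} 0≤p-qs ⟨ 0≤-diffℝ {u} {0ℝ} u≤0 ⟩)
      (pw⊑ {y = fromℚ (ι q) * (s * u) - fromℚ (ι p) * u} λ n → ℚ.≤-reflexive (e (ι p) (ι q) (seq s n) (seq u n))))) ⟩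
      where
      e : ∀ p q s u → (p ℚ.- q ℚ.* s) ℚ.* (0ℚ ℚ.- u) ≡ q ℚ.* (s ℚ.* u) ℚ.- p ℚ.* u
      e = solve-∀ ℚring
    negative : u ≤ 0ℝ → fromℚ (1/ᵘ (2 ℕ.^ F)) ⊑ Exp (s * u)
    negative u≤0 = root-⊒ q-1 (Exp-nonneg (s * u))
      (⊑-trans (fromℚ-⊑ (subst₂ ℚ._≤_ (sym (dyadic-^ F q)) (sym (dyadic-^ M p)) (1/2^-antimono (subst₂ ℕ._≤_ (ℕ.*-comm p M) (ℕ.*-comm q F) h))))
      (⊑-trans (≋⇒⊑ (≋-sym (fromℚ-^ (1/ᵘ (2 ℕ.^ M)) p)))
      (⊑-trans (^-mono p (fromℚ-⊑ (0≤1/ᵘ (2 ℕ.^ M))) (⊑-trans M≤d (≋⇒⊑ (Exp-unique {u} {d} expU))))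
      (⊑-trans (≋⇒⊑ (≋-sym (Exp-ι* p u)))
      (⊑-trans (Exp-mono (exponents u≤0)) (≋⇒⊑ (Exp-ι* q (s * u))))))))

  -- The hypothesis `growth` says that from level `K` on the mass 2^(-F) of a node is at most the
  -- (p/q)-th power of the gap one level below it.
  module LowerBound (σ : ℕ → ℕ) (1≤σ : ∀ n → 1 ℕ.≤ n → 0 ℕ.< σ n) (s : ℝ) (0≤s : 0ℝ ⊑ s) (p q-1 : ℕ) (s≤ : s ⊑ fromℚ (fraction p (suc q-1)))
    (K : ℕ) (growth : ∀ κ → K ℕ.≤ κ → p ℕ.* gapExponent (suc κ) ℕ.≤ suc q-1 ℕ.* sumℕ (CantorSet.branching em σ 1≤σ) κ)
    (unbounded : ∀ M → ∃[ κ ] M ℕ.≤ sumℕ (CantorSet.branching em σ 1≤σ) κ) where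

    open CantorSet em σ 1≤σ
    open SmallIntervals em using (last-above)

    mass : ℕ → ℚ
    mass κ = 1/ᵘ (2 ℕ.^ sumℕ branching κ)

    gap : ℕ → ℚ
    gap κ = 1/ᵘ (2 ℕ.^ gapExponent κ)

    0<gap : ∀ κ → 0ℚ ℚ.< gap κ
    0<gap κ = 0<1/ᵘ (1≤^ {2} (gapExponent κ) (s≤s z≤n))

    -- Handles the sets whose diameter is at least the gap of level `K`: each costs at least 1/C, so
    -- the root, of mass 1, may be assigned to it.
    C : ℕ
    C = 2 ℕ.^ (p ℕ.* gapExponent K)

    1≤C : 1 ℕ.≤ C
    1≤C = 1≤^ {2} (p ℕ.* gapExponent K) (s≤s z≤n)

    Focused : Pred 𝕀 0ℓ → ℕ → Set
    Focused U κ = ∀ g g′ (hg : WithinBounds branching g) (hg′ : WithinBounds branching g′) → point-of g hg ∈ U → point-of g′ hg′ ∈ U → AgreeUpTo κ g g′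

    focused-0 : ∀ U → Focused U 0
    focused-0 U _ _ _ _ _ _ j 1≤j j≤0 = ⊥-elim (ℕ.<-irrefl refl (ℕ.≤-trans 1≤j j≤0))

    focused-diameter : ∀ U d κ → IsDiameter U d → d < fromℚ (gap κ) → Focused U κ
    focused-diameter U d κ (upper , _) d<gap g g′ hg hg′ x∈ y∈ = close-points-agree g g′ hg hg′ κ
      (≤-<-trans {dist x y} {d} {fromℚ (gap κ)} (upper (dist x y) (x , y , x∈ , y∈ , ≈-refl {dist x y})) d<gap)
      where
      x = point-of g hg
      y = point-of g′ hg′

    -- The term η is for empty sets and sets of diameter 0: their cost may vanish although every
    -- node has positive mass, but they fit into nodes of arbitrarily small mass.
    Controlled : Pred 𝕀 0ℓ → ℝ → ℚ → Set
    Controlled U c η = ∃[ κ ] Focused U κ × fromℚ (mass κ) ⊑ fromℚ (ι C) * c + fromℚ η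

    drop-η : ∀ {x c η} → 0ℚ ℚ.< η → x ⊑ fromℚ (ι C) * c → x ⊑ fromℚ (ι C) * c + fromℚ η
    drop-η {x} {c} {η} 0<η h = ⊑-trans h (pw⊑ λ n → p≤p+ε (ι C ℚ.* seq c n) (ℚ.<⇒≤ 0<η))

    mass-tiny : ∀ κ n η → 1 ℕ.≤ n → 1/ᵘ n ℚ.≤ η → n ℕ.≤ sumℕ branching κ → mass κ ℚ.≤ η
    mass-tiny κ n η 1≤n small n≤F = ℚ.≤-trans (1/2^-antimono {n} {sumℕ branching κ} n≤F)
      (ℚ.≤-trans (1/ᵘ-antimono {n} {2 ℕ.^ n} 1≤n (ℕ.<⇒≤ (n<2^n n))) small)

    add-nonneg : ∀ x c η → 0ℝ ⊑ c → x ℚ.≤ η → fromℚ x ⊑ fromℚ (ι C) * c + fromℚ η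
    add-nonneg x c η 0≤c x≤η = ⊑-trans {y = 0ℝ + fromℚ η}
      (pw⊑ λ _ → ℚ.≤-trans x≤η (ℚ.≤-reflexive (sym (ℚ.+-identityˡ η))))
      (+-⊑ {0ℝ} {fromℚ (ι C) * c} {fromℚ η} {fromℚ η} (*-nonneg⊑ {fromℚ (ι C)} {c} (fromℚ-⊑ (0≤ι C)) 0≤c) ⊑-refl)

    controlled-tiny : ∀ U c η → 0ℚ ℚ.< η → 0ℝ ⊑ c → (∀ κ → Focused U κ) → Controlled U c η
    controlled-tiny U c η 0<η 0≤c focus = at (archimedean η 0<η)
      where
      at : (∃[ n ] 1 ℕ.≤ n × 1/ᵘ n ℚ.≤ η) → Controlled U c η
      at (n , 1≤n , small) = found (unbounded n)
        where
        found : (∃[ κ ] n ℕ.≤ sumℕ branching κ) → Controlled U c η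
        found (κ , n≤F) = κ , focus κ , add-nonneg (mass κ) c η 0≤c (mass-tiny κ n η 1≤n small n≤F)

    scale≥ : ∀ {x c} → 0ℝ ⊑ c → x ⊑ c → x ⊑ fromℚ (ι C) * c
    scale≥ {x} {c} 0≤c h = ⊑-trans h (⊑-trans {y = 1ℝ * c} (pw⊑ λ n → ℚ.≤-reflexive (sym (ℚ.*-identityˡ (seq c n))))
      (*-⊑ {1ℝ} {fromℚ (ι C)} (fromℚ-⊑ 0≤1) 0≤c (fromℚ-⊑ (subst (ℚ._≤ ι C) ι1 (ι-mono-≤ 1≤C))) ⊑-refl))

    controlled-exp : ∀ U d u c η → 0ℚ ℚ.< η → 0ℝ < d → IsDiameter U d → IsExp u d → IsExp (s * u) c → Controlled U c η
    controlled-exp U d u c η 0<η 0<d diam expU expSU = cases (≤⊎< (fromℚ (gap K)) d)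
      where
      0≤c : 0ℝ ⊑ c
      0≤c = ⊑-trans (Exp-nonneg (s * u)) (≋⇒⊑ (≋-sym (Exp-unique {s * u} {c} expSU)))
      lower : ∀ F M → fromℚ (1/ᵘ (2 ℕ.^ M)) ⊑ d → p ℕ.* M ℕ.≤ suc q-1 ℕ.* F → fromℚ (1/ᵘ (2 ℕ.^ F)) ⊑ c
      lower F M = power-lower {s} {u} {d} {c} p q-1 F M 0≤s s≤ expU expSU
      coarse : fromℚ (gap K) ≤ d → Controlled U c η
      coarse gap≤d = 0 , focused-0 U , drop-η 0<η (⊑-trans {y = fromℚ (ι C) * fromℚ (1/ᵘ C)}
        (pw⊑ λ _ → ℚ.≤-reflexive (trans 1/ᵘ-one (sym (trans (ℚ.*-comm (ι C) (1/ᵘ C)) (1/ᵘ-* 1≤C)))))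
        (*-⊑ {fromℚ (ι C)} (fromℚ-⊑ (0≤ι C)) 0≤c ⊑-refl (lower (p ℕ.* gapExponent K) (gapExponent K) ⟨ gap≤d ⟩ (ℕ.m≤n*m (p ℕ.* gapExponent K) (suc q-1)))))
      fine : d < fromℚ (gap K) → Controlled U c η
      fine d<gap =
        let (r , 0<r , r<d) = dense {0ℝ} {d} 0<d
            (n , 1≤n , small) = archimedean r (fromℚ-cancel-< {0ℚ} {r} 0<r)
            gap≤r : gap (n ℕ.+ K) ℚ.≤ r
            gap≤r = ℚ.≤-trans (1/ᵘ-antimono 1≤n (ℕ.≤-trans (ℕ.≤-trans (ℕ.m≤m+n n K) (n≤gapExponent (n ℕ.+ K))) (ℕ.<⇒≤ (n<2^n (gapExponent (n ℕ.+ K)))))) small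
            -- At level j + K the diameter is below the gap, which confines `U` to one node; one
            -- level further it no longer is, which bounds the cost from below through `growth`.
            (j , below , above) = last-above (λ j → d < fromℚ (gap (j ℕ.+ K))) d<gap n
              (λ bad → <⇒≱ {d} {fromℚ (gap (n ℕ.+ K))} bad (un⊑ (⊑-trans {fromℚ (gap (n ℕ.+ K))} {fromℚ r} {d} (fromℚ-⊑ gap≤r) (<⇒⊑ (fromℚ r) d r<d))))
        in j ℕ.+ K , focused-diameter U d (j ℕ.+ K) diam below , drop-η 0<η (scale≥ 0≤c
             (lower (sumℕ branching (j ℕ.+ K)) (gapExponent (suc (j ℕ.+ K))) ⟨ ≮⇒≥ {d} {fromℚ (gap (suc (j ℕ.+ K)))} above ⟩ (growth (j ℕ.+ K) (ℕ.m≤n+m K j))))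
      cases : fromℚ (gap K) ≤ d ⊎ d < fromℚ (gap K) → Controlled U c η
      cases = [_,_]′ coarse fine

    controlled : ∀ {δ} U c η → 0ℚ ℚ.< η → IsTerm s δ U c → Controlled U c η
    controlled U c η 0<η (inj₁ (empty , c≈0)) = controlled-tiny U c η 0<η (≋⇒⊑ (≋-sym {c} {0ℝ} ⟪ c≈0 ⟫)) λ κ g _ hg _ x∈ _ → ⊥-elim (empty _ x∈)
    controlled U c η 0<η (inj₂ (d , diam , _ , power)) = [_,_]′
      (λ d≤0 → controlled-tiny U c η 0<η (0≤power power) λ κ → focused-diameter U d κ diam (≤-<-trans {d} {0ℝ} {fromℚ (gap κ)} d≤0 (fromℚ-mono-< (0<gap κ))))
      (λ 0<d → by-power 0<d power)
      (≤⊎< d 0ℝ)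
      where
      0≤power : IsPower d s c → 0ℝ ⊑ c
      0≤power (inj₁ (_ , _ , c≈1)) = ⊑-trans (fromℚ-⊑ 0≤1) (≋⇒⊑ (≋-sym {c} {1ℝ} ⟪ c≈1 ⟫))
      0≤power (inj₂ (inj₁ (_ , _ , c≈0))) = ≋⇒⊑ (≋-sym {c} {0ℝ} ⟪ c≈0 ⟫)
      0≤power (inj₂ (inj₂ (u , _ , expSU))) = ⊑-trans (Exp-nonneg (s * u)) (≋⇒⊑ (≋-sym (Exp-unique {s * u} {c} expSU)))
      by-power : 0ℝ < d → IsPower d s c → Controlled U c η
      by-power 0<d (inj₁ (d≈0 , _)) = ⊥-elim (<⇒≱ {0ℝ} {d} 0<d (≈⇒≤ {d} {0ℝ} d≈0))
      by-power 0<d (inj₂ (inj₁ (d≈0 , _))) = ⊥-elim (<⇒≱ {0ℝ} {d} 0<d (≈⇒≤ {d} {0ℝ} d≈0))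
      by-power 0<d (inj₂ (inj₂ (u , expU , expSU))) = controlled-exp U d u c η 0<η 0<d diam expU expSU

    opaque
      -- With total cost at most 1/(4C) and total slack at most 1/4, the forbidden mass is at most
      -- 1/4 + 1/4, the half that `Avoid` tolerates.
      ε₀ : ℚ
      ε₀ = 1/ᵘ C ℚ.* (½ ℚ.* ½)

      0<ε₀ : 0ℚ ℚ.< ε₀
      0<ε₀ = 0<* {1/ᵘ C} {½ ℚ.* ½} (0<1/ᵘ 1≤C) (0<* {½} {½} 0<½ 0<½)

      Cε₀ : ι C ℚ.* ε₀ ≡ ½ ℚ.* ½
      Cε₀ = trans (sym (ℚ.*-assoc (ι C) (1/ᵘ C) (½ ℚ.* ½)))
        (trans (cong (ℚ._* (½ ℚ.* ½)) (trans (ℚ.*-comm (ι C) (1/ᵘ C)) (1/ᵘ-* 1≤C))) (ℚ.*-identityˡ (½ ℚ.* ½)))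

      slack : ℕ → ℚ
      slack i = (½ ℚ.* ½) ℚ.* 1/ᵘ (geometric i)

      0<slack : ∀ i → 0ℚ ℚ.< slack i
      0<slack i = 0<* {½ ℚ.* ½} {1/ᵘ (geometric i)} (0<* {½} {½} 0<½ 0<½) (0<1/ᵘ (1≤^ {2} (suc i) (s≤s z≤n)))

      Σslack≤ : ∀ n → sum slack n ℚ.≤ ½ ℚ.* ½
      Σslack≤ n = subst₂ ℚ._≤_ (sym (sum-scale (½ ℚ.* ½) (1/ᵘ ∘ geometric) n)) (ℚ.*-identityʳ (½ ℚ.* ½))
        (*-monoʳ-≤ {sum (1/ᵘ ∘ geometric) n} {1ℚ} (½ ℚ.* ½) (ℚ.<⇒≤ (0<* {½} {½} 0<½ 0<½)) (Σgeometric≤1 n))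

    no-cheap-focused-cover : ∀ (U : ℕ → Pred 𝕀 0ℓ) (c : ℕ → ℝ) → G σ ⊆ ⋃ ℕ U → (κ : ℕ → ℕ) → (∀ i → Focused (U i) (κ i)) →
      (∀ i → fromℚ (mass (κ i)) ⊑ fromℚ (ι C) * c i + fromℚ (slack i)) → ¬ (∀ n → partialSum c n ⊑ fromℚ ε₀)
    no-cheap-focused-cover U c covers κ focused mass≤ cheap = path-avoids i (agree-f i path path-bounded x∈U)
      where
      Touched : ℕ → Set
      Touched i = ∃[ g ] Σ (WithinBounds branching g) λ hg → point-of g hg ∈ U i
      f′ : ∀ i → Dec (Touched i) → ℕ → ℕ
      f′ i (yes (g , _)) = g
      f′ i (no _) = λ _ → 0
      f : ℕ → ℕ → ℕ
      f i = f′ i (em 0ℓ)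
      agree-f : ∀ i g (hg : WithinBounds branching g) → point-of g hg ∈ U i → AgreeUpTo (κ i) g (f i)
      agree-f i g hg x∈ = go (em 0ℓ)
        where
        go : (d : Dec (Touched i)) → AgreeUpTo (κ i) g (f′ i d)
        go (yes (g′ , hg′ , y∈)) = focused i g g′ hg hg′ x∈ y∈
        go (no untouched) = ⊥-elim (untouched (g , hg , x∈))
      mass-sum : ∀ n → fromℚ (sum (λ i → mass (κ i)) n) ⊑ fromℚ (ι C) * partialSum c n + fromℚ (sum slack n)
      mass-sum zero = pw⊑ λ _ → ℚ.≤-reflexive (e (ι C))
        where
        e : ∀ c → 0ℚ ≡ c ℚ.* 0ℚ ℚ.+ 0ℚ
        e = solve-∀ ℚring
      mass-sum (suc n) = ⊑-trans {y = fromℚ (sum (λ i → mass (κ i)) n) + fromℚ (mass (κ n))} (pw⊑ λ _ → ℚ.≤-refl)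
        (⊑-trans (+-⊑ (mass-sum n) (mass≤ n))
          (pw⊑ {y = fromℚ (ι C) * partialSum c (suc n) + fromℚ (sum slack (suc n))} λ k →
            ℚ.≤-reflexive (e (ι C) (seq (partialSum c n) k) (sum slack n) (seq (c n) k) (slack n))))
        where
        e : ∀ C a s b t → (C ℚ.* a ℚ.+ s) ℚ.+ (C ℚ.* b ℚ.+ t) ≡ C ℚ.* (a ℚ.+ b) ℚ.+ (s ℚ.+ t)
        e = solve-∀ ℚring
      light : ∀ n → sum (λ i → mass (κ i)) n ℚ.≤ ½
      light n = fromℚ-cancel-≤ (un⊑ (⊑-trans {fromℚ (sum (λ i → mass (κ i)) n)} {fromℚ (ι C) * fromℚ ε₀ + fromℚ (½ ℚ.* ½)} {fromℚ ½}
        (⊑-trans (mass-sum n) (+-⊑ (*-⊑ {fromℚ (ι C)} (fromℚ-⊑ (0≤ι C)) (fromℚ-⊑ (ℚ.<⇒≤ 0<ε₀)) ⊑-refl (cheap n)) (fromℚ-⊑ (Σslack≤ n))))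
        (pw⊑ λ _ → ℚ.≤-reflexive (trans (cong (ℚ._+ ½ ℚ.* ½) Cε₀) refl))))
      open Avoid em branching κ f light using (path; path-bounded; path-avoids)
      covered : ∃[ i ] point-of path path-bounded ∈ U i
      covered = covers {point-of path path-bounded} (point∈G path path-bounded)
      i = proj₁ covered
      x∈U = proj₂ covered

    no-cheap-cover : ∀ δ (U : ℕ → Pred 𝕀 0ℓ) (c : ℕ → ℝ) → G σ ⊆ ⋃ ℕ U → (∀ i → IsTerm s δ (U i) (c i)) →
      ¬ (∀ n → partialSum c n ⊑ fromℚ ε₀)
    no-cheap-cover δ U c covers isTerm = no-cheap-focused-cover U c covers (λ i → proj₁ (control i)) (λ i → proj₁ (proj₂ (control i))) (λ i → proj₂ (proj₂ (control i)))
      where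
      control : ∀ i → Controlled (U i) (c i) (slack i)
      control i = controlled {δ} (U i) (c i) (slack i) (0<slack i) (isTerm i)

    cover-sum-≥ : ∀ δ t → CoverSum s δ (G σ) t → fin (fromℚ ε₀) ≤∞ t
    cover-sum-≥ δ ∞ _ = ≤-top
    cover-sum-≥ δ (fin x) (U , c , covers , isTerm , upper , _) = fin≤fin (≮⇒≥ {x} {fromℚ ε₀} λ x<ε₀ →
      no-cheap-cover δ U c (λ {y} → covers {y}) isTerm λ n → ⊑-trans (fin⊑ (upper (fin (partialSum c n)) (n , refl))) (<⇒⊑ x (fromℚ ε₀) x<ε₀))
      where
      fin⊑ : ∀ {y} → fin y ≤∞ fin x → y ⊑ x
      fin⊑ (fin≤fin h) = ⟨ h ⟩

    -- A measure 0 would be the supremum of the premeasures. Any premeasure is at least ε₀ > 0, so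
    -- there could be none; but then -1 would be an upper bound, forcing 0 ≤ -1.
    not-null : ¬ IsHausdorffMeasure s (G σ) (fin 0ℝ)
    not-null (upper , least) = impossible (least (fin (fromℚ (ℚ.- 1ℚ))) λ t premeasure → ⊥-elim (no-premeasure t premeasure))
      where
      impossible : ¬ (fin 0ℝ ≤∞ fin (fromℚ (ℚ.- 1ℚ)))
      impossible (fin≤fin h) = ℚ.<-irrefl refl (ℚ.<-≤-trans (toWitness {a? = ℚ.- 1ℚ ℚ.<? 0ℚ} _) (fromℚ-cancel-≤ h))
      no-premeasure : ∀ t → ¬ (∃[ δ ] 0ℝ < δ × IsHausdorffPremeasure s δ (G σ) t)
      no-premeasure t m@(δ , _ , _ , greatest) = contradict (greatest (fin (fromℚ ε₀)) (cover-sum-≥ δ)) (upper t m)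
        where
        contradict : ∀ {t} → fin (fromℚ ε₀) ≤∞ t → ¬ (t ≤∞ fin 0ℝ)
        contradict (fin≤fin {y = x} h) (fin≤fin k) = ℚ.<-irrefl refl (ℚ.<-≤-trans 0<ε₀ (fromℚ-cancel-≤ (≤-trans {fromℚ ε₀} {x} {0ℝ} h k)))

-- Growth of the number of choices.  The density hypothesis says that at most
-- the fraction 1 − θ of each gap is determined, where θ = (2p+1)/(q+1) > 2p/q.

module Growth (em : ∀ ℓ → ExcludedMiddle ℓ) (σ : ℕ → ℕ) (1≤σ : ∀ n → 1 ℕ.≤ n → 0 ℕ.< σ n) (σ-inc : IncreasingFrom1 σ)
  (σ-gap : ∀ n → 1 ℕ.≤ n → n ℕ.≤ σ (suc n) ℕ.∸ σ n) (p q N : ℕ)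
  (density : ∀ k → N ℕ.≤ k → suc q ℕ.* suc k ℕ.+ suc (2 ℕ.* p) ℕ.* (σ (suc (suc k)) ℕ.∸ σ (suc k)) ℕ.≤ suc q ℕ.* (σ (suc (suc k)) ℕ.∸ σ (suc k))) where

  open CantorSet em σ 1≤σ
  open Blocks σ 1≤σ σ-inc σ-gap using (blockEnd; blockEnd<σ)

  F : ℕ → ℕ
  F = sumℕ branching

  gapℕ : ℕ → ℕ
  gapℕ k = σ (suc (suc k)) ℕ.∸ σ (suc k)

  σ+gap : ∀ k → σ (suc k) ℕ.+ gapℕ k ≡ σ (suc (suc k))
  σ+gap k = ℕ.m+[n∸m]≡n (ℕ.<⇒≤ (σ-inc (suc k) (s≤s z≤n)))

  σ-mono : ∀ {i j} → i ℕ.≤ j → σ (suc i) ℕ.≤ σ (suc j)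
  σ-mono h = increasing-≤ σ-inc (s≤s z≤n) (s≤s h)

  between-blocks : ∀ k j → blockEnd k ℕ.< j → j ℕ.≤ σ (suc (suc k)) → ¬ Determined j
  between-blocks k j x<j j≤ (k′ , σ<j , j≤end) with ℕ.<-cmp k′ k
  ... | tri< k′<k _ _ = ℕ.<-irrefl refl (ℕ.<-≤-trans (ℕ.≤-<-trans j≤end (blockEnd<σ k′))
    (ℕ.≤-trans (σ-mono k′<k) (ℕ.≤-trans (ℕ.m≤m+n (σ (suc k)) k) (ℕ.<⇒≤ x<j))))
  ... | tri≈ _ refl _ = ℕ.<-irrefl refl (ℕ.<-≤-trans x<j j≤end)
  ... | tri> _ _ k<k′ = ℕ.<-irrefl refl (ℕ.<-≤-trans σ<j (ℕ.≤-trans j≤ (σ-mono k<k′)))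

  branching-free : ∀ j → ¬ Determined j → branching j ≡ 2 ℕ.* j
  branching-free j free = go (determined? j)
    where
    go : (d : Dec (Determined j)) → branching′ j d ≡ 2 ℕ.* j
    go (yes d) = ⊥-elim (free d)
    go (no _)  = refl

  -- The sum of 2j over x < j ≤ y is y (y + 1) - x (x + 1), stated without subtraction.
  F-free : ∀ x d → (∀ j → x ℕ.< j → j ℕ.≤ d ℕ.+ x → ¬ Determined j) →
    F (d ℕ.+ x) ℕ.+ x ℕ.* suc x ≡ F x ℕ.+ (d ℕ.+ x) ℕ.* suc (d ℕ.+ x)
  F-free x zero    free = refl
  F-free x (suc d) free = trans (cong (λ z → F y ℕ.+ z ℕ.+ x ℕ.* suc x) (branching-free (suc y) (free (suc y) (s≤s (ℕ.m≤n+m x d)) ℕ.≤-refl)))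
    (trans (e₁ (F y) (2 ℕ.* suc y) (x ℕ.* suc x))
    (trans (cong (ℕ._+ 2 ℕ.* suc y) (F-free x d λ j x<j j≤ → free j x<j (ℕ.m≤n⇒m≤1+n j≤))) (e₂ (F x) y)))
    where
    y = d ℕ.+ x
    e₁ : ∀ f b c → f ℕ.+ b ℕ.+ c ≡ f ℕ.+ c ℕ.+ b
    e₁ = ℕRing.solve-∀
    e₂ : ∀ f y → f ℕ.+ y ℕ.* suc y ℕ.+ 2 ℕ.* suc y ≡ f ℕ.+ suc y ℕ.* suc (suc y)
    e₂ = ℕRing.solve-∀

  F-mono : ∀ {x y} → x ℕ.≤ y → F x ℕ.≤ F y
  F-mono {x} {zero}  z≤n = ℕ.≤-refl
  F-mono {x} {suc y} h with ℕ.m≤n⇒m<n∨m≡n h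
  ... | inj₁ (s≤s x≤y) = ℕ.≤-trans (F-mono x≤y) (ℕ.m≤m+n (F y) (branching (suc y)))
  ... | inj₂ refl      = ℕ.≤-refl

  -- The increment is (S + k + h)² - (S + k)², from the h free positions that follow the determined
  -- ones.
  F-gain : ∀ k h → let S = σ (suc k) in S ℕ.+ k ℕ.+ h ℕ.≤ σ (suc (suc k)) →
    F S ℕ.+ h ℕ.* (2 ℕ.* S ℕ.+ 2 ℕ.* k ℕ.+ h) ℕ.≤ F (S ℕ.+ k ℕ.+ h)
  F-gain k h y≤ = ℕ.+-cancelʳ-≤ (x ℕ.* x ℕ.+ x) _ _ (begin
    F S ℕ.+ h ℕ.* (2 ℕ.* S ℕ.+ 2 ℕ.* k ℕ.+ h) ℕ.+ (x ℕ.* x ℕ.+ x)   ≤⟨ ℕ.m≤m+n _ h ⟩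
    F S ℕ.+ h ℕ.* (2 ℕ.* S ℕ.+ 2 ℕ.* k ℕ.+ h) ℕ.+ (x ℕ.* x ℕ.+ x) ℕ.+ h ≡⟨ e₁ (F S) h S k ⟩
    F S ℕ.+ (h ℕ.+ x) ℕ.* suc (h ℕ.+ x)                             ≤⟨ ℕ.+-monoˡ-≤ ((h ℕ.+ x) ℕ.* suc (h ℕ.+ x)) (F-mono (ℕ.m≤m+n S k)) ⟩
    F x ℕ.+ (h ℕ.+ x) ℕ.* suc (h ℕ.+ x)                             ≡⟨ F-free x h (λ j x<j j≤ → between-blocks k j x<j (ℕ.≤-trans j≤ (subst (ℕ._≤ σ (suc (suc k))) (ℕ.+-comm x h) y≤))) ⟨
    F (h ℕ.+ x) ℕ.+ x ℕ.* suc x                                     ≡⟨ cong₂ ℕ._+_ (cong F (ℕ.+-comm h x)) (e₂ x) ⟩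
    F (x ℕ.+ h) ℕ.+ (x ℕ.* x ℕ.+ x)                                 ∎)
    where
    open ℕ.≤-Reasoning
    S = σ (suc k)
    x = S ℕ.+ k
    e₁ : ∀ f h S k → f ℕ.+ h ℕ.* (2 ℕ.* S ℕ.+ 2 ℕ.* k ℕ.+ h) ℕ.+ ((S ℕ.+ k) ℕ.* (S ℕ.+ k) ℕ.+ (S ℕ.+ k)) ℕ.+ h
      ≡ f ℕ.+ (h ℕ.+ (S ℕ.+ k)) ℕ.* suc (h ℕ.+ (S ℕ.+ k))
    e₁ = ℕRing.solve-∀
    e₂ : ∀ x → x ℕ.* suc x ≡ x ℕ.* x ℕ.+ x
    e₂ = ℕRing.solve-∀

  Q P′ C : ℕ
  Q = suc q
  P′ = suc (2 ℕ.* p)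
  C = P′ ℕ.* (σ (suc N) ℕ.* σ (suc N))

  excess : ∀ k → N ℕ.≤ k → ∃[ h ] gapℕ k ≡ k ℕ.+ h × P′ ℕ.* gapℕ k ℕ.≤ Q ℕ.* h
  excess k N≤k = h , sym split , ℕ.+-cancelˡ-≤ (Q ℕ.* k) _ _ (begin
    Q ℕ.* k ℕ.+ P′ ℕ.* gapℕ k       ≤⟨ ℕ.+-monoˡ-≤ (P′ ℕ.* gapℕ k) (ℕ.*-monoʳ-≤ Q (ℕ.n≤1+n k)) ⟩
    Q ℕ.* suc k ℕ.+ P′ ℕ.* gapℕ k   ≤⟨ density k N≤k ⟩
    Q ℕ.* gapℕ k                    ≡⟨ cong (Q ℕ.*_) split ⟨
    Q ℕ.* (k ℕ.+ h)                 ≡⟨ ℕ.*-distribˡ-+ Q k h ⟩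
    Q ℕ.* k ℕ.+ Q ℕ.* h             ∎)
    where
    open ℕ.≤-Reasoning
    h = gapℕ k ℕ.∸ k
    split : k ℕ.+ h ≡ gapℕ k
    split = ℕ.m+[n∸m]≡n (ℕ.<⇒≤ (σ-gap (suc k) (s≤s z≤n)))

  -- This is θ S² ≤ F S plus a constant. In the induction step θ ((S + g)² - S²) = θ g (2S + g),
  -- where θ g ≤ h by `excess` and g = k + h; `F-gain` supplies h (2S + 2k + h).
  at-blocks : ∀ d → let S = σ (suc (d ℕ.+ N)) in P′ ℕ.* (S ℕ.* S) ℕ.≤ Q ℕ.* F S ℕ.+ C
  at-blocks zero    = ℕ.m≤n+m C (Q ℕ.* F (σ (suc N)))
  at-blocks (suc d) = by (excess k (ℕ.m≤n+m N d))
    where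
    open ℕ.≤-Reasoning
    k = d ℕ.+ N
    S = σ (suc k)
    g = gapℕ k
    by : (∃[ h ] g ≡ k ℕ.+ h × P′ ℕ.* g ℕ.≤ Q ℕ.* h) → P′ ℕ.* (σ (suc (suc k)) ℕ.* σ (suc (suc k))) ℕ.≤ Q ℕ.* F (σ (suc (suc k))) ℕ.+ C
    by (h , g≡ , Ph) = subst (λ z → P′ ℕ.* (z ℕ.* z) ℕ.≤ Q ℕ.* F z ℕ.+ C) (σ+gap k) (begin
      P′ ℕ.* ((S ℕ.+ g) ℕ.* (S ℕ.+ g))                                    ≡⟨ e₁ P′ S g ⟩
      P′ ℕ.* (S ℕ.* S) ℕ.+ P′ ℕ.* g ℕ.* (2 ℕ.* S ℕ.+ g)                   ≤⟨ ℕ.+-mono-≤ (at-blocks d) (ℕ.*-mono-≤ Ph (ℕ.+-monoʳ-≤ (2 ℕ.* S) (ℕ.≤-trans (ℕ.≤-reflexive g≡) (ℕ.+-monoˡ-≤ h (ℕ.m≤n*m k 2))))) ⟩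
      Q ℕ.* F S ℕ.+ C ℕ.+ Q ℕ.* h ℕ.* (2 ℕ.* S ℕ.+ (2 ℕ.* k ℕ.+ h))       ≡⟨ e₂ Q (F S) C h (2 ℕ.* S) (2 ℕ.* k) ⟩
      Q ℕ.* (F S ℕ.+ h ℕ.* (2 ℕ.* S ℕ.+ 2 ℕ.* k ℕ.+ h)) ℕ.+ C             ≤⟨ ℕ.+-monoˡ-≤ C (ℕ.*-monoʳ-≤ Q (F-gain k h (ℕ.≤-reflexive (trans (sym shape) (σ+gap k))))) ⟩
      Q ℕ.* F (S ℕ.+ k ℕ.+ h) ℕ.+ C                                       ≡⟨ cong (λ z → Q ℕ.* F z ℕ.+ C) shape ⟨
      Q ℕ.* F (S ℕ.+ g) ℕ.+ C                                             ∎)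
      where
      shape : S ℕ.+ g ≡ S ℕ.+ k ℕ.+ h
      shape = trans (cong (S ℕ.+_) g≡) (sym (ℕ.+-assoc S k h))
      e₁ : ∀ p s g → p ℕ.* ((s ℕ.+ g) ℕ.* (s ℕ.+ g)) ≡ p ℕ.* (s ℕ.* s) ℕ.+ p ℕ.* g ℕ.* (2 ℕ.* s ℕ.+ g)
      e₁ = ℕRing.solve-∀
      e₂ : ∀ q f c h s k → q ℕ.* f ℕ.+ c ℕ.+ q ℕ.* h ℕ.* (s ℕ.+ (k ℕ.+ h)) ≡ q ℕ.* (f ℕ.+ h ℕ.* (s ℕ.+ k ℕ.+ h)) ℕ.+ c
      e₂ = ℕRing.solve-∀

  -- The density hypothesis at `N` compares (2p + 1) and (q + 1) times the same gap, with a positive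
  -- term added on the smaller side.
  2p<q : 2 ℕ.* p ℕ.< q
  2p<q = ℕ.≤-pred (ℕ.*-cancelʳ-< (gapℕ N) P′ Q (ℕ.<-≤-trans (ℕ.m<n+m (P′ ℕ.* gapℕ N) (ℕ.<-≤-trans (s≤s z≤n) (ℕ.m≤n*m (suc N) Q))) (density N ℕ.≤-refl)))

  -- The k determined positions after S are discounted by passing to κ - k. If this is at most S,
  -- monotonicity from the block start suffices; otherwise its excess over S counts free positions,
  -- and θ ≤ 1.
  inside-block : ∀ d κ → let k = d ℕ.+ N in σ (suc k) ℕ.≤ κ → κ ℕ.≤ σ (suc (suc k)) →
    P′ ℕ.* ((κ ℕ.∸ k) ℕ.* (κ ℕ.∸ k)) ℕ.≤ Q ℕ.* F κ ℕ.+ C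
  inside-block d κ S≤κ κ≤ = by (ℕ.≤-total z S)
    where
    open ℕ.≤-Reasoning
    k = d ℕ.+ N
    S = σ (suc k)
    z = κ ℕ.∸ k
    by : z ℕ.≤ S ⊎ S ℕ.≤ z → P′ ℕ.* (z ℕ.* z) ℕ.≤ Q ℕ.* F κ ℕ.+ C
    by (inj₁ z≤S) = ℕ.≤-trans (ℕ.*-monoʳ-≤ P′ (ℕ.*-mono-≤ z≤S z≤S)) (ℕ.≤-trans (at-blocks d) (ℕ.+-monoˡ-≤ C (ℕ.*-monoʳ-≤ Q (F-mono S≤κ))))
    by (inj₂ S≤z) = begin
      P′ ℕ.* (z ℕ.* z)                                              ≡⟨ cong (λ w → P′ ℕ.* (w ℕ.* w)) z≡ ⟩
      P′ ℕ.* ((S ℕ.+ h) ℕ.* (S ℕ.+ h))                              ≡⟨ e₁ P′ S h ⟩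
      P′ ℕ.* (S ℕ.* S) ℕ.+ P′ ℕ.* (h ℕ.* (2 ℕ.* S ℕ.+ h))           ≤⟨ ℕ.+-mono-≤ (at-blocks d) (ℕ.*-mono-≤ (s≤s (ℕ.<⇒≤ 2p<q)) (ℕ.*-monoʳ-≤ h (ℕ.+-monoˡ-≤ h (ℕ.m≤m+n (2 ℕ.* S) (2 ℕ.* k))))) ⟩
      Q ℕ.* F S ℕ.+ C ℕ.+ Q ℕ.* (h ℕ.* (2 ℕ.* S ℕ.+ 2 ℕ.* k ℕ.+ h)) ≡⟨ e₂ Q (F S) C (h ℕ.* (2 ℕ.* S ℕ.+ 2 ℕ.* k ℕ.+ h)) ⟩
      Q ℕ.* (F S ℕ.+ h ℕ.* (2 ℕ.* S ℕ.+ 2 ℕ.* k ℕ.+ h)) ℕ.+ C       ≤⟨ ℕ.+-monoˡ-≤ C (ℕ.*-monoʳ-≤ Q (F-gain k h (subst (ℕ._≤ σ (suc (suc k))) κ≡ κ≤))) ⟩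
      Q ℕ.* F (S ℕ.+ k ℕ.+ h) ℕ.+ C                                 ≡⟨ cong (λ w → Q ℕ.* F w ℕ.+ C) κ≡ ⟨
      Q ℕ.* F κ ℕ.+ C                                               ∎
      where
      h = z ℕ.∸ S
      z≡ : z ≡ S ℕ.+ h
      z≡ = sym (ℕ.m+[n∸m]≡n S≤z)
      k≤κ : k ℕ.≤ κ
      k≤κ = ℕ.<⇒≤ (ℕ.m∸n≢0⇒n<m λ z≡0 → ℕ.<-irrefl refl (ℕ.<-≤-trans (1≤σ (suc k) (s≤s z≤n)) (subst (S ℕ.≤_) z≡0 S≤z)))
      e₃ : ∀ k s h → k ℕ.+ (s ℕ.+ h) ≡ s ℕ.+ k ℕ.+ h
      e₃ = ℕRing.solve-∀
      κ≡ : κ ≡ S ℕ.+ k ℕ.+ h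
      κ≡ = trans (sym (ℕ.m+[n∸m]≡n k≤κ)) (trans (cong (k ℕ.+_) z≡) (e₃ k S h))
      e₁ : ∀ p s g → p ℕ.* ((s ℕ.+ g) ℕ.* (s ℕ.+ g)) ≡ p ℕ.* (s ℕ.* s) ℕ.+ p ℕ.* (g ℕ.* (2 ℕ.* s ℕ.+ g))
      e₁ = ℕRing.solve-∀
      e₂ : ∀ q f c x → q ℕ.* f ℕ.+ c ℕ.+ q ℕ.* x ≡ q ℕ.* (f ℕ.+ x) ℕ.+ c
      e₂ = ℕRing.solve-∀

  triangle≤σ : ∀ k → triangle k ℕ.≤ σ (suc k)
  triangle≤σ zero    = z≤n
  triangle≤σ (suc k) = subst (suc (k ℕ.+ triangle k) ℕ.≤_) (trans (ℕ.+-comm (gapℕ k) (σ (suc k))) (σ+gap k)) (ℕ.+-mono-≤ (σ-gap (suc k) (s≤s z≤n)) (triangle≤σ k))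

  square≤triangle : ∀ k → k ℕ.* k ℕ.≤ 2 ℕ.* triangle k
  square≤triangle k = ℕ.≤-trans (ℕ.m≤m+n (k ℕ.* k) k) (ℕ.≤-reflexive (exact k))
    where
    e : ∀ k → suc k ℕ.* suc k ℕ.+ suc k ≡ 2 ℕ.+ 2 ℕ.* k ℕ.+ (k ℕ.* k ℕ.+ k)
    e = ℕRing.solve-∀
    e₂ : ∀ k t → 2 ℕ.+ 2 ℕ.* k ℕ.+ 2 ℕ.* t ≡ 2 ℕ.* suc (k ℕ.+ t)
    e₂ = ℕRing.solve-∀
    exact : ∀ k → k ℕ.* k ℕ.+ k ≡ 2 ℕ.* triangle k
    exact zero    = refl
    exact (suc k) = trans (e k) (trans (cong (2 ℕ.+ 2 ℕ.* k ℕ.+_) (exact k)) (e₂ k (triangle k)))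

  -- The block number k is negligible compared to a position κ ≥ σ (k + 1) ≥ k²/2.
  block-number-small : ∀ L k κ → σ (suc k) ℕ.≤ κ → 2 ℕ.* (L ℕ.* L) ℕ.≤ κ → L ℕ.* k ℕ.≤ κ
  block-number-small L k κ S≤κ 2LL≤κ = by (ℕ.≤-total k (2 ℕ.* L))
    where
    e : ∀ L → L ℕ.* (2 ℕ.* L) ≡ 2 ℕ.* (L ℕ.* L)
    e = ℕRing.solve-∀
    by : k ℕ.≤ 2 ℕ.* L ⊎ 2 ℕ.* L ℕ.≤ k → L ℕ.* k ℕ.≤ κ
    by (inj₁ k≤) = ℕ.≤-trans (ℕ.*-monoʳ-≤ L k≤) (ℕ.≤-trans (ℕ.≤-reflexive (e L)) 2LL≤κ)
    by (inj₂ ≤k) = ℕ.*-cancelˡ-≤ 2 (ℕ.≤-trans (ℕ.≤-reflexive (sym (ℕ.*-assoc 2 L k))) (ℕ.≤-trans (ℕ.*-monoˡ-≤ k ≤k)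
      (ℕ.≤-trans (square≤triangle k) (ℕ.*-monoʳ-≤ 2 (ℕ.≤-trans (triangle≤σ k) S≤κ)))))

  -- With w = κ - k, the expansion of R times `gapExponent (suc κ)` has, beyond 2R w², at most 6R k
  -- w + 23R w, where 23 = 8 + 8 + 7. `L` secures 12R k ≤ w and `W₀` secures 2 (23R + q C) ≤ w, so
  -- all of this together with q C stays within w².
  R W₀ L K : ℕ
  R = Q ℕ.* p
  W₀ = suc (2 ℕ.* (23 ℕ.* R ℕ.+ q ℕ.* C))
  L = suc (suc (12 ℕ.* R))
  K = σ (suc N) ℕ.+ (2 ℕ.* (L ℕ.* L) ℕ.+ 2 ℕ.* W₀)

  -- A whole w² is available for the lower-order terms, because 2p < q gives 2 (q + 1) p + 1 ≤ q (2p
  -- + 1).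
  quadratic : ∀ w k → suc (12 ℕ.* R) ℕ.* k ℕ.≤ w → W₀ ℕ.≤ w → P′ ℕ.* (w ℕ.* w) ℕ.≤ Q ℕ.* F (w ℕ.+ k) ℕ.+ C →
    p ℕ.* gapExponent (suc (w ℕ.+ k)) ℕ.≤ q ℕ.* F (w ℕ.+ k)
  quadratic w k Lk≤w W≤w h = ℕ.*-cancelˡ-≤ Q (ℕ.+-cancelʳ-≤ (q ℕ.* C) _ _ (begin
    Q ℕ.* (p ℕ.* gapExponent (suc (w ℕ.+ k))) ℕ.+ q ℕ.* C                                    ≡⟨ cong (ℕ._+ q ℕ.* C) (e₀ Q p w k) ⟩
    R ℕ.* (2 ℕ.* (w ℕ.* w) ℕ.+ 4 ℕ.* (w ℕ.* k) ℕ.+ 2 ℕ.* (k ℕ.* k) ℕ.+ 8 ℕ.* w ℕ.+ 8 ℕ.* k ℕ.+ 7) ℕ.+ q ℕ.* C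
      ≤⟨ ℕ.+-monoˡ-≤ (q ℕ.* C) (ℕ.*-monoʳ-≤ R (ℕ.+-mono-≤ (ℕ.+-mono-≤ (ℕ.+-monoˡ-≤ (8 ℕ.* w) (ℕ.+-monoʳ-≤ (2 ℕ.* (w ℕ.* w) ℕ.+ 4 ℕ.* (w ℕ.* k)) (ℕ.*-monoʳ-≤ 2 (ℕ.*-monoˡ-≤ k k≤w)))) (ℕ.*-monoʳ-≤ 8 k≤w)) (ℕ.m≤m*n 7 w {{ℕ.>-nonZero 1≤w}}))) ⟩
    R ℕ.* (2 ℕ.* (w ℕ.* w) ℕ.+ 4 ℕ.* (w ℕ.* k) ℕ.+ 2 ℕ.* (w ℕ.* k) ℕ.+ 8 ℕ.* w ℕ.+ 8 ℕ.* w ℕ.+ 7 ℕ.* w) ℕ.+ q ℕ.* C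
      ≤⟨ ℕ.+-mono-≤ (ℕ.≤-reflexive (e₁ R w k)) (ℕ.m≤m*n (q ℕ.* C) w {{ℕ.>-nonZero 1≤w}}) ⟩
    R ℕ.* 2 ℕ.* (w ℕ.* w) ℕ.+ 6 ℕ.* R ℕ.* k ℕ.* w ℕ.+ 23 ℕ.* R ℕ.* w ℕ.+ q ℕ.* C ℕ.* w ≡⟨ e₂ (R ℕ.* 2 ℕ.* (w ℕ.* w)) (6 ℕ.* R ℕ.* k ℕ.* w) R w (q ℕ.* C) ⟩
    R ℕ.* 2 ℕ.* (w ℕ.* w) ℕ.+ (6 ℕ.* R ℕ.* k ℕ.* w ℕ.+ (23 ℕ.* R ℕ.+ q ℕ.* C) ℕ.* w)  ≤⟨ ℕ.+-monoʳ-≤ (R ℕ.* 2 ℕ.* (w ℕ.* w)) lower-order ⟩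
    R ℕ.* 2 ℕ.* (w ℕ.* w) ℕ.+ w ℕ.* w                                                ≤⟨ leading ⟩
    q ℕ.* (P′ ℕ.* (w ℕ.* w))                                                         ≤⟨ ℕ.*-monoʳ-≤ q h ⟩
    q ℕ.* (Q ℕ.* F (w ℕ.+ k) ℕ.+ C)                                                  ≡⟨ e₃ q Q (F (w ℕ.+ k)) C ⟩
    Q ℕ.* (q ℕ.* F (w ℕ.+ k)) ℕ.+ q ℕ.* C                                            ∎))
    where
    open ℕ.≤-Reasoning
    k≤w : k ℕ.≤ w
    k≤w = ℕ.≤-trans (ℕ.m≤m+n k _) Lk≤w
    1≤w : 1 ℕ.≤ w
    1≤w = ℕ.≤-trans (s≤s z≤n) W≤w
    e₀ : ∀ Q p w k → Q ℕ.* (p ℕ.* suc (2 ℕ.* (suc (w ℕ.+ k) ℕ.* suc (w ℕ.+ k)) ℕ.+ 4 ℕ.* suc (w ℕ.+ k)))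
      ≡ Q ℕ.* p ℕ.* (2 ℕ.* (w ℕ.* w) ℕ.+ 4 ℕ.* (w ℕ.* k) ℕ.+ 2 ℕ.* (k ℕ.* k) ℕ.+ 8 ℕ.* w ℕ.+ 8 ℕ.* k ℕ.+ 7)
    e₀ = ℕRing.solve-∀
    e₁ : ∀ R w k → R ℕ.* (2 ℕ.* (w ℕ.* w) ℕ.+ 4 ℕ.* (w ℕ.* k) ℕ.+ 2 ℕ.* (w ℕ.* k) ℕ.+ 8 ℕ.* w ℕ.+ 8 ℕ.* w ℕ.+ 7 ℕ.* w)
      ≡ R ℕ.* 2 ℕ.* (w ℕ.* w) ℕ.+ 6 ℕ.* R ℕ.* k ℕ.* w ℕ.+ 23 ℕ.* R ℕ.* w
    e₁ = ℕRing.solve-∀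
    e₂ : ∀ a b R w c → a ℕ.+ b ℕ.+ 23 ℕ.* R ℕ.* w ℕ.+ c ℕ.* w ≡ a ℕ.+ (b ℕ.+ (23 ℕ.* R ℕ.+ c) ℕ.* w)
    e₂ = ℕRing.solve-∀
    e₃ : ∀ q Q f c → q ℕ.* (Q ℕ.* f ℕ.+ c) ≡ Q ℕ.* (q ℕ.* f) ℕ.+ q ℕ.* c
    e₃ = ℕRing.solve-∀
    e₄ : ∀ R k w c → 2 ℕ.* (6 ℕ.* R ℕ.* k ℕ.* w ℕ.+ c ℕ.* w) ≡ 12 ℕ.* R ℕ.* k ℕ.* w ℕ.+ 2 ℕ.* c ℕ.* w
    e₄ = ℕRing.solve-∀
    e₅ : ∀ x → x ℕ.+ x ≡ 2 ℕ.* x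
    e₅ = ℕRing.solve-∀
    lower-order : 6 ℕ.* R ℕ.* k ℕ.* w ℕ.+ (23 ℕ.* R ℕ.+ q ℕ.* C) ℕ.* w ℕ.≤ w ℕ.* w
    lower-order = ℕ.*-cancelˡ-≤ 2 (begin
      2 ℕ.* (6 ℕ.* R ℕ.* k ℕ.* w ℕ.+ (23 ℕ.* R ℕ.+ q ℕ.* C) ℕ.* w)   ≡⟨ e₄ R k w (23 ℕ.* R ℕ.+ q ℕ.* C) ⟩
      12 ℕ.* R ℕ.* k ℕ.* w ℕ.+ 2 ℕ.* (23 ℕ.* R ℕ.+ q ℕ.* C) ℕ.* w    ≤⟨ ℕ.+-mono-≤ (ℕ.*-monoˡ-≤ w (ℕ.≤-trans (ℕ.m≤n+m _ k) Lk≤w)) (ℕ.*-monoˡ-≤ w (ℕ.≤-trans (ℕ.n≤1+n _) W≤w)) ⟩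
      w ℕ.* w ℕ.+ w ℕ.* w                                            ≡⟨ e₅ (w ℕ.* w) ⟩
      2 ℕ.* (w ℕ.* w)                                                ∎)
    leading : R ℕ.* 2 ℕ.* (w ℕ.* w) ℕ.+ w ℕ.* w ℕ.≤ q ℕ.* (P′ ℕ.* (w ℕ.* w))
    leading = subst₂ ℕ._≤_ (e₆ (R ℕ.* 2) (w ℕ.* w)) (ℕ.*-assoc q P′ (w ℕ.* w)) (ℕ.*-monoˡ-≤ (w ℕ.* w) coefficient)
      where
      e₆ : ∀ r x → (r ℕ.+ 1) ℕ.* x ≡ r ℕ.* x ℕ.+ x
      e₆ = ℕRing.solve-∀
      e₇ : ∀ q p → suc q ℕ.* p ℕ.* 2 ℕ.+ 1 ≡ q ℕ.* (2 ℕ.* p) ℕ.+ suc (2 ℕ.* p)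
      e₇ = ℕRing.solve-∀
      e₈ : ∀ q p → q ℕ.* (2 ℕ.* p) ℕ.+ q ≡ q ℕ.* suc (2 ℕ.* p)
      e₈ = ℕRing.solve-∀
      coefficient : R ℕ.* 2 ℕ.+ 1 ℕ.≤ q ℕ.* P′
      coefficient = ℕ.≤-trans (ℕ.≤-reflexive (e₇ q p)) (ℕ.≤-trans (ℕ.+-monoʳ-≤ (q ℕ.* (2 ℕ.* p)) 2p<q) (ℕ.≤-reflexive (e₈ q p)))

  n≤σ : ∀ n → n ℕ.≤ σ (suc n)
  n≤σ zero    = z≤n
  n≤σ (suc n) = ℕ.≤-trans (s≤s (n≤σ n)) (σ-inc (suc n) (s≤s z≤n))

  growth : ∀ κ → K ℕ.≤ κ → p ℕ.* gapExponent (suc κ) ℕ.≤ q ℕ.* F κ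
  growth κ K≤κ = by (SmallIntervals.last-above em (λ j → σ (suc (j ℕ.+ N)) ℕ.≤ κ) (ℕ.m+n≤o⇒m≤o (σ (suc N)) K≤κ) (suc κ)
      λ bad → ℕ.<-irrefl refl (ℕ.<-≤-trans (s≤s (ℕ.m≤m+n κ N)) (ℕ.≤-trans (n≤σ (suc κ ℕ.+ N)) bad)))
    where
    by : ∃[ d ] σ (suc (d ℕ.+ N)) ℕ.≤ κ × ¬ (σ (suc (suc d ℕ.+ N)) ℕ.≤ κ) → p ℕ.* gapExponent (suc κ) ℕ.≤ q ℕ.* F κ
    by (d , S≤κ , κ<) = subst (λ z → p ℕ.* gapExponent (suc z) ℕ.≤ q ℕ.* F z) w+k (quadratic w k Lk≤w W≤w
        (subst (λ z → P′ ℕ.* (w ℕ.* w) ℕ.≤ Q ℕ.* F z ℕ.+ C) (sym w+k) (inside-block d κ S≤κ (ℕ.<⇒≤ (ℕ.≰⇒> κ<)))))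
      where
      k = d ℕ.+ N
      w = κ ℕ.∸ k
      rest≤κ : 2 ℕ.* (L ℕ.* L) ℕ.+ 2 ℕ.* W₀ ℕ.≤ κ
      rest≤κ = ℕ.m+n≤o⇒n≤o (σ (suc N)) K≤κ
      Lk≤κ : L ℕ.* k ℕ.≤ κ
      Lk≤κ = block-number-small L k κ S≤κ (ℕ.m+n≤o⇒m≤o (2 ℕ.* (L ℕ.* L)) rest≤κ)
      k≤κ : k ℕ.≤ κ
      k≤κ = ℕ.≤-trans (ℕ.m≤m+n k _) Lk≤κ
      w+k : w ℕ.+ k ≡ κ
      w+k = ℕ.m∸n+n≡m k≤κ
      Lk≤w : suc (12 ℕ.* R) ℕ.* k ℕ.≤ w
      Lk≤w = ℕ.+-cancelˡ-≤ k _ _ (ℕ.≤-trans Lk≤κ (ℕ.≤-reflexive (trans (sym w+k) (ℕ.+-comm w k))))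
      W≤w : W₀ ℕ.≤ w
      W≤w = ℕ.*-cancelˡ-≤ 2 (ℕ.≤-trans (ℕ.m+n≤o⇒n≤o (2 ℕ.* (L ℕ.* L)) rest≤κ) (ℕ.≤-trans (ℕ.≤-reflexive (sym w+k))
        (ℕ.≤-trans (ℕ.+-monoʳ-≤ w (ℕ.≤-trans (ℕ.m≤m+n k _) Lk≤w)) (ℕ.≤-reflexive (cong (w ℕ.+_) (sym (ℕ.+-identityʳ w)))))))

  unbounded : 1 ℕ.≤ p → ∀ M → ∃[ κ ] M ℕ.≤ F κ
  unbounded 1≤p M = κ , ℕ.*-cancelˡ-≤ q {{ℕ.>-nonZero (ℕ.≤-<-trans z≤n 2p<q)}} (ℕ.≤-trans (ℕ.≤-trans (ℕ.m≤n+m (q ℕ.* M) K)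
      (ℕ.≤-trans (ℕ.n≤1+n κ) (ℕ.≤-trans (n≤gapExponent (suc κ)) (ℕ.m≤n*m (gapExponent (suc κ)) p {{ℕ.>-nonZero 1≤p}})))) (growth κ (ℕ.m≤m+n K (q ℕ.* M))))
    where κ = K ℕ.+ q ℕ.* M

-- From the limit of the gap ratios to the exponents

ev≋ : ∀ {x y} → Eventually (λ n → seq x n ≡ seq y n) → x ≋ y
ev≋ {x} {y} h = ⟪ ≤-antisym {x} {y} (ev≤ {x} {y} (mapEv h λ n eq → ℚ.≤-reflexive eq)) (ev≤ {y} {x} (mapEv h λ n eq → ℚ.≤-reflexive (sym eq))) ⟫

0≤inv : ∀ x 0<x → 0ℝ ⊑ inv x 0<x
0≤inv x 0<x@(ε , 0<ε , h) = ⟨ ev≤ {0ℝ} {inv x 0<x} (mapEv h λ n le →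
  ℚ.<⇒≤ (0<recip (ℚ.<-≤-trans 0<ε (subst (ℚ._≤ seq x n) (ℚ.+-identityˡ ε) le)))) ⟩

inv-* : ∀ x 0<x → inv x 0<x * x ≋ 1ℝ
inv-* x 0<x@(ε , 0<ε , h) = ev≋ {inv x 0<x * x} {1ℝ} (mapEv h λ n le →
  recip-* (seq x n) (ℚ.<-≤-trans 0<ε (subst (ℚ._≤ seq x n) (ℚ.+-identityˡ ε) le)))

-- Expanding the fraction makes 1/q at most ρ, so the slack ρ absorbs the units added in q + 1 and
-- 2p + 1.
nonneg⇒scaled-fraction : ∀ r ρ → 0ℚ ℚ.≤ r → 0ℚ ℚ.< ρ → ∃[ p ] ∃[ q-1 ] r ≡ fraction p (suc q-1) × 1ℚ ℚ.≤ ι (suc q-1) ℚ.* ρ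
nonneg⇒scaled-fraction r ρ 0≤r 0<ρ =
  let (c , d , 1≤d , r≡) = nonneg⇒fraction r 0≤r
      (T , 1≤T , small) = archimedean ρ 0<ρ
      dT≡ = ℕ.suc-pred (d ℕ.* T) {{ℕ.>-nonZero (1≤* 1≤d 1≤T)}}
  in c ℕ.* T , ℕ.pred (d ℕ.* T) , trans r≡ (trans (scale c d T 1≤d 1≤T) (cong (fraction (c ℕ.* T)) (sym dT≡))) ,
     subst (λ z → 1ℚ ℚ.≤ ι z ℚ.* ρ) (sym dT≡) (ℚ.≤-trans (large T 1≤T small)
       (*-monoˡ-≤ ρ (ℚ.<⇒≤ 0<ρ) (ι-mono-≤ (ℕ.m≤n*m T d {{ℕ.>-nonZero 1≤d}}))))
  where
  e : ∀ c t u v → (c ℚ.* t) ℚ.* (u ℚ.* v) ≡ (v ℚ.* t) ℚ.* (c ℚ.* u)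
  e = solve-∀ ℚring
  scale : ∀ c d T → 1 ℕ.≤ d → 1 ℕ.≤ T → fraction c d ≡ fraction (c ℕ.* T) (d ℕ.* T)
  scale c d T 1≤d 1≤T = sym (trans (cong₂ ℚ._*_ (ι-* c T) (1/ᵘ-mul 1≤d 1≤T)) (trans (e (ι c) (ι T) (1/ᵘ d) (1/ᵘ T))
    (trans (cong (ℚ._* (ι c ℚ.* 1/ᵘ d)) (1/ᵘ-* 1≤T)) (ℚ.*-identityˡ (ι c ℚ.* 1/ᵘ d)))))
  large : ∀ T → 1 ℕ.≤ T → 1/ᵘ T ℚ.≤ ρ → 1ℚ ℚ.≤ ι T ℚ.* ρ
  large T 1≤T small = subst (ℚ._≤ ι T ℚ.* ρ) (trans (ℚ.*-comm (ι T) (1/ᵘ T)) (1/ᵘ-* 1≤T)) (*-monoʳ-≤ (ι T) (0≤ι T) small)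

fraction-numerator : ∀ {r} p q → 1 ℕ.≤ q → r ≡ fraction p q → r ℚ.* ι q ≡ ι p
fraction-numerator p q 1≤q r≡ = trans (cong (ℚ._* ι q) r≡) (trans (ℚ.*-assoc (ι p) (1/ᵘ q) (ι q)) (trans (cong (ι p ℚ.*_) (1/ᵘ-* 1≤q)) (ℚ.*-identityʳ (ι p))))

2/1≡ : + 2 ℚ./ 1 ≡ 1ℚ ℚ.+ 1ℚ
2/1≡ = refl

-- 1 − 2r; the inequality β (1 − 2r) ≶ 1 says that (β − 1)/(2β) ≶ r.
defect : ℚ → ℚ
defect r = 1ℚ ℚ.- (r ℚ.+ r)

ι-double : ∀ p → ι (p ℕ.+ p) ≡ ι p ℚ.+ ι p
ι-double p = ι-+ p p

module Gaps (σ : ℕ → ℕ) (1≤σ : ∀ n → 1 ℕ.≤ n → 0 ℕ.< σ n) (σ-inc : IncreasingFrom1 σ)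
  (σ-gap : ∀ n → 1 ℕ.≤ n → n ℕ.≤ σ (suc n) ℕ.∸ σ n) where

  open Blocks σ 1≤σ σ-inc σ-gap

  gapAt : ℕ → ℕ
  gapAt k = σ (suc (suc k)) ℕ.∸ σ (suc k)

  ratio : ℕ → ℚ
  ratio k = + gapAt k ℚ./ suc k

  ratio-* : ∀ k → ratio k ℚ.* ι (suc k) ≡ ι (gapAt k)
  ratio-* k = /-* (gapAt k) (suc k)

  freeCount+k : ∀ k → freeCount k ℕ.+ k ≡ suc (gapAt k)
  freeCount+k k = ℕ.+-cancelˡ-≡ (σ (suc k)) _ _ (trans (e (σ (suc k)) (freeCount k) k) (trans (blockEnd+freeCount k)
    (trans (cong suc (sym (ℕ.m+[n∸m]≡n (ℕ.<⇒≤ (σ-inc (suc k) (s≤s z≤n)))))) (sym (ℕ.+-suc (σ (suc k)) (gapAt k))))))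
    where
    e : ∀ s f k → s ℕ.+ (f ℕ.+ k) ≡ (s ℕ.+ k) ℕ.+ f
    e = ℕRing.solve-∀

  scaled-ratio : ∀ k A B → ratio k ℚ.* A ℚ.≤ B → ι (gapAt k) ℚ.* A ℚ.≤ ι (suc k) ℚ.* B
  scaled-ratio k A B h = subst (ℚ._≤ ι (suc k) ℚ.* B) (trans (e (ι (suc k)) (ratio k) A) (cong (ℚ._* A) (ratio-* k))) (*-monoʳ-≤ (ι (suc k)) (0≤ι (suc k)) h)
    where
    e : ∀ n r a → n ℚ.* (r ℚ.* a) ≡ (r ℚ.* n) ℚ.* a
    e = solve-∀ ℚring

  scaled-ratio′ : ∀ k A B → B ℚ.≤ ratio k ℚ.* A → ι (suc k) ℚ.* B ℚ.≤ ι (gapAt k) ℚ.* A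
  scaled-ratio′ k A B h = subst (ι (suc k) ℚ.* B ℚ.≤_) (trans (e (ι (suc k)) (ratio k) A) (cong (ℚ._* A) (ratio-* k))) (*-monoʳ-≤ (ι (suc k)) (0≤ι (suc k)) h)
    where
    e : ∀ n r a → n ℚ.* (r ℚ.* a) ≡ (r ℚ.* n) ℚ.* a
    e = solve-∀ ℚring

  suc≤gap : ∀ k → ι (suc k) ℚ.≤ ι (gapAt k)
  suc≤gap k = ι-mono-≤ (σ-gap (suc k) (s≤s z≤n))

  exponent-above : ∀ r ρ p q-1 → 0ℚ ℚ.< ρ → r ≡ fraction p (suc q-1) → 1ℚ ℚ.≤ ι (suc q-1) ℚ.* ρ →
    Eventually (λ k → ratio k ℚ.* defect (r ℚ.- ρ) ℚ.≤ 1ℚ ℚ.+ ρ ℚ.* ½) →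
    Eventually (λ k → suc (suc q-1) ℕ.* freeCount k ℕ.≤ (p ℕ.+ p) ℕ.* (freeCount k ℕ.+ k))
  exponent-above r ρ p q-1 0<ρ r≡ 1≤qρ h =
    let (M , 1≤M , small) = archimedean (ρ ℚ.* ½ ℚ.* ½) (0<half (0<half 0<ρ)) in
    zipEv h (suc M , λ _ → id) λ k hk M<k → at k hk (large k M 1≤M small (ℕ.<⇒≤ M<k)) (ℕ.≤-trans (s≤s z≤n) M<k)
    where
    q = suc q-1
    e₀ : ∀ u → (u ℚ.* ½ ℚ.* ½) ℚ.* (1ℚ ℚ.+ 1ℚ) ≡ u ℚ.* ½
    e₀ = solve-∀ ℚring
    e₁ : ∀ x m → (x ℚ.* m) ℚ.* (1ℚ ℚ.+ 1ℚ) ≡ (x ℚ.* (1ℚ ℚ.+ 1ℚ)) ℚ.* m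
    e₁ = solve-∀ ℚring
    -- The free count is the gap minus (k + 1) plus 2; the surplus 2 is covered once ρ (k + 1)/2 ≥
    -- 2.
    large : ∀ k M → 1 ℕ.≤ M → 1/ᵘ M ℚ.≤ ρ ℚ.* ½ ℚ.* ½ → M ℕ.≤ k → 1ℚ ℚ.+ 1ℚ ℚ.≤ (ρ ℚ.* ½) ℚ.* ι (suc k)
    large k M 1≤M small M≤k = subst₂ ℚ._≤_ (trans (cong (ℚ._* (1ℚ ℚ.+ 1ℚ)) (1/ᵘ-* 1≤M)) (ℚ.*-identityˡ (1ℚ ℚ.+ 1ℚ)))
      (trans (e₁ (ρ ℚ.* ½ ℚ.* ½) (ι (suc k))) (cong (ℚ._* ι (suc k)) (e₀ ρ)))
      (*-monoˡ-≤ (1ℚ ℚ.+ 1ℚ) (toWitness {a? = 0ℚ ℚ.≤? 1ℚ ℚ.+ 1ℚ} _)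
        (*-mono-≤ {1/ᵘ M} {ρ ℚ.* ½ ℚ.* ½} {ι M} {ι (suc k)} (0≤1/ᵘ M) (0≤ι M) small (ι-mono-≤ (ℕ.m≤n⇒m≤1+n M≤k))))
    -- Exhibits the right side minus the left as a combination of quantities that are nonnegative by
    -- the ratio hypothesis, by k + 1 ≤ Γ, by Q ρ ≥ 1, by `large`, by r Q ≥ 0 and by k ≥ 1; Γ stands
    -- for the gap and r Q for p.
    certificate : ∀ r ρ Q Γ k →
      (r ℚ.* Q ℚ.+ r ℚ.* Q) ℚ.* (1ℚ ℚ.+ Γ) ≡ (1ℚ ℚ.+ Q) ℚ.* ((1ℚ ℚ.+ Γ) ℚ.- k) ℚ.+
        (Q ℚ.* (((1ℚ ℚ.+ k) ℚ.* (1ℚ ℚ.+ ρ ℚ.* ½) ℚ.- Γ ℚ.* (1ℚ ℚ.- ((r ℚ.- ρ) ℚ.+ (r ℚ.- ρ)))) ℚ.+ ρ ℚ.* (Γ ℚ.- (1ℚ ℚ.+ k)))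
          ℚ.+ ((Q ℚ.* ρ ℚ.- 1ℚ) ℚ.* Γ ℚ.+ (Q ℚ.* ((ρ ℚ.* ½) ℚ.* (1ℚ ℚ.+ k) ℚ.- (1ℚ ℚ.+ 1ℚ)) ℚ.+ ((r ℚ.* Q ℚ.+ r ℚ.* Q) ℚ.+ (k ℚ.- 1ℚ)))))
    certificate = solve-∀ ℚring
    at : ∀ k → ratio k ℚ.* defect (r ℚ.- ρ) ℚ.≤ 1ℚ ℚ.+ ρ ℚ.* ½ → 1ℚ ℚ.+ 1ℚ ℚ.≤ (ρ ℚ.* ½) ℚ.* ι (suc k) → 1 ℕ.≤ k →
      suc q ℕ.* freeCount k ℕ.≤ (p ℕ.+ p) ℕ.* (freeCount k ℕ.+ k)
    at k hk 2≤ 1≤k = ι-cancel-≤ (subst₂ ℚ._≤_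
        (sym (trans (ι-* (suc q) (freeCount k)) (cong₂ ℚ._*_ (ι-suc q) f≡)))
        (sym (trans (ι-* (p ℕ.+ p) (freeCount k ℕ.+ k)) (cong₂ ℚ._*_ (trans (ι-double p) (cong₂ ℚ._+_ (sym P≡) (sym P≡))) (trans (cong ι (freeCount+k k)) (ι-suc (gapAt k))))))
        (≤-by _ (0≤+ {Q ℚ.* (X ℚ.+ Y)} {Z ℚ.+ (T ℚ.+ (P2 ℚ.+ (κ ℚ.- 1ℚ)))}
          (0≤* {Q} {X ℚ.+ Y} (0≤ι q) (0≤+ {X} {Y}
            (0≤-diff (subst (λ z → Γ ℚ.* defect (r ℚ.- ρ) ℚ.≤ z ℚ.* (1ℚ ℚ.+ ρ ℚ.* ½)) (ι-suc k) (scaled-ratio k (defect (r ℚ.- ρ)) (1ℚ ℚ.+ ρ ℚ.* ½) hk)))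
            (0≤* {ρ} {Γ ℚ.- (1ℚ ℚ.+ κ)} (ℚ.<⇒≤ 0<ρ) (0≤-diff (subst (ℚ._≤ Γ) (ι-suc k) (suc≤gap k))))))
          (0≤+ {Z} {T ℚ.+ (P2 ℚ.+ (κ ℚ.- 1ℚ))} (0≤* {Q ℚ.* ρ ℚ.- 1ℚ} {Γ} (0≤-diff 1≤qρ) (0≤ι (gapAt k)))
            (0≤+ {T} {P2 ℚ.+ (κ ℚ.- 1ℚ)} (0≤* {Q} {(ρ ℚ.* ½) ℚ.* (1ℚ ℚ.+ κ) ℚ.- (1ℚ ℚ.+ 1ℚ)} (0≤ι q)
                (0≤-diff (subst (λ z → 1ℚ ℚ.+ 1ℚ ℚ.≤ (ρ ℚ.* ½) ℚ.* z) (ι-suc k) 2≤)))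
              (0≤+ {P2} {κ ℚ.- 1ℚ} (0≤+ {r ℚ.* Q} {r ℚ.* Q} 0≤rQ 0≤rQ) (0≤-diff (subst (ℚ._≤ κ) ι1 (ι-mono-≤ 1≤k)))))))
          (certificate r ρ Q Γ κ)))
      where
      Q = ι q
      Γ = ι (gapAt k)
      κ = ι k
      X = (1ℚ ℚ.+ κ) ℚ.* (1ℚ ℚ.+ ρ ℚ.* ½) ℚ.- Γ ℚ.* (1ℚ ℚ.- ((r ℚ.- ρ) ℚ.+ (r ℚ.- ρ)))
      Y = ρ ℚ.* (Γ ℚ.- (1ℚ ℚ.+ κ))
      Z = (Q ℚ.* ρ ℚ.- 1ℚ) ℚ.* Γ
      T = Q ℚ.* ((ρ ℚ.* ½) ℚ.* (1ℚ ℚ.+ κ) ℚ.- (1ℚ ℚ.+ 1ℚ))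
      P2 = r ℚ.* Q ℚ.+ r ℚ.* Q
      P≡ : r ℚ.* Q ≡ ι p
      P≡ = fraction-numerator p q (s≤s z≤n) r≡
      0≤rQ : 0ℚ ℚ.≤ r ℚ.* Q
      0≤rQ = subst (0ℚ ℚ.≤_) (sym P≡) (0≤ι p)
      e₂ : ∀ f k → f ≡ (f ℚ.+ k) ℚ.- k
      e₂ = solve-∀ ℚring
      f≡ : ι (freeCount k) ≡ (1ℚ ℚ.+ Γ) ℚ.- κ
      f≡ = trans (e₂ (ι (freeCount k)) κ) (cong (ℚ._- κ) (trans (sym (ι-+ (freeCount k) k)) (trans (cong ι (freeCount+k k)) (ι-suc (gapAt k)))))

  density-below : ∀ r ρ p q-1 → 0ℚ ℚ.< ρ → r ≡ fraction p (suc q-1) → 1ℚ ℚ.≤ ι (suc q-1) ℚ.* ρ →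
    Eventually (λ k → 1ℚ ℚ.- ρ ℚ.≤ ratio k ℚ.* defect (r ℚ.+ ρ)) →
    Eventually (λ k → suc (suc q-1) ℕ.* suc k ℕ.+ suc (2 ℕ.* p) ℕ.* gapAt k ℕ.≤ suc (suc q-1) ℕ.* gapAt k)
  density-below r ρ p q-1 0<ρ r≡ 1≤qρ h = mapEv h at
    where
    q = suc q-1
    -- Again the difference as a nonnegative combination: of the ratio hypothesis, of n ≤ Γ and of Q
    -- ρ ≥ 1, where n is k + 1.
    certificate : ∀ r ρ Q Γ n →
      (1ℚ ℚ.+ Q) ℚ.* Γ ≡ ((1ℚ ℚ.+ Q) ℚ.* n ℚ.+ (1ℚ ℚ.+ (r ℚ.* Q ℚ.+ r ℚ.* Q)) ℚ.* Γ) ℚ.+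
        (Q ℚ.* ((Γ ℚ.* (1ℚ ℚ.- ((r ℚ.+ ρ) ℚ.+ (r ℚ.+ ρ))) ℚ.- n ℚ.* (1ℚ ℚ.- ρ)) ℚ.+ (ρ ℚ.+ ρ) ℚ.* (Γ ℚ.- n)) ℚ.+ (Q ℚ.* ρ ℚ.- 1ℚ) ℚ.* n)
    certificate = solve-∀ ℚring
    at : ∀ k → 1ℚ ℚ.- ρ ℚ.≤ ratio k ℚ.* defect (r ℚ.+ ρ) → suc q ℕ.* suc k ℕ.+ suc (2 ℕ.* p) ℕ.* gapAt k ℕ.≤ suc q ℕ.* gapAt k
    at k hk = ι-cancel-≤ (subst₂ ℚ._≤_
        (sym (trans (ι-+ (suc q ℕ.* suc k) (suc (2 ℕ.* p) ℕ.* gapAt k)) (cong₂ ℚ._+_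
          (trans (ι-* (suc q) (suc k)) (cong (ℚ._* n) (ι-suc q)))
          (trans (ι-* (suc (2 ℕ.* p)) (gapAt k)) (cong (ℚ._* Γ) (trans (ι-suc (2 ℕ.* p)) (cong (1ℚ ℚ.+_) (trans (cong (λ z → ι (p ℕ.+ z)) (ℕ.+-identityʳ p)) (trans (ι-double p) (cong₂ ℚ._+_ (sym P≡) (sym P≡)))))))))))
        (sym (trans (ι-* (suc q) (gapAt k)) (cong (ℚ._* Γ) (ι-suc q))))
        (≤-by _ (0≤+ {Q ℚ.* (X ℚ.+ Y)} {(Q ℚ.* ρ ℚ.- 1ℚ) ℚ.* n}
          (0≤* {Q} {X ℚ.+ Y} (0≤ι q) (0≤+ {X} {Y} (0≤-diff (scaled-ratio′ k (defect (r ℚ.+ ρ)) (1ℚ ℚ.- ρ) hk))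
            (0≤* {ρ ℚ.+ ρ} {Γ ℚ.- n} (0≤+ {ρ} {ρ} (ℚ.<⇒≤ 0<ρ) (ℚ.<⇒≤ 0<ρ)) (0≤-diff (suc≤gap k)))))
          (0≤* {Q ℚ.* ρ ℚ.- 1ℚ} {n} (0≤-diff 1≤qρ) (0≤ι (suc k))))
          (certificate r ρ Q Γ n)))
      where
      Q = ι q
      Γ = ι (gapAt k)
      n = ι (suc k)
      X = Γ ℚ.* (1ℚ ℚ.- ((r ℚ.+ ρ) ℚ.+ (r ℚ.+ ρ))) ℚ.- n ℚ.* (1ℚ ℚ.- ρ)
      Y = (ρ ℚ.+ ρ) ℚ.* (Γ ℚ.- n)
      P≡ : r ℚ.* Q ≡ ι p
      P≡ = fraction-numerator p q (s≤s z≤n) r≡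

-- The dimension

module FiniteLimit (β : ℝ) (1≤β : 1ℝ ≤ β) (h : ℕ → ℚ) (lim : (λ n → fromℚ (h n)) ⟶ fin β) where

  D : ℝ
  D = (β - 1ℝ) * inv (2ℝ * β) (0<2* β 1≤β)

  0⊑2β : 0ℝ ⊑ 2ℝ * β
  0⊑2β = <⇒⊑ 0ℝ (2ℝ * β) (0<2* β 1≤β)

  D*2β : D * (2ℝ * β) ≋ β - 1ℝ
  D*2β = ≋-trans (pw≋ λ n → ℚ.*-assoc (seq (β - 1ℝ) n) (seq (inv (2ℝ * β) (0<2* β 1≤β)) n) (seq (2ℝ * β) n))
    (≋-trans (*-≋ {β - 1ℝ} {β - 1ℝ} ≋-refl (inv-* (2ℝ * β) (0<2* β 1≤β))) (*-identityʳ≋ (β - 1ℝ)))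

  0≤D : 0ℝ ⊑ D
  0≤D = *-nonneg⊑ ⟨ 0≤-diffℝ {1ℝ} {β} 1≤β ⟩ (0≤inv (2ℝ * β) (0<2* β 1≤β))

  e₁ : ∀ r b → (r ℚ.* ((+ 2 ℚ./ 1) ℚ.* b) ℚ.- (b ℚ.- 1ℚ)) ≡ 1ℚ ℚ.- (1ℚ ℚ.- (r ℚ.+ r)) ℚ.* b
  e₁ r b = trans (cong (λ z → r ℚ.* (z ℚ.* b) ℚ.- (b ℚ.- 1ℚ)) 2/1≡) (e r b)
    where
    e : ∀ r b → r ℚ.* ((1ℚ ℚ.+ 1ℚ) ℚ.* b) ℚ.- (b ℚ.- 1ℚ) ≡ 1ℚ ℚ.- (1ℚ ℚ.- (r ℚ.+ r)) ℚ.* b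
    e = solve-∀ ℚring

  e₂ : ∀ r b → (b ℚ.- 1ℚ) ℚ.- r ℚ.* ((+ 2 ℚ./ 1) ℚ.* b) ≡ (1ℚ ℚ.- (r ℚ.+ r)) ℚ.* b ℚ.- 1ℚ
  e₂ r b = trans (cong (λ z → (b ℚ.- 1ℚ) ℚ.- r ℚ.* (z ℚ.* b)) 2/1≡) (e r b)
    where
    e : ∀ r b → (b ℚ.- 1ℚ) ℚ.- r ℚ.* ((1ℚ ℚ.+ 1ℚ) ℚ.* b) ≡ (1ℚ ℚ.- (r ℚ.+ r)) ℚ.* b ℚ.- 1ℚ
    e = solve-∀ ℚring

  below⇒defect : ∀ r → D ⊑ fromℚ r → fromℚ (defect r) * β ⊑ 1ℝ
  below⇒defect r D≤r = ⟨ diff-≤ {fromℚ (defect r) * β} {1ℝ} (un⊑ (⊑-trans {0ℝ} {fromℚ r * (2ℝ * β) - (β - 1ℝ)} {1ℝ - fromℚ (defect r) * β}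
    ⟨ 0≤-diffℝ {β - 1ℝ} {fromℚ r * (2ℝ * β)} (un⊑ (⊑-trans (≋⇒⊑ (≋-sym D*2β))
        (*-⊑ {D} {fromℚ r} {2ℝ * β} {2ℝ * β} 0≤D 0⊑2β D≤r ⊑-refl))) ⟩
    (pw⊑ λ n → ℚ.≤-reflexive (e₁ r (seq β n))))) ⟩

  above⇒defect : ∀ r → 0ℚ ℚ.≤ r → fromℚ r ⊑ D → 1ℝ ⊑ fromℚ (defect r) * β
  above⇒defect r 0≤r r≤D = ⟨ diff-≤ {1ℝ} {fromℚ (defect r) * β} (un⊑ (⊑-trans {0ℝ} {(β - 1ℝ) - fromℚ r * (2ℝ * β)} {fromℚ (defect r) * β - 1ℝ}
    ⟨ 0≤-diffℝ {fromℚ r * (2ℝ * β)} {β - 1ℝ} (un⊑ (⊑-trans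
        (*-⊑ {fromℚ r} {D} {2ℝ * β} {2ℝ * β} (fromℚ-⊑ 0≤r) 0⊑2β r≤D ⊑-refl) (≋⇒⊑ D*2β))) ⟩
    (pw⊑ λ n → ℚ.≤-reflexive (e₂ r (seq β n))))) ⟩

  deviation : ∀ A τ → 0ℚ ℚ.< τ → Eventually λ n → fromℚ (ℚ.∣ A ∣) * ∣ fromℚ (h n) - β ∣ ⊑ fromℚ τ
  deviation A τ 0<τ =
    let (δ , 0<δ , small) = scale-small ℚ.∣ A ∣ τ (ℚ.0≤∣p∣ A) 0<τ in
    mapEv (lim (fromℚ δ) (fromℚ-mono-< 0<δ)) λ n close →
      ⊑-trans (*-⊑ {fromℚ (ℚ.∣ A ∣)} {fromℚ (ℚ.∣ A ∣)} {∣ fromℚ (h n) - β ∣} {fromℚ δ} (fromℚ-⊑ (ℚ.0≤∣p∣ A)) (fromℚ-⊑ (ℚ.<⇒≤ 0<δ)) ⊑-refl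
                (<⇒⊑ (∣ fromℚ (h n) - β ∣) (fromℚ δ) close))
        (pw⊑ λ _ → small δ ℚ.≤-refl)

  product-deviation : ∀ A p b → ℚ.∣ p ℚ.* A ℚ.- A ℚ.* b ∣ ≡ ℚ.∣ A ∣ ℚ.* ℚ.∣ p ℚ.- b ∣
  product-deviation A p b = trans (cong ℚ.∣_∣ (e A p b)) (ℚ.∣p*q∣≡∣p∣*∣q∣ A (p ℚ.- b))
    where
    e : ∀ A p b → p ℚ.* A ℚ.- A ℚ.* b ≡ A ℚ.* (p ℚ.- b)
    e = solve-∀ ℚring

  eventually-≤ : ∀ A τ → 0ℚ ℚ.< τ → fromℚ A * β ⊑ 1ℝ → Eventually λ n → h n ℚ.* A ℚ.≤ 1ℚ ℚ.+ τ
  eventually-≤ A τ 0<τ Aβ≤1 = mapEv (deviation A τ 0<τ) λ n close → fromℚ-cancel-≤ (un⊑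
    (⊑-trans {fromℚ (h n ℚ.* A)} {fromℚ A * β + fromℚ (ℚ.∣ A ∣) * ∣ fromℚ (h n) - β ∣} {fromℚ (1ℚ ℚ.+ τ)}
      (pw⊑ λ k → ∣-∣≤⇒≤ (h n ℚ.* A) (A ℚ.* seq β k) (ℚ.≤-reflexive (product-deviation A (h n) (seq β k))))
      (⊑-trans {y = 1ℝ + fromℚ τ} (+-⊑ Aβ≤1 close) (pw⊑ λ _ → ℚ.≤-refl))))

  eventually-≥ : ∀ A τ → 0ℚ ℚ.< τ → 1ℝ ⊑ fromℚ A * β → Eventually λ n → 1ℚ ℚ.- τ ℚ.≤ h n ℚ.* A
  eventually-≥ A τ 0<τ 1≤Aβ = mapEv (deviation A τ 0<τ) λ n close → ≤-by (h n ℚ.* A ℚ.+ τ ℚ.- 1ℚ)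
    (0≤-diff {1ℚ} {h n ℚ.* A ℚ.+ τ} (fromℚ-cancel-≤ {1ℚ} {h n ℚ.* A ℚ.+ τ} (un⊑ (⊑-trans {1ℝ} {fromℚ A * β} {fromℚ (h n ℚ.* A ℚ.+ τ)} 1≤Aβ
      (⊑-trans {y = fromℚ (h n ℚ.* A) + fromℚ (ℚ.∣ A ∣) * ∣ fromℚ (h n) - β ∣}
        (pw⊑ λ k → ∣-∣≤⇒≤ (A ℚ.* seq β k) (h n ℚ.* A) (ℚ.≤-reflexive (trans (∣-∣-comm (A ℚ.* seq β k) (h n ℚ.* A)) (product-deviation A (h n) (seq β k)))))
        (⊑-trans {y = fromℚ (h n ℚ.* A) + fromℚ τ} (+-⊑ {fromℚ (h n ℚ.* A)} ⊑-refl close) (pw⊑ λ _ → ℚ.≤-refl)))))))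
    (e (h n ℚ.* A) τ)
    where
    e : ∀ x τ → x ≡ (1ℚ ℚ.- τ) ℚ.+ (x ℚ.+ τ ℚ.- 1ℚ)
    e = solve-∀ ℚring

module InfiniteLimit (h : ℕ → ℚ) (0≤h : ∀ n → 0ℚ ℚ.≤ h n) (lim : (λ n → fromℚ (h n)) ⟶ ∞) where

  e : ∀ r → 1ℚ ℚ.- (r ℚ.+ r) ≡ (½ ℚ.- r) ℚ.+ (½ ℚ.- r)
  e = solve-∀ ℚring

  eventually-≤ : ∀ r τ → 0ℚ ℚ.< τ → ½ ℚ.≤ r → Eventually λ n → h n ℚ.* defect r ℚ.≤ 1ℚ ℚ.+ τ
  eventually-≤ r τ 0<τ ½≤r = always λ n → ≤-by (h n ℚ.* ((r ℚ.- ½) ℚ.+ (r ℚ.- ½)) ℚ.+ (1ℚ ℚ.+ τ))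
    (0≤+ {h n ℚ.* ((r ℚ.- ½) ℚ.+ (r ℚ.- ½))} {1ℚ ℚ.+ τ}
      (0≤* {h n} {(r ℚ.- ½) ℚ.+ (r ℚ.- ½)} (0≤h n) (0≤+ {r ℚ.- ½} {r ℚ.- ½} (0≤-diff ½≤r) (0≤-diff ½≤r))) (0≤+ {1ℚ} {τ} 0≤1 (ℚ.<⇒≤ 0<τ)))
    (e₁ (h n) r τ)
    where
    e₁ : ∀ h r τ → 1ℚ ℚ.+ τ ≡ h ℚ.* (1ℚ ℚ.- (r ℚ.+ r)) ℚ.+ (h ℚ.* ((r ℚ.- ½) ℚ.+ (r ℚ.- ½)) ℚ.+ (1ℚ ℚ.+ τ))
    e₁ = solve-∀ ℚring

  -- For r below 1/2 the factor `defect r` is positive, and the ratio eventually exceeds its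
  -- reciprocal.
  eventually-≥ : ∀ r τ → 0ℚ ℚ.< τ → r ℚ.< ½ → Eventually λ n → 1ℚ ℚ.- τ ℚ.≤ h n ℚ.* defect r
  eventually-≥ r τ 0<τ r<½ = mapEv (lim (fromℚ (recip A))) λ n big → ℚ.≤-trans (≤-by τ (ℚ.<⇒≤ 0<τ) (e₁ τ))
    (subst (ℚ._≤ h n ℚ.* A) (recip-* A 0<A) (*-monoˡ-≤ A (ℚ.<⇒≤ 0<A) (ℚ.<⇒≤ (fromℚ-cancel-< {recip A} {h n} big))))
    where
    A : ℚ
    A = defect r
    0<A : 0ℚ ℚ.< A
    0<A = subst (0ℚ ℚ.<_) (sym (e r)) (ℚ.+-mono-< (0<-diff r<½) (0<-diff r<½))
    e₁ : ∀ τ → 1ℚ ≡ (1ℚ ℚ.- τ) ℚ.+ τ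
    e₁ = solve-∀ ℚring

module Dimension (em : ∀ ℓ → ExcludedMiddle ℓ) (σ : ℕ → ℕ) (1≤σ : ∀ n → 1 ℕ.≤ n → 0 ℕ.< σ n) (σ-inc : IncreasingFrom1 σ)
  (σ-gap : ∀ n → 1 ℕ.≤ n → n ℕ.≤ σ (suc n) ℕ.∸ σ n) where

  open Gaps σ 1≤σ σ-inc σ-gap
  open Classical em

  0≤ratio : ∀ k → 0ℚ ℚ.≤ ratio k
  0≤ratio k = subst (0ℚ ℚ.≤_) (sym (/≡ (gapAt k) (suc k))) (0≤* {ι (gapAt k)} {1/ᵘ (suc k)} (0≤ι (gapAt k)) (0≤1/ᵘ (suc k)))

  -- The only form in which the limit of the ratios is used, common to finite and infinite β. The
  -- same ρ shifts r and sets the tolerance.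
  Subcritical Supercritical : ℚ → Set
  Subcritical r = ∃[ ρ ] 0ℚ ℚ.< ρ × Eventually λ k → 1ℚ ℚ.- ρ ℚ.≤ ratio k ℚ.* defect (r ℚ.+ ρ)
  Supercritical r = ∃[ ρ ] 0ℚ ℚ.< ρ × Eventually λ k → ratio k ℚ.* defect (r ℚ.- ρ) ℚ.≤ 1ℚ ℚ.+ ρ ℚ.* ½

  supercritical : ∀ r r₁ → r₁ ℚ.< r → (∀ τ → 0ℚ ℚ.< τ → Eventually λ k → ratio k ℚ.* defect r₁ ℚ.≤ 1ℚ ℚ.+ τ) → Supercritical r
  supercritical r r₁ r₁<r h = r ℚ.- r₁ , 0<-diff r₁<r ,
    subst (λ z → Eventually λ k → ratio k ℚ.* defect z ℚ.≤ 1ℚ ℚ.+ (r ℚ.- r₁) ℚ.* ½) (e r r₁) (h ((r ℚ.- r₁) ℚ.* ½) (0<half (0<-diff r₁<r)))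
    where
    e : ∀ r s → s ≡ r ℚ.- (r ℚ.- s)
    e = solve-∀ ℚring

  subcritical : ∀ r r₁ → r ℚ.< r₁ → (∀ τ → 0ℚ ℚ.< τ → Eventually λ k → 1ℚ ℚ.- τ ℚ.≤ ratio k ℚ.* defect r₁) → Subcritical r
  subcritical r r₁ r<r₁ h = r₁ ℚ.- r , 0<-diff r<r₁ ,
    subst (λ z → Eventually λ k → 1ℚ ℚ.- (r₁ ℚ.- r) ℚ.≤ ratio k ℚ.* defect z) (e r r₁) (h (r₁ ℚ.- r) (0<-diff r<r₁))
    where
    e : ∀ r s → s ≡ r ℚ.+ (s ℚ.- r)
    e = solve-∀ ℚring

  null : ∀ r → 0ℚ ℚ.≤ r → Supercritical r → IsHausdorffMeasure (fromℚ r) (G σ) (fin 0ℝ)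
  null r 0≤r (ρ , 0<ρ , h) =
    let (p , q-1 , r≡ , large) = nonneg⇒scaled-fraction r ρ 0≤r 0<ρ
        (N , exponent) = exponent-above r ρ p q-1 0<ρ r≡ large h
    in subst (λ z → IsHausdorffMeasure (fromℚ z) (G σ) (fin 0ℝ)) (sym r≡) (Blocks.null-above σ 1≤σ σ-inc σ-gap em p q-1 N exponent)

  not-null : ∀ s r → 0ℝ ⊑ s → s < fromℚ r → Subcritical r → ¬ IsHausdorffMeasure s (G σ) (fin 0ℝ)
  not-null s r 0≤s s<r (ρ , 0<ρ , h) = from (nonneg⇒scaled-fraction r ρ (ℚ.<⇒≤ 0<r) 0<ρ)
    where
    0<r : 0ℚ ℚ.< r
    0<r = fromℚ-cancel-< {0ℚ} {r} (≤-<-trans {0ℝ} {s} {fromℚ r} (un⊑ 0≤s) s<r)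
    from : (∃[ p ] ∃[ q-1 ] r ≡ fraction p (suc q-1) × 1ℚ ℚ.≤ ι (suc q-1) ℚ.* ρ) → ¬ IsHausdorffMeasure s (G σ) (fin 0ℝ)
    from (p , q-1 , r≡ , large) = by (density-below r ρ p q-1 0<ρ r≡ large h)
      where
      1≤p : 1 ℕ.≤ p
      1≤p = ℕ.≰⇒> λ p≤0 → ℚ.<-irrefl (sym (trans r≡ (trans (cong (λ z → ι z ℚ.* 1/ᵘ (suc q-1)) (ℕ.n≤0⇒n≡0 p≤0)) (trans (cong (ℚ._* 1/ᵘ (suc q-1)) ι0) (ℚ.*-zeroˡ (1/ᵘ (suc q-1))))))) 0<r
      by : Eventually (λ k → suc (suc q-1) ℕ.* suc k ℕ.+ suc (2 ℕ.* p) ℕ.* gapAt k ℕ.≤ suc (suc q-1) ℕ.* gapAt k) → ¬ IsHausdorffMeasure s (G σ) (fin 0ℝ)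
      by (N , density) = LowerBound.not-null em σ 1≤σ s 0≤s p q-1 (⊑-trans (<⇒⊑ s (fromℚ r) s<r) (fromℚ-⊑ (ℚ.≤-reflexive r≡))) K growth (unbounded 1≤p)
        where open Growth em σ 1≤σ σ-inc σ-gap p (suc q-1) N density using (K; growth; unbounded)

  -- Null measure is available at the rationals above D and fails at every real s with 0 ≤ s < D;
  -- density of the rationals makes D the infimum.
  isDimension : ∀ D → 0ℝ ⊑ D → (∀ r → D < fromℚ r → Supercritical r) → (∀ s → 0ℝ ⊑ s → s < D → ∃[ r ] s < fromℚ r × Subcritical r) →
    IsHausdorffDim (G σ) (fin D)
  isDimension D 0≤D above below = lower , greatest
    where
    lower : ∀ t → (∃[ s ] t ≡ fin s × 0ℝ ≤ s × IsHausdorffMeasure s (G σ) (fin 0ℝ)) → fin D ≤∞ t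
    lower _ (s , refl , 0≤s , measure) = fin≤fin (≮⇒≥ {s} {D} λ s<D →
      let (r , s<r , sub) = below s ⟨ 0≤s ⟩ s<D in not-null s r ⟨ 0≤s ⟩ s<r sub measure)
    null-at : ∀ r → D < fromℚ r → ∃[ s ] fin (fromℚ r) ≡ fin s × 0ℝ ≤ s × IsHausdorffMeasure s (G σ) (fin 0ℝ)
    null-at r D<r = fromℚ r , refl , fromℚ-mono 0≤r , null r 0≤r (above r D<r)
      where
      0≤r : 0ℚ ℚ.≤ r
      0≤r = fromℚ-cancel-≤ (un⊑ (⊑-trans {0ℝ} {D} {fromℚ r} 0≤D (<⇒⊑ D (fromℚ r) D<r)))
    greatest : ∀ b → (∀ t → (∃[ s ] t ≡ fin s × 0ℝ ≤ s × IsHausdorffMeasure s (G σ) (fin 0ℝ)) → b ≤∞ t) → b ≤∞ fin D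
    -- A lower bound ∞ is excluded because some rational above D does have null measure.
    greatest ∞ h = ⊥-elim (infinite (dense {D} {D + 1ℝ} (1ℚ , 0<1 , always λ n → ℚ.≤-refl)))
      where
      absurd : ∀ {x} → ¬ (∞ ≤∞ fin x)
      absurd ()
      infinite : ¬ (∃[ r ] D < fromℚ r × fromℚ r < D + 1ℝ)
      infinite (r , D<r , _) = absurd (h (fin (fromℚ r)) (null-at r D<r))
    greatest (fin y) h = fin≤fin (≮⇒≥ {D} {y} λ D<y → contradict (dense {D} {y} D<y))
      where
      contradict : ¬ (∃[ r ] D < fromℚ r × fromℚ r < y)
      contradict (r , D<r , r<y) = below-r (h (fin (fromℚ r)) (null-at r D<r))
        where
        below-r : ¬ (fin y ≤∞ fin (fromℚ r))
        below-r (fin≤fin y≤r) = <⇒≱ {fromℚ r} {y} r<y y≤r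

  finite-dimension : ∀ β (1≤β : 1ℝ ≤ β) → gapRatio σ ⟶ fin β → IsHausdorffDim (G σ) (fin ((β - 1ℝ) * inv (2ℝ * β) (0<2* β 1≤β)))
  finite-dimension β 1≤β lim = isDimension D 0≤D
    (λ r D<r → let (r₁ , D<r₁ , r₁<r) = dense {D} {fromℚ r} D<r in
      supercritical r r₁ (fromℚ-cancel-< {r₁} {r} r₁<r) λ τ 0<τ → eventually-≤ (defect r₁) τ 0<τ (below⇒defect r₁ (<⇒⊑ D (fromℚ r₁) D<r₁)))
    (λ s 0≤s s<D →
      let (r , s<r , r<D) = dense {s} {D} s<D
          (r₁ , r<r₁ , r₁<D) = dense {fromℚ r} {D} r<D
          r<r₁′ = fromℚ-cancel-< {r} {r₁} r<r₁
          0≤r = fromℚ-cancel-≤ {0ℚ} {r} (un⊑ (⊑-trans {0ℝ} {s} {fromℚ r} 0≤s (<⇒⊑ s (fromℚ r) s<r)))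
      in r , s<r , subcritical r r₁ r<r₁′ λ τ 0<τ → eventually-≥ (defect r₁) τ 0<τ
           (above⇒defect r₁ (ℚ.≤-trans 0≤r (ℚ.<⇒≤ r<r₁′)) (<⇒⊑ (fromℚ r₁) D r₁<D)))
    where open FiniteLimit β 1≤β ratio lim

  infinite-dimension : gapRatio σ ⟶ ∞ → IsHausdorffDim (G σ) (fin ½ℝ)
  infinite-dimension lim = isDimension ½ℝ (fromℚ-⊑ 0≤½)
    (λ r ½<r → let (r₁ , ½<r₁ , r₁<r) = dense {½ℝ} {fromℚ r} ½<r in
      supercritical r r₁ (fromℚ-cancel-< {r₁} {r} r₁<r) λ τ 0<τ → eventually-≤ r₁ τ 0<τ (ℚ.<⇒≤ (fromℚ-cancel-< {½} {r₁} ½<r₁)))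
    (λ s 0≤s s<½ →
      let (r , s<r , r<½) = dense {s} {½ℝ} s<½
          (r₁ , r<r₁ , r₁<½) = dense {fromℚ r} {½ℝ} r<½
      in r , s<r , subcritical r r₁ (fromℚ-cancel-< {r} {r₁} r<r₁) λ τ 0<τ → eventually-≥ r₁ τ 0<τ (fromℚ-cancel-< {r₁} {½} r₁<½))
    where open InfiniteLimit ratio 0≤ratio lim

theorem1p2 : (∀ ℓ → ExcludedMiddle ℓ) →
    (σ : ℕ → ℕ) →
    (∀ n → 1 ℕ.≤ n → 0 ℕ.< σ n) →
    IncreasingFrom1 σ →
    (∀ n → 1 ℕ.≤ n → n ℕ.≤ σ (suc n) ℕ.∸ σ n) →
    (β : ℝ∞) (1≤β : fin 1ℝ ≤∞ β) →
    gapRatio σ ⟶ β →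
    IsHausdorffDim (G σ) (fin (dimFormula β 1≤β))
theorem1p2 em σ 1≤σ inc gap (fin β) (fin≤fin 1≤β) lim = Dimension.finite-dimension em σ 1≤σ inc gap β 1≤β lim
theorem1p2 em σ 1≤σ inc gap ∞       ≤-top         lim = Dimension.infinite-dimension em σ 1≤σ inc gap lim
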